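{- For $0<|q|<1$, \begin{align*} \overline{r}_0(0)&=\frac{J_{6}^{12}}{6J_{1,6}^8J_{2}^4J_{3,6}}+\frac{2J_{6}^3J_{3,6}}{3J^2_{1,6}J_{2}}-\frac{J_{1,6}^4J_2^2J_{3,6}^3}{3J_{6}^6}+\frac{2}{J_{3,6}}\sum_{n=-\infty}^\infty\frac{(-1)^nq^{3n^2+3n}}{(1+q^{3n})^2},\\ \overline{r}_1(0)&=\frac{J_{6}^{12}}{6J_{1,6}^8J_{2}^4J_{3,6}}+\frac{J_{1,6}^4J_2^2J_{3,6}^3}{3J_{6}^6}-\frac{2}{J_{3,6}}\sum_{n=-\infty}^\infty\frac{(-1)^nq^{3n^2+3n}}{(1+q^{3n})^2},\\ \overline{r}_2(0)&=\frac{J_{6}^{12}}{6J_{1,6}^8J_{2}^4J_{3,6}}-\frac{J_{6}^3J_{3,6}}{3J^2_{1,6}J_{2}}-\frac{J_{1,6}^4J_2^2J_{3,6}^3}{3J_{6}^6}+\frac{2}{J_{3,6}}\sum_{n=-\infty}^\infty\frac{(-1)^nq^{3n^2+3n}}{(1+q^{3n})^2},\\ \overline{r}_3(0)&=\frac{J_{6}^{12}}{6J_{1,6}^8J_{2}^4J_{3,6}}+\frac{J_{1,6}^4J_2^2J_{3,6}^3}{3J_{6}^6}-\frac{2}{J_{3,6}}\sum_{n=-\infty}^\infty\frac{(-1)^nq^{3n^2+3n}}{(1+q^{3n})^2}. \end{align*}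
   Context: An overpartition of a non-negative integer $n$ is a partition of $n$ in which the first occurrence of each distinct part may be overlined; the empty overpartition of $0$ is counted and has rank $0$. The rank of an overpartition is its largest part minus its number of parts. $\overline N(s,6,n)$ is the number of overpartitions of $n$ with rank congruent to $s$ modulo $6$, and $\overline r_s(d)=\sum_{n\ge0}\overline N(s,6,3n+d)q^n$. Notation: $(a;q)_\infty=\prod_{n\ge0}(1-aq^n)$, $j(z;q)=(z;q)_\infty(q/z;q)_\infty(q;q)_\infty$, $J_{a,m}=j(q^a;q^m)$, $J_m=(q^m;q^m)_\infty$. -}

module Defs where

open import Data.Nat as ℕ using (ℕ; zero; suc; _∸_; _≤ᵇ_)
open import Data.Integer as ℤ using (ℤ; +_; -[1+_])
open import Data.Integer.DivMod using (_%ℕ_)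
open import Data.Rational as ℚ using (ℚ; 0ℚ; 1ℚ; ≢-nonZero)
open import Data.Rational.Properties using (_≟_)
open import Data.Bool using (Bool; true; false; if_then_else_)
open import Data.List as List using (List; []; _∷_; upTo; applyUpTo; zipWith; concatMap; map; filter; length; foldr)
open import Data.Product using (_×_; _,_; proj₁)
open import Relation.Nullary using (yes; no)
open import Relation.Binary.PropositionalEquality using (_≡_)

Series : Set
Series = ℕ → ℚ

sumℚ : List ℚ → ℚ
sumℚ = foldr ℚ._+_ 0ℚ

_≋_ : Series → Series → Set
a ≋ b = ∀ n → a n ≡ b n

infix 4 _≋_
infixl 6 _⊕_ _⊖_
infixl 7 _⊗_ _·_

_⊕_ : Series → Series → Series
(a ⊕ b) n = a n ℚ.+ b n

_⊖_ : Series → Series → Series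
(a ⊖ b) n = a n ℚ.- b n

_·_ : ℚ → Series → Series
(c · a) n = c ℚ.* a n

_⊗_ : Series → Series → Series
(a ⊗ b) n = sumℚ (map (λ k → a k ℚ.* b (n ∸ k)) (upTo (suc n)))

one : Series
one zero    = 1ℚ
one (suc _) = 0ℚ

mono : ℕ → Series
mono e n = if (e ℕ.≡ᵇ n) then 1ℚ else 0ℚ

_^^_ : Series → ℕ → Series
a ^^ zero  = one
a ^^ suc k = a ⊗ (a ^^ k)

-- reciprocal of a rational (total; only ever applied to nonzero values below)
recip : ℚ → ℚ
recip c with c ≟ 0ℚ
... | yes _ = 0ℚ
... | no c≢0 = ℚ.1/_ c {{≢-nonZero c≢0}}

-- multiplicative inverse of a power series with nonzero constant term:
-- b₀ = 1/a₀ , b_{n+1} = -(1/a₀) Σ_{k=1}^{n+1} a_k b_{n+1-k}.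
-- invAux a n = (b_n , [b_n , … , b_0])
invAux : Series → ℕ → ℚ × List ℚ
invAux a zero = recip (a 0) , recip (a 0) ∷ []
invAux a (suc n) with invAux a n
... | (_ , bs) =
  let b = ℚ.- (recip (a 0) ℚ.* sumℚ (zipWith ℚ._*_ (applyUpTo (λ i → a (suc i)) (suc n)) bs))
  in b , b ∷ bs

inv : Series → Series
inv a n = proj₁ (invAux a n)

_⊘_ : Series → Series → Series
a ⊘ b = a ⊗ inv b

infixl 7 _⊘_

-- Infinite q-Pochhammer symbols (q^a ; q^m)_∞ with a ≥ 1, m ≥ 1.
-- The coefficient of q^N only depends on the factors (1 - q^{a+mk}) with
-- a + mk ≤ N, all of which occur among k = 0 … N; so the coefficient of q^N
-- of the infinite product is that of the finite product over k ≤ N.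

pochFin : ℕ → ℕ → ℕ → Series
pochFin a m zero    = one ⊖ mono a
pochFin a m (suc k) = pochFin a m k ⊗ (one ⊖ mono (a ℕ.+ m ℕ.* suc k))

-- (q^(suc a) ; q^(suc m))_∞   (written with suc to force a, m ≥ 1)
poch : ℕ → ℕ → Series
poch a m N = pochFin (suc a) (suc m) N N

-- (q^a ; q^m)_∞ for a, m ≥ 1 (a = 0 or m = 0 never used)
P : ℕ → ℕ → Series
P (suc a) (suc m) = poch a m
P _ _ = one

J : ℕ → Series
J m = P m m

-- J_{a,m} = j(q^a ; q^m) = (q^a ; q^m)_∞ (q^{m-a} ; q^m)_∞ (q^m ; q^m)_∞   (0 < a < m)
J[_,_] : ℕ → ℕ → Series
J[ a , m ] = P a m ⊗ P (m ∸ a) m ⊗ P m m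

-- The bilateral sum  Σ_{n ∈ ℤ} (-1)^n q^{3n²+3n} / (1 + q^{3n})²
-- as a formal power series (its expansion for 0 < |q| < 1).
-- For n ≥ 0 the term is q^{3n²+3n} · (1+q^{3n})^{-2}.
-- For n = -m < 0 we have |q^{3n}| > 1, and the term is expanded as
-- q^{3m²-3m} · q^{6m} · (q^{3m} + 1)^{-2}  (numerator and denominator
-- multiplied by q^{6m}).  The term with index n has lowest degree
-- 3n² + 3|n| ≥ 6|n| for n ≠ 0, so the coefficient of q^N only involves
-- indices with |n| ≤ N.

sgn : ℕ → ℚ
sgn k = if (k ℕ.% 2 ℕ.≡ᵇ 0) then 1ℚ else ℚ.- 1ℚ

term : ℤ → Series
term (+ k) = sgn k · (mono (3 ℕ.* k ℕ.* k ℕ.+ 3 ℕ.* k) ⊘ ((one ⊕ mono (3 ℕ.* k)) ^^ 2))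
term -[1+ k ] = let m = suc k in
  sgn m · ((mono (3 ℕ.* m ℕ.* m ∸ 3 ℕ.* m) ⊗ mono (6 ℕ.* m)) ⊘ ((mono (3 ℕ.* m) ⊕ one) ^^ 2))

bilateral : Series
bilateral N = sumℚ (map (λ k → term (+ k) N) (upTo (suc N)))
         ℚ.+ sumℚ (map (λ k → term -[1+ k ] N) (upTo N))

-- Overpartitions.
-- An overpartition is represented by its list of blocks
-- (part , multiplicity ≥ 1 , whether the first occurrence is overlined),
-- with strictly decreasing parts.

record Block : Set where
  constructor blk
  field
    part mult : ℕ
    over      : Bool

Overpartition : Set
Overpartition = List Block

gen : ℕ → ℕ → List Overpartition
gen zero n = if (n ℕ.≡ᵇ 0) then ([] ∷ []) else []
gen (suc m) n = gen m n List.++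
  concatMap (λ k → let c = suc k in
      if (c ℕ.* suc m ≤ᵇ n)
      then concatMap (λ b → map (blk (suc m) c b ∷_) (gen m (n ∸ c ℕ.* suc m)))
                     (false ∷ true ∷ [])
      else [])
    (upTo n)

overpartitions : ℕ → List Overpartition
overpartitions n = gen n n

largestPart : Overpartition → ℕ
largestPart = foldr (λ b r → Block.part b ℕ.⊔ r) 0

numParts : Overpartition → ℕ
numParts = foldr (λ b r → Block.mult b ℕ.+ r) 0

rank : Overpartition → ℤ
rank π = + largestPart π ℤ.- + numParts π

Nbar : ℕ → (t : ℕ) → .{{ℕ.NonZero t}} → ℕ → ℕ
Nbar s t n = length (filter (λ π → (rank π %ℕ t) ℕ.≟ (s ℕ.% t)) (overpartitions n))

rbar : ℕ → ℕ → Series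
rbar s d n = + Nbar s 6 (3 ℕ.* n ℕ.+ d) ℚ./ 1

const : ℚ → Series
const c = c · one

A B C D : Series
A = (J 6 ^^ 12) ⊘ ((J[ 1 , 6 ] ^^ 8) ⊗ (J 2 ^^ 4) ⊗ J[ 3 , 6 ])
B = (J 6 ^^ 3 ⊗ J[ 3 , 6 ]) ⊘ ((J[ 1 , 6 ] ^^ 2) ⊗ J 2)
C = ((J[ 1 , 6 ] ^^ 4) ⊗ (J 2 ^^ 2) ⊗ (J[ 3 , 6 ] ^^ 3)) ⊘ (J 6 ^^ 6)
D = bilateral ⊘ J[ 3 , 6 ]

-- Let φ = Σ (-1)^k q^{k²}, so that P̄ = 1/φ is the generating function of the overpartitions, and let v m be the mean
-- of the generating functions of the overpartitions of rank ≥ m and of rank ≥ m+1.  A symmetric count by largest part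
-- and number of parts gives v m = q^{m+1}(P̄ - v (m+2)), and summation by parts expresses Σ_π χ(rank π) q^{|π|}, for
-- even χ, through the v m.  On the exponents divisible by 3 this recursion is also solved by bilateral theta series
-- whose terms carry a partial theta function ρ_{k-N}, and it has only one solution.  For χ(m) = Re ζ^m, ζ⁶ = 1, the sum
-- over m collapses by the reflection ρ_k + ρ_{-1-k} = 1 and leaves theta series with linear weights, which factor.
-- Writing R(ζ) for the part in exponents divisible by 3 and a = φ(q³), one finds R(ω) = R(-ω) = a²/φ, and that R(-1)
-- differs by -2φ²a from three times the whole rank sum at -1 taken at q³, which is four times the bilateral sum over a.
-- The cubic norm from ℚ((q)) to ℚ((q³)) of the product φ J₂ = J₁² gives R(1) = a³/φ⁴.

module Submission where

open import Defs
open import Algebra using (CommutativeRing; IsCommutativeRing)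
open import Algebra.Solver.Ring.AlmostCommutativeRing using (fromCommutativeRing; _-Raw-AlmostCommutative⟶_)
import Algebra.Solver.Ring as RingSolver
open import Data.Bool using (true; false; if_then_else_) renaming (T to IsTrue)
open import Data.Integer as ℤ using (ℤ; +_; -[1+_]; ∣_∣)
open import Data.Integer.DivMod using (_%ℕ_)
import Data.Integer.Properties as ℤP
import Data.Integer.Solver as ℤS
open import Data.List as List using (List; []; _∷_; _++_; map; concatMap; filter; length; upTo; applyUpTo; zipWith)
import Data.List.Properties as LP
open import Data.List.Relation.Unary.All as All using (All; []; _∷_)
import Data.List.Relation.Unary.All.Properties as AllP
open import Data.Maybe using (Maybe; just; nothing)
open import Data.Nat as ℕ using (ℕ; zero; suc; _∸_; z≤n; s≤s; _≤_; _<_; _≤ᵇ_)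
open import Data.Nat.Induction using (<-rec)
import Data.Nat.Properties as ℕP
import Data.Nat.Solver as ℕS
open import Data.Product using (Σ; _×_; _,_; proj₁; proj₂; Σ-syntax)
open import Data.Rational as ℚ using (ℚ; 0ℚ; 1ℚ; ½; _/_)
import Data.Rational.Properties as ℚP
import Data.Rational.Solver as ℚS
open import Data.Rational.Unnormalised using (mkℚᵘ; *≡*)
import Data.Rational.Unnormalised.Properties as ℚᵘP
open import Data.Sum using (_⊎_; inj₁; inj₂)
open import Function using (_∘_)
open import Level using (0ℓ)
open import Relation.Nullary using (yes; no; does; contradiction)
open import Relation.Binary.PropositionalEquality using (_≡_; refl; sym; trans; cong; cong₂; subst; _≢_)

-- The ring of formal power series over ℚ

-- The recursion for v m shifts the residue of its exponents modulo 3. Three steps raise m by 6 and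
-- multiply by q^(3m+9), so only the threefold iterate can be restricted to exponents divisible by
-- 3. Its inhomogeneous terms are components of 1/φ, and those of the theta recursion are `c₀` and
-- `c₁`. The two match because P₁ : P₀ = c₀ : c₁. That proportion, like the other relations between
-- `a`, `b`, `c₀`, `c₁`, is read off the residue classes of a single identity: Jacobi's derivative
-- formula in the form X = φ² ψ₂, whose exponents are triangular and so never 2 modulo 3. For m
-- divisible by 3 the match fails by 1/a, and the failure is repaired by the rank functions
-- themselves, taken at q³. At ω and -ω the weights of these m are zero, so the repair is visible
-- only at -1; this is where the bilateral sum comes from. The factor φ² first appears as an unknown
-- constant of an alternating recursion. It is identified because its quotient by φ² is invariant
-- under q ↦ q². All exponents stay natural numbers: recursions that would need q^(-1) are stated
-- after clearing denominators.

∑< : ℕ → (ℕ → ℚ) → ℚ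
∑< zero f = 0ℚ
∑< (suc n) f = f 0 ℚ.+ ∑< n (λ k → f (suc k))

sum-map-applyUpTo : (f : ℕ → ℚ) (g : ℕ → ℕ) (n : ℕ) → sumℚ (map f (applyUpTo g n)) ≡ ∑< n (λ k → f (g k))
sum-map-applyUpTo f g zero = refl
sum-map-applyUpTo f g (suc n) = cong (f (g 0) ℚ.+_) (sum-map-applyUpTo f (g ∘ suc) n)

sum-map-upTo : (f : ℕ → ℚ) (n : ℕ) → sumℚ (map f (upTo n)) ≡ ∑< n f
sum-map-upTo f n = sum-map-applyUpTo f (λ k → k) n

infix 4 _≈_
-- A record rather than a bare family of equations, so that unification recovers both series from a
-- proof.
record _≈_ (a b : Series) : Set where
  constructor mk
  field at : ∀ n → a n ≡ b n
open _≈_ public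

≈-refl : ∀ {a} → a ≈ a
≈-refl = mk λ n → refl

≈-sym : ∀ {a b} → a ≈ b → b ≈ a
≈-sym p = mk λ n → sym (at p n)

≈-trans : ∀ {a b c} → a ≈ b → b ≈ c → a ≈ c
≈-trans p q = mk λ n → trans (at p n) (at q n)

shift : Series → Series
shift a n = a (suc n)

𝟘 : Series
𝟘 n = 0ℚ

⊗-zero : ∀ a b → (a ⊗ b) 0 ≡ a 0 ℚ.* b 0
⊗-zero a b = ℚP.+-identityʳ _

-- Peeling the constant term off the left factor makes the convolution a structural recursion on
-- `n`. The ring laws are inductions along it.
⊗-suc : ∀ a b n → (a ⊗ b) (suc n) ≡ a 0 ℚ.* b (suc n) ℚ.+ (shift a ⊗ b) n
⊗-suc a b n = cong (a 0 ℚ.* b (suc n) ℚ.+_)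
  (trans (sum-map-applyUpTo (λ k → a k ℚ.* b (suc n ∸ k)) suc (suc n))
         (sym (sum-map-upTo (λ k → shift a k ℚ.* b (n ∸ k)) (suc n))))

module ℚR where
  open ℚS.+-*-Solver public

⊗-cong : ∀ {a a′ b b′} → a ≈ a′ → b ≈ b′ → (a ⊗ b) ≈ (a′ ⊗ b′)
⊗-cong {a} {a′} {b} {b′} p q = mk (go a a′ p)
  where
  go : ∀ a a′ → a ≈ a′ → ∀ n → (a ⊗ b) n ≡ (a′ ⊗ b′) n
  go a a′ p zero = trans (⊗-zero a b) (trans (cong₂ ℚ._*_ (at p 0) (at q 0)) (sym (⊗-zero a′ b′)))
  go a a′ p (suc n) = trans (⊗-suc a b n) (trans
    (cong₂ ℚ._+_ (cong₂ ℚ._*_ (at p 0) (at q (suc n))) (go (shift a) (shift a′) (mk λ k → at p (suc k)) n))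
    (sym (⊗-suc a′ b′ n)))

⊗-distribʳ : ∀ a b c n → ((a ⊕ b) ⊗ c) n ≡ (a ⊗ c) n ℚ.+ (b ⊗ c) n
⊗-distribʳ a b c zero = trans (⊗-zero (a ⊕ b) c) (trans (ℚP.*-distribʳ-+ (c 0) (a 0) (b 0))
  (sym (cong₂ ℚ._+_ (⊗-zero a c) (⊗-zero b c))))
⊗-distribʳ a b c (suc n) = trans (⊗-suc (a ⊕ b) c n)
  (trans (cong ((a 0 ℚ.+ b 0) ℚ.* c (suc n) ℚ.+_) (⊗-distribʳ (shift a) (shift b) c n))
  (trans (ℚR.solve 5 (λ a b c x y → (a ℚR.:+ b) ℚR.:* c ℚR.:+ (x ℚR.:+ y) ℚR.:= (a ℚR.:* c ℚR.:+ x) ℚR.:+ (b ℚR.:* c ℚR.:+ y)) refl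
     (a 0) (b 0) (c (suc n)) ((shift a ⊗ c) n) ((shift b ⊗ c) n))
  (sym (cong₂ ℚ._+_ (⊗-suc a c n) (⊗-suc b c n)))))

⊗-scaleˡ : ∀ x a b n → ((x · a) ⊗ b) n ≡ x ℚ.* (a ⊗ b) n
⊗-scaleˡ x a b zero = trans (⊗-zero (x · a) b) (trans (ℚP.*-assoc x (a 0) (b 0)) (cong (x ℚ.*_) (sym (⊗-zero a b))))
⊗-scaleˡ x a b (suc n) = trans (⊗-suc (x · a) b n)
  (trans (cong ((x ℚ.* a 0) ℚ.* b (suc n) ℚ.+_) (⊗-scaleˡ x (shift a) b n))
  (trans (ℚR.solve 4 (λ x a b y → (x ℚR.:* a) ℚR.:* b ℚR.:+ x ℚR.:* y ℚR.:= x ℚR.:* (a ℚR.:* b ℚR.:+ y)) refl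
    x (a 0) (b (suc n)) ((shift a ⊗ b) n))
  (cong (x ℚ.*_) (sym (⊗-suc a b n)))))

-- The mirror image of `⊗-suc`: commutativity exchanges the factor that is peeled.
⊗-sucʳ : ∀ a b n → (a ⊗ b) (suc n) ≡ (a ⊗ shift b) n ℚ.+ a (suc n) ℚ.* b 0
⊗-sucʳ a b zero = trans (⊗-suc a b 0) (cong₂ ℚ._+_ (sym (⊗-zero a (shift b))) (⊗-zero (shift a) b))
⊗-sucʳ a b (suc n) = trans (⊗-suc a b (suc n)) (trans (cong (a 0 ℚ.* b (suc (suc n)) ℚ.+_) (⊗-sucʳ (shift a) b n))
  (trans (sym (ℚP.+-assoc (a 0 ℚ.* b (suc (suc n))) ((shift a ⊗ shift b) n) (a (suc (suc n)) ℚ.* b 0)))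
   (cong (ℚ._+ a (suc (suc n)) ℚ.* b 0) (sym (⊗-suc a (shift b) n)))))

⊗-comm′ : ∀ a b n → (a ⊗ b) n ≡ (b ⊗ a) n
⊗-comm′ a b zero = trans (⊗-zero a b) (trans (ℚP.*-comm (a 0) (b 0)) (sym (⊗-zero b a)))
⊗-comm′ a b (suc n) = trans (⊗-suc a b n) (trans (cong₂ ℚ._+_ (ℚP.*-comm (a 0) (b (suc n))) (⊗-comm′ (shift a) b n))
  (trans (ℚP.+-comm (b (suc n) ℚ.* a 0) ((b ⊗ shift a) n)) (sym (⊗-sucʳ b a n))))

⊗-assoc′ : ∀ a b c n → ((a ⊗ b) ⊗ c) n ≡ (a ⊗ (b ⊗ c)) n
⊗-assoc′ a b c zero = trans (⊗-zero (a ⊗ b) c) (trans (cong (ℚ._* c 0) (⊗-zero a b)) (trans (ℚP.*-assoc (a 0) (b 0) (c 0))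
  (trans (cong (a 0 ℚ.*_) (sym (⊗-zero b c))) (sym (⊗-zero a (b ⊗ c))))))
⊗-assoc′ a b c (suc n) = trans (⊗-suc (a ⊗ b) c n)
  (trans (cong₂ ℚ._+_ (cong (ℚ._* c (suc n)) (⊗-zero a b))
     (trans (at (⊗-cong {b = c} (mk (λ k → ⊗-suc a b k)) ≈-refl) n)
       (trans (⊗-distribʳ (a 0 · shift b) (shift a ⊗ b) c n)
         (cong₂ ℚ._+_ (⊗-scaleˡ (a 0) (shift b) c n) (⊗-assoc′ (shift a) b c n)))))
  (trans (ℚR.solve 5 (λ a b c x y → (a ℚR.:* b) ℚR.:* c ℚR.:+ (a ℚR.:* x ℚR.:+ y) ℚR.:= a ℚR.:* (b ℚR.:* c ℚR.:+ x) ℚR.:+ y) refl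
     (a 0) (b 0) (c (suc n)) ((shift b ⊗ c) n) ((shift a ⊗ (b ⊗ c)) n))
  (trans (cong (λ z → a 0 ℚ.* z ℚ.+ (shift a ⊗ (b ⊗ c)) n) (sym (⊗-suc b c n))) (sym (⊗-suc a (b ⊗ c) n)))))

⊗-zeroˡ : ∀ a n → (𝟘 ⊗ a) n ≡ 0ℚ
⊗-zeroˡ a zero = trans (⊗-zero 𝟘 a) (ℚP.*-zeroˡ (a 0))
⊗-zeroˡ a (suc n) = trans (⊗-suc 𝟘 a n) (trans (cong₂ ℚ._+_ (ℚP.*-zeroˡ (a (suc n))) (⊗-zeroˡ a n)) refl)

⊗-oneˡ : ∀ a n → (one ⊗ a) n ≡ a n
⊗-oneˡ a zero = trans (⊗-zero one a) (ℚP.*-identityˡ (a 0))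
⊗-oneˡ a (suc n) = trans (⊗-suc one a n) (trans (cong₂ ℚ._+_ (ℚP.*-identityˡ (a (suc n)))
   (trans (at (⊗-cong {shift one} {𝟘} {a} (mk λ k → refl) ≈-refl) n) (⊗-zeroˡ a n))) (ℚP.+-identityʳ (a (suc n))))

-- With opaque operations the solver and the type checker see ring symbols and never unfold a
-- convolution.
opaque
  infixl 6 _+_
  infixl 7 _*_
  infix 8 -_

  _+_ _*_ : Series → Series → Series
  _+_ = _⊕_
  _*_ = _⊗_

  -_ : Series → Series
  (- a) n = ℚ.- a n

  q^_ : ℕ → Series
  q^_ = mono

  κ : ℚ → Series
  κ = const

0# 1# : Series
0# = κ 0ℚ
1# = κ 1ℚ

opaque
  unfolding _+_

  +-at : ∀ a b n → (a + b) n ≡ a n ℚ.+ b n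
  +-at a b n = refl

  neg-at : ∀ a n → (- a) n ≡ ℚ.- a n
  neg-at a n = refl

  0-at : ∀ n → 0# n ≡ 0ℚ
  0-at n = ℚP.*-zeroˡ (one n)

  1-at-0 : 1# 0 ≡ 1ℚ
  1-at-0 = refl

  *-at-0 : ∀ a b → (a * b) 0 ≡ a 0 ℚ.* b 0
  *-at-0 = ⊗-zero

  *-at-suc : ∀ a b n → (a * b) (suc n) ≡ a 0 ℚ.* b (suc n) ℚ.+ (shift a * b) n
  *-at-suc = ⊗-suc

  ⊕-is-+ : ∀ a b → a ⊕ b ≈ a + b
  ⊕-is-+ a b = ≈-refl

  ⊖-is-− : ∀ a b → a ⊖ b ≈ a + - b
  ⊖-is-− a b = ≈-refl

  ⊗-is-* : ∀ a b → a ⊗ b ≈ a * b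
  ⊗-is-* a b = ≈-refl

  one-is-1 : one ≈ 1#
  one-is-1 = mk λ n → sym (ℚP.*-identityˡ (one n))

  mono-is-q^ : ∀ e → mono e ≈ q^ e
  mono-is-q^ e = ≈-refl

  ·-is-κ* : ∀ c a → c · a ≈ κ c * a
  ·-is-κ* c a = mk λ n → sym (trans (⊗-scaleˡ c one a n) (cong (c ℚ.*_) (⊗-oneˡ a n)))

  κ-* : ∀ x y → κ (x ℚ.* y) ≈ κ x * κ y
  κ-* x y = mk λ n → trans (ℚP.*-assoc x y (one n)) (sym (trans (⊗-scaleˡ x one (const y) n) (cong (x ℚ.*_) (⊗-oneˡ (const y) n))))

  κ-at : ∀ c a n → (κ c * a) n ≡ c ℚ.* a n
  κ-at c a n = trans (⊗-scaleˡ c one a n) (cong (c ℚ.*_) (⊗-oneˡ a n))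

  isCR : IsCommutativeRing _≈_ _+_ _*_ -_ 0# 1#
  isCR = record
      { isRing = record
        { +-isAbelianGroup = record
          { isGroup = record
            { isMonoid = record
              { isSemigroup = record
                { isMagma = record
                  { isEquivalence = record { refl = ≈-refl ; sym = ≈-sym ; trans = ≈-trans }
                  ; ∙-cong = λ p q → mk λ n → cong₂ ℚ._+_ (at p n) (at q n) }
                ; assoc = λ a b c → mk λ n → ℚP.+-assoc (a n) (b n) (c n) }
              ; identity = (λ a → mk λ n → trans (cong (ℚ._+ a n) (0-at n)) (ℚP.+-identityˡ (a n))) , (λ a → mk λ n → trans (cong (a n ℚ.+_) (0-at n)) (ℚP.+-identityʳ (a n))) }
            ; inverse = (λ a → mk λ n → trans (ℚP.+-inverseˡ (a n)) (sym (0-at n))) , (λ a → mk λ n → trans (ℚP.+-inverseʳ (a n)) (sym (0-at n)))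
            ; ⁻¹-cong = λ p → mk λ n → cong ℚ.-_ (at p n) }
          ; comm = λ a b → mk λ n → ℚP.+-comm (a n) (b n) }
        ; *-cong = ⊗-cong
        ; *-assoc = λ a b c → mk (⊗-assoc′ a b c)
        ; *-identity = (λ a → ≈-trans (⊗-cong (≈-sym one-is-1) (≈-refl {a})) (mk (⊗-oneˡ a))) , (λ a → ≈-trans (⊗-cong (≈-refl {a}) (≈-sym one-is-1)) (mk λ n → trans (⊗-comm′ a one n) (⊗-oneˡ a n)))
        ; distrib = (λ a b c → mk λ n → trans (⊗-comm′ a (b ⊕ c) n) (trans (⊗-distribʳ b c a n) (cong₂ ℚ._+_ (⊗-comm′ b a n) (⊗-comm′ c a n))))
                  , (λ a b c → mk (⊗-distribʳ b c a)) }
      ; *-comm = λ a b → mk (⊗-comm′ a b) }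

  κ-+ : ∀ x y → κ (x ℚ.+ y) ≈ κ x + κ y
  κ-+ x y = mk λ n → ℚP.*-distribʳ-+ (one n) x y

  κ-neg : ∀ x → κ (ℚ.- x) ≈ - κ x
  κ-neg x = mk λ n → sym (ℚP.neg-distribˡ-* x (one n))

seriesRing : CommutativeRing 0ℓ 0ℓ
seriesRing = record
  { Carrier = Series ; _≈_ = _≈_ ; _+_ = _+_ ; _*_ = _*_ ; -_ = -_ ; 0# = 0# ; 1# = 1#
  ; isCommutativeRing = isCR }

infixl 6 _-_
_-_ : Series → Series → Series
a - b = a + - b

open CommutativeRing seriesRing public
  using (setoid; semiring; +-cong; *-cong; +-comm; *-comm; +-assoc; *-assoc; -‿cong; zeroˡ; zeroʳ; *-identityˡ; *-identityʳ; +-identityˡ; +-identityʳ; distribˡ; distribʳ; -‿inverseʳ; -‿inverseˡ)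
open import Algebra.Properties.Semiring.Exp semiring public using (_^_; ^-cong)

private
  κ≟ : (x y : ℚ) → Maybe (κ x ≈ κ y)
  κ≟ x y with x ℚP.≟ y
  ... | yes p = just (mk λ n → cong (λ z → κ z n) p)
  ... | no _ = nothing

  -- Rational coefficients for the solver, so that identities containing fractions normalise as
  -- well.
  constants : CommutativeRing.rawRing ℚP.+-*-commutativeRing -Raw-AlmostCommutative⟶ fromCommutativeRing seriesRing
  constants = record { ⟦_⟧ = κ ; +-homo = κ-+ ; *-homo = κ-* ; -‿homo = κ-neg ; 0-homo = ≈-refl ; 1-homo = ≈-refl }

module 𝓢 = RingSolver (CommutativeRing.rawRing ℚP.+-*-commutativeRing) (fromCommutativeRing seriesRing) constants κ≟

open 𝓢 public using (solve; _:=_; _:+_; _:*_; _:-_; :-_; con; _:^_)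

import Relation.Binary.Reasoning.Setoid setoid as SR

-- Limits and sums of series

Agree : ℕ → Series → Series → Set
Agree N a b = ∀ n → n < N → a n ≡ b n

Ord : ℕ → Series → Set
Ord N a = ∀ n → n < N → a n ≡ 0ℚ

≈⇒agree : ∀ {a b} N → a ≈ b → Agree N a b
≈⇒agree N p n _ = at p n

agree⇒≈ : ∀ {a b} → (∀ N → Agree N a b) → a ≈ b
agree⇒≈ h = mk λ n → h (suc n) n ℕP.≤-refl

agree-trans : ∀ {N a b c} → Agree N a b → Agree N b c → Agree N a c
agree-trans p q n n<N = trans (p n n<N) (q n n<N)

agree-sym : ∀ {N a b} → Agree N a b → Agree N b a
agree-sym p n n<N = sym (p n n<N)

agree-⊕ : ∀ {N a a′ b b′} → Agree N a a′ → Agree N b b′ → Agree N (a + b) (a′ + b′)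
agree-⊕ {a = a} {a′} {b} {b′} p q n n<N = trans (+-at a b n) (trans (cong₂ ℚ._+_ (p n n<N) (q n n<N)) (sym (+-at a′ b′ n)))

agree-⊗ : ∀ {N a a′ b b′} → Agree N a a′ → Agree N b b′ → Agree N (a * b) (a′ * b′)
agree-⊗ {N} {a} {a′} {b} {b′} p q n n<N =
  go a a′ n (λ m m≤n → p m (ℕP.≤-<-trans m≤n n<N)) (λ m m≤n → q m (ℕP.≤-<-trans m≤n n<N))
  where
  go : ∀ a a′ n → (∀ m → m ≤ n → a m ≡ a′ m) → (∀ m → m ≤ n → b m ≡ b′ m) → (a * b) n ≡ (a′ * b′) n
  go a a′ zero p q = trans (*-at-0 a b) (trans (cong₂ ℚ._*_ (p 0 z≤n) (q 0 z≤n)) (sym (*-at-0 a′ b′)))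
  go a a′ (suc n) p q = trans (*-at-suc a b n) (trans
    (cong₂ ℚ._+_ (cong₂ ℚ._*_ (p 0 z≤n) (q (suc n) ℕP.≤-refl))
      (go (shift a) (shift a′) n (λ m m≤n → p (suc m) (s≤s m≤n)) (λ m m≤n → q m (ℕP.m≤n⇒m≤1+n m≤n))))
    (sym (*-at-suc a′ b′ n)))

ord-≤ : ∀ {M N a} → M ≤ N → Ord N a → Ord M a
ord-≤ M≤N o n n<M = o n (ℕP.<-≤-trans n<M M≤N)

ord-≈ : ∀ {N a b} → a ≈ b → Ord N a → Ord N b
ord-≈ p o n n<N = trans (sym (at p n)) (o n n<N)

ord-⊕ : ∀ {N a b} → Ord N a → Ord N b → Ord N (a + b)
ord-⊕ {a = a} {b} p q n n<N = trans (+-at a b n) (trans (cong₂ ℚ._+_ (p n n<N) (q n n<N)) refl)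

ord-- : ∀ {N a} → Ord N a → Ord N (- a)
ord-- {a = a} p n n<N = trans (neg-at a n) (cong ℚ.-_ (p n n<N))

ord-⊗ˡ : ∀ {N a} b → Ord N a → Ord N (a * b)
ord-⊗ˡ b p n n<N = trans (agree-⊗ {a′ = 0#} {b = b} (λ m m<N → trans (p m m<N) (sym (0-at m))) (λ _ _ → refl) n n<N) (trans (at (zeroˡ b) n) (0-at n))

ord-⊗ʳ : ∀ {N} a {b} → Ord N b → Ord N (a * b)
ord-⊗ʳ a {b} p n n<N = trans (at (*-comm a b) n) (ord-⊗ˡ a p n n<N)

ord-0# : ∀ {N} → Ord N 0#
ord-0# n _ = 0-at n

opaque
  unfolding _*_ one-is-1

  q^-shift : ∀ e f n → (q^ suc e * f) (suc n) ≡ (q^ e * f) n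
  q^-shift e f n = trans (⊗-suc (mono (suc e)) f n)
    (trans (cong (ℚ._+ (mono e ⊗ f) n) (ℚP.*-zeroˡ (f (suc n)))) (ℚP.+-identityˡ _))

  q^-suc-at-0 : ∀ e f → (q^ suc e * f) 0 ≡ 0ℚ
  q^-suc-at-0 e f = trans (⊗-zero (mono (suc e)) f) (ℚP.*-zeroˡ (f 0))

  q^-0 : q^ 0 ≈ 1#
  q^-0 = ≈-trans (mk λ { zero → refl ; (suc n) → refl }) one-is-1

  q^suc-at : ∀ e n → (q^ suc e) (suc n) ≡ (q^ e) n
  q^suc-at e n = refl

  q^suc-at-0 : ∀ e → (q^ suc e) 0 ≡ 0ℚ
  q^suc-at-0 e = refl

q^-cong : ∀ {d e} → d ≡ e → q^ d ≈ q^ e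
q^-cong refl = ≈-refl

q^0* : ∀ f → q^ 0 * f ≈ f
q^0* f = ≈-trans (*-cong q^-0 ≈-refl) (*-identityˡ f)

q^-at-+ : ∀ e f n → (q^ e * f) (e ℕ.+ n) ≡ f n
q^-at-+ zero f n = at (q^0* f) n
q^-at-+ (suc e) f n = trans (q^-shift e f (e ℕ.+ n)) (q^-at-+ e f n)

q^-+ : ∀ d e → q^ d * q^ e ≈ q^ (d ℕ.+ e)
q^-+ zero e = q^0* (q^ e)
q^-+ (suc d) e = mk λ
  { zero → trans (q^-suc-at-0 d (q^ e)) (sym (q^suc-at-0 (d ℕ.+ e)))
  ; (suc n) → trans (q^-shift d (q^ e) n) (trans (at (q^-+ d e) n) (sym (q^suc-at (d ℕ.+ e) n))) }

ord-q^* : ∀ e {M f} → Ord M f → Ord (e ℕ.+ M) (q^ e * f)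
ord-q^* zero {f = f} o = ord-≈ (≈-sym (q^0* f)) o
ord-q^* (suc e) {f = f} o zero _ = q^-suc-at-0 e f
ord-q^* (suc e) {f = f} o (suc n) (s≤s n<) = trans (q^-shift e f n) (ord-q^* e o n n<)

ord-q^ : ∀ e f → Ord e (q^ e * f)
ord-q^ e f = subst (λ m → Ord m (q^ e * f)) (ℕP.+-identityʳ e) (ord-q^* e {0} {f} λ _ ())

q^-ord : ∀ e → Ord e (q^ e)
q^-ord e = ord-≈ (≈-trans (*-comm (q^ e) 1#) (*-identityˡ (q^ e))) (ord-q^ e 1#)

infix 4 _⟶_
-- Convergence in the q-adic topology, with an explicit modulus.
_⟶_ : (ℕ → Series) → Series → Set
s ⟶ F = ∀ N → Σ[ M ∈ ℕ ] (∀ L → M ≤ L → Agree N F (s L))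

⟶-unique : ∀ {s F G} → s ⟶ F → s ⟶ G → F ≈ G
⟶-unique p q = agree⇒≈ λ N → let (M , h) = p N ; (M′ , h′) = q N in
  agree-trans (h (M ℕ.⊔ M′) (ℕP.m≤m⊔n M M′)) (agree-sym (h′ (M ℕ.⊔ M′) (ℕP.m≤n⊔m M M′)))

⟶-cong : ∀ {s t F G} → (∀ n → s n ≈ t n) → F ≈ G → s ⟶ F → t ⟶ G
⟶-cong p q h N = let (M , k) = h N in
  M , λ L M≤L → agree-trans (≈⇒agree N (≈-sym q)) (agree-trans (k L M≤L) (≈⇒agree N (p L)))

⟶-const : ∀ F → (λ _ → F) ⟶ F
⟶-const F N = 0 , λ L _ n _ → refl

⟶-⊕ : ∀ {s t F G} → s ⟶ F → t ⟶ G → (λ n → s n + t n) ⟶ F + G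
⟶-⊕ p q N = let (M , h) = p N ; (M′ , h′) = q N in M ℕ.⊔ M′ , λ L l →
  agree-⊕ (h L (ℕP.≤-trans (ℕP.m≤m⊔n M M′) l)) (h′ L (ℕP.≤-trans (ℕP.m≤n⊔m M M′) l))

⟶-⊗ : ∀ {s t F G} → s ⟶ F → t ⟶ G → (λ n → s n * t n) ⟶ F * G
⟶-⊗ p q N = let (M , h) = p N ; (M′ , h′) = q N in M ℕ.⊔ M′ , λ L l →
  agree-⊗ (h L (ℕP.≤-trans (ℕP.m≤m⊔n M M′) l)) (h′ L (ℕP.≤-trans (ℕP.m≤n⊔m M M′) l))

⟶-0 : ∀ {s} → (∀ N → Σ[ M ∈ ℕ ] (∀ L → M ≤ L → Ord N (s L))) → s ⟶ 0#
⟶-0 h N = let (M , k) = h N in M , λ L l n n<N → trans (0-at n) (sym (k L l n n<N))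

⟶-subseq : ∀ {s F} (φ : ℕ → ℕ) → (∀ n → n ≤ φ n) → s ⟶ F → (λ n → s (φ n)) ⟶ F
⟶-subseq φ φ≥ h N = let (M , k) = h N in M , λ L l → k (φ L) (ℕP.≤-trans l (φ≥ L))

psum : ℕ → (ℕ → Series) → Series
psum zero u = 0#
psum (suc L) u = psum L u + u L

HasSum : (ℕ → Series) → Series → Set
HasSum u F = (λ L → psum L u) ⟶ F

-- The terms tend to 0 q-adically. The modulus is data: it tells `∑` how many terms a coefficient
-- needs. The value of the sum does not depend on it, so the two sides of an identity may carry
-- different moduli.
Dec : (ℕ → Series) → Set
Dec u = ∀ N → Σ[ M ∈ ℕ ] (∀ n → M ≤ n → Ord N (u n))

opaque
  ∑ : (u : ℕ → Series) → Dec u → Series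
  ∑ u d n = psum (proj₁ (d (suc n))) u n

psum-stable : ∀ u n K → (∀ k → K ≤ k → u k n ≡ 0ℚ) → ∀ L → K ≤ L → psum L u n ≡ psum K u n
psum-stable u n K h L K≤L = trans (cong (λ z → psum z u n) (sym (ℕP.m+[n∸m]≡n K≤L))) (go (L ∸ K))
  where
  go : ∀ i → psum (K ℕ.+ i) u n ≡ psum K u n
  go zero = cong (λ z → psum z u n) (ℕP.+-identityʳ K)
  go (suc i) rewrite ℕP.+-suc K i = trans (+-at (psum (K ℕ.+ i) u) (u (K ℕ.+ i)) n) (trans (cong₂ ℚ._+_ (go i) (h (K ℕ.+ i) (ℕP.m≤m+n K i))) (ℚP.+-identityʳ _))

opaque
  unfolding ∑

  ∑-approx : ∀ u d N L → proj₁ (d N) ≤ L → Agree N (∑ u d) (psum L u)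
  ∑-approx u d N L K≤L n n<N =
    let K = proj₁ (d N)
        K′ = proj₁ (d (suc n))
        K″ = K ℕ.⊔ K′
        hK = λ k K≤k → proj₂ (d N) k K≤k n n<N
        hK′ = λ k K′≤k → proj₂ (d (suc n)) k K′≤k n ℕP.≤-refl
    in trans (sym (psum-stable u n K′ hK′ K″ (ℕP.m≤n⊔m K K′)))
         (trans (psum-stable u n K hK K″ (ℕP.m≤m⊔n K K′)) (sym (psum-stable u n K hK L K≤L)))

∑-has : ∀ u d → HasSum u (∑ u d)
∑-has u d N = proj₁ (d N) , ∑-approx u d N

psum-cong : ∀ {u v} → (∀ n → u n ≈ v n) → ∀ L → psum L u ≈ psum L v
psum-cong p zero = ≈-refl
psum-cong p (suc L) = +-cong (psum-cong p L) (p L)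

psum-⊕ : ∀ u v L → psum L (λ n → u n + v n) ≈ (psum L u + psum L v)
psum-⊕ u v zero = ≈-sym (+-identityˡ 0#)
psum-⊕ u v (suc L) = ≈-trans (+-cong (psum-⊕ u v L) ≈-refl)
  (solve 4 (λ a b c d → (a :+ b) :+ (c :+ d) := (a :+ c) :+ (b :+ d)) ≈-refl (psum L u) (psum L v) (u L) (v L))

psum-⊗ : ∀ c u L → psum L (λ n → c * u n) ≈ (c * psum L u)
psum-⊗ c u zero = ≈-sym (zeroʳ c)
psum-⊗ c u (suc L) = ≈-trans (+-cong (psum-⊗ c u L) ≈-refl) (≈-sym (distribˡ c (psum L u) (u L)))

psum-suc : ∀ u L → psum (suc L) u ≈ (u 0 + psum L (λ n → u (suc n)))
psum-suc u zero = +-comm 0# (u 0)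
psum-suc u (suc L) = ≈-trans (+-cong (psum-suc u L) ≈-refl) (+-assoc (u 0) (psum L (λ n → u (suc n))) (u (suc L)))

∑-unique : ∀ {u F} d → HasSum u F → ∑ u d ≈ F
∑-unique {u} d h = ⟶-unique (∑-has u d) h

∑-cong : ∀ {u v} d d′ → (∀ n → u n ≈ v n) → ∑ u d ≈ ∑ v d′
∑-cong {u} {v} d d′ p = ∑-unique d (⟶-cong (λ L → psum-cong (λ n → ≈-sym (p n)) L) ≈-refl (∑-has v d′))

∑-⊕ : ∀ {u v} d d₁ d₂ → ∑ (λ n → u n + v n) d ≈ (∑ u d₁ + ∑ v d₂)
∑-⊕ {u} {v} d d₁ d₂ = ∑-unique d (⟶-cong (λ L → ≈-sym (psum-⊕ u v L)) ≈-refl (⟶-⊕ (∑-has u d₁) (∑-has v d₂)))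

∑-⊗ : ∀ {u} c d d₁ → ∑ (λ n → c * u n) d ≈ (c * ∑ u d₁)
∑-⊗ {u} c d d₁ = ∑-unique d (⟶-cong (λ L → ≈-sym (psum-⊗ c u L)) ≈-refl (⟶-⊗ (⟶-const c) (∑-has u d₁)))

∑-suc : ∀ {u} d d₁ → ∑ u d ≈ (u 0 + ∑ (λ n → u (suc n)) d₁)
∑-suc {u} d d₁ = ⟶-unique
  (⟶-subseq suc ℕP.n≤1+n (∑-has u d))
  (⟶-cong (λ L → ≈-sym (psum-suc u L)) ≈-refl (⟶-⊕ (⟶-const (u 0)) (∑-has (λ n → u (suc n)) d₁)))

dec-≈ : ∀ {u v} → (∀ n → u n ≈ v n) → Dec u → Dec v
dec-≈ p d N = proj₁ (d N) , λ n M≤n → ord-≈ (p n) (proj₂ (d N) n M≤n)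

dec-⊕ : ∀ {u v} → Dec u → Dec v → Dec (λ n → u n + v n)
dec-⊕ d e N = let (A , h) = d N ; (A′ , h′) = e N in A ℕ.⊔ A′ , λ n l →
  ord-⊕ (h n (ℕP.≤-trans (ℕP.m≤m⊔n A A′) l)) (h′ n (ℕP.≤-trans (ℕP.m≤n⊔m A A′) l))

dec-⊗ʳ : ∀ {u} (c : ℕ → Series) → Dec u → Dec (λ n → c n * u n)
dec-⊗ʳ c d N = proj₁ (d N) , λ n l → ord-⊗ʳ (c n) (proj₂ (d N) n l)

dec-suc : ∀ {u} → Dec u → Dec (λ n → u (suc n))
dec-suc d N = proj₁ (d N) , λ n l → proj₂ (d N) (suc n) (ℕP.m≤n⇒m≤1+n l)

dec-ord : ∀ {u} → (∀ n → Ord n (u n)) → Dec u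
dec-ord h N = N , λ n l → ord-≤ l (h n)

dec-sub : ∀ {u} (φ : ℕ → ℕ) → (∀ n → n ≤ φ n) → Dec u → Dec (λ n → u (φ n))
dec-sub φ h d N = proj₁ (d N) , λ n l → proj₂ (d N) (φ n) (ℕP.≤-trans l (h n))

-- One large index is enough for a high order. Up to a given exponent the double sum is then a
-- finite square, which legitimates every interchange of summations.
Dec² : (ℕ → ℕ → Series) → Set
Dec² g = ∀ N → Σ[ M ∈ ℕ ] (∀ i j → M ≤ i ⊎ M ≤ j → Ord N (g i j))

row : ∀ {g} → Dec² g → ∀ i → Dec (g i)
row D i N = proj₁ (D N) , λ j l → proj₂ (D N) i j (inj₂ l)

transpose : ∀ {g : ℕ → ℕ → Series} → Dec² g → Dec² (λ j i → g i j)
transpose D N = proj₁ (D N) , λ { j i (inj₁ l) → proj₂ (D N) i j (inj₂ l) ; j i (inj₂ l) → proj₂ (D N) i j (inj₁ l) }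

psum-0 : ∀ u L n → (∀ k → u k n ≡ 0ℚ) → psum L u n ≡ 0ℚ
psum-0 u zero n h = 0-at n
psum-0 u (suc L) n h = trans (+-at (psum L u) (u L) n) (cong₂ ℚ._+_ (psum-0 u L n h) (h L))

opaque
  unfolding ∑

  ∑-ord : ∀ {u} d N → (∀ n → Ord N (u n)) → Ord N (∑ u d)
  ∑-ord {u} d N h n n<N = psum-0 u (proj₁ (d (suc n))) n (λ k → h k n n<N)

rows : ∀ {g} (D : Dec² g) → Dec (λ i → ∑ (g i) (row D i))
rows D N = proj₁ (D N) , λ i l → ∑-ord (row D i) N (λ j → proj₂ (D N) i j (inj₁ l))

psum-swap : ∀ (g : ℕ → ℕ → Series) L K → psum L (λ i → psum K (g i)) ≈ psum K (λ j → psum L (λ i → g i j))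
psum-swap g zero K = mk λ n → trans (0-at n) (sym (psum-0 _ K n (λ k → 0-at n)))
psum-swap g (suc L) K = ≈-trans (+-cong (psum-swap g L K) ≈-refl) (≈-sym (psum-⊕ (λ j → psum L (λ i → g i j)) (g L) K))

double-sum : ∀ {g} (D : Dec² g) N → let M = proj₁ (D N) in
  Agree N (∑ (λ i → ∑ (g i) (row D i)) (rows D)) (psum M (λ i → psum M (g i)))
double-sum {g} D N = agree-trans (proj₂ (∑-has _ (rows D) N) M ℕP.≤-refl) (inner M)
  where
  M = proj₁ (D N)
  inner : ∀ L → Agree N (psum L (λ i → ∑ (g i) (row D i))) (psum L (λ i → psum M (g i)))
  inner zero n _ = refl
  inner (suc L) = agree-⊕ (inner L) (proj₂ (∑-has (g L) (row D L) N) M ℕP.≤-refl)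

∑-swap : ∀ {g} (D : Dec² g) (D′ : Dec² (λ j i → g i j)) →
  ∑ (λ i → ∑ (g i) (row D i)) (rows D) ≈ ∑ (λ j → ∑ (λ i → g i j) (row D′ j)) (rows D′)
∑-swap {g} D D′ = ≈-trans
  (agree⇒≈ λ N → agree-trans (double-sum D N) (agree-trans (≈⇒agree N (psum-swap g (proj₁ (D N)) (proj₁ (D N)))) (agree-sym (double-sum (transpose D) N))))
  (∑-cong (rows (transpose D)) (rows D′) λ j → ∑-cong (row (transpose D) j) (row D′ j) λ i → ≈-refl)

-- Bilateral sums

module ℤR = ℤS.+-*-Solver

-- The reflection k ↦ -1 - k. It exchanges the two constructors of ℤ, so the pairs of `fold` are
-- exactly its orbits.
~_ : ℤ → ℤ
~ (+ n) = -[1+ n ]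
~ -[1+ n ] = + n

~-is : ∀ k → ~ k ≡ ℤ.- k ℤ.- + 1
~-is (+ zero) = refl
~-is (+ suc n) = cong (λ z → -[1+ suc z ]) (sym (ℕP.+-identityʳ n))
~-is -[1+ n ] = refl

fold : (ℤ → Series) → ℕ → Series
fold g n = g (+ n) + g -[1+ n ]

Decℤ : (ℤ → Series) → Set
Decℤ g = ∀ N → Σ[ M ∈ ℕ ] (∀ k → M ≤ ∣ k ∣ → Ord N (g k))

dec-fold : ∀ {g} → Decℤ g → Dec (fold g)
dec-fold d N = proj₁ (d N) , λ n l → ord-⊕ (proj₂ (d N) (+ n) l) (proj₂ (d N) -[1+ n ] (ℕP.m≤n⇒m≤1+n l))

opaque
  ∑ℤ : (g : ℤ → Series) → Decℤ g → Series
  ∑ℤ g d = ∑ (fold g) (dec-fold d)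

  ∑ℤ-is : ∀ g d → ∑ℤ g d ≈ ∑ (fold g) (dec-fold d)
  ∑ℤ-is g d = ≈-refl

opaque
  unfolding ∑ℤ

  ∑ℤ-cong : ∀ {g h} d d′ → (∀ k → g k ≈ h k) → ∑ℤ g d ≈ ∑ℤ h d′
  ∑ℤ-cong d d′ p = ∑-cong _ _ λ n → +-cong (p (+ n)) (p -[1+ n ])

decℤ-+ : ∀ {g h} → Decℤ g → Decℤ h → Decℤ (λ k → g k + h k)
decℤ-+ d e N = let (m , p) = d N ; (m′ , p′) = e N in m ℕ.⊔ m′ , λ k l →
  ord-⊕ (p k (ℕP.≤-trans (ℕP.m≤m⊔n m m′) l)) (p′ k (ℕP.≤-trans (ℕP.m≤n⊔m m m′) l))

decℤ-*ʳ : ∀ {g} (c : ℤ → Series) → Decℤ g → Decℤ (λ k → c k * g k)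
decℤ-*ʳ c d N = proj₁ (d N) , λ k l → ord-⊗ʳ (c k) (proj₂ (d N) k l)

decℤ-*ˡ : ∀ {g} (c : ℤ → Series) → Decℤ g → Decℤ (λ k → g k * c k)
decℤ-*ˡ c d N = proj₁ (d N) , λ k l → ord-⊗ˡ (c k) (proj₂ (d N) k l)

decℤ-neg : ∀ {g} → Decℤ g → Decℤ (λ k → - g k)
decℤ-neg d N = proj₁ (d N) , λ k l → ord-- (proj₂ (d N) k l)

decℤ-≈ : ∀ {g h} → (∀ k → g k ≈ h k) → Decℤ g → Decℤ h
decℤ-≈ p d N = proj₁ (d N) , λ k l → ord-≈ (p k) (proj₂ (d N) k l)

decℤ-∘ : ∀ {g} (φ : ℤ → ℤ) c → (∀ k → ∣ k ∣ ≤ ∣ φ k ∣ ℕ.+ c) → Decℤ g → Decℤ (λ k → g (φ k))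
decℤ-∘ φ c h d N = proj₁ (d N) ℕ.+ c , λ k l → proj₂ (d N) (φ k) (ℕP.+-cancelʳ-≤ c _ _ (ℕP.≤-trans l (h k)))

decℤ-q : (e : ℤ → ℕ) (c : ℕ) → (∀ k → ∣ k ∣ ≤ e k ℕ.+ c) → Decℤ (λ k → q^ e k)
decℤ-q e c h N = N ℕ.+ c , λ k l → ord-≤ (ℕP.+-cancelʳ-≤ c _ _ (ℕP.≤-trans l (h k))) (q^-ord (e k))

opaque
  unfolding ∑ℤ

  ∑ℤ-+ : ∀ {g h} d d₁ d₂ → ∑ℤ (λ k → g k + h k) d ≈ ∑ℤ g d₁ + ∑ℤ h d₂
  ∑ℤ-+ {g} {h} d d₁ d₂ = ≈-trans
    (∑-cong _ (dec-⊕ (dec-fold d₁) (dec-fold d₂)) λ n → solve 4 (λ a b c d → (a :+ b) :+ (c :+ d) := (a :+ c) :+ (b :+ d)) ≈-refl (g (+ n)) (h (+ n)) (g -[1+ n ]) (h -[1+ n ]))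
    (∑-⊕ _ _ _)

  ∑ℤ-* : ∀ {g} c d d₁ → ∑ℤ (λ k → c * g k) d ≈ c * ∑ℤ g d₁
  ∑ℤ-* {g} c d d₁ = ≈-trans (∑-cong _ (dec-⊗ʳ (λ _ → c) (dec-fold d₁)) λ n → ≈-sym (distribˡ c (g (+ n)) (g -[1+ n ]))) (∑-⊗ c _ _)

∑ℤ-neg : ∀ {g} d d₁ → ∑ℤ (λ k → - g k) d ≈ - ∑ℤ g d₁
∑ℤ-neg {g} d d₁ = ≈-trans (∑ℤ-cong d (decℤ-*ʳ (λ _ → - 1#) d₁) λ k → solve 1 (λ x → :- x := :- con 1ℚ :* x) ≈-refl (g k))
  (≈-trans (∑ℤ-* (- 1#) (decℤ-*ʳ (λ _ → - 1#) d₁) d₁) (solve 1 (λ x → :- con 1ℚ :* x := :- x) ≈-refl (∑ℤ g d₁)))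

opaque
  unfolding ∑ℤ

  ∑ℤ-~ : ∀ {g} d d₁ → ∑ℤ g d ≈ ∑ℤ (λ k → g (~ k)) d₁
  ∑ℤ-~ {g} d d₁ = ∑-cong _ _ λ n → +-comm (g (+ n)) (g -[1+ n ])

private
  neg-suc : ℕ → ℤ
  neg-suc zero = + 0
  neg-suc (suc n) = -[1+ n ]

  suc-neg : ∀ n → ℤ.suc -[1+ n ] ≡ neg-suc n
  suc-neg zero = refl
  suc-neg (suc n) = refl

  -- A symmetric window moved by one place loses a term at one end and gains one at the other; both
  -- tend to 0.
  psum-shift : ∀ g L → psum L (fold (λ k → g (ℤ.suc k))) + g (neg-suc L) ≈ psum L (fold g) + g (+ L)
  psum-shift g zero = ≈-refl
  psum-shift g (suc L) = begin
    (p′ + (g (+ suc L) + g (ℤ.suc -[1+ L ]))) + g -[1+ L ]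
      ≈⟨ +-cong (+-cong ≈-refl (+-cong ≈-refl (≡⇒≈ (cong g (suc-neg L))))) ≈-refl ⟩
    (p′ + (g (+ suc L) + g (neg-suc L))) + g -[1+ L ]
      ≈⟨ solve 4 (λ a b c d → (a :+ (b :+ c)) :+ d := (a :+ c) :+ (b :+ d)) ≈-refl p′ (g (+ suc L)) (g (neg-suc L)) (g -[1+ L ]) ⟩
    (p′ + g (neg-suc L)) + (g (+ suc L) + g -[1+ L ]) ≈⟨ +-cong (psum-shift g L) ≈-refl ⟩
    (psum L (fold g) + g (+ L)) + (g (+ suc L) + g -[1+ L ])
      ≈⟨ solve 4 (λ a b c d → (a :+ b) :+ (c :+ d) := (a :+ (b :+ d)) :+ c) ≈-refl (psum L (fold g)) (g (+ L)) (g (+ suc L)) (g -[1+ L ]) ⟩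
    (psum L (fold g) + (g (+ L) + g -[1+ L ])) + g (+ suc L) ∎
    where
    open SR
    p′ = psum L (fold (λ k → g (ℤ.suc k)))
    ≡⇒≈ : ∀ {a b} → a ≡ b → a ≈ b
    ≡⇒≈ refl = ≈-refl

  neg-suc-abs : ∀ n → ∣ neg-suc n ∣ ≡ n
  neg-suc-abs zero = refl
  neg-suc-abs (suc n) = refl

≡⇒≈ : ∀ {a b : Series} → a ≡ b → a ≈ b
≡⇒≈ refl = ≈-refl

opaque
  unfolding ∑ℤ

  ∑ℤ-shift : ∀ {g} d d₁ → ∑ℤ g d ≈ ∑ℤ (λ k → g (ℤ.suc k)) d₁
  ∑ℤ-shift {g} d d₁ = ⟶-unique
    (⟶-cong {s = λ L → psum L (fold g) + g (+ L)} (λ L → ≈-refl) (+-identityʳ _)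
      (⟶-⊕ (∑-has (fold g) (dec-fold d)) (⟶-0 λ N → proj₁ (d N) , λ L l → proj₂ (d N) (+ L) l)))
    (⟶-cong (psum-shift g) (+-identityʳ _)
      (⟶-⊕ (∑-has (fold (λ k → g (ℤ.suc k))) (dec-fold d₁))
        (⟶-0 λ N → proj₁ (d N) , λ L l → proj₂ (d N) (neg-suc L) (subst (proj₁ (d N) ≤_) (sym (neg-suc-abs L)) l))))

Decℤ² : (ℤ → ℤ → Series) → Set
Decℤ² g = ∀ N → Σ[ M ∈ ℕ ] (∀ i j → M ≤ ∣ i ∣ ⊎ M ≤ ∣ j ∣ → Ord N (g i j))

transposeℤ : ∀ {g : ℤ → ℤ → Series} → Decℤ² g → Decℤ² (λ j i → g i j)
transposeℤ D N = proj₁ (D N) , λ { j i (inj₁ l) → proj₂ (D N) i j (inj₂ l) ; j i (inj₂ l) → proj₂ (D N) i j (inj₁ l) }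

rowℤ : ∀ {g} → Decℤ² g → ∀ i → Decℤ (g i)
rowℤ D i N = proj₁ (D N) , λ j l → proj₂ (D N) i j (inj₂ l)

opaque
  unfolding ∑ℤ

  rowsℤ : ∀ {g} (D : Decℤ² g) → Decℤ (λ i → ∑ℤ (g i) (rowℤ D i))
  rowsℤ D N = proj₁ (D N) , λ i l → ∑-ord _ N (λ n → ord-⊕ (proj₂ (D N) i (+ n) (inj₁ l)) (proj₂ (D N) i -[1+ n ] (inj₁ l)))

Decℕℤ : (ℕ → ℤ → Series) → Set
Decℕℤ g = ∀ N → Σ[ M ∈ ℕ ] (∀ i j → M ≤ i ⊎ M ≤ ∣ j ∣ → Ord N (g i j))

rowℕℤ : ∀ {g} → Decℕℤ g → ∀ i → Decℤ (g i)
rowℕℤ D i N = proj₁ (D N) , λ j l → proj₂ (D N) i j (inj₂ l)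

colℕℤ : ∀ {g} → Decℕℤ g → ∀ j → Dec (λ i → g i j)
colℕℤ D j N = proj₁ (D N) , λ i l → proj₂ (D N) i j (inj₁ l)

opaque
  unfolding ∑ℤ

  rowsℕℤ : ∀ {g} (D : Decℕℤ g) → Dec (λ i → ∑ℤ (g i) (rowℕℤ D i))
  rowsℕℤ D N = proj₁ (D N) , λ i l → ∑-ord _ N (λ n → ord-⊕ (proj₂ (D N) i (+ n) (inj₁ l)) (proj₂ (D N) i -[1+ n ] (inj₁ l)))

colsℕℤ : ∀ {g} (D : Decℕℤ g) → Decℤ (λ j → ∑ (λ i → g i j) (colℕℤ D j))
colsℕℤ D N = proj₁ (D N) , λ j l → ∑-ord _ N (λ i → proj₂ (D N) i j (inj₂ l))

opaque
  unfolding ∑ℤ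

  ∑∑ℤ-swap : ∀ {g} (D : Decℕℤ g) →
    ∑ (λ i → ∑ℤ (g i) (rowℕℤ D i)) (rowsℕℤ D) ≈ ∑ℤ (λ j → ∑ (λ i → g i j) (colℕℤ D j)) (colsℕℤ D)
  ∑∑ℤ-swap {g} D = ≈-trans (∑-cong _ (rows D²) λ i → ∑-cong _ _ λ j → ≈-refl)
    (≈-trans (∑-swap D² (transpose D²)) (∑-cong _ _ λ j → ∑-⊕ _ _ _))
    where
    D² : Dec² (λ i j → fold (g i) j)
    D² N = proj₁ (D N) , λ
      { i j (inj₁ l) → ord-⊕ (proj₂ (D N) i (+ j) (inj₁ l)) (proj₂ (D N) i -[1+ j ] (inj₁ l))
      ; i j (inj₂ l) → ord-⊕ (proj₂ (D N) i (+ j) (inj₂ l)) (proj₂ (D N) i -[1+ j ] (inj₂ (ℕP.m≤n⇒m≤1+n l))) }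

  ∑ℤ-swap : ∀ {g} (D : Decℤ² g) (D′ : Decℤ² (λ j i → g i j)) →
    ∑ℤ (λ i → ∑ℤ (g i) (rowℤ D i)) (rowsℤ D) ≈ ∑ℤ (λ j → ∑ℤ (λ i → g i j) (rowℤ D′ j)) (rowsℤ D′)
  ∑ℤ-swap {g} D D′ = ≈-trans
    (∑-cong _ (rowsℕℤ Dℕ) λ i → ≈-sym (∑ℤ-+ (rowℕℤ Dℕ i) (rowℤ D (+ i)) (rowℤ D -[1+ i ])))
    (≈-trans (∑∑ℤ-swap Dℕ) (∑ℤ-cong (colsℕℤ Dℕ) (rowsℤ D′) λ j → ∑-cong {fold (λ i → g i j)} {fold (λ i → g i j)} (colℕℤ Dℕ j) (dec-fold (rowℤ D′ j)) λ i → ≈-refl))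
    where
    Dℕ : Decℕℤ (λ i j → g (+ i) j + g -[1+ i ] j)
    Dℕ N = proj₁ (D N) , λ
      { i j (inj₁ l) → ord-⊕ (proj₂ (D N) (+ i) j (inj₁ l)) (proj₂ (D N) -[1+ i ] j (inj₁ (ℕP.m≤n⇒m≤1+n l)))
      ; i j (inj₂ l) → ord-⊕ (proj₂ (D N) (+ i) j (inj₂ l)) (proj₂ (D N) -[1+ i ] j (inj₂ l)) }

-- Splitting sums by residue classes modulo 2 and 3

thrice : ℕ → ℕ
thrice zero = 0
thrice (suc n) = suc (suc (suc (thrice n)))

twice : ℕ → ℕ
twice zero = 0
twice (suc n) = suc (suc (twice n))

≤-thrice : ∀ n → n ≤ thrice n
≤-thrice zero = z≤n
≤-thrice (suc n) = s≤s (ℕP.m≤n⇒m≤1+n (ℕP.m≤n⇒m≤1+n (≤-thrice n)))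

≤-twice : ∀ n → n ≤ twice n
≤-twice zero = z≤n
≤-twice (suc n) = s≤s (ℕP.m≤n⇒m≤1+n (≤-twice n))

psum-thrice : ∀ u L → psum L (λ n → u (thrice n) + u (suc (thrice n)) + u (suc (suc (thrice n)))) ≈ psum (thrice L) u
psum-thrice u zero = ≈-refl
psum-thrice u (suc L) = ≈-trans (+-cong (psum-thrice u L) ≈-refl)
  (solve 4 (λ p a b c → p :+ (a :+ b :+ c) := p :+ a :+ b :+ c) ≈-refl (psum (thrice L) u) (u (thrice L)) (u (suc (thrice L))) (u (suc (suc (thrice L)))))

psum-twice : ∀ u L → psum L (λ n → u (twice n) + u (suc (twice n))) ≈ psum (twice L) u
psum-twice u zero = ≈-refl
psum-twice u (suc L) = ≈-trans (+-cong (psum-twice u L) ≈-refl) (≈-sym (+-assoc _ _ _))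

∑-split₃ : ∀ {u} d d₀ d₁ d₂ → ∑ u d ≈ ∑ (λ n → u (thrice n)) d₀ + ∑ (λ n → u (suc (thrice n))) d₁ + ∑ (λ n → u (suc (suc (thrice n)))) d₂
∑-split₃ {u} d d₀ d₁ d₂ = ≈-trans
  (⟶-unique (⟶-subseq thrice ≤-thrice (∑-has u d)) (⟶-cong (psum-thrice u) ≈-refl (∑-has _ d₃)))
  (≈-trans (∑-⊕ d₃ (dec-⊕ d₀ d₁) d₂) (+-cong (∑-⊕ (dec-⊕ d₀ d₁) d₀ d₁) ≈-refl))
  where d₃ = dec-⊕ (dec-⊕ d₀ d₁) d₂

-- Given on constructors, so that the images are literally the indices met by `fold`. The class of a
-- negative index is reversed: -1 - 3n lies in the class 3k + 2 and is paired with 3n.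
dbl dbl⁺ tpl tpl⁺ tpl⁺⁺ : ℤ → ℤ
dbl (+ n) = + twice n
dbl -[1+ n ] = -[1+ suc (twice n) ]
dbl⁺ (+ n) = + suc (twice n)
dbl⁺ -[1+ n ] = -[1+ twice n ]
tpl (+ n) = + thrice n
tpl -[1+ n ] = -[1+ suc (suc (thrice n)) ]
tpl⁺ (+ n) = + suc (thrice n)
tpl⁺ -[1+ n ] = -[1+ suc (thrice n) ]
tpl⁺⁺ (+ n) = + suc (suc (thrice n))
tpl⁺⁺ -[1+ n ] = -[1+ thrice n ]

twice-is : ∀ n → twice n ≡ n ℕ.+ n
twice-is zero = refl
twice-is (suc n) = cong suc (trans (cong suc (twice-is n)) (sym (ℕP.+-suc n n)))

thrice-is : ∀ n → thrice n ≡ n ℕ.+ (n ℕ.+ n)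
thrice-is zero = refl
thrice-is (suc n) = cong suc (trans (cong (suc ∘ suc) (thrice-is n))
  (sym (trans (ℕP.+-suc n (n ℕ.+ suc n)) (cong suc (trans (cong (n ℕ.+_) (ℕP.+-suc n n)) (ℕP.+-suc n (n ℕ.+ n)))))))

dbl-is : ∀ k → dbl k ≡ k ℤ.+ k
dbl-is (+ n) = cong +_ (twice-is n)
dbl-is -[1+ n ] = cong (λ z → -[1+ suc z ]) (twice-is n)

dbl⁺-is : ∀ k → dbl⁺ k ≡ k ℤ.+ k ℤ.+ + 1
dbl⁺-is (+ n) = trans (cong (λ z → + suc z) (twice-is n)) (cong +_ (ℕP.+-comm 1 (n ℕ.+ n)))
dbl⁺-is -[1+ n ] = cong -[1+_] (twice-is n)

tpl-is : ∀ k → tpl k ≡ k ℤ.+ (k ℤ.+ k)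
tpl-is (+ n) = cong +_ (thrice-is n)
tpl-is -[1+ n ] = cong (λ z → -[1+ suc z ]) (trans (cong suc (thrice-is n)) (sym (ℕP.+-suc n (n ℕ.+ n))))

tpl⁺-is : ∀ k → tpl⁺ k ≡ k ℤ.+ (k ℤ.+ k) ℤ.+ + 1
tpl⁺-is k = trans (go k) (trans (cong (λ z → + 1 ℤ.+ z) (tpl-is k)) (ℤP.+-comm (+ 1) (k ℤ.+ (k ℤ.+ k))))
  where go : ∀ k → tpl⁺ k ≡ + 1 ℤ.+ tpl k
        go (+ n) = refl
        go -[1+ n ] = refl

tpl⁺⁺-is : ∀ k → tpl⁺⁺ k ≡ k ℤ.+ (k ℤ.+ k) ℤ.+ + 2
tpl⁺⁺-is k = trans (go k) (trans (cong (λ z → + 2 ℤ.+ z) (tpl-is k)) (ℤP.+-comm (+ 2) (k ℤ.+ (k ℤ.+ k))))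
  where go : ∀ k → tpl⁺⁺ k ≡ + 2 ℤ.+ tpl k
        go (+ n) = refl
        go -[1+ n ] = refl

abs-dbl : ∀ k → ∣ k ∣ ≤ ∣ dbl k ∣ ℕ.+ 0
abs-dbl (+ n) = ℕP.≤-trans (≤-twice n) (ℕP.m≤m+n _ 0)
abs-dbl -[1+ n ] = s≤s (ℕP.≤-trans (ℕP.m≤n⇒m≤1+n (≤-twice n)) (ℕP.m≤m+n _ 0))

abs-dbl⁺ : ∀ k → ∣ k ∣ ≤ ∣ dbl⁺ k ∣ ℕ.+ 0
abs-dbl⁺ (+ n) = ℕP.≤-trans (ℕP.m≤n⇒m≤1+n (≤-twice n)) (ℕP.m≤m+n _ 0)
abs-dbl⁺ -[1+ n ] = s≤s (ℕP.≤-trans (≤-twice n) (ℕP.m≤m+n _ 0))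

opaque
  unfolding ∑ℤ

  ∑ℤ-split₂ : ∀ {g} d d₀ d₁ → ∑ℤ g d ≈ ∑ℤ (λ k → g (dbl k)) d₀ + ∑ℤ (λ k → g (dbl⁺ k)) d₁
  ∑ℤ-split₂ {g} d d₀ d₁ = ≈-trans
    (⟶-unique (⟶-subseq twice ≤-twice (∑-has _ (dec-fold d)))
      (⟶-cong (λ L → ≈-trans (psum-cong (λ n → solve 4 (λ a b c d → (a :+ b) :+ (c :+ d) := (a :+ d) :+ (c :+ b)) ≈-refl (g (dbl (+ n))) (g (dbl -[1+ n ])) (g (dbl⁺ (+ n))) (g (dbl⁺ -[1+ n ]))) L) (psum-twice (fold g) L)) ≈-refl
        (∑-has _ (dec-⊕ (dec-fold d₀) (dec-fold d₁)))))
    (∑-⊕ _ _ _)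

  ∑ℤ-split₃ : ∀ {g} d d₀ d₁ d₂ → ∑ℤ g d ≈ ∑ℤ (λ k → g (tpl k)) d₀ + ∑ℤ (λ k → g (tpl⁺ k)) d₁ + ∑ℤ (λ k → g (tpl⁺⁺ k)) d₂
  ∑ℤ-split₃ {g} d d₀ d₁ d₂ = ≈-trans
    (⟶-unique (⟶-subseq thrice ≤-thrice (∑-has _ (dec-fold d)))
      (⟶-cong (λ L → ≈-trans (psum-cong (λ n → solve 6 (λ a a′ b b′ c c′ → (a :+ a′) :+ (b :+ b′) :+ (c :+ c′) := (a :+ c′) :+ (b :+ b′) :+ (c :+ a′)) ≈-refl
           (g (tpl (+ n))) (g (tpl -[1+ n ])) (g (tpl⁺ (+ n))) (g (tpl⁺ -[1+ n ])) (g (tpl⁺⁺ (+ n))) (g (tpl⁺⁺ -[1+ n ]))) L) (psum-thrice (fold g) L)) ≈-refl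
        (∑-has _ (dec-⊕ (dec-⊕ (dec-fold d₀) (dec-fold d₁)) (dec-fold d₂)))))
    (≈-trans (∑-⊕ _ (dec-⊕ (dec-fold d₀) (dec-fold d₁)) _) (+-cong (∑-⊕ _ _ _) ≈-refl))

abs-tpl : ∀ k → ∣ k ∣ ≤ ∣ tpl k ∣ ℕ.+ 0
abs-tpl (+ n) = ℕP.≤-trans (≤-thrice n) (ℕP.m≤m+n _ 0)
abs-tpl -[1+ n ] = s≤s (ℕP.≤-trans (ℕP.m≤n⇒m≤1+n (ℕP.m≤n⇒m≤1+n (≤-thrice n))) (ℕP.m≤m+n _ 0))

abs-tpl⁺ : ∀ k → ∣ k ∣ ≤ ∣ tpl⁺ k ∣ ℕ.+ 0
abs-tpl⁺ (+ n) = ℕP.≤-trans (ℕP.m≤n⇒m≤1+n (≤-thrice n)) (ℕP.m≤m+n _ 0)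
abs-tpl⁺ -[1+ n ] = s≤s (ℕP.≤-trans (ℕP.m≤n⇒m≤1+n (≤-thrice n)) (ℕP.m≤m+n _ 0))

abs-tpl⁺⁺ : ∀ k → ∣ k ∣ ≤ ∣ tpl⁺⁺ k ∣ ℕ.+ 0
abs-tpl⁺⁺ (+ n) = ℕP.≤-trans (ℕP.m≤n⇒m≤1+n (ℕP.m≤n⇒m≤1+n (≤-thrice n))) (ℕP.m≤m+n _ 0)
abs-tpl⁺⁺ -[1+ n ] = s≤s (ℕP.≤-trans (≤-thrice n) (ℕP.m≤m+n _ 0))

abs-suc : ∀ k → ∣ k ∣ ≤ ∣ ℤ.suc k ∣ ℕ.+ 1
abs-suc (+ n) = ℕP.m≤n⇒m≤1+n (ℕP.m≤m+n n 1)
abs-suc -[1+ zero ] = s≤s z≤n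
abs-suc -[1+ suc n ] = s≤s (ℕP.≤-reflexive (ℕP.+-comm 1 n))

abs-~ : ∀ k → ∣ k ∣ ≤ ∣ ~ k ∣ ℕ.+ 1
abs-~ (+ n) = ℕP.m≤n⇒m≤1+n (ℕP.m≤m+n n 1)
abs-~ -[1+ n ] = ℕP.≤-reflexive (ℕP.+-comm 1 n)

-- Signs, linear weights and triangular exponents

σℕ ιℕ : ℕ → Series
σℕ zero = 1#
σℕ (suc n) = - σℕ n
ιℕ zero = 0#
ιℕ (suc n) = ιℕ n + 1#

σ : ℤ → Series
σ (+ n) = σℕ n
σ -[1+ n ] = - σℕ n

σ-suc : ∀ k → σ (ℤ.suc k) ≈ - σ k
σ-suc (+ n) = ≈-refl
σ-suc -[1+ zero ] = solve 0 (con 1ℚ := :- (:- con 1ℚ)) ≈-refl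
σ-suc -[1+ suc n ] = solve 1 (λ x → :- x := :- (:- (:- x))) ≈-refl (σ (+ n))

σ-~ : ∀ k → σ (~ k) ≈ - σ k
σ-~ (+ n) = ≈-refl
σ-~ -[1+ n ] = solve 1 (λ x → x := :- (:- x)) ≈-refl (σ (+ n))

ι : ℤ → Series
ι (+ n) = ιℕ n
ι -[1+ n ] = - (ιℕ n + 1#)

ι-suc : ∀ k → ι (ℤ.suc k) ≈ ι k + 1#
ι-suc (+ n) = ≈-refl
ι-suc -[1+ zero ] = solve 0 (con 0ℚ := :- (con 0ℚ :+ con 1ℚ) :+ con 1ℚ) ≈-refl
ι-suc -[1+ suc n ] = solve 1 (λ x → :- (x :+ con 1ℚ) := :- ((x :+ con 1ℚ) :+ con 1ℚ) :+ con 1ℚ) ≈-refl (ι (+ n))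

ι-~ : ∀ k → ι (~ k) ≈ - (ι k + 1#)
ι-~ (+ n) = ≈-refl
ι-~ -[1+ n ] = solve 1 (λ x → x := :- (:- (x :+ con 1ℚ) :+ con 1ℚ)) ≈-refl (ι (+ n))

suc-induction : ∀ {f : ℤ → Series} (c : Series) → (∀ k → f (ℤ.suc k) ≈ c * f k) → (∀ k → f k ≈ c * f (ℤ.suc k)) → f (+ 0) ≈ 0# → ∀ k → f k ≈ 0#
suc-induction c h h′ z (+ zero) = z
suc-induction c h h′ z (+ suc n) = ≈-trans (h (+ n)) (≈-trans (*-cong ≈-refl (suc-induction c h h′ z (+ n))) (zeroʳ c))
suc-induction c h h′ z -[1+ zero ] = ≈-trans (h′ -[1+ 0 ]) (≈-trans (*-cong ≈-refl z) (zeroʳ c))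
suc-induction c h h′ z -[1+ suc n ] = ≈-trans (h′ -[1+ suc n ]) (≈-trans (*-cong ≈-refl (suc-induction c h h′ z -[1+ n ])) (zeroʳ c))

-- Closed forms containing (-1)^k are proved in this way: both sides obey the same first-order
-- recursion, which can be run in both directions of ℤ, and agree at 0.
suc-alternating : ∀ {f : ℤ → Series} → (∀ k → f (ℤ.suc k) + f k ≈ 0#) → f (+ 0) ≈ 0# → ∀ k → f k ≈ 0#
suc-alternating {f} h = suc-induction (- 1#)
  (λ k → ≈-trans (solve 2 (λ x y → x := (x :+ y) :+ :- con 1ℚ :* y) ≈-refl (f (ℤ.suc k)) (f k)) (≈-trans (+-cong (h k) ≈-refl) (+-identityˡ _)))
  (λ k → ≈-trans (solve 2 (λ x y → y := (x :+ y) :+ :- con 1ℚ :* x) ≈-refl (f (ℤ.suc k)) (f k)) (≈-trans (+-cong (h k) ≈-refl) (+-identityˡ _)))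

suc-constant : ∀ {f : ℤ → Series} → (∀ k → f (ℤ.suc k) ≈ f k) → f (+ 0) ≈ 0# → ∀ k → f k ≈ 0#
suc-constant {f} h = suc-induction 1# (λ k → ≈-trans (h k) (≈-sym (*-identityˡ _))) (λ k → ≈-trans (≈-sym (h k)) (≈-sym (*-identityˡ _)))

-- T n = n(n-1)/2 and tri k = k(k-1)/2
T : ℕ → ℕ
T zero = 0
T (suc n) = n ℕ.+ T n

tri : ℤ → ℕ
tri (+ n) = T n
tri -[1+ n ] = T (suc (suc n))

-- k², as the sum of two neighbouring triangular numbers.
sq : ℤ → ℕ
sq k = tri k ℕ.+ tri (ℤ.suc k)

tri-suc : ∀ k → + tri (ℤ.suc k) ≡ k ℤ.+ + tri k
tri-suc (+ n) = refl
tri-suc -[1+ zero ] = refl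
tri-suc -[1+ suc n ] = trans (ℤR.solve 1 (λ t → t ℤR.:= (ℤR.:- (ℤR.con (+ 0))) ℤR.:+ t) refl (+ T (suc (suc n))))
  (sym (trans (cong (λ z → -[1+ suc n ] ℤ.+ z) (ℤP.pos-+ (suc (suc n)) (T (suc (suc n)))))
    (trans (sym (ℤP.+-assoc -[1+ suc n ] (+ suc (suc n)) (+ T (suc (suc n)))))
      (cong (λ z → z ℤ.+ + T (suc (suc n))) (ℤP.+-inverseˡ (+ suc (suc n)))))))

-- Partial theta functions

module ℕR = ℕS.+-*-Solver

neg-term : ∀ x y → x + y ≈ 0# → x ≈ - y
neg-term x y h = ≈-trans (solve 2 (λ x y → x := (x :+ y) :- y) ≈-refl x y) (≈-trans (+-cong h ≈-refl) (+-identityˡ _))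

diff-zero : ∀ {x y} → x - y ≈ 0# → x ≈ y
diff-zero {x} {y} h = ≈-trans (neg-term x (- y) h) (solve 1 (λ y → :- (:- y) := y) ≈-refl y)

zero-diff : ∀ {x y} → x ≈ y → x - y ≈ 0#
zero-diff {x} {y} h = ≈-trans (+-cong h ≈-refl) (-‿inverseʳ y)

-- a solution of d m = - q^(e m) d (s m) with all e m ≥ 1 is divisible by every power of q
contraction : {I : Set} (d : I → Series) (s : I → I) (e : I → ℕ) →
  (∀ m → d m + q^ suc (e m) * d (s m) ≈ 0#) → ∀ m → d m ≈ 0#
contraction d s e h m = agree⇒≈ λ N n n<N → trans (go N m n n<N) (sym (0-at n))
  where
  go : ∀ N m → Ord N (d m)
  go zero m n ()
  go (suc N) m = ord-≈ (≈-sym (neg-term _ _ (h m))) (ord-- (ord-≤ (s≤s (ℕP.m≤n+m N (e m))) (ord-q^* (suc (e m)) (go N (s m)))))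

-- Terms of the partial theta function Σ (-1)^i q^(i(i+1)/2) z^i, i ≥ 0, at z = q^n.
r-term : ℕ → ℕ → Series
r-term n i = σℕ i * q^ (T (suc i) ℕ.+ i ℕ.* n)

dec-r : ∀ n → Dec (r-term n)
dec-r n = dec-⊗ʳ σℕ (dec-ord λ i → ord-≤ (ℕP.≤-trans (ℕP.m≤m+n i (T i)) (ℕP.m≤m+n (T (suc i)) (i ℕ.* n))) (q^-ord _))

opaque
  r : ℕ → Series
  r n = ∑ (r-term n) (dec-r n)

  r-is : ∀ n → r n ≈ ∑ (r-term n) (dec-r n)
  r-is n = ≈-refl

q^*q^ : ∀ {a b c} → a ℕ.+ b ≡ c → q^ a * q^ b ≈ q^ c
q^*q^ {a} {b} p = ≈-trans (q^-+ a b) (q^-cong p)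

r-rec : ∀ n → r n ≈ 1# - q^ suc n * r (suc n)
r-rec n = begin
  r n ≈⟨ ≈-trans (r-is n) (∑-suc (dec-r n) (dec-suc (dec-r n))) ⟩
  r-term n 0 + ∑ (λ i → r-term n (suc i)) (dec-suc (dec-r n))
    ≈⟨ +-cong (≈-trans (*-identityˡ _) q^-0) (∑-cong _ (dec-⊗ʳ (λ _ → - q^ suc n) (dec-r (suc n))) step) ⟩
  1# + ∑ (λ i → (- q^ suc n) * r-term (suc n) i) (dec-⊗ʳ (λ _ → - q^ suc n) (dec-r (suc n)))
    ≈⟨ +-cong ≈-refl (≈-trans (∑-⊗ (- q^ suc n) _ (dec-r (suc n))) (*-cong ≈-refl (≈-sym (r-is (suc n))))) ⟩
  1# + (- q^ suc n) * r (suc n) ≈⟨ solve 2 (λ x y → con 1ℚ :+ (:- x) :* y := con 1ℚ :- x :* y) ≈-refl (q^ suc n) (r (suc n)) ⟩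
  1# - q^ suc n * r (suc n) ∎
  where
  open SR
  step : ∀ i → r-term n (suc i) ≈ (- q^ suc n) * r-term (suc n) i
  step i = ≈-trans (*-cong ≈-refl (≈-sym (q^*q^ {suc n} {T (suc i) ℕ.+ i ℕ.* suc n}
     (ℕR.solve 3 (λ n i t → (ℕR.con 1 ℕR.:+ n) ℕR.:+ (t ℕR.:+ i ℕR.:* (ℕR.con 1 ℕR.:+ n)) ℕR.:= (ℕR.con 1 ℕR.:+ i ℕR.:+ t) ℕR.:+ (n ℕR.:+ i ℕR.:* n)) refl n i (T (suc i))))))
     (solve 3 (λ s x y → (:- s) :* (x :* y) := (:- x) :* (s :* y)) ≈-refl (σℕ i) (q^ suc n) (q^ (T (suc i) ℕ.+ i ℕ.* suc n)))

-- The continuation of r n = 1 - q^(n+1) r (n+1) to negative indices. It stays within power series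
-- because 1 - r n is divisible by q^(n+1), which cancels the negative powers.
ρ : ℤ → Series
ρ (+ n) = r n
ρ -[1+ n ] = 1# - r n

ρ-~ : ∀ k → ρ k + ρ (~ k) ≈ 1#
ρ-~ (+ n) = solve 1 (λ x → x :+ (con 1ℚ :- x) := con 1ℚ) ≈-refl (r n)
ρ-~ -[1+ n ] = solve 1 (λ x → (con 1ℚ :- x) :+ x := con 1ℚ) ≈-refl (r n)

r-rec′ : ∀ n → 1# - r n ≈ q^ suc n * r (suc n)
r-rec′ n = ≈-trans (+-cong ≈-refl (-‿cong (r-rec n))) (solve 1 (λ x → con 1ℚ :- (con 1ℚ :- x) := x) ≈-refl _)

ρ-ord : ∀ n → Ord (suc n) (ρ -[1+ n ])
ρ-ord n = ord-≈ (≈-sym (r-rec′ n)) (ord-q^ (suc n) (r (suc n)))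

-- The recursion of `r` at every integer index; the exponents `u` and `v` clear q^(M+1) when M + 1
-- is negative.
ρ-step : ∀ M u v → + u ≡ + v ℤ.+ ℤ.suc M → q^ v * ρ M + q^ u * ρ (ℤ.suc M) ≈ q^ v
ρ-step (+ n) u v p = ≈-trans (+-cong (*-cong ≈-refl (r-rec n)) (*-cong (≈-sym (q^*q^ {v} {suc n} (sym (ℤP.+-injective p)))) ≈-refl))
  (solve 3 (λ v x y → v :* (con 1ℚ :- x :* y) :+ v :* x :* y := v) ≈-refl (q^ v) (q^ suc n) (r (suc n)))
ρ-step -[1+ zero ] u v p = ≈-trans (+-cong ≈-refl (*-cong (q^-cong (ℤP.+-injective (trans p (ℤP.+-identityʳ (+ v))))) ≈-refl))
  (solve 2 (λ v x → v :* (con 1ℚ :- x) :+ v :* x := v) ≈-refl (q^ v) (r 0))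
ρ-step -[1+ suc n ] u v p = ≈-trans (+-cong (*-cong (≈-sym e) ≈-refl) (*-cong ≈-refl (r-rec′ n)))
  (≈-trans (solve 3 (λ u x y → (u :* x) :* (con 1ℚ :- y) :+ u :* (x :* y) := u :* x) ≈-refl (q^ u) (q^ suc n) (r (suc n))) e)
  where
  e : q^ u * q^ suc n ≈ q^ v
  e = q^*q^ {u} {suc n} (ℤP.+-injective (trans (ℤP.pos-+ u (suc n)) (trans (cong (λ z → z ℤ.+ + suc n) p)
        (trans (ℤP.+-assoc (+ v) -[1+ n ] (+ suc n)) (trans (cong (λ z → + v ℤ.+ z) (ℤP.+-inverseˡ (+ suc n))) (ℤP.+-identityʳ (+ v)))))))

suc-pred : ∀ k → ℤ.suc (ℤ.pred k) ≡ k
suc-pred k = ℤP.suc-pred k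

pred-suc : ∀ k → ℤ.pred (ℤ.suc k) ≡ k
pred-suc k = ℤP.pred-suc k

ρ-pred : ∀ M u v → + u ≡ + v ℤ.+ M → q^ u * ρ M ≈ q^ v - q^ v * ρ (ℤ.pred M)
ρ-pred M u v p = begin
  q^ u * ρ M ≈⟨ solve 2 (λ x y → x := (y :+ x) :- y) ≈-refl (q^ u * ρ M) (q^ v * ρ (ℤ.pred M)) ⟩
  (q^ v * ρ (ℤ.pred M) + q^ u * ρ M) - q^ v * ρ (ℤ.pred M)
    ≈⟨ +-cong (≈-trans (+-cong ≈-refl (*-cong ≈-refl (≡⇒≈ (cong ρ (sym (suc-pred M)))))) (ρ-step (ℤ.pred M) u v (trans p (cong (λ z → + v ℤ.+ z) (sym (suc-pred M)))))) ≈-refl ⟩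
  q^ v - q^ v * ρ (ℤ.pred M) ∎
  where open SR

infixl 6 _⊟_
-- Subtraction by iterated predecessor: dropping the first term of a `tail` then lowers its index by
-- computation.
_⊟_ : ℤ → ℕ → ℤ
k ⊟ zero = k
k ⊟ suc n = ℤ.pred k ⊟ n

⊟-is : ∀ k n → k ⊟ n ≡ k ℤ.- + n
⊟-is k zero = sym (ℤP.+-identityʳ k)
⊟-is k (suc n) = trans (⊟-is (ℤ.pred k) n) (ℤR.solve 2 (λ k n → (ℤR.con (ℤ.- + 1) ℤR.:+ k) ℤR.:- n ℤR.:= k ℤR.:- (ℤR.con (+ 1) ℤR.:+ n)) refl k (+ n))

neg-⊟ : ∀ n i → -[1+ n ] ⊟ i ≡ -[1+ i ℕ.+ n ]
neg-⊟ n zero = refl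
neg-⊟ n (suc i) = trans (neg-⊟ (suc n) i) (cong -[1+_] (ℕP.+-suc i n))

ρ-⊟-ord : ∀ k N i → ∣ k ∣ ℕ.+ N ≤ i → Ord N (ρ (k ⊟ i))
ρ-⊟-ord -[1+ n ] N i l = subst (λ z → Ord N (ρ z)) (sym (neg-⊟ n i))
  (ord-≤ (ℕP.≤-trans (ℕP.m≤n+m N (suc n)) (ℕP.≤-trans l (ℕP.m≤n⇒m≤1+n (ℕP.m≤m+n i n)))) (ρ-ord _))
ρ-⊟-ord (+ zero) zero i l _ ()
ρ-⊟-ord (+ zero) (suc N) (suc i) (s≤s l) = subst (λ z → Ord (suc N) (ρ z)) (sym (neg-⊟ 0 i))
  (ord-≤ (s≤s (ℕP.≤-trans l (ℕP.m≤m+n i 0))) (ρ-ord _))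
ρ-⊟-ord (+ suc n) N (suc i) (s≤s l) = ρ-⊟-ord (+ n) N i l

dec-ρ : ∀ (w : ℕ → Series) k → Dec (λ i → w i * ρ (k ⊟ i))
dec-ρ w k = dec-⊗ʳ w λ N → ∣ k ∣ ℕ.+ N , λ i l → ρ-⊟-ord k N i l

opaque
  tail : (ℕ → Series) → ℤ → Series
  tail w k = ∑ (λ i → w i * ρ (k ⊟ i)) (dec-ρ w k)

  tail-is : ∀ w k → tail w k ≈ ∑ (λ i → w i * ρ (k ⊟ i)) (dec-ρ w k)
  tail-is w k = ≈-refl

  tail-pred : ∀ w k → tail w k ≈ w 0 * ρ k + tail (λ i → w (suc i)) (ℤ.pred k)
  tail-pred w k = ∑-suc (dec-ρ w k) (dec-ρ (λ i → w (suc i)) (ℤ.pred k))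

  tail-cong : ∀ {w w′} → (∀ i → w i ≈ w′ i) → ∀ k → tail w k ≈ tail w′ k
  tail-cong h k = ∑-cong _ _ λ i → *-cong (h i) ≈-refl

  tail-⊕ : ∀ w w′ k → tail (λ i → w i + w′ i) k ≈ tail w k + tail w′ k
  tail-⊕ w w′ k = ≈-trans (∑-cong _ (dec-⊕ (dec-ρ w k) (dec-ρ w′ k)) λ i → distribʳ _ (w i) (w′ i)) (∑-⊕ _ _ _)

  tail-neg : ∀ w k → tail (λ i → - w i) k ≈ - tail w k
  tail-neg w k = ≈-trans (∑-cong _ (dec-⊗ʳ (λ _ → - 1#) (dec-ρ w k)) λ i → solve 2 (λ w x → (:- w) :* x := :- con 1ℚ :* (w :* x)) ≈-refl (w i) (ρ (k ⊟ i)))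
    (≈-trans (∑-⊗ (- 1#) _ (dec-ρ w k)) (solve 1 (λ x → :- con 1ℚ :* x := :- x) ≈-refl (tail w k)))

-- The weights that will be needed: constant at ω, alternating at -ω, alternating and linear at -1.
S₁ S₂ S₃ : ℤ → Series
S₁ = tail σℕ
S₂ = tail (λ i → σℕ i * ιℕ i)
S₃ = tail (λ _ → 1#)

S₁-rec : ∀ k → S₁ k + S₁ (ℤ.pred k) ≈ ρ k
S₁-rec k = ≈-trans (+-cong (≈-trans (tail-pred σℕ k) (+-cong (*-identityˡ _) (tail-neg σℕ _))) ≈-refl)
  (solve 2 (λ x y → (x :+ :- y) :+ y := x) ≈-refl (ρ k) (S₁ (ℤ.pred k)))

S₂-rec : ∀ k → S₂ k + S₂ (ℤ.pred k) + S₁ (ℤ.pred k) ≈ 0#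
S₂-rec k = ≈-trans (+-cong (+-cong (≈-trans (tail-pred _ k)
    (+-cong ≈-refl (≈-trans (tail-cong (λ i → solve 2 (λ s i → (:- s) :* (i :+ con 1ℚ) := (:- (s :* i)) :+ (:- s)) ≈-refl (σℕ i) (ιℕ i)) _)
      (≈-trans (tail-⊕ _ _ _) (+-cong (tail-neg _ _) (tail-neg _ _)))))) ≈-refl) ≈-refl)
  (solve 4 (λ s x a b → (((con 1ℚ :* con 0ℚ) :* x) :+ (:- a :+ :- b)) :+ a :+ b := con 0ℚ) ≈-refl 1# (ρ k) (S₂ (ℤ.pred k)) (S₁ (ℤ.pred k)))

S₃-rec : ∀ k → S₃ k ≈ ρ k + S₃ (ℤ.pred k)
S₃-rec k = ≈-trans (tail-pred _ k) (+-cong (*-identityˡ _) ≈-refl)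

~-suc : ∀ k → ~ (ℤ.suc k) ≡ ℤ.pred (~ k)
~-suc (+ n) = refl
~-suc -[1+ zero ] = refl
~-suc -[1+ suc n ] = refl

-- The two indices belong to m congruent to 1 and to 2 modulo 3. Adding neighbours telescopes both
-- tails and leaves ρ_k + ρ_(-1-k) = 1, so the sum depends on k only through the sign (-1)^k.
sₖ : ℤ → Series
sₖ k = S₁ (ℤ.pred k) + S₁ (~ k)

-- The one constant that the alternating recursion of `sₖ` leaves undetermined.
ε : Series
ε = sₖ (+ 0) - κ ½

sₖ-rec : ∀ k → sₖ (ℤ.suc k) + sₖ k ≈ 1#
sₖ-rec k = begin
  (S₁ (ℤ.pred (ℤ.suc k)) + S₁ (~ (ℤ.suc k))) + (S₁ (ℤ.pred k) + S₁ (~ k))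
    ≈⟨ +-cong (+-cong (≡⇒≈ (cong S₁ (pred-suc k))) (≡⇒≈ (cong S₁ (~-suc k)))) ≈-refl ⟩
  (S₁ k + S₁ (ℤ.pred (~ k))) + (S₁ (ℤ.pred k) + S₁ (~ k))
    ≈⟨ solve 4 (λ a b c d → (a :+ b) :+ (c :+ d) := (a :+ c) :+ (d :+ b)) ≈-refl _ _ _ _ ⟩
  (S₁ k + S₁ (ℤ.pred k)) + (S₁ (~ k) + S₁ (ℤ.pred (~ k))) ≈⟨ +-cong (S₁-rec k) (S₁-rec (~ k)) ⟩
  ρ k + ρ (~ k) ≈⟨ ρ-~ k ⟩
  1# ∎
  where open SR

sₖ-val : ∀ k → sₖ k ≈ κ ½ + σ k * ε
sₖ-val k = diff-zero (suc-alternating {λ k → sₖ k - (κ ½ + σ k * ε)}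
  (λ k → begin
    (sₖ (ℤ.suc k) - (κ ½ + σ (ℤ.suc k) * ε)) + (sₖ k - (κ ½ + σ k * ε))
      ≈⟨ +-cong (+-cong ≈-refl (-‿cong (+-cong ≈-refl (*-cong (σ-suc k) ≈-refl)))) ≈-refl ⟩
    (sₖ (ℤ.suc k) - (κ ½ + - σ k * ε)) + (sₖ k - (κ ½ + σ k * ε))
      ≈⟨ solve 4 (λ a b s e → (a :- (con ½ :+ :- s :* e)) :+ (b :- (con ½ :+ s :* e)) := (a :+ b) :- con 1ℚ) ≈-refl (sₖ (ℤ.suc k)) (sₖ k) (σ k) ε ⟩
    (sₖ (ℤ.suc k) + sₖ k) - 1# ≈⟨ zero-diff (sₖ-rec k) ⟩
    0# ∎)
  (solve 1 (λ s → s :- (con ½ :+ con 1ℚ :* (s :- con ½)) := con 0ℚ) ≈-refl (sₖ (+ 0))) k)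
  where open SR

-- `Dₖ` serves ω. At -1 the weight of v m is 4 (-1)^m m: m = 3n + 2 and m = 3n + 1 give the
-- coefficients 3, 2 and 3, 1 of `Aₖ`, while `Bₖ` is the symmetrised tail for m divisible by 3.
Dₖ Aₖ Bₖ : ℤ → Series
Dₖ k = S₃ (ℤ.pred k) - S₃ (~ k)
Aₖ k = (κ (+ 3 ℚ./ 1) * S₂ (~ k) + κ (+ 2 ℚ./ 1) * S₁ (~ k)) - (κ (+ 3 ℚ./ 1) * S₂ (ℤ.pred k) + S₁ (ℤ.pred k))
Bₖ k = S₂ k + S₂ (~ k)

Dₖ-val : ∀ k → Dₖ k ≈ ι k
Dₖ-val k = diff-zero (suc-constant {λ k → Dₖ k - ι k}
  (λ k → begin
    (S₃ (ℤ.pred (ℤ.suc k)) - S₃ (~ (ℤ.suc k))) - ι (ℤ.suc k)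
      ≈⟨ +-cong (+-cong (≈-trans (≡⇒≈ (cong S₃ (pred-suc k))) (S₃-rec k)) (-‿cong (≡⇒≈ (cong S₃ (~-suc k))))) (-‿cong (ι-suc k)) ⟩
    ((ρ k + S₃ (ℤ.pred k)) - S₃ (ℤ.pred (~ k))) - (ι k + 1#)
      ≈⟨ +-cong ≈-refl (-‿cong (+-cong ≈-refl (≈-sym (ρ-~ k)))) ⟩
    ((ρ k + S₃ (ℤ.pred k)) - S₃ (ℤ.pred (~ k))) - (ι k + (ρ k + ρ (~ k)))
      ≈⟨ solve 5 (λ r a b i r′ → ((r :+ a) :- b) :- (i :+ (r :+ r′)) := (a :- (r′ :+ b)) :- i) ≈-refl (ρ k) (S₃ (ℤ.pred k)) (S₃ (ℤ.pred (~ k))) (ι k) (ρ (~ k)) ⟩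
    (S₃ (ℤ.pred k) - (ρ (~ k) + S₃ (ℤ.pred (~ k)))) - ι k ≈⟨ +-cong (+-cong ≈-refl (-‿cong (≈-sym (S₃-rec (~ k))))) ≈-refl ⟩
    Dₖ k - ι k ∎)
  (solve 1 (λ s → (s :- s) :- con 0ℚ := con 0ℚ) ≈-refl (S₃ -[1+ 0 ])) k)
  where open SR

¼ ¾ 3ℚ 6ℚ 2ℚ : ℚ
¼ = + 1 ℚ./ 4
¾ = + 3 ℚ./ 4
3ℚ = + 3 ℚ./ 1
6ℚ = + 6 ℚ./ 1
2ℚ = + 2 ℚ./ 1

-- The sum of neighbouring values contains a multiple of `sₖ`, hence of (-1)^k ε. Being itself a
-- solution of the homogeneous alternating recursion, this term resonates and produces a factor
-- linear in k.
Aₖ-val : ∀ k → Aₖ k ≈ κ ¼ + κ ½ * (σ k * ε * (1# - κ 6ℚ * ι k))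
Aₖ-val k = diff-zero (suc-alternating {λ k → Aₖ k - (κ ¼ + κ ½ * (σ k * ε * (1# - κ 6ℚ * ι k)))} step
  (≈-trans (+-cong ≈-refl (-‿cong (+-cong ≈-refl (*-cong ≈-refl (*-cong (*-cong ≈-refl ≈-refl) ≈-refl)))))
    (solve 2 (λ a b → ((con 3ℚ :* b :+ con 2ℚ :* a) :- (con 3ℚ :* b :+ a)) :- (con ¼ :+ con ½ :* (con 1ℚ :* ((a :+ a) :- con ½) :* (con 1ℚ :- con 6ℚ :* con 0ℚ))) := con 0ℚ)
      ≈-refl (S₁ -[1+ 0 ]) (S₂ -[1+ 0 ]))) k)
  where
  open SR
  step : ∀ k → (Aₖ (ℤ.suc k) - (κ ¼ + κ ½ * (σ (ℤ.suc k) * ε * (1# - κ 6ℚ * ι (ℤ.suc k))))) + (Aₖ k - (κ ¼ + κ ½ * (σ k * ε * (1# - κ 6ℚ * ι k)))) ≈ 0#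
  step k = begin
    (Aₖ (ℤ.suc k) - (κ ¼ + κ ½ * (σ (ℤ.suc k) * ε * (1# - κ 6ℚ * ι (ℤ.suc k))))) + (Aₖ k - (κ ¼ + κ ½ * (σ k * ε * (1# - κ 6ℚ * ι k))))
      ≈⟨ +-cong (+-cong (+-cong (+-cong (*-cong ≈-refl (≡⇒≈ (cong S₂ (~-suc k)))) (*-cong ≈-refl (≡⇒≈ (cong S₁ (~-suc k)))))
            (-‿cong (+-cong (*-cong ≈-refl (≡⇒≈ (cong S₂ (pred-suc k)))) (≡⇒≈ (cong S₁ (pred-suc k))))))
          (-‿cong (+-cong ≈-refl (*-cong ≈-refl (*-cong (*-cong (σ-suc k) ≈-refl) (+-cong ≈-refl (-‿cong (*-cong ≈-refl (ι-suc k))))))))) ≈-refl ⟩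
    (((κ 3ℚ * b₂ + κ 2ℚ * b₁) - (κ 3ℚ * c₂ + c₁)) - (κ ¼ + κ ½ * (- σ k * ε * (1# - κ 6ℚ * (ι k + 1#)))))
      + (((κ 3ℚ * d₂ + κ 2ℚ * d₁) - (κ 3ℚ * a₂ + a₁)) - (κ ¼ + κ ½ * (σ k * ε * (1# - κ 6ℚ * ι k))))
      ≈⟨ 𝓢.solve 11 (λ b₂ b₁ c₂ c₁ d₂ d₁ a₂ a₁ s e i →
           (((con 3ℚ :* b₂ :+ con 2ℚ :* b₁) :- (con 3ℚ :* c₂ :+ c₁)) :- (con ¼ :+ con ½ :* (:- s :* e :* (con 1ℚ :- con 6ℚ :* (i :+ con 1ℚ)))))
             :+ (((con 3ℚ :* d₂ :+ con 2ℚ :* d₁) :- (con 3ℚ :* a₂ :+ a₁)) :- (con ¼ :+ con ½ :* (s :* e :* (con 1ℚ :- con 6ℚ :* i))))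
           := con 3ℚ :* ((d₂ :+ b₂ :+ b₁) :- (c₂ :+ a₂ :+ a₁)) :+ con 3ℚ :* ((a₁ :+ d₁) :- (con ½ :+ s :* e)) :- ((d₁ :+ b₁) :+ (c₁ :+ a₁) :- con 1ℚ)) ≈-refl
           b₂ b₁ c₂ c₁ d₂ d₁ a₂ a₁ (σ k) ε (ι k) ⟩
    κ 3ℚ * ((d₂ + b₂ + b₁) - (c₂ + a₂ + a₁)) + κ 3ℚ * (sₖ k - (κ ½ + σ k * ε)) - ((d₁ + b₁) + (c₁ + a₁) - 1#)
      ≈⟨ +-cong (+-cong (*-cong ≈-refl (+-cong (S₂-rec (~ k)) (-‿cong (S₂-rec k)))) (*-cong ≈-refl (zero-diff (sₖ-val k))))
           (-‿cong (zero-diff (≈-trans (+-cong (S₁-rec (~ k)) (S₁-rec k)) (≈-trans (+-comm _ _) (ρ-~ k))))) ⟩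
    κ 3ℚ * (0# - 0#) + κ 3ℚ * 0# - 0# ≈⟨ solve 0 (con 3ℚ :* (con 0ℚ :- con 0ℚ) :+ con 3ℚ :* con 0ℚ :- con 0ℚ := con 0ℚ) ≈-refl ⟩
    0# ∎
    where
    a₁ = S₁ (ℤ.pred k)
    a₂ = S₂ (ℤ.pred k)
    b₁ = S₁ (ℤ.pred (~ k))
    b₂ = S₂ (ℤ.pred (~ k))
    c₁ = S₁ k
    c₂ = S₂ k
    d₁ = S₁ (~ k)
    d₂ = S₂ (~ k)

-- Theta series of partial theta functions

Bₖ-rec : ∀ k → Bₖ (ℤ.suc k) + Bₖ k ≈ - sₖ (ℤ.suc k)
Bₖ-rec k = begin
  (S₂ (ℤ.suc k) + S₂ (~ (ℤ.suc k))) + (S₂ k + S₂ (~ k))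
    ≈⟨ +-cong (+-cong ≈-refl (≡⇒≈ (cong S₂ (~-suc k)))) ≈-refl ⟩
  (S₂ (ℤ.suc k) + S₂ (ℤ.pred (~ k))) + (S₂ k + S₂ (~ k))
    ≈⟨ solve 6 (λ a b c d x y → (a :+ b) :+ (c :+ d) := ((a :+ c :+ x) :+ (d :+ b :+ y)) :- (x :+ y)) ≈-refl (S₂ (ℤ.suc k)) (S₂ (ℤ.pred (~ k))) (S₂ k) (S₂ (~ k)) (S₁ k) (S₁ (ℤ.pred (~ k))) ⟩
  ((S₂ (ℤ.suc k) + S₂ k + S₁ k) + (S₂ (~ k) + S₂ (ℤ.pred (~ k)) + S₁ (ℤ.pred (~ k)))) - (S₁ k + S₁ (ℤ.pred (~ k)))
    ≈⟨ +-cong (+-cong (≈-trans (≡⇒≈ (cong (λ z → S₂ (ℤ.suc k) + S₂ z + S₁ z) (sym (pred-suc k)))) (S₂-rec (ℤ.suc k))) (S₂-rec (~ k)))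
              (-‿cong (+-cong (≡⇒≈ (cong S₁ (sym (pred-suc k)))) (≡⇒≈ (cong S₁ (sym (~-suc k)))))) ⟩
  (0# + 0#) - sₖ (ℤ.suc k) ≈⟨ solve 1 (λ x → (con 0ℚ :+ con 0ℚ) :- x := :- x) ≈-refl _ ⟩
  - sₖ (ℤ.suc k) ∎
  where open SR

Bₖ-val : ∀ k → Bₖ k ≈ - κ ¼ - σ k * ε * (ι k + κ ½)
Bₖ-val k = diff-zero (suc-alternating {λ k → Bₖ k - (- κ ¼ - σ k * ε * (ι k + κ ½))} step base k)
  where
  open SR
  step : ∀ k → (Bₖ (ℤ.suc k) - (- κ ¼ - σ (ℤ.suc k) * ε * (ι (ℤ.suc k) + κ ½))) + (Bₖ k - (- κ ¼ - σ k * ε * (ι k + κ ½))) ≈ 0#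
  step k = begin
    (Bₖ (ℤ.suc k) - (- κ ¼ - σ (ℤ.suc k) * ε * (ι (ℤ.suc k) + κ ½))) + (Bₖ k - (- κ ¼ - σ k * ε * (ι k + κ ½)))
      ≈⟨ +-cong (+-cong ≈-refl (-‿cong (+-cong ≈-refl (-‿cong (*-cong (*-cong (σ-suc k) ≈-refl) (+-cong (ι-suc k) ≈-refl)))))) ≈-refl ⟩
    (Bₖ (ℤ.suc k) - (- κ ¼ - - σ k * ε * ((ι k + 1#) + κ ½))) + (Bₖ k - (- κ ¼ - σ k * ε * (ι k + κ ½)))
      ≈⟨ solve 5 (λ b b′ s e i → (b :- (:- con ¼ :- :- s :* e :* ((i :+ con 1ℚ) :+ con ½))) :+ (b′ :- (:- con ¼ :- s :* e :* (i :+ con ½)))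
            := (b :+ b′) :+ (con ½ :+ :- s :* e)) ≈-refl (Bₖ (ℤ.suc k)) (Bₖ k) (σ k) ε (ι k) ⟩
    (Bₖ (ℤ.suc k) + Bₖ k) + (κ ½ + - σ k * ε)
      ≈⟨ +-cong (Bₖ-rec k) (≈-trans (+-cong ≈-refl (*-cong (≈-sym (σ-suc k)) ≈-refl)) (≈-sym (sₖ-val (ℤ.suc k)))) ⟩
    - sₖ (ℤ.suc k) + sₖ (ℤ.suc k) ≈⟨ -‿inverseˡ _ ⟩
    0# ∎
  -- `Bₖ` is invariant under k ↦ -1 - k, so the recursion at k = -1 reads 2 Bₖ(0) = - sₖ(0) and
  -- fixes the initial value.
  base : Bₖ (+ 0) - (- κ ¼ - σ (+ 0) * ε * (ι (+ 0) + κ ½)) ≈ 0#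
  base = begin
    Bₖ (+ 0) - (- κ ¼ - 1# * (sₖ (+ 0) - κ ½) * (0# + κ ½))
      ≈⟨ solve 3 (λ b b′ s → (b :+ b′) :- (:- con ¼ :- con 1ℚ :* (s :- con ½) :* (con 0ℚ :+ con ½))
           := con ½ :* (((b :+ b′) :+ (b′ :+ b)) :+ s)) ≈-refl (S₂ (+ 0)) (S₂ -[1+ 0 ]) (sₖ (+ 0)) ⟩
    κ ½ * ((Bₖ (+ 0) + Bₖ -[1+ 0 ]) + sₖ (+ 0)) ≈⟨ *-cong ≈-refl (≈-trans (+-cong (Bₖ-rec -[1+ 0 ]) ≈-refl) (-‿inverseˡ _)) ⟩
    κ ½ * 0# ≈⟨ zeroʳ _ ⟩
    0# ∎

-- The exponents k(3k-1)/2, k(3k+1)/2 and 3k(k-1)/2, written through `tri` so that identities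
-- between them become polynomial in k and tri k.
E₁ E₁′ E₀ : ℤ → ℕ
E₁ k = tri k ℕ.+ (tri k ℕ.+ tri (ℤ.suc k))
E₁′ k = tri k ℕ.+ (tri (ℤ.suc k) ℕ.+ tri (ℤ.suc k))
E₀ k = tri k ℕ.+ (tri k ℕ.+ tri k)

tri-bound : ∀ k → ∣ k ∣ ≤ tri k ℕ.+ 1
tri-bound (+ zero) = z≤n
tri-bound (+ suc n) = ℕP.≤-trans (s≤s (ℕP.m≤m+n n (T n))) (ℕP.≤-reflexive (ℕP.+-comm 1 _))
tri-bound -[1+ n ] = ℕP.≤-trans (s≤s (ℕP.m≤m+n n _)) (ℕP.m≤m+n _ 1)

bound-+ : ∀ {k : ℤ} {a : ℕ} b {c} → ∣ k ∣ ≤ a ℕ.+ c → ∣ k ∣ ≤ (a ℕ.+ b) ℕ.+ c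
bound-+ {a = a} b {c} h = ℕP.≤-trans h (ℕP.+-monoˡ-≤ c (ℕP.m≤m+n a b))

dec-tri : Decℤ (λ k → q^ tri k)
dec-tri = decℤ-q tri 1 tri-bound

dec-E₁ : Decℤ (λ k → q^ E₁ k)
dec-E₁ = decℤ-q E₁ 1 λ k → bound-+ {k} {tri k} _ (tri-bound k)

dec-E₁′ : Decℤ (λ k → q^ E₁′ k)
dec-E₁′ = decℤ-q E₁′ 1 λ k → bound-+ {k} {tri k} _ (tri-bound k)

dec-E₀ : Decℤ (λ k → q^ E₀ k)
dec-E₀ = decℤ-q E₀ 1 λ k → bound-+ {k} {tri k} _ (tri-bound k)

dec-suc∘ : ∀ {g} → Decℤ g → Decℤ (λ k → g (ℤ.suc k))
dec-suc∘ = decℤ-∘ ℤ.suc 1 abs-suc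

dec-~∘ : ∀ {g} → Decℤ g → Decℤ (λ k → g (~ k))
dec-~∘ = decℤ-∘ ~_ 1 abs-~

c₀ c₁ : Series
c₀ = ∑ℤ (λ k → q^ E₀ k) dec-E₀
c₁ = ∑ℤ (λ k → q^ E₁ k) dec-E₁

tri-~ : ∀ k → tri (~ k) ≡ tri (ℤ.suc (ℤ.suc k))
tri-~ (+ n) = refl
tri-~ -[1+ zero ] = refl
tri-~ -[1+ suc zero ] = refl
tri-~ -[1+ suc (suc n) ] = refl

tri-suc-~ : ∀ k → tri (ℤ.suc (~ k)) ≡ tri (ℤ.suc k)
tri-suc-~ (+ zero) = refl
tri-suc-~ (+ suc n) = refl
tri-suc-~ -[1+ zero ] = refl
tri-suc-~ -[1+ suc n ] = refl

~-~ : ∀ k → ~ (~ k) ≡ k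
~-~ (+ n) = refl
~-~ -[1+ n ] = refl

∑ℤ-neg′ : ∀ {g} d d₁ → ∑ℤ g d ≈ ∑ℤ (λ k → g (ℤ.suc (~ k))) d₁
∑ℤ-neg′ d d₁ = ≈-trans (∑ℤ-shift d (dec-suc∘ d)) (∑ℤ-~ (dec-suc∘ d) d₁)

E₁′-neg : ∀ k → E₁′ (ℤ.suc (~ k)) ≡ E₁ k
E₁′-neg k = trans (cong₂ (λ a b → a ℕ.+ (b ℕ.+ b)) (tri-suc-~ k) (trans (sym (tri-~ (~ k))) (cong tri (~-~ k))))
  (ℕR.solve 2 (λ a b → b ℕR.:+ (a ℕR.:+ a) ℕR.:= a ℕR.:+ (a ℕR.:+ b)) refl (tri k) (tri (ℤ.suc k)))

c₁′ : ∑ℤ (λ k → q^ E₁′ k) dec-E₁′ ≈ c₁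
c₁′ = ≈-trans (∑ℤ-neg′ dec-E₁′ (decℤ-∘ (λ k → ℤ.suc (~ k)) 2 bnd dec-E₁′)) (∑ℤ-cong _ _ λ k → q^-cong (E₁′-neg k))
  where
  bnd : ∀ k → ∣ k ∣ ≤ ∣ ℤ.suc (~ k) ∣ ℕ.+ 2
  bnd k = ℕP.≤-trans (abs-~ k) (ℕP.≤-trans (ℕP.+-monoˡ-≤ 1 (abs-suc (~ k))) (ℕP.≤-reflexive (ℕP.+-assoc ∣ ℤ.suc (~ k) ∣ 1 1)))

three-step : ∀ M a b c d → + a ≡ + b ℤ.+ M → + b ≡ + c ℤ.+ ℤ.pred M → + c ≡ + d ℤ.+ ℤ.pred (ℤ.pred M) →
  q^ a * ρ M ≈ q^ b - q^ c + q^ d - q^ d * ρ (ℤ.pred (ℤ.pred (ℤ.pred M)))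
three-step M a b c d p₁ p₂ p₃ = begin
  q^ a * ρ M ≈⟨ ρ-pred M a b p₁ ⟩
  q^ b - q^ b * ρ (ℤ.pred M) ≈⟨ +-cong ≈-refl (-‿cong (≈-trans (ρ-pred (ℤ.pred M) b c p₂) (+-cong ≈-refl (-‿cong (ρ-pred (ℤ.pred (ℤ.pred M)) c d p₃))))) ⟩
  q^ b - (q^ c - (q^ d - q^ d * ρ (ℤ.pred (ℤ.pred (ℤ.pred M)))))
    ≈⟨ solve 4 (λ b c d x → b :- (c :- (d :- x)) := b :- c :+ d :- x) ≈-refl (q^ b) (q^ c) (q^ d) (q^ d * ρ (ℤ.pred (ℤ.pred (ℤ.pred M)))) ⟩
  q^ b - q^ c + q^ d - q^ d * ρ (ℤ.pred (ℤ.pred (ℤ.pred M))) ∎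
  where open SR

⊟-pred : ∀ k n → ℤ.pred (k ⊟ n) ≡ k ⊟ suc n
⊟-pred k n = trans (cong ℤ.pred (⊟-is k n)) (trans (ℤR.solve 2 (λ k n → ℤR.con (ℤ.- + 1) ℤR.:+ (k ℤR.:- n) ℤR.:= k ℤR.:- (ℤR.con (+ 1) ℤR.:+ n)) refl k (+ n)) (sym (⊟-is k (suc n))))

-- A shift of k followed by three uses of the recursion of ρ replaces N by N + 2. Each use
-- contributes q to a power linear in k, which carries one quadratic exponent of the chain `a`, `b`,
-- `c`, `d` to the next, up to a constant depending on N.
module ThetaStep (a b c d : ℤ → ℕ) (db : Decℤ (λ k → q^ b k)) (dc : Decℤ (λ k → q^ c k)) (dd : Decℤ (λ k → q^ d k))
  (N x y z : ℕ)
  (p₁ : ∀ k → + a (ℤ.suc k) ≡ + (b k ℕ.+ x) ℤ.+ (k ℤ.- + N))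
  (p₂ : ∀ k → + (b k ℕ.+ x) ≡ + (c k ℕ.+ y) ℤ.+ (k ℤ.- + suc N))
  (p₃ : ∀ k → + (c k ℕ.+ y) ≡ + (d k ℕ.+ z) ℤ.+ (k ℤ.- + suc (suc N)))
  (da : Decℤ (λ k → q^ a k)) where

  private
    pull : ∀ {f : ℤ → ℕ} n (df : Decℤ (λ k → q^ f k)) → Decℤ (λ k → q^ n * q^ f k)
    pull n df = decℤ-*ʳ (λ _ → q^ n) df
    dρ : Decℤ (λ k → q^ d k * ρ (k ⊟ suc (suc (suc N))))
    dρ = decℤ-*ˡ _ dd

  theta-step : ∑ℤ (λ k → q^ a k * ρ (k ⊟ suc N)) (decℤ-*ˡ _ da) ≈
    q^ x * ∑ℤ (λ k → q^ b k) db - q^ y * ∑ℤ (λ k → q^ c k) dc + q^ z * ∑ℤ (λ k → q^ d k) dd - q^ z * ∑ℤ (λ k → q^ d k * ρ (k ⊟ suc (suc (suc N)))) dρ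
  theta-step = begin
    ∑ℤ (λ k → q^ a k * ρ (k ⊟ suc N)) (decℤ-*ˡ _ da) ≈⟨ ∑ℤ-shift _ (dec-suc∘ (decℤ-*ˡ (λ k → ρ (k ⊟ suc N)) da)) ⟩
    ∑ℤ (λ k → q^ a (ℤ.suc k) * ρ (ℤ.suc k ⊟ suc N)) (dec-suc∘ (decℤ-*ˡ (λ k → ρ (k ⊟ suc N)) da))
      ≈⟨ ∑ℤ-cong _ d₃ (λ k → ≈-trans (three k) (≈-trans (+-cong (+-cong (+-cong (q^+ x (b k)) (-‿cong (q^+ y (c k)))) (q^+ z (d k))) (-‿cong (*-cong (q^+ z (d k)) ≈-refl)))
           (+-cong ≈-refl (-‿cong (*-assoc _ _ _))))) ⟩
    ∑ℤ (λ k → q^ x * q^ b k - q^ y * q^ c k + q^ z * q^ d k - q^ z * (q^ d k * ρ (k ⊟ suc (suc (suc N))))) d₃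
      ≈⟨ ∑ℤ-+ d₃ d₂ (decℤ-neg (decℤ-*ʳ (λ _ → q^ z) dρ)) ⟩
    ∑ℤ (λ k → q^ x * q^ b k - q^ y * q^ c k + q^ z * q^ d k) d₂ + ∑ℤ (λ k → - (q^ z * (q^ d k * ρ (k ⊟ suc (suc (suc N)))))) (decℤ-neg (decℤ-*ʳ (λ _ → q^ z) dρ))
      ≈⟨ +-cong (≈-trans (∑ℤ-+ d₂ d₁ (pull z dd)) (+-cong (≈-trans (∑ℤ-+ d₁ (pull x db) (decℤ-neg (pull y dc)))
           (+-cong (∑ℤ-* _ _ db) (≈-trans (∑ℤ-neg _ (pull y dc)) (-‿cong (∑ℤ-* _ _ dc))))) (∑ℤ-* _ _ dd)))
         (≈-trans (∑ℤ-neg _ (decℤ-*ʳ (λ _ → q^ z) dρ)) (-‿cong (∑ℤ-* _ _ dρ))) ⟩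
    q^ x * ∑ℤ (λ k → q^ b k) db - q^ y * ∑ℤ (λ k → q^ c k) dc + q^ z * ∑ℤ (λ k → q^ d k) dd - q^ z * ∑ℤ (λ k → q^ d k * ρ (k ⊟ suc (suc (suc N)))) dρ ∎
    where
    open SR
    d₁ = decℤ-+ (pull x db) (decℤ-neg (pull y dc))
    d₂ = decℤ-+ d₁ (pull z dd)
    d₃ = decℤ-+ d₂ (decℤ-neg (decℤ-*ʳ (λ _ → q^ z) dρ))
    q^+ : ∀ n f → q^ (f ℕ.+ n) ≈ q^ n * q^ f
    q^+ n f = ≈-trans (q^-cong (ℕP.+-comm f n)) (≈-sym (q^-+ n f))
    M≡ : ∀ k → ℤ.suc k ⊟ suc N ≡ k ⊟ N
    M≡ k = cong (_⊟ N) (pred-suc k)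
    three : ∀ k → q^ a (ℤ.suc k) * ρ (ℤ.suc k ⊟ suc N) ≈ q^ (b k ℕ.+ x) - q^ (c k ℕ.+ y) + q^ (d k ℕ.+ z) - q^ (d k ℕ.+ z) * ρ (k ⊟ suc (suc (suc N)))
    three k = ≈-trans (*-cong ≈-refl (≡⇒≈ (cong ρ (M≡ k))))
      (≈-trans (three-step (k ⊟ N) _ _ _ _
         (trans (p₁ k) (cong (λ w → + (b k ℕ.+ x) ℤ.+ w) (sym (⊟-is k N))))
         (trans (p₂ k) (cong (λ w → + (c k ℕ.+ y) ℤ.+ w) (sym (trans (⊟-pred k N) (⊟-is k (suc N))))))
         (trans (p₃ k) (cong (λ w → + (d k ℕ.+ z) ℤ.+ w) (sym (trans (cong ℤ.pred (⊟-pred k N)) (trans (⊟-pred k (suc N)) (⊟-is k (suc (suc N)))))))))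
      (+-cong ≈-refl (-‿cong (*-cong ≈-refl (≡⇒≈ (cong ρ (trans (cong (ℤ.pred ∘ ℤ.pred) (⊟-pred k N)) (trans (cong ℤ.pred (⊟-pred k (suc N))) (⊟-pred k (suc (suc N)))))))))))

-- One family for each residue of m modulo 3: P₀ U₁ / c₁ and P₀ U₂ / c₁ will turn out to be the
-- parts of v (3N+1) and v (3N+2) in exponents divisible by 3.
U₀ U₁ U₂ : ℕ → Series
U₀ N = ∑ℤ (λ k → q^ E₀ k * ρ (k ⊟ suc N)) (decℤ-*ˡ _ dec-E₀)
U₁ N = ∑ℤ (λ k → q^ E₁ k * ρ (k ⊟ suc N)) (decℤ-*ˡ _ dec-E₁)
U₂ N = ∑ℤ (λ k → q^ E₁′ k * ρ (k ⊟ suc N)) (decℤ-*ˡ _ dec-E₁′)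

private
  trisuc trisuc² : ℤ → ℤ
  trisuc k = + tri (ℤ.suc k)
  trisuc² k = + tri (ℤ.suc (ℤ.suc k))

  -- with t = tri k, every exponent below is an integer polynomial in k, t and N
  by-tri : ∀ {ℓ} (Q : ℤ → ℤ → Set ℓ) k → Q (k ℤ.+ + tri k) (ℤ.suc k ℤ.+ (k ℤ.+ + tri k)) → Q (trisuc k) (trisuc² k)
  by-tri Q k h = subst (λ w → Q (trisuc k) w) (sym (tri-suc (ℤ.suc k)))
    (subst (λ w → Q w (ℤ.suc k ℤ.+ w)) (sym (tri-suc k)) h)

open ℤR using () renaming (_:+_ to _⊞_; _:-_ to _⊖′_; _:=_ to _⩵_; con to c′) public

U₁-rec : ∀ N → U₁ N ≈ q^ suc N * c₀ - q^ (N ℕ.+ N ℕ.+ 2) * c₁ + q^ (N ℕ.+ (N ℕ.+ N) ℕ.+ 4) * c₁ - q^ (N ℕ.+ (N ℕ.+ N) ℕ.+ 4) * U₁ (suc (suc N))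
U₁-rec N = ≈-trans (ThetaStep.theta-step E₁ (E₀ ∘ ℤ.suc) E₁′ E₁ (dec-suc∘ dec-E₀) dec-E₁′ dec-E₁ N (suc N) (N ℕ.+ N ℕ.+ 2) (N ℕ.+ (N ℕ.+ N) ℕ.+ 4)
    (λ k → by-tri (λ t₁ t₂ → (t₁ ℤ.+ (t₁ ℤ.+ t₂)) ≡ (t₁ ℤ.+ (t₁ ℤ.+ t₁) ℤ.+ (+ 1 ℤ.+ + N)) ℤ.+ (k ℤ.- + N)) k
      (ℤR.solve 3 (λ k t N → ((k ⊞ t) ⊞ ((k ⊞ t) ⊞ ((c′ (+ 1) ⊞ k) ⊞ (k ⊞ t)))) ⩵ ((k ⊞ t) ⊞ ((k ⊞ t) ⊞ (k ⊞ t)) ⊞ (c′ (+ 1) ⊞ N)) ⊞ (k ⊖′ N)) refl k (+ tri k) (+ N)))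
    (λ k → by-tri (λ t₁ t₂ → (t₁ ℤ.+ (t₁ ℤ.+ t₁) ℤ.+ (+ 1 ℤ.+ + N)) ≡ (+ tri k ℤ.+ (t₁ ℤ.+ t₁) ℤ.+ (+ N ℤ.+ + N ℤ.+ + 2)) ℤ.+ (k ℤ.- (+ 1 ℤ.+ + N))) k
      (ℤR.solve 3 (λ k t N → ((k ⊞ t) ⊞ ((k ⊞ t) ⊞ (k ⊞ t)) ⊞ (c′ (+ 1) ⊞ N)) ⩵ (t ⊞ ((k ⊞ t) ⊞ (k ⊞ t)) ⊞ (N ⊞ N ⊞ c′ (+ 2))) ⊞ (k ⊖′ (c′ (+ 1) ⊞ N))) refl k (+ tri k) (+ N)))
    (λ k → by-tri (λ t₁ t₂ → (+ tri k ℤ.+ (t₁ ℤ.+ t₁) ℤ.+ (+ N ℤ.+ + N ℤ.+ + 2)) ≡ (+ tri k ℤ.+ (+ tri k ℤ.+ t₁) ℤ.+ (+ N ℤ.+ (+ N ℤ.+ + N) ℤ.+ + 4)) ℤ.+ (k ℤ.- (+ 2 ℤ.+ + N))) k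
      (ℤR.solve 3 (λ k t N → (t ⊞ ((k ⊞ t) ⊞ (k ⊞ t)) ⊞ (N ⊞ N ⊞ c′ (+ 2))) ⩵ (t ⊞ (t ⊞ (k ⊞ t)) ⊞ (N ⊞ (N ⊞ N) ⊞ c′ (+ 4))) ⊞ (k ⊖′ (c′ (+ 2) ⊞ N))) refl k (+ tri k) (+ N)))
    dec-E₁)
  (+-cong (+-cong (+-cong (*-cong ≈-refl (≈-sym (∑ℤ-shift dec-E₀ (dec-suc∘ dec-E₀)))) (-‿cong (*-cong ≈-refl c₁′))) ≈-refl) (-‿cong (*-cong ≈-refl (∑ℤ-cong _ _ λ k → ≈-refl))))

U₂-rec : ∀ N → U₂ N ≈ q^ suc N * c₁ - q^ (N ℕ.+ N ℕ.+ 3) * c₀ + q^ (N ℕ.+ (N ℕ.+ N) ℕ.+ 5) * c₁ - q^ (N ℕ.+ (N ℕ.+ N) ℕ.+ 5) * U₂ (suc (suc N))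
U₂-rec N = ≈-trans (ThetaStep.theta-step E₁′ (E₁ ∘ ℤ.suc) (E₀ ∘ ℤ.suc) E₁′ (dec-suc∘ dec-E₁) (dec-suc∘ dec-E₀) dec-E₁′ N (suc N) (N ℕ.+ N ℕ.+ 3) (N ℕ.+ (N ℕ.+ N) ℕ.+ 5)
    (λ k → by-tri (λ t₁ t₂ → (t₁ ℤ.+ (t₂ ℤ.+ t₂)) ≡ (t₁ ℤ.+ (t₁ ℤ.+ t₂) ℤ.+ (+ 1 ℤ.+ + N)) ℤ.+ (k ℤ.- + N)) k
      (ℤR.solve 3 (λ k t N → ((k ⊞ t) ⊞ (((c′ (+ 1) ⊞ k) ⊞ (k ⊞ t)) ⊞ ((c′ (+ 1) ⊞ k) ⊞ (k ⊞ t)))) ⩵ ((k ⊞ t) ⊞ ((k ⊞ t) ⊞ ((c′ (+ 1) ⊞ k) ⊞ (k ⊞ t))) ⊞ (c′ (+ 1) ⊞ N)) ⊞ (k ⊖′ N)) refl k (+ tri k) (+ N)))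
    (λ k → by-tri (λ t₁ t₂ → (t₁ ℤ.+ (t₁ ℤ.+ t₂) ℤ.+ (+ 1 ℤ.+ + N)) ≡ (t₁ ℤ.+ (t₁ ℤ.+ t₁) ℤ.+ (+ N ℤ.+ + N ℤ.+ + 3)) ℤ.+ (k ℤ.- (+ 1 ℤ.+ + N))) k
      (ℤR.solve 3 (λ k t N → ((k ⊞ t) ⊞ ((k ⊞ t) ⊞ ((c′ (+ 1) ⊞ k) ⊞ (k ⊞ t))) ⊞ (c′ (+ 1) ⊞ N)) ⩵ ((k ⊞ t) ⊞ ((k ⊞ t) ⊞ (k ⊞ t)) ⊞ (N ⊞ N ⊞ c′ (+ 3))) ⊞ (k ⊖′ (c′ (+ 1) ⊞ N))) refl k (+ tri k) (+ N)))
    (λ k → by-tri (λ t₁ t₂ → (t₁ ℤ.+ (t₁ ℤ.+ t₁) ℤ.+ (+ N ℤ.+ + N ℤ.+ + 3)) ≡ (+ tri k ℤ.+ (t₁ ℤ.+ t₁) ℤ.+ (+ N ℤ.+ (+ N ℤ.+ + N) ℤ.+ + 5)) ℤ.+ (k ℤ.- (+ 2 ℤ.+ + N))) k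
      (ℤR.solve 3 (λ k t N → ((k ⊞ t) ⊞ ((k ⊞ t) ⊞ (k ⊞ t)) ⊞ (N ⊞ N ⊞ c′ (+ 3))) ⩵ (t ⊞ ((k ⊞ t) ⊞ (k ⊞ t)) ⊞ (N ⊞ (N ⊞ N) ⊞ c′ (+ 5))) ⊞ (k ⊖′ (c′ (+ 2) ⊞ N))) refl k (+ tri k) (+ N)))
    dec-E₁′)
  (+-cong (+-cong (+-cong (*-cong ≈-refl (≈-sym (∑ℤ-shift dec-E₁ (dec-suc∘ dec-E₁)))) (-‿cong (*-cong ≈-refl (≈-sym (∑ℤ-shift dec-E₀ (dec-suc∘ dec-E₀)))))) (*-cong ≈-refl c₁′)) (-‿cong (*-cong ≈-refl (∑ℤ-cong _ _ λ k → ≈-refl))))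

U₀-rec : ∀ N → U₀ N ≈ q^ N * c₁ - q^ (N ℕ.+ N ℕ.+ 1) * c₁ + q^ (N ℕ.+ (N ℕ.+ N) ℕ.+ 3) * c₀ - q^ (N ℕ.+ (N ℕ.+ N) ℕ.+ 3) * U₀ (suc (suc N))
U₀-rec N = ≈-trans (ThetaStep.theta-step E₀ E₁′ E₁ E₀ dec-E₁′ dec-E₁ dec-E₀ N N (N ℕ.+ N ℕ.+ 1) (N ℕ.+ (N ℕ.+ N) ℕ.+ 3)
    (λ k → by-tri (λ t₁ t₂ → (t₁ ℤ.+ (t₁ ℤ.+ t₁)) ≡ (+ tri k ℤ.+ (t₁ ℤ.+ t₁) ℤ.+ + N) ℤ.+ (k ℤ.- + N)) k
      (ℤR.solve 3 (λ k t N → ((k ⊞ t) ⊞ ((k ⊞ t) ⊞ (k ⊞ t))) ⩵ (t ⊞ ((k ⊞ t) ⊞ (k ⊞ t)) ⊞ N) ⊞ (k ⊖′ N)) refl k (+ tri k) (+ N)))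
    (λ k → by-tri (λ t₁ t₂ → (+ tri k ℤ.+ (t₁ ℤ.+ t₁) ℤ.+ + N) ≡ (+ tri k ℤ.+ (+ tri k ℤ.+ t₁) ℤ.+ (+ N ℤ.+ + N ℤ.+ + 1)) ℤ.+ (k ℤ.- (+ 1 ℤ.+ + N))) k
      (ℤR.solve 3 (λ k t N → (t ⊞ ((k ⊞ t) ⊞ (k ⊞ t)) ⊞ N) ⩵ (t ⊞ (t ⊞ (k ⊞ t)) ⊞ (N ⊞ N ⊞ c′ (+ 1))) ⊞ (k ⊖′ (c′ (+ 1) ⊞ N))) refl k (+ tri k) (+ N)))
    (λ k → by-tri (λ t₁ t₂ → (+ tri k ℤ.+ (+ tri k ℤ.+ t₁) ℤ.+ (+ N ℤ.+ + N ℤ.+ + 1)) ≡ (+ tri k ℤ.+ (+ tri k ℤ.+ + tri k) ℤ.+ (+ N ℤ.+ (+ N ℤ.+ + N) ℤ.+ + 3)) ℤ.+ (k ℤ.- (+ 2 ℤ.+ + N))) k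
      (ℤR.solve 3 (λ k t N → (t ⊞ (t ⊞ (k ⊞ t)) ⊞ (N ⊞ N ⊞ c′ (+ 1))) ⩵ (t ⊞ (t ⊞ t) ⊞ (N ⊞ (N ⊞ N) ⊞ c′ (+ 3))) ⊞ (k ⊖′ (c′ (+ 2) ⊞ N))) refl k (+ tri k) (+ N)))
    dec-E₀)
  (+-cong (+-cong (+-cong (*-cong ≈-refl c₁′) ≈-refl) ≈-refl) (-‿cong (*-cong ≈-refl (∑ℤ-cong _ _ λ k → ≈-refl))))

-- Trisection

opaque
  -- The coefficients in f(q) = f₀(q³) + q f₁(q³) + q² f₂(q³). They are linear over series in q³,
  -- and multiplication by q rotates them.
  comp₀ comp₁ comp₂ : Series → Series
  comp₀ f n = f (thrice n)
  comp₁ f n = f (suc (thrice n))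
  comp₂ f n = f (suc (suc (thrice n)))

  comp₀-at : ∀ f n → comp₀ f n ≡ f (thrice n)
  comp₀-at f n = refl

  comp₀-cong : ∀ {f g} → f ≈ g → comp₀ f ≈ comp₀ g
  comp₀-cong p = mk λ n → at p _
  comp₁-cong : ∀ {f g} → f ≈ g → comp₁ f ≈ comp₁ g
  comp₁-cong p = mk λ n → at p _
  comp₂-cong : ∀ {f g} → f ≈ g → comp₂ f ≈ comp₂ g
  comp₂-cong p = mk λ n → at p _

  comp₀-+ : ∀ f g → comp₀ (f + g) ≈ comp₀ f + comp₀ g
  comp₀-+ f g = mk λ n → trans (+-at f g _) (sym (+-at (comp₀ f) (comp₀ g) n))
  comp₁-+ : ∀ f g → comp₁ (f + g) ≈ comp₁ f + comp₁ g
  comp₁-+ f g = mk λ n → trans (+-at f g _) (sym (+-at (comp₁ f) (comp₁ g) n))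
  comp₂-+ : ∀ f g → comp₂ (f + g) ≈ comp₂ f + comp₂ g
  comp₂-+ f g = mk λ n → trans (+-at f g _) (sym (+-at (comp₂ f) (comp₂ g) n))

  comp₀-neg : ∀ f → comp₀ (- f) ≈ - comp₀ f
  comp₀-neg f = mk λ n → trans (neg-at f _) (sym (neg-at (comp₀ f) n))
  comp₁-neg : ∀ f → comp₁ (- f) ≈ - comp₁ f
  comp₁-neg f = mk λ n → trans (neg-at f _) (sym (neg-at (comp₁ f) n))
  comp₂-neg : ∀ f → comp₂ (- f) ≈ - comp₂ f
  comp₂-neg f = mk λ n → trans (neg-at f _) (sym (neg-at (comp₂ f) n))

  comp₀-0 : comp₀ 0# ≈ 0#
  comp₀-0 = mk λ n → trans (0-at _) (sym (0-at n))

  q*-0 : ∀ f → (q^ 1 * f) 0 ≡ 0ℚ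
  q*-0 f = q^-suc-at-0 0 f
  q*-suc : ∀ f n → (q^ 1 * f) (suc n) ≡ f n
  q*-suc f n = trans (q^-shift 0 f n) (at (q^0* f) n)

  comp₀-q* : ∀ f → comp₀ (q^ 1 * f) ≈ q^ 1 * comp₂ f
  comp₀-q* f = mk λ { zero → trans (q*-0 f) (sym (q*-0 (comp₂ f))) ; (suc n) → trans (q*-suc f _) (sym (q*-suc (comp₂ f) n)) }
  comp₁-q* : ∀ f → comp₁ (q^ 1 * f) ≈ comp₀ f
  comp₁-q* f = mk λ n → q*-suc f _
  comp₂-q* : ∀ f → comp₂ (q^ 1 * f) ≈ comp₁ f
  comp₂-q* f = mk λ n → q*-suc f _

  comps : ∀ {f g} → comp₀ f ≈ comp₀ g → comp₁ f ≈ comp₁ g → comp₂ f ≈ comp₂ g → f ≈ g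
  comps {f} {g} p₀ p₁ p₂ = mk λ n → go n (at p₀) (at p₁) (at p₂)
    where
    go : ∀ {f g : Series} n → (∀ n → f (thrice n) ≡ g (thrice n)) → (∀ n → f (suc (thrice n)) ≡ g (suc (thrice n))) →
      (∀ n → f (suc (suc (thrice n))) ≡ g (suc (suc (thrice n)))) → f n ≡ g n
    go zero h₀ h₁ h₂ = h₀ 0
    go (suc zero) h₀ h₁ h₂ = h₁ 0
    go (suc (suc zero)) h₀ h₁ h₂ = h₂ 0
    go {f} {g} (suc (suc (suc n))) h₀ h₁ h₂ = go {λ m → f (suc (suc (suc m)))} {λ m → g (suc (suc (suc m)))} n (h₀ ∘ suc) (h₁ ∘ suc) (h₂ ∘ suc)

  -- substitution q ↦ q³
  𝐒 : Series → Series
  𝐒 f zero = f 0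
  𝐒 f (suc zero) = 0ℚ
  𝐒 f (suc (suc zero)) = 0ℚ
  𝐒 f (suc (suc (suc n))) = 𝐒 (shift f) n

  𝐒-at : ∀ f n → 𝐒 f (thrice n) ≡ f n
  𝐒-at f zero = refl
  𝐒-at f (suc n) = 𝐒-at (shift f) n

  𝐒-at₁ : ∀ f n → 𝐒 f (suc (thrice n)) ≡ 0ℚ
  𝐒-at₁ f zero = refl
  𝐒-at₁ f (suc n) = 𝐒-at₁ (shift f) n

  𝐒-at₂ : ∀ f n → 𝐒 f (suc (suc (thrice n))) ≡ 0ℚ
  𝐒-at₂ f zero = refl
  𝐒-at₂ f (suc n) = 𝐒-at₂ (shift f) n

  comp₀-𝐒 : ∀ f → comp₀ (𝐒 f) ≈ f
  comp₀-𝐒 f = mk (𝐒-at f)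
  comp₁-𝐒 : ∀ f → comp₁ (𝐒 f) ≈ 0#
  comp₁-𝐒 f = mk λ n → trans (𝐒-at₁ f n) (sym (0-at n))
  comp₂-𝐒 : ∀ f → comp₂ (𝐒 f) ≈ 0#
  comp₂-𝐒 f = mk λ n → trans (𝐒-at₂ f n) (sym (0-at n))

  private
    𝐒-step : ∀ h f n → (𝐒 h * f) (suc (suc (suc n))) ≡ h 0 ℚ.* f (suc (suc (suc n))) ℚ.+ (𝐒 (shift h) * f) n
    𝐒-step h f n = trans (*-at-suc (𝐒 h) f _) (cong (h 0 ℚ.* f (suc (suc (suc n))) ℚ.+_)
      (trans (*-at-suc (shift (𝐒 h)) f _) (trans (cong₂ ℚ._+_ (ℚP.*-zeroˡ (f (suc (suc n)))) (*-at-suc (shift (shift (𝐒 h))) f n))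
        (trans (ℚP.+-identityˡ _) (trans (cong (ℚ._+ (𝐒 (shift h) * f) n) (ℚP.*-zeroˡ (f (suc n)))) (ℚP.+-identityˡ _))))))

    𝐒-1 : ∀ h f → (𝐒 h * f) 1 ≡ h 0 ℚ.* f 1
    𝐒-1 h f = trans (*-at-suc (𝐒 h) f 0) (trans (cong (h 0 ℚ.* f 1 ℚ.+_) (trans (*-at-0 (shift (𝐒 h)) f) (ℚP.*-zeroˡ (f 0)))) (ℚP.+-identityʳ _))
    𝐒-2 : ∀ h f → (𝐒 h * f) 2 ≡ h 0 ℚ.* f 2
    𝐒-2 h f = trans (*-at-suc (𝐒 h) f 1) (trans (cong (h 0 ℚ.* f 2 ℚ.+_) (trans (*-at-suc (shift (𝐒 h)) f 0)
      (trans (cong₂ ℚ._+_ (ℚP.*-zeroˡ (f 1)) (trans (*-at-0 (shift (shift (𝐒 h))) f) (ℚP.*-zeroˡ (f 0)))) refl))) (ℚP.+-identityʳ _))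

  comp₀-𝐒* : ∀ h f → comp₀ (𝐒 h * f) ≈ h * comp₀ f
  comp₀-𝐒* h f = mk (go h)
    where go : ∀ h n → (𝐒 h * f) (thrice n) ≡ (h * comp₀ f) n
          go h zero = trans (*-at-0 (𝐒 h) f) (sym (*-at-0 h (comp₀ f)))
          go h (suc n) = trans (𝐒-step h f _) (trans (cong (h 0 ℚ.* f (thrice (suc n)) ℚ.+_) (go (shift h) n)) (sym (*-at-suc h (comp₀ f) n)))
  comp₁-𝐒* : ∀ h f → comp₁ (𝐒 h * f) ≈ h * comp₁ f
  comp₁-𝐒* h f = mk (go h)
    where go : ∀ h n → (𝐒 h * f) (suc (thrice n)) ≡ (h * comp₁ f) n
          go h zero = trans (𝐒-1 h f) (sym (*-at-0 h (comp₁ f)))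
          go h (suc n) = trans (𝐒-step h f _) (trans (cong (h 0 ℚ.* f (suc (thrice (suc n))) ℚ.+_) (go (shift h) n)) (sym (*-at-suc h (comp₁ f) n)))
  comp₂-𝐒* : ∀ h f → comp₂ (𝐒 h * f) ≈ h * comp₂ f
  comp₂-𝐒* h f = mk (go h)
    where go : ∀ h n → (𝐒 h * f) (suc (suc (thrice n))) ≡ (h * comp₂ f) n
          go h zero = trans (𝐒-2 h f) (sym (*-at-0 h (comp₂ f)))
          go h (suc n) = trans (𝐒-step h f _) (trans (cong (h 0 ℚ.* f (suc (suc (thrice (suc n)))) ℚ.+_) (go (shift h) n)) (sym (*-at-suc h (comp₂ f) n)))

  𝐒-agree : ∀ {N f g} → Agree N f g → Agree N (𝐒 f) (𝐒 g)
  𝐒-agree h zero l = h 0 l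
  𝐒-agree h (suc zero) l = refl
  𝐒-agree h (suc (suc zero)) l = refl
  𝐒-agree {suc N} {f} {g} h (suc (suc (suc n))) (s≤s l) = 𝐒-agree {N} {shift f} {shift g} (λ m m<N → h (suc m) (s≤s m<N)) n
    (ℕP.≤-trans (ℕP.m≤n⇒m≤1+n (ℕP.m≤n⇒m≤1+n ℕP.≤-refl)) l)

  comp₀-⟶ : ∀ {s F} → s ⟶ F → (λ n → comp₀ (s n)) ⟶ comp₀ F
  comp₀-⟶ h N = let (M , k) = h (thrice N) in M , λ L l n n<N → k L l (thrice n) (mono₃ n<N)
    where
    mono₃ : ∀ {m n} → m < n → thrice m < thrice n
    mono₃ {zero} {suc n} _ = s≤s z≤n
    mono₃ {suc m} {suc n} (s≤s l) = s≤s (s≤s (s≤s (mono₃ l)))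

𝐒-cong : ∀ {f g} → f ≈ g → 𝐒 f ≈ 𝐒 g
𝐒-cong {f} {g} p = agree⇒≈ λ N → 𝐒-agree {N} {f} {g} (≈⇒agree N p)

𝐒-+ : ∀ f g → 𝐒 (f + g) ≈ 𝐒 f + 𝐒 g
𝐒-+ f g = comps
  (≈-trans (comp₀-𝐒 _) (≈-sym (≈-trans (comp₀-+ _ _) (+-cong (comp₀-𝐒 f) (comp₀-𝐒 g)))))
  (≈-trans (comp₁-𝐒 _) (≈-sym (≈-trans (comp₁-+ _ _) (≈-trans (+-cong (comp₁-𝐒 f) (comp₁-𝐒 g)) (+-identityˡ _)))))
  (≈-trans (comp₂-𝐒 _) (≈-sym (≈-trans (comp₂-+ _ _) (≈-trans (+-cong (comp₂-𝐒 f) (comp₂-𝐒 g)) (+-identityˡ _)))))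

𝐒-* : ∀ f g → 𝐒 (f * g) ≈ 𝐒 f * 𝐒 g
𝐒-* f g = comps
  (≈-trans (comp₀-𝐒 _) (≈-sym (≈-trans (comp₀-𝐒* f _) (*-cong ≈-refl (comp₀-𝐒 g)))))
  (≈-trans (comp₁-𝐒 _) (≈-sym (≈-trans (comp₁-𝐒* f _) (≈-trans (*-cong ≈-refl (comp₁-𝐒 g)) (zeroʳ f)))))
  (≈-trans (comp₂-𝐒 _) (≈-sym (≈-trans (comp₂-𝐒* f _) (≈-trans (*-cong ≈-refl (comp₂-𝐒 g)) (zeroʳ f)))))

opaque
  unfolding 𝐒 κ

  𝐒-κ : ∀ c → 𝐒 (κ c) ≈ κ c
  𝐒-κ c = mk go
    where
    shiftκ : ∀ n → shift (κ c) n ≡ 0ℚ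
    shiftκ n = ℚP.*-zeroʳ c
    go : ∀ n → 𝐒 (κ c) n ≡ κ c n
    go zero = refl
    go (suc zero) = sym (ℚP.*-zeroʳ c)
    go (suc (suc zero)) = sym (ℚP.*-zeroʳ c)
    go (suc (suc (suc n))) = trans (𝐒-agree {suc n} {shift (κ c)} {λ _ → 0ℚ} (λ m _ → shiftκ m) n ℕP.≤-refl)
      (trans (zeroes n) (sym (ℚP.*-zeroʳ c)))
      where
      zeroes : ∀ n → 𝐒 (λ _ → 0ℚ) n ≡ 0ℚ
      zeroes zero = refl
      zeroes (suc zero) = refl
      zeroes (suc (suc zero)) = refl
      zeroes (suc (suc (suc n))) = zeroes n

𝐒-neg : ∀ f → 𝐒 (- f) ≈ - 𝐒 f
𝐒-neg f = neg-term _ _ (≈-trans (≈-sym (𝐒-+ (- f) f)) (≈-trans (𝐒-cong (-‿inverseˡ f)) (𝐒-κ 0ℚ)))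

𝐒-⟶ : ∀ {s F} → s ⟶ F → (λ n → 𝐒 (s n)) ⟶ 𝐒 F
𝐒-⟶ {s} {F} h N = let (M , k) = h N in M , λ L l → 𝐒-agree {N} {F} {s L} (k L l)

comp₀-q³ : ∀ f → comp₀ (q^ 3 * f) ≈ q^ 1 * comp₀ f
comp₀-q³ f = ≈-trans (comp₀-cong (≈-trans (*-cong (≈-trans (≈-sym (q^-+ 1 2)) (*-cong ≈-refl (≈-sym (q^-+ 1 1)))) ≈-refl) (≈-trans (*-assoc _ _ _) (*-cong ≈-refl (*-assoc _ _ _)))))
  (≈-trans (comp₀-q* _) (*-cong ≈-refl (≈-trans (comp₂-q* _) (comp₁-q* f))))

comp₀-q^thrice : ∀ e f → comp₀ (q^ thrice e * f) ≈ q^ e * comp₀ f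
comp₀-q^thrice zero f = ≈-trans (comp₀-cong (q^0* f)) (≈-sym (q^0* _))
comp₀-q^thrice (suc e) f = begin
  comp₀ (q^ (3 ℕ.+ thrice e) * f) ≈⟨ comp₀-cong (≈-trans (*-cong (≈-sym (q^-+ 3 (thrice e))) ≈-refl) (*-assoc _ _ _)) ⟩
  comp₀ (q^ 3 * (q^ thrice e * f)) ≈⟨ comp₀-q³ _ ⟩
  q^ 1 * comp₀ (q^ thrice e * f) ≈⟨ *-cong ≈-refl (comp₀-q^thrice e f) ⟩
  q^ 1 * (q^ e * comp₀ f) ≈⟨ ≈-trans (≈-sym (*-assoc _ _ _)) (*-cong (q^-+ 1 e) ≈-refl) ⟩
  q^ suc e * comp₀ f ∎
  where open SR

comp₀-q^thrice⁺ : ∀ e f → comp₀ (q^ suc (thrice e) * f) ≈ q^ suc e * comp₂ f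
comp₀-q^thrice⁺ e f = ≈-trans (comp₀-cong (≈-trans (*-cong (≈-trans (q^-cong (ℕP.+-comm 1 (thrice e))) (≈-sym (q^-+ (thrice e) 1))) ≈-refl) (*-assoc _ _ _)))
  (≈-trans (comp₀-q^thrice e _) (≈-trans (*-cong ≈-refl (comp₀-q* f)) (≈-trans (≈-sym (*-assoc _ _ _)) (*-cong (≈-trans (q^-+ e 1) (q^-cong (ℕP.+-comm e 1))) ≈-refl))))

comp₀-q^thrice⁺⁺ : ∀ e f → comp₀ (q^ suc (suc (thrice e)) * f) ≈ q^ suc e * comp₁ f
comp₀-q^thrice⁺⁺ e f = ≈-trans (comp₀-cong (≈-trans (*-cong (≈-sym (q^-+ 1 (suc (thrice e)))) ≈-refl)
     (solve 3 (λ x y z → (x :* y) :* z := y :* (x :* z)) ≈-refl (q^ 1) (q^ suc (thrice e)) f)))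
  (≈-trans (comp₀-q^thrice⁺ e _) (*-cong ≈-refl (comp₂-q* f)))

𝐒-q^ : ∀ e → 𝐒 (q^ e) ≈ q^ thrice e
𝐒-q^ zero = ≈-trans (𝐒-cong q^-0) (≈-trans (𝐒-κ 1ℚ) (≈-sym q^-0))
𝐒-q^ (suc e) = begin
  𝐒 (q^ suc e) ≈⟨ 𝐒-cong (≈-sym (q^-+ 1 e)) ⟩
  𝐒 (q^ 1 * q^ e) ≈⟨ 𝐒-* _ _ ⟩
  𝐒 (q^ 1) * 𝐒 (q^ e) ≈⟨ *-cong 𝐒-q (𝐒-q^ e) ⟩
  q^ 3 * q^ thrice e ≈⟨ q^-+ 3 (thrice e) ⟩
  q^ thrice (suc e) ∎
  where
  open SR
  𝐒-q : 𝐒 (q^ 1) ≈ q^ 3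
  𝐒-q = comps
    (≈-trans (comp₀-𝐒 _) (≈-sym (≈-trans (comp₀-cong (≈-sym (≈-trans (*-comm _ _) (*-identityˡ _)))) (≈-trans (comp₀-q^thrice 1 1#) (≈-trans (*-cong ≈-refl c0) (≈-trans (*-comm _ _) (*-identityˡ _)))))))
    (≈-trans (comp₁-𝐒 _) (≈-sym (≈-trans (comp₁-cong q³) (≈-trans (comp₁-q* _) (≈-trans (comp₀-q* _) (≈-trans (*-cong ≈-refl c2) (zeroʳ _)))))))
    (≈-trans (comp₂-𝐒 _) (≈-sym (≈-trans (comp₂-cong q³) (≈-trans (comp₂-q* _) (≈-trans (comp₁-q* _) c0′)))))
    where
    q³ : q^ 3 ≈ q^ 1 * (q^ 1 * q^ 1)
    q³ = ≈-sym (≈-trans (*-cong ≈-refl (q^-+ 1 1)) (q^-+ 1 2))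
    c0 : comp₀ 1# ≈ 1#
    c0 = ≈-trans (comp₀-cong (≈-sym (𝐒-κ 1ℚ))) (comp₀-𝐒 1#)
    c1 : comp₁ 1# ≈ 0#
    c1 = ≈-trans (comp₁-cong (≈-sym (𝐒-κ 1ℚ))) (comp₁-𝐒 1#)
    c2 : comp₂ (q^ 1) ≈ 0#
    c2 = ≈-trans (comp₂-cong (≈-sym (≈-trans (*-comm _ _) (*-identityˡ _)))) (≈-trans (comp₂-q* 1#) c1)
    c0′ : comp₀ (q^ 1) ≈ 0#
    c0′ = ≈-trans (comp₀-cong (≈-sym (≈-trans (*-comm _ _) (*-identityˡ _)))) (≈-trans (comp₀-q* 1#) (≈-trans (*-cong ≈-refl c2′) (zeroʳ _)))
      where
      c2′ : comp₂ 1# ≈ 0#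
      c2′ = ≈-trans (comp₂-cong (≈-sym (𝐒-κ 1ℚ))) (comp₂-𝐒 1#)

psum-𝐒 : ∀ u L → 𝐒 (psum L u) ≈ psum L (λ n → 𝐒 (u n))
psum-𝐒 u zero = 𝐒-κ 0ℚ
psum-𝐒 u (suc L) = ≈-trans (𝐒-+ _ _) (+-cong (psum-𝐒 u L) ≈-refl)

psum-comp₀ : ∀ u L → comp₀ (psum L u) ≈ psum L (λ n → comp₀ (u n))
psum-comp₀ u zero = comp₀-0
psum-comp₀ u (suc L) = ≈-trans (comp₀-+ _ _) (+-cong (psum-comp₀ u L) ≈-refl)

𝐒-∑ : ∀ {u} d d′ → 𝐒 (∑ u d) ≈ ∑ (λ n → 𝐒 (u n)) d′
𝐒-∑ {u} d d′ = ≈-sym (∑-unique d′ (⟶-cong (psum-𝐒 u) ≈-refl (𝐒-⟶ (∑-has u d))))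

comp₀-∑ : ∀ {u} d d′ → comp₀ (∑ u d) ≈ ∑ (λ n → comp₀ (u n)) d′
comp₀-∑ {u} d d′ = ≈-sym (∑-unique d′ (⟶-cong (psum-comp₀ u) ≈-refl (comp₀-⟶ (∑-has u d))))

𝐒-ord : ∀ {N f} → Ord N f → Ord N (𝐒 f)
𝐒-ord {N} {f} o n l = trans (𝐒-agree {N} {f} {0#} (λ m m<N → trans (o m m<N) (sym (0-at m))) n l) (trans (at (𝐒-κ 0ℚ) n) (0-at n))

decℤ-𝐒 : ∀ {g} → Decℤ g → Decℤ (λ k → 𝐒 (g k))
decℤ-𝐒 d N = proj₁ (d N) , λ k l → 𝐒-ord (proj₂ (d N) k l)

𝐒-∑ℤ : ∀ {g} d d′ → 𝐒 (∑ℤ g d) ≈ ∑ℤ (λ k → 𝐒 (g k)) d′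
𝐒-∑ℤ {g} d d′ = ≈-trans (𝐒-cong (∑ℤ-is g d)) (≈-trans (𝐒-∑ (dec-fold d) (dec-≈ (λ n → ≈-sym (𝐒-+ _ _)) (dec-fold d′)))
  (≈-trans (∑-cong _ _ (λ n → 𝐒-+ _ _)) (≈-sym (∑ℤ-is _ d′))))

-- Series that may be cancelled. Identities are kept free of quotients in this way until the very
-- end.
Unit : Series → Set
Unit f = f 0 ≡ 1ℚ

unit-* : ∀ {f g} → Unit f → Unit g → Unit (f * g)
unit-* {f} {g} p q = trans (*-at-0 f g) (cong₂ ℚ._*_ p q)

unit-cancel₀ : ∀ f g → Unit f → f * g ≈ 0# → g ≈ 0#
unit-cancel₀ f g u h = agree⇒≈ λ N n l → trans (go N n l) (sym (0-at n))
  where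
  go : ∀ N → Ord N g
  go zero n ()
  go (suc N) n (s≤s n≤N) = trans (sym (trans (sum-form f g n (λ m m<n → go N m (ℕP.<-≤-trans m<n n≤N))) (trans (cong (ℚ._* g n) u) (ℚP.*-identityˡ _)))) (trans (at h n) (0-at n))
    where
    sum-form : ∀ f g n → (∀ m → m < n → g m ≡ 0ℚ) → (f * g) n ≡ f 0 ℚ.* g n
    sum-form f g zero z = *-at-0 f g
    sum-form f g (suc n) z = trans (*-at-suc f g n) (trans (cong (f 0 ℚ.* g (suc n) ℚ.+_)
      (trans (at (*-comm (shift f) g) n) (ord-⊗ˡ {suc n} {g} (shift f) (λ m l → z m l) n ℕP.≤-refl))) (ℚP.+-identityʳ _))

unit-cancel : ∀ {f g h} → Unit f → f * g ≈ f * h → g ≈ h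
unit-cancel {f} {g} {h} u p = diff-zero (unit-cancel₀ f (g - h) u (≈-trans (solve 3 (λ f g h → f :* (g :- h) := f :* g :- f :* h) ≈-refl f g h) (zero-diff p)))

-- Theta exponents and weights at 3k, 3k + 1, 3k + 2

ℤ-induction : (Q : ℤ → Set) → Q (+ 0) → (∀ k → Q k → Q (ℤ.suc k)) → (∀ k → Q (ℤ.suc k) → Q k) → ∀ k → Q k
ℤ-induction Q z s p (+ zero) = z
ℤ-induction Q z s p (+ suc n) = s (+ n) (ℤ-induction Q z s p (+ n))
ℤ-induction Q z s p -[1+ zero ] = p -[1+ 0 ] z
ℤ-induction Q z s p -[1+ suc n ] = p -[1+ suc n ] (ℤ-induction Q z s p -[1+ n ])

tri-double : ∀ k → + tri k ℤ.+ + tri k ≡ k ℤ.* k ℤ.- k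
tri-double = ℤ-induction _ refl
  (λ k h → trans (cong₂ ℤ._+_ (tri-suc k) (tri-suc k)) (trans (ℤR.solve 2 (λ k t → (k ⊞ t) ⊞ (k ⊞ t) ⩵ (t ⊞ t) ⊞ (k ⊞ k)) refl k (+ tri k))
    (trans (cong (λ z → z ℤ.+ (k ℤ.+ k)) h) (ℤR.solve 1 (λ k → (k ℤR.:* k ⊖′ k) ⊞ (k ⊞ k) ⩵ (c′ (+ 1) ⊞ k) ℤR.:* (c′ (+ 1) ⊞ k) ⊖′ (c′ (+ 1) ⊞ k)) refl k))))
  (λ k h → trans (ℤR.solve 2 (λ k t → t ⊞ t ⩵ ((k ⊞ t) ⊞ (k ⊞ t)) ⊖′ (k ⊞ k)) refl k (+ tri k))
    (trans (cong (λ z → z ℤ.- (k ℤ.+ k)) (trans (cong₂ ℤ._+_ (sym (tri-suc k)) (sym (tri-suc k))) h))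
      (ℤR.solve 1 (λ k → ((c′ (+ 1) ⊞ k) ℤR.:* (c′ (+ 1) ⊞ k) ⊖′ (c′ (+ 1) ⊞ k)) ⊖′ (k ⊞ k) ⩵ (k ℤR.:* k ⊖′ k)) refl k)))

halve : ∀ x y → x ℤ.+ x ≡ y ℤ.+ y → x ≡ y
halve x y h = ℤP.*-cancelʳ-≡ x y (+ 2) (trans (dbl2 x) (trans h (sym (dbl2 y))))
  where
  dbl2 : ∀ x → x ℤ.* + 2 ≡ x ℤ.+ x
  dbl2 x = ℤR.solve 1 (λ x → x ℤR.:* c′ (+ 2) ⩵ x ⊞ x) refl x

9× 4× : ℤ → ℤ
9× x = (x ℤ.+ (x ℤ.+ x)) ℤ.+ ((x ℤ.+ (x ℤ.+ x)) ℤ.+ (x ℤ.+ (x ℤ.+ x)))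
4× x = (x ℤ.+ x) ℤ.+ (x ℤ.+ x)

tri-tpl : ∀ k → + tri (tpl k) ≡ 9× (+ tri k) ℤ.+ (k ℤ.+ (k ℤ.+ k))
tri-tpl k = halve _ _ (trans (tri-double (tpl k)) (trans (cong (λ z → z ℤ.* z ℤ.- z) (tpl-is k))
  (trans (ℤR.solve 1 (λ k → (k ⊞ (k ⊞ k)) ℤR.:* (k ⊞ (k ⊞ k)) ⊖′ (k ⊞ (k ⊞ k)) ⩵ c′ (+ 9) ℤR.:* (k ℤR.:* k ⊖′ k) ⊞ ((k ⊞ (k ⊞ k)) ⊞ (k ⊞ (k ⊞ k)))) refl k)
  (trans (cong (λ z → + 9 ℤ.* z ℤ.+ ((k ℤ.+ (k ℤ.+ k)) ℤ.+ (k ℤ.+ (k ℤ.+ k)))) (sym (tri-double k)))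
    (ℤR.solve 2 (λ k t → c′ (+ 9) ℤR.:* (t ⊞ t) ⊞ ((k ⊞ (k ⊞ k)) ⊞ (k ⊞ (k ⊞ k))) ⩵
       (((t ⊞ (t ⊞ t)) ⊞ ((t ⊞ (t ⊞ t)) ⊞ (t ⊞ (t ⊞ t)))) ⊞ (k ⊞ (k ⊞ k))) ⊞ (((t ⊞ (t ⊞ t)) ⊞ ((t ⊞ (t ⊞ t)) ⊞ (t ⊞ (t ⊞ t)))) ⊞ (k ⊞ (k ⊞ k)))) refl k (+ tri k))))))

tpl⁺-suc : ∀ k → tpl⁺ k ≡ ℤ.suc (tpl k)
tpl⁺-suc (+ n) = refl
tpl⁺-suc -[1+ n ] = refl

tpl⁺⁺-suc : ∀ k → tpl⁺⁺ k ≡ ℤ.suc (tpl⁺ k)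
tpl⁺⁺-suc (+ n) = refl
tpl⁺⁺-suc -[1+ n ] = refl

tri-tpl⁺ : ∀ k → + tri (tpl⁺ k) ≡ 9× (+ tri k) ℤ.+ ((k ℤ.+ (k ℤ.+ k)) ℤ.+ (k ℤ.+ (k ℤ.+ k)))
tri-tpl⁺ k = trans (cong (λ z → + tri z) (tpl⁺-suc k)) (trans (tri-suc (tpl k)) (trans (cong₂ ℤ._+_ (tpl-is k) (tri-tpl k))
  (ℤR.solve 2 (λ k t → k ⊞ (t ⊞ k) ⩵ t ⊞ (k ⊞ k)) refl (k ℤ.+ (k ℤ.+ k)) (9× (+ tri k)))))

tri-tpl⁺⁺ : ∀ k → + tri (tpl⁺⁺ k) ≡ + 1 ℤ.+ (9× (+ tri k) ℤ.+ 9× k)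
tri-tpl⁺⁺ k = trans (cong (λ z → + tri z) (tpl⁺⁺-suc k)) (trans (tri-suc (tpl⁺ k)) (trans (cong₂ ℤ._+_ (tpl⁺-is k) (tri-tpl⁺ k))
  (ℤR.solve 2 (λ k t → (k ⊞ c′ (+ 1)) ⊞ (t ⊞ (k ⊞ k)) ⩵ c′ (+ 1) ⊞ (t ⊞ (k ⊞ (k ⊞ k)))) refl (k ℤ.+ (k ℤ.+ k)) (9× (+ tri k)))))

σ-tpl : ∀ k → σ (tpl k) ≈ σ k
σ-tpl (+ n) = go n where
  go : ∀ n → σℕ (thrice n) ≈ σℕ n
  go zero = ≈-refl
  go (suc n) = ≈-trans (solve 1 (λ x → :- (:- (:- x)) := :- x) ≈-refl (σℕ (thrice n))) (-‿cong (go n))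
σ-tpl -[1+ n ] = ≈-trans (-‿cong (-‿cong (-‿cong (σ-tpl (+ n))))) (solve 1 (λ x → :- (:- (:- x)) := :- x) ≈-refl (σℕ n))

σ-tpl⁺ : ∀ k → σ (tpl⁺ k) ≈ - σ k
σ-tpl⁺ k = ≈-trans (≡⇒≈ (cong σ (tpl⁺-suc k))) (≈-trans (σ-suc (tpl k)) (-‿cong (σ-tpl k)))

σ-tpl⁺⁺ : ∀ k → σ (tpl⁺⁺ k) ≈ σ k
σ-tpl⁺⁺ k = ≈-trans (≡⇒≈ (cong σ (tpl⁺⁺-suc k))) (≈-trans (σ-suc (tpl⁺ k)) (≈-trans (-‿cong (σ-tpl⁺ k)) (solve 1 (λ x → :- (:- x) := x) ≈-refl (σ k))))

ι-tpl : ∀ k → ι (tpl k) ≈ κ 3ℚ * ι k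
ι-tpl (+ n) = go n where
  go : ∀ n → ιℕ (thrice n) ≈ κ 3ℚ * ιℕ n
  go zero = solve 0 (con 0ℚ := con 3ℚ :* con 0ℚ) ≈-refl
  go (suc n) = ≈-trans (+-cong (+-cong (+-cong (go n) ≈-refl) ≈-refl) ≈-refl) (solve 1 (λ x → con 3ℚ :* x :+ con 1ℚ :+ con 1ℚ :+ con 1ℚ := con 3ℚ :* (x :+ con 1ℚ)) ≈-refl (ιℕ n))
ι-tpl -[1+ n ] = ≈-trans (-‿cong (+-cong (+-cong (+-cong (ι-tpl (+ n)) ≈-refl) ≈-refl) ≈-refl)) (solve 1 (λ x → :- (con 3ℚ :* x :+ con 1ℚ :+ con 1ℚ :+ con 1ℚ) := con 3ℚ :* (:- (x :+ con 1ℚ))) ≈-refl (ιℕ n))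

ι-tpl⁺ : ∀ k → ι (tpl⁺ k) ≈ κ 3ℚ * ι k + 1#
ι-tpl⁺ k = ≈-trans (≡⇒≈ (cong ι (tpl⁺-suc k))) (≈-trans (ι-suc (tpl k)) (+-cong (ι-tpl k) ≈-refl))

ι-tpl⁺⁺ : ∀ k → ι (tpl⁺⁺ k) ≈ κ 3ℚ * ι k + 1# + 1#
ι-tpl⁺⁺ k = ≈-trans (≡⇒≈ (cong ι (tpl⁺⁺-suc k))) (≈-trans (ι-suc (tpl⁺ k)) (+-cong (ι-tpl⁺ k) ≈-refl))

q^-𝐒 : ∀ {x} y → + x ≡ + y ℤ.+ (+ y ℤ.+ + y) → q^ x ≈ 𝐒 (q^ y)
q^-𝐒 {x} y h = ≈-trans (q^-cong (trans (ℤP.+-injective h) (sym (thrice-is y)))) (≈-sym (𝐒-q^ y))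

q^-q𝐒 : ∀ {x} y → + x ≡ + 1 ℤ.+ (+ y ℤ.+ (+ y ℤ.+ + y)) → q^ x ≈ q^ 1 * 𝐒 (q^ y)
q^-q𝐒 {x} y h = ≈-trans (q^-cong (trans (ℤP.+-injective h) (cong suc (sym (thrice-is y))))) (≈-trans (≈-sym (q^-+ 1 (thrice y))) (*-cong ≈-refl (≈-sym (𝐒-q^ y))))

by-tri₁ : ∀ {ℓ} (Q : ℤ → Set ℓ) k → Q (k ℤ.+ + tri k) → Q (+ tri (ℤ.suc k))
by-tri₁ Q k h = subst Q (sym (tri-suc k)) h

q^tri-tpl : ∀ k → q^ tri (tpl k) ≈ 𝐒 (q^ E₁ k)
q^tri-tpl k = q^-𝐒 (E₁ k) (trans (tri-tpl k) (by-tri₁ (λ s → 9× (+ tri k) ℤ.+ (k ℤ.+ (k ℤ.+ k)) ≡ (+ tri k ℤ.+ (+ tri k ℤ.+ s)) ℤ.+ ((+ tri k ℤ.+ (+ tri k ℤ.+ s)) ℤ.+ (+ tri k ℤ.+ (+ tri k ℤ.+ s)))) k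
  (ℤR.solve 2 (λ k t → ((t ⊞ (t ⊞ t)) ⊞ ((t ⊞ (t ⊞ t)) ⊞ (t ⊞ (t ⊞ t)))) ⊞ (k ⊞ (k ⊞ k)) ⩵ (t ⊞ (t ⊞ (k ⊞ t))) ⊞ ((t ⊞ (t ⊞ (k ⊞ t))) ⊞ (t ⊞ (t ⊞ (k ⊞ t))))) refl k (+ tri k))))

q^tri-tpl⁺ : ∀ k → q^ tri (tpl⁺ k) ≈ 𝐒 (q^ E₁′ k)
q^tri-tpl⁺ k = q^-𝐒 (E₁′ k) (trans (tri-tpl⁺ k) (by-tri₁ (λ s → 9× (+ tri k) ℤ.+ ((k ℤ.+ (k ℤ.+ k)) ℤ.+ (k ℤ.+ (k ℤ.+ k))) ≡ (+ tri k ℤ.+ (s ℤ.+ s)) ℤ.+ ((+ tri k ℤ.+ (s ℤ.+ s)) ℤ.+ (+ tri k ℤ.+ (s ℤ.+ s)))) k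
  (ℤR.solve 2 (λ k t → ((t ⊞ (t ⊞ t)) ⊞ ((t ⊞ (t ⊞ t)) ⊞ (t ⊞ (t ⊞ t)))) ⊞ ((k ⊞ (k ⊞ k)) ⊞ (k ⊞ (k ⊞ k))) ⩵ (t ⊞ ((k ⊞ t) ⊞ (k ⊞ t))) ⊞ ((t ⊞ ((k ⊞ t) ⊞ (k ⊞ t))) ⊞ (t ⊞ ((k ⊞ t) ⊞ (k ⊞ t))))) refl k (+ tri k))))

q^tri-tpl⁺⁺ : ∀ k → q^ tri (tpl⁺⁺ k) ≈ q^ 1 * 𝐒 (q^ E₀ (ℤ.suc k))
q^tri-tpl⁺⁺ k = q^-q𝐒 (E₀ (ℤ.suc k)) (trans (tri-tpl⁺⁺ k) (by-tri₁ (λ s → + 1 ℤ.+ (9× (+ tri k) ℤ.+ 9× k) ≡ + 1 ℤ.+ ((s ℤ.+ (s ℤ.+ s)) ℤ.+ ((s ℤ.+ (s ℤ.+ s)) ℤ.+ (s ℤ.+ (s ℤ.+ s))))) k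
  (ℤR.solve 2 (λ k t → c′ (+ 1) ⊞ (((t ⊞ (t ⊞ t)) ⊞ ((t ⊞ (t ⊞ t)) ⊞ (t ⊞ (t ⊞ t)))) ⊞ ((k ⊞ (k ⊞ k)) ⊞ ((k ⊞ (k ⊞ k)) ⊞ (k ⊞ (k ⊞ k))))) ⩵
     c′ (+ 1) ⊞ (((k ⊞ t) ⊞ ((k ⊞ t) ⊞ (k ⊞ t))) ⊞ (((k ⊞ t) ⊞ ((k ⊞ t) ⊞ (k ⊞ t))) ⊞ ((k ⊞ t) ⊞ ((k ⊞ t) ⊞ (k ⊞ t)))))) refl k (+ tri k))))

-- 3k² + 2k = ((3k+1)² - 1)/3: the squares prime to 3, after removing q and replacing q³ by q.
Eb : ℤ → ℕ
Eb k = tri k ℕ.+ ((tri (ℤ.suc k) ℕ.+ tri (ℤ.suc k)) ℕ.+ (tri (ℤ.suc k) ℕ.+ (tri (ℤ.suc k) ℕ.+ tri (ℤ.suc k))))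

dec-Eb : Decℤ (λ k → q^ Eb k)
dec-Eb = decℤ-q Eb 1 λ k → bound-+ {k} {tri k} _ (tri-bound k)

dec-sq : Decℤ (λ k → q^ sq k)
dec-sq = decℤ-q sq 1 λ k → bound-+ {k} {tri k} _ (tri-bound k)

-- Summation over all of ℤ doubles the classical series: `ψ₂` is twice Gauss' sum over triangular
-- numbers, and `X` twice Jacobi's Σ (-1)^n (2n+1) q^(n(n+1)/2). `𝒫₋` is the analogue of `X` on
-- pentagonal exponents.
φ b ψ₂ X 𝒫₋ : Series
φ = ∑ℤ (λ k → σ k * q^ sq k) (decℤ-*ʳ σ dec-sq)
b = ∑ℤ (λ k → σ k * q^ Eb k) (decℤ-*ʳ σ dec-Eb)
ψ₂ = ∑ℤ (λ k → q^ tri k) dec-tri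

lin : ℚ → ℤ → Series
lin c k = 1# - κ c * ι k

X = ∑ℤ (λ k → (σ k * lin 2ℚ k) * q^ tri k) (decℤ-*ʳ _ dec-tri)
𝒫₋ = ∑ℤ (λ k → (σ k * lin 6ℚ k) * q^ E₁ k) (decℤ-*ʳ _ dec-E₁)

dec-tpl : ∀ {g} → Decℤ g → Decℤ (λ k → g (tpl k))
dec-tpl = decℤ-∘ tpl 0 abs-tpl
dec-tpl⁺ : ∀ {g} → Decℤ g → Decℤ (λ k → g (tpl⁺ k))
dec-tpl⁺ = decℤ-∘ tpl⁺ 0 abs-tpl⁺
dec-tpl⁺⁺ : ∀ {g} → Decℤ g → Decℤ (λ k → g (tpl⁺⁺ k))
dec-tpl⁺⁺ = decℤ-∘ tpl⁺⁺ 0 abs-tpl⁺⁺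

∑ℤ-tripart : ∀ {g} d → ∑ℤ g d ≈ ∑ℤ (λ k → g (tpl k)) (dec-tpl d) + ∑ℤ (λ k → g (tpl⁺ k)) (dec-tpl⁺ d) + ∑ℤ (λ k → g (tpl⁺⁺ k)) (dec-tpl⁺⁺ d)
∑ℤ-tripart d = ∑ℤ-split₃ d (dec-tpl d) (dec-tpl⁺ d) (dec-tpl⁺⁺ d)

dec-neg∘ : ∀ {g} → Decℤ g → Decℤ (λ k → g (ℤ.suc (~ k)))
dec-neg∘ = decℤ-∘ (λ k → ℤ.suc (~ k)) 2 λ k →
  ℕP.≤-trans (abs-~ k) (ℕP.≤-trans (ℕP.+-monoˡ-≤ 1 (abs-suc (~ k))) (ℕP.≤-reflexive (ℕP.+-assoc ∣ ℤ.suc (~ k) ∣ 1 1)))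

ψ₂-dissection : ψ₂ ≈ κ 2ℚ * 𝐒 c₁ + q^ 1 * 𝐒 c₀
ψ₂-dissection = begin
  ψ₂ ≈⟨ ∑ℤ-tripart dec-tri ⟩
  _ ≈⟨ +-cong (+-cong
        (≈-trans (∑ℤ-cong _ (decℤ-𝐒 dec-E₁) q^tri-tpl) (≈-sym (𝐒-∑ℤ dec-E₁ _)))
        (≈-trans (∑ℤ-cong _ (decℤ-𝐒 dec-E₁′) q^tri-tpl⁺) (≈-trans (≈-sym (𝐒-∑ℤ dec-E₁′ _)) (𝐒-cong c₁′))))
        (≈-trans (∑ℤ-cong _ (decℤ-*ʳ (λ _ → q^ 1) (decℤ-𝐒 (dec-suc∘ dec-E₀))) q^tri-tpl⁺⁺) (≈-trans (∑ℤ-* _ _ (decℤ-𝐒 (dec-suc∘ dec-E₀)))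
           (*-cong ≈-refl (≈-trans (≈-sym (𝐒-∑ℤ (dec-suc∘ dec-E₀) _)) (𝐒-cong (≈-sym (∑ℤ-shift dec-E₀ (dec-suc∘ dec-E₀)))))))) ⟩
  𝐒 c₁ + 𝐒 c₁ + q^ 1 * 𝐒 c₀ ≈⟨ solve 2 (λ x y → x :+ x :+ y := con 2ℚ :* x :+ y) ≈-refl (𝐒 c₁) (q^ 1 * 𝐒 c₀) ⟩
  κ 2ℚ * 𝐒 c₁ + q^ 1 * 𝐒 c₀ ∎
  where open SR

σ-neg : ∀ k → σ (ℤ.suc (~ k)) ≈ σ k
σ-neg k = ≈-trans (σ-suc (~ k)) (≈-trans (-‿cong (σ-~ k)) (solve 1 (λ x → :- (:- x) := x) ≈-refl (σ k)))

ι-neg : ∀ k → ι (ℤ.suc (~ k)) ≈ - ι k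
ι-neg k = ≈-trans (ι-suc (~ k)) (≈-trans (+-cong (ι-~ k) ≈-refl) (solve 1 (λ x → :- (x :+ con 1ℚ) :+ con 1ℚ := :- x) ≈-refl (ι k)))

𝐒-σ : ∀ k → 𝐒 (σ k) ≈ σ k
𝐒-σ = λ { (+ n) → go n ; -[1+ n ] → ≈-trans (𝐒-neg (σℕ n)) (-‿cong (go n)) }
  where
  go : ∀ n → 𝐒 (σℕ n) ≈ σℕ n
  go zero = 𝐒-κ 1ℚ
  go (suc n) = ≈-trans (𝐒-neg (σℕ n)) (-‿cong (go n))

𝐒-ι : ∀ k → 𝐒 (ι k) ≈ ι k
𝐒-ι = λ { (+ n) → go n ; -[1+ n ] → ≈-trans (𝐒-neg _) (-‿cong (≈-trans (𝐒-+ _ _) (+-cong (go n) (𝐒-κ 1ℚ)))) }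
  where
  go : ∀ n → 𝐒 (ιℕ n) ≈ ιℕ n
  go zero = 𝐒-κ 0ℚ
  go (suc n) = ≈-trans (𝐒-+ (ιℕ n) 1#) (+-cong (go n) (𝐒-κ 1ℚ))

𝐒-lin : ∀ c k → 𝐒 (lin c k) ≈ lin c k
𝐒-lin c k = ≈-trans (𝐒-+ _ _) (+-cong (𝐒-κ 1ℚ) (≈-trans (𝐒-neg _) (-‿cong (≈-trans (𝐒-* _ _) (*-cong (𝐒-κ c) (𝐒-ι k))))))

𝐒-weight : ∀ {w : ℤ → Series} {e : ℤ → ℕ} (d : Decℤ (λ k → q^ e k)) → (∀ k → 𝐒 (w k) ≈ w k) →
  𝐒 (∑ℤ (λ k → w k * q^ e k) (decℤ-*ʳ w d)) ≈ ∑ℤ (λ k → w k * 𝐒 (q^ e k)) (decℤ-*ʳ w (decℤ-𝐒 d))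
𝐒-weight {w} d h = ≈-trans (𝐒-∑ℤ _ (decℤ-𝐒 (decℤ-*ʳ w d))) (∑ℤ-cong _ _ λ k → ≈-trans (𝐒-* _ _) (*-cong (h k) ≈-refl))

𝐒-σlin : ∀ c k → 𝐒 (σ k * lin c k) ≈ σ k * lin c k
𝐒-σlin c k = ≈-trans (𝐒-* _ _) (*-cong (𝐒-σ k) (𝐒-lin c k))

-- The classes 3k and 3k + 1 are exchanged by k ↦ -k and give `𝒫₋` twice. In the class 3k + 2 the
-- weight 1 - 2k becomes three times its own value at k + 1, and the sign changes, so `X` returns at
-- q⁹ with the factor -3.
X-dissection : X ≈ κ 2ℚ * 𝐒 𝒫₋ - κ 3ℚ * (q^ 1 * 𝐒 (𝐒 X))
X-dissection = begin
  X ≈⟨ ∑ℤ-tripart (decℤ-*ʳ _ dec-tri) ⟩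
  _ ≈⟨ +-cong (+-cong
      (≈-trans (∑ℤ-cong _ (decℤ-*ʳ _ (decℤ-𝐒 dec-E₁)) (λ k → *-cong (*-cong (σ-tpl k) (≈-trans (+-cong ≈-refl (-‿cong (*-cong ≈-refl (ι-tpl k)))) (lem6 (ι k)))) (q^tri-tpl k)))
         (≈-sym (𝐒-weight dec-E₁ (𝐒-σlin 6ℚ))))
      (≈-trans (∑ℤ-neg′ _ (dec-neg∘ (dec-tpl⁺ (decℤ-*ʳ (λ k → σ k * lin 2ℚ k) dec-tri)))) (≈-trans (∑ℤ-cong _ (decℤ-*ʳ _ (decℤ-𝐒 dec-E₁)) second) (≈-sym (𝐒-weight dec-E₁ (𝐒-σlin 6ℚ))))))
      (≈-trans (∑ℤ-cong _ (decℤ-*ʳ (λ _ → - κ 3ℚ * q^ 1) d₃) third) (≈-trans (∑ℤ-* _ _ d₃) (*-cong ≈-refl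
        (≈-trans (≈-sym (∑ℤ-shift (decℤ-*ʳ _ (decℤ-𝐒 dec-E₀)) d₃)) (≈-trans (≈-sym (𝐒-weight dec-E₀ (𝐒-σlin 2ℚ))) (𝐒-cong
          (≈-trans (∑ℤ-cong _ (decℤ-*ʳ _ (decℤ-𝐒 dec-tri)) (λ k → *-cong ≈-refl (q^-𝐒 (tri k) refl))) (≈-sym (𝐒-weight dec-tri (𝐒-σlin 2ℚ)))))))))) ⟩
  𝐒 𝒫₋ + 𝐒 𝒫₋ + (- κ 3ℚ * q^ 1) * 𝐒 (𝐒 X)
    ≈⟨ solve 3 (λ x q y → x :+ x :+ (:- con 3ℚ :* q) :* y := con 2ℚ :* x :- con 3ℚ :* (q :* y)) ≈-refl (𝐒 𝒫₋) (q^ 1) (𝐒 (𝐒 X)) ⟩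
  κ 2ℚ * 𝐒 𝒫₋ - κ 3ℚ * (q^ 1 * 𝐒 (𝐒 X)) ∎
  where
  open SR
  d₃ : Decℤ (λ k → (σ (ℤ.suc k) * lin 2ℚ (ℤ.suc k)) * 𝐒 (q^ E₀ (ℤ.suc k)))
  d₃ = dec-suc∘ (decℤ-*ʳ (λ k → σ k * lin 2ℚ k) (decℤ-𝐒 dec-E₀))
  lem6 : ∀ i → 1# - κ 2ℚ * (κ 3ℚ * i) ≈ 1# - κ 6ℚ * i
  lem6 = solve 1 (λ i → con 1ℚ :- con 2ℚ :* (con 3ℚ :* i) := con 1ℚ :- con 6ℚ :* i) ≈-refl
  second : ∀ k → (σ (tpl⁺ (ℤ.suc (~ k))) * lin 2ℚ (tpl⁺ (ℤ.suc (~ k)))) * q^ tri (tpl⁺ (ℤ.suc (~ k))) ≈ (σ k * lin 6ℚ k) * 𝐒 (q^ E₁ k)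
  second k = *-cong
    (≈-trans (*-cong (≈-trans (σ-tpl⁺ (ℤ.suc (~ k))) (-‿cong (σ-neg k))) (+-cong ≈-refl (-‿cong (*-cong ≈-refl (≈-trans (ι-tpl⁺ (ℤ.suc (~ k))) (+-cong (*-cong ≈-refl (ι-neg k)) ≈-refl))))))
      (solve 2 (λ s i → :- s :* (con 1ℚ :- con 2ℚ :* (con 3ℚ :* (:- i) :+ con 1ℚ)) := s :* (con 1ℚ :- con 6ℚ :* i)) ≈-refl (σ k) (ι k)))
    (≈-trans (q^tri-tpl⁺ (ℤ.suc (~ k))) (𝐒-cong (q^-cong (E₁′-neg k))))
  third : ∀ k → (σ (tpl⁺⁺ k) * lin 2ℚ (tpl⁺⁺ k)) * q^ tri (tpl⁺⁺ k) ≈ (- κ 3ℚ * q^ 1) * ((σ (ℤ.suc k) * lin 2ℚ (ℤ.suc k)) * 𝐒 (q^ E₀ (ℤ.suc k)))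
  third k = ≈-trans (*-cong (*-cong (σ-tpl⁺⁺ k) (+-cong ≈-refl (-‿cong (*-cong ≈-refl (ι-tpl⁺⁺ k))))) (q^tri-tpl⁺⁺ k))
    (≈-trans (solve 4 (λ s i q z → (s :* (con 1ℚ :- con 2ℚ :* (con 3ℚ :* i :+ con 1ℚ :+ con 1ℚ))) :* (q :* z) := (:- con 3ℚ :* q) :* ((:- s :* (con 1ℚ :- con 2ℚ :* (i :+ con 1ℚ))) :* z)) ≈-refl (σ k) (ι k) (q^ 1) _)
      (*-cong ≈-refl (*-cong (*-cong (≈-sym (σ-suc k)) (+-cong ≈-refl (-‿cong (*-cong ≈-refl (≈-sym (ι-suc k)))))) ≈-refl)))

-- Jacobi's derivative formula

φ-dissection : φ ≈ 𝐒 (𝐒 φ) - κ 2ℚ * (q^ 1 * 𝐒 b)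
φ-dissection = begin
  φ ≈⟨ ∑ℤ-tripart (decℤ-*ʳ σ dec-sq) ⟩
  _ ≈⟨ +-cong (+-cong
      (≈-trans (∑ℤ-cong _ (decℤ-𝐒 (decℤ-𝐒 (decℤ-*ʳ σ dec-sq))) first) (≈-sym (≈-trans (𝐒-cong (𝐒-∑ℤ _ (decℤ-𝐒 (decℤ-*ʳ σ dec-sq)))) (𝐒-∑ℤ _ _))))
      (≈-trans (∑ℤ-cong _ (decℤ-*ʳ (λ _ → - q^ 1) dB) second) (∑ℤ-* _ _ dB)))
      (≈-trans (∑ℤ-cong _ (decℤ-*ʳ (λ _ → - q^ 1) (dec-~∘ dB)) third) (≈-trans (∑ℤ-* _ _ (dec-~∘ dB)) (*-cong ≈-refl (≈-sym (∑ℤ-~ dB (dec-~∘ dB)))))) ⟩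
  𝐒 (𝐒 φ) + (- q^ 1) * ∑ℤ (λ k → 𝐒 (σ k * q^ Eb k)) dB + (- q^ 1) * ∑ℤ (λ k → 𝐒 (σ k * q^ Eb k)) dB
    ≈⟨ solve 3 (λ x q y → x :+ :- q :* y :+ :- q :* y := x :- con 2ℚ :* (q :* y)) ≈-refl (𝐒 (𝐒 φ)) (q^ 1) _ ⟩
  𝐒 (𝐒 φ) - κ 2ℚ * (q^ 1 * ∑ℤ (λ k → 𝐒 (σ k * q^ Eb k)) dB) ≈⟨ +-cong ≈-refl (-‿cong (*-cong ≈-refl (*-cong ≈-refl (≈-sym (𝐒-∑ℤ _ dB))))) ⟩
  𝐒 (𝐒 φ) - κ 2ℚ * (q^ 1 * 𝐒 b) ∎
  where
  open SR
  dB : Decℤ (λ k → 𝐒 (σ k * q^ Eb k))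
  dB = decℤ-𝐒 (decℤ-*ʳ σ dec-Eb)
  3sq : ℤ → ℕ
  3sq k = sq k ℕ.+ (sq k ℕ.+ sq k)
  first : ∀ k → σ (tpl k) * q^ sq (tpl k) ≈ 𝐒 (𝐒 (σ k * q^ sq k))
  first k = ≈-trans (*-cong (σ-tpl k) (≈-trans (q^-𝐒 (3sq k)
      (trans (cong₂ ℤ._+_ (tri-tpl k) (trans (cong (λ z → + tri z) (sym (tpl⁺-suc k))) (tri-tpl⁺ k)))
        (by-tri₁ (λ s → (9× (+ tri k) ℤ.+ (k ℤ.+ (k ℤ.+ k))) ℤ.+ (9× (+ tri k) ℤ.+ ((k ℤ.+ (k ℤ.+ k)) ℤ.+ (k ℤ.+ (k ℤ.+ k)))) ≡
            ((+ tri k ℤ.+ s) ℤ.+ ((+ tri k ℤ.+ s) ℤ.+ (+ tri k ℤ.+ s))) ℤ.+ (((+ tri k ℤ.+ s) ℤ.+ ((+ tri k ℤ.+ s) ℤ.+ (+ tri k ℤ.+ s))) ℤ.+ ((+ tri k ℤ.+ s) ℤ.+ ((+ tri k ℤ.+ s) ℤ.+ (+ tri k ℤ.+ s))))) k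
          (ℤR.solve 2 (λ k t → (((t ⊞ (t ⊞ t)) ⊞ ((t ⊞ (t ⊞ t)) ⊞ (t ⊞ (t ⊞ t)))) ⊞ (k ⊞ (k ⊞ k))) ⊞ (((t ⊞ (t ⊞ t)) ⊞ ((t ⊞ (t ⊞ t)) ⊞ (t ⊞ (t ⊞ t)))) ⊞ ((k ⊞ (k ⊞ k)) ⊞ (k ⊞ (k ⊞ k)))) ⩵
            ((t ⊞ (k ⊞ t)) ⊞ ((t ⊞ (k ⊞ t)) ⊞ (t ⊞ (k ⊞ t)))) ⊞ (((t ⊞ (k ⊞ t)) ⊞ ((t ⊞ (k ⊞ t)) ⊞ (t ⊞ (k ⊞ t)))) ⊞ ((t ⊞ (k ⊞ t)) ⊞ ((t ⊞ (k ⊞ t)) ⊞ (t ⊞ (k ⊞ t)))))) refl k (+ tri k)))))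
      (𝐒-cong (q^-𝐒 (sq k) refl))))
    (≈-sym (≈-trans (𝐒-cong (≈-trans (𝐒-* _ _) (*-cong (𝐒-σ k) ≈-refl))) (≈-trans (𝐒-* _ _) (*-cong (𝐒-σ k) ≈-refl))))
  second : ∀ k → σ (tpl⁺ k) * q^ sq (tpl⁺ k) ≈ (- q^ 1) * 𝐒 (σ k * q^ Eb k)
  second k = ≈-trans (*-cong (σ-tpl⁺ k) (q^-q𝐒 (Eb k)
      (trans (cong₂ ℤ._+_ (tri-tpl⁺ k) (trans (cong (λ z → + tri z) (sym (tpl⁺⁺-suc k))) (tri-tpl⁺⁺ k)))
        (by-tri₁ (λ s → (9× (+ tri k) ℤ.+ ((k ℤ.+ (k ℤ.+ k)) ℤ.+ (k ℤ.+ (k ℤ.+ k)))) ℤ.+ (+ 1 ℤ.+ (9× (+ tri k) ℤ.+ 9× k)) ≡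
            + 1 ℤ.+ ((+ tri k ℤ.+ ((s ℤ.+ s) ℤ.+ (s ℤ.+ (s ℤ.+ s)))) ℤ.+ ((+ tri k ℤ.+ ((s ℤ.+ s) ℤ.+ (s ℤ.+ (s ℤ.+ s)))) ℤ.+ (+ tri k ℤ.+ ((s ℤ.+ s) ℤ.+ (s ℤ.+ (s ℤ.+ s))))))) k
          (ℤR.solve 2 (λ k t → let s = k ⊞ t ; e = t ⊞ ((s ⊞ s) ⊞ (s ⊞ (s ⊞ s))) ; k3 = k ⊞ (k ⊞ k) ; t3 = t ⊞ (t ⊞ t) in
              ((t3 ⊞ (t3 ⊞ t3)) ⊞ (k3 ⊞ k3)) ⊞ (c′ (+ 1) ⊞ ((t3 ⊞ (t3 ⊞ t3)) ⊞ (k3 ⊞ (k3 ⊞ k3)))) ⩵ c′ (+ 1) ⊞ (e ⊞ (e ⊞ e))) refl k (+ tri k))))))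
    (≈-trans (solve 3 (λ s q z → :- s :* (q :* z) := :- q :* (s :* z)) ≈-refl (σ k) (q^ 1) _) (*-cong ≈-refl (≈-sym (≈-trans (𝐒-* _ _) (*-cong (𝐒-σ k) ≈-refl)))))
  -- 3k + 2 is the negative of 3(-1-k) + 1, so this class is the previous one reflected.
  third : ∀ k → σ (tpl⁺⁺ k) * q^ sq (tpl⁺⁺ k) ≈ (- q^ 1) * 𝐒 (σ (~ k) * q^ Eb (~ k))
  third k = ≈-trans (*-cong (≈-trans (σ-tpl⁺⁺ k) (≈-trans (≈-sym (≡⇒≈ (cong σ (~-~ k)))) (σ-~ (~ k)))) (q^-q𝐒 (Eb (~ k))
      (trans (cong₂ ℤ._+_ (tri-tpl⁺⁺ k) (trans (tri-suc (tpl⁺⁺ k)) (cong₂ ℤ._+_ (tpl⁺⁺-is k) (tri-tpl⁺⁺ k))))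
        (trans (ℤR.solve 2 (λ k t → let k3 = k ⊞ (k ⊞ k) ; t3 = t ⊞ (t ⊞ t) ; u = (c′ (+ 1) ⊞ k) ⊞ (k ⊞ t) ; s = k ⊞ t ; e = u ⊞ ((s ⊞ s) ⊞ (s ⊞ (s ⊞ s))) in
              (c′ (+ 1) ⊞ ((t3 ⊞ (t3 ⊞ t3)) ⊞ (k3 ⊞ (k3 ⊞ k3)))) ⊞ ((k3 ⊞ c′ (+ 2)) ⊞ (c′ (+ 1) ⊞ ((t3 ⊞ (t3 ⊞ t3)) ⊞ (k3 ⊞ (k3 ⊞ k3))))) ⩵ c′ (+ 1) ⊞ (e ⊞ (e ⊞ e))) refl k (+ tri k))
          (cong (λ z → + 1 ℤ.+ (z ℤ.+ (z ℤ.+ z))) (cong₂ (λ u s → u ℤ.+ ((s ℤ.+ s) ℤ.+ (s ℤ.+ (s ℤ.+ s))))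
            (sym (trans (cong +_ (tri-~ k)) (trans (tri-suc (ℤ.suc k)) (cong (λ z → ℤ.suc k ℤ.+ z) (tri-suc k)))))
            (sym (trans (cong +_ (tri-suc-~ k)) (tri-suc k)))))))))
    (≈-trans (solve 3 (λ s q z → :- s :* (q :* z) := :- q :* (s :* z)) ≈-refl (σ (~ k)) (q^ 1) _) (*-cong ≈-refl (≈-sym (≈-trans (𝐒-* _ _) (*-cong (𝐒-σ (~ k)) ≈-refl)))))

-- For large k the theta term is small; for bounded k and large N the index of ρ is very negative,
-- and there ρ has high order.
decℕℤ-ρ : ∀ {h} (w : ℕ → Series) (m : ℤ → ℤ) → (∀ k → ∣ m k ∣ ≤ suc ∣ k ∣) → Decℤ h → Decℕℤ (λ N k → w N * (h k * ρ (m k ⊟ N)))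
decℕℤ-ρ {h} w m m≤ d n = M ℕ.+ n , go
  where
  M₁ = proj₁ (d n)
  M = suc M₁
  go : ∀ i j → M ℕ.+ n ≤ i ⊎ M ℕ.+ n ≤ ∣ j ∣ → Ord n (w i * (h j * ρ (m j ⊟ i)))
  go i j (inj₂ l) = ord-⊗ʳ (w i) (ord-⊗ˡ _ (proj₂ (d n) j (ℕP.≤-trans (ℕP.n≤1+n M₁) (ℕP.≤-trans (ℕP.m≤m+n M n) l))))
  go i j (inj₁ l) with M₁ ℕP.≤? ∣ j ∣
  ... | yes p = ord-⊗ʳ (w i) (ord-⊗ˡ _ (proj₂ (d n) j p))
  ... | no p = ord-⊗ʳ (w i) (ord-⊗ʳ (h j) (ρ-⊟-ord (m j) n i (ℕP.≤-trans (ℕP.+-monoˡ-≤ n (ℕP.≤-trans (m≤ j) (s≤s (ℕP.<⇒≤ (ℕP.≰⇒> p))))) l)))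

dec-theta : ∀ {h} (w : ℕ → Series) (m : ℤ → ℤ) → (∀ k → ∣ m k ∣ ≤ suc ∣ k ∣) → (d : Decℤ h) → Dec (λ N → w N * ∑ℤ (λ k → h k * ρ (m k ⊟ N)) (decℤ-*ˡ (λ k → ρ (m k ⊟ N)) d))
dec-theta {h} w m m≤ d = dec-≈ (λ N → ∑ℤ-* (w N) _ _) (rowsℕℤ (decℕℤ-ρ w m m≤ d))

-- Summing over N first: the weights in N act on ρ alone, so a weighted sum of theta series becomes
-- one theta series with a `tail` as coefficient.
theta-tail : ∀ {h} (w : ℕ → Series) (m : ℤ → ℤ) (m≤ : ∀ k → ∣ m k ∣ ≤ suc ∣ k ∣) (d : Decℤ h) →
  ∑ (λ N → w N * ∑ℤ (λ k → h k * ρ (m k ⊟ N)) (decℤ-*ˡ (λ k → ρ (m k ⊟ N)) d)) (dec-theta w m m≤ d)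
    ≈ ∑ℤ (λ k → h k * tail w (m k)) (decℤ-*ˡ (λ k → tail w (m k)) d)
theta-tail {h} w m m≤ d = begin
  ∑ (λ N → w N * ∑ℤ (λ k → h k * ρ (m k ⊟ N)) (decℤ-*ˡ _ d)) (dec-theta w m m≤ d)
    ≈⟨ ∑-cong _ (rowsℕℤ Dℕ) (λ N → ≈-sym (∑ℤ-* (w N) (rowℕℤ Dℕ N) _)) ⟩
  ∑ (λ N → ∑ℤ (λ k → w N * (h k * ρ (m k ⊟ N))) (rowℕℤ Dℕ N)) (rowsℕℤ Dℕ) ≈⟨ ∑∑ℤ-swap Dℕ ⟩
  ∑ℤ (λ k → ∑ (λ N → w N * (h k * ρ (m k ⊟ N))) (colℕℤ Dℕ k)) (colsℕℤ Dℕ)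
    ≈⟨ ∑ℤ-cong _ _ (λ k → ≈-trans (∑-cong _ (dec-⊗ʳ (λ _ → h k) (dec-ρ w (m k))) (λ N → solve 3 (λ w h r → w :* (h :* r) := h :* (w :* r)) ≈-refl (w N) (h k) (ρ (m k ⊟ N))))
         (≈-trans (∑-⊗ (h k) _ (dec-ρ w (m k))) (*-cong ≈-refl (≈-sym (tail-is w (m k)))))) ⟩
  ∑ℤ (λ k → h k * tail w (m k)) (decℤ-*ˡ (λ k → tail w (m k)) d) ∎
  where
  open SR
  Dℕ = decℕℤ-ρ w m m≤ d

abs-pred : ∀ k → ∣ ℤ.pred k ∣ ≤ suc ∣ k ∣
abs-pred (+ zero) = s≤s z≤n
abs-pred (+ suc n) = ℕP.m≤n⇒m≤1+n (ℕP.n≤1+n n)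
abs-pred -[1+ n ] = ℕP.≤-refl

abs-~′ : ∀ k → ∣ ~ k ∣ ≤ suc ∣ k ∣
abs-~′ (+ n) = ℕP.≤-refl
abs-~′ -[1+ n ] = ℕP.m≤n⇒m≤1+n (ℕP.n≤1+n n)

dec-σtri : Decℤ (λ k → σ k * q^ tri k)
dec-σtri = decℤ-*ʳ σ dec-tri

V : ℕ → Series
V N = ∑ℤ (λ k → (σ k * q^ tri k) * ρ (k ⊟ N)) (decℤ-*ˡ _ dec-σtri)

self-neg : ∀ {x} → x ≈ - x → x ≈ 0#
self-neg {x} h = begin
  x ≈⟨ solve 1 (λ x → x := con ½ :* (x :- (:- x))) ≈-refl x ⟩
  κ ½ * (x - (- x)) ≈⟨ *-cong ≈-refl (zero-diff h) ⟩
  κ ½ * 0# ≈⟨ zeroʳ _ ⟩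
  0# ∎
  where open SR

-- The reflection k ↦ 1 - k preserves tri k and reverses the sign.
alternating-tri : ∑ℤ (λ k → σ k * q^ tri k) dec-σtri ≈ 0#
alternating-tri = self-neg (≈-trans (∑ℤ-~ dec-σtri (dec-~∘ dec-σtri)) (≈-trans
  (∑ℤ-cong _ (decℤ-neg d₂) (λ k → ≈-trans (*-cong (σ-~ k) (q^-cong (tri-~ k))) (≈-trans (*-cong (-‿cong (≈-sym (σ₂ k))) ≈-refl) (solve 2 (λ x y → :- x :* y := :- (x :* y)) ≈-refl _ _))))
  (≈-trans (∑ℤ-neg _ d₂) (-‿cong (≈-sym (≈-trans (∑ℤ-shift dec-σtri (dec-suc∘ dec-σtri)) (∑ℤ-shift (dec-suc∘ dec-σtri) d₂)))))))
  where
  d₂ : Decℤ (λ k → σ (ℤ.suc (ℤ.suc k)) * q^ tri (ℤ.suc (ℤ.suc k)))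
  d₂ = dec-suc∘ (dec-suc∘ dec-σtri)
  σ₂ : ∀ k → σ (ℤ.suc (ℤ.suc k)) ≈ σ k
  σ₂ k = ≈-trans (σ-suc (ℤ.suc k)) (≈-trans (-‿cong (σ-suc k)) (solve 1 (λ x → :- (:- x) := x) ≈-refl (σ k)))

-- Shifting k raises the index of ρ and one use of its recursion lowers it again, so the same series
-- comes back times q^N. The inhomogeneous term is `alternating-tri`, which vanishes. For N > 0 this
-- forces `V` to be zero.
V-fixed : ∀ N → V (suc N) ≈ q^ N * V (suc N)
V-fixed N = begin
  V (suc N) ≈⟨ ∑ℤ-shift _ d₁ ⟩
  ∑ℤ (λ k → (σ (ℤ.suc k) * q^ tri (ℤ.suc k)) * ρ (ℤ.suc k ⊟ suc N)) d₁
    ≈⟨ ∑ℤ-cong d₁ d₂ step ⟩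
  ∑ℤ (λ k → (- q^ N) * (σ k * q^ tri k) + q^ N * ((σ k * q^ tri k) * ρ (k ⊟ suc N))) d₂
    ≈⟨ ≈-trans (∑ℤ-+ d₂ d₃ d₄) (+-cong (∑ℤ-* _ _ dec-σtri) (∑ℤ-* _ _ dV)) ⟩
  (- q^ N) * ∑ℤ (λ k → σ k * q^ tri k) dec-σtri + q^ N * V (suc N) ≈⟨ +-cong (≈-trans (*-cong ≈-refl alternating-tri) (zeroʳ _)) ≈-refl ⟩
  0# + q^ N * V (suc N) ≈⟨ +-identityˡ _ ⟩
  q^ N * V (suc N) ∎
  where
  open SR
  dV : Decℤ (λ k → (σ k * q^ tri k) * ρ (k ⊟ suc N))
  dV = decℤ-*ˡ _ dec-σtri
  d₁ : Decℤ (λ k → (σ (ℤ.suc k) * q^ tri (ℤ.suc k)) * ρ (ℤ.suc k ⊟ suc N))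
  d₁ = dec-suc∘ dV
  d₃ : Decℤ (λ k → (- q^ N) * (σ k * q^ tri k))
  d₃ = decℤ-*ʳ (λ _ → - q^ N) dec-σtri
  d₄ : Decℤ (λ k → q^ N * ((σ k * q^ tri k) * ρ (k ⊟ suc N)))
  d₄ = decℤ-*ʳ (λ _ → q^ N) dV
  d₂ = decℤ-+ d₃ d₄
  step : ∀ k → (σ (ℤ.suc k) * q^ tri (ℤ.suc k)) * ρ (ℤ.suc k ⊟ suc N) ≈ (- q^ N) * (σ k * q^ tri k) + q^ N * ((σ k * q^ tri k) * ρ (k ⊟ suc N))
  step k = begin
    (σ (ℤ.suc k) * q^ tri (ℤ.suc k)) * ρ (ℤ.suc k ⊟ suc N)
      ≈⟨ ≈-trans (*-assoc _ _ _) (*-cong (σ-suc k) (*-cong ≈-refl (≡⇒≈ (cong ρ (cong (_⊟ N) (pred-suc k)))))) ⟩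
    (- σ k) * (q^ tri (ℤ.suc k) * ρ (k ⊟ N))
      ≈⟨ *-cong ≈-refl (ρ-pred (k ⊟ N) (tri (ℤ.suc k)) (N ℕ.+ tri k) (trans (tri-suc k) (trans (ℤR.solve 3 (λ k t n → k ⊞ t ⩵ (n ⊞ t) ⊞ (k ⊖′ n)) refl k (+ tri k) (+ N)) (cong (λ z → + (N ℕ.+ tri k) ℤ.+ z) (sym (⊟-is k N)))))) ⟩
    (- σ k) * (q^ (N ℕ.+ tri k) - q^ (N ℕ.+ tri k) * ρ (ℤ.pred (k ⊟ N)))
      ≈⟨ *-cong ≈-refl (+-cong (≈-sym (q^-+ N (tri k))) (-‿cong (*-cong (≈-sym (q^-+ N (tri k))) (≡⇒≈ (cong ρ (⊟-pred k N)))))) ⟩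
    (- σ k) * (q^ N * q^ tri k - (q^ N * q^ tri k) * ρ (k ⊟ suc N))
      ≈⟨ solve 4 (λ s n t r → (:- s) :* (n :* t :- (n :* t) :* r) := (:- n) :* (s :* t) :+ n :* ((s :* t) :* r)) ≈-refl (σ k) (q^ N) (q^ tri k) _ ⟩
    (- q^ N) * (σ k * q^ tri k) + q^ N * ((σ k * q^ tri k) * ρ (k ⊟ suc N)) ∎

q^-fixed : ∀ n {x} → x ≈ q^ suc n * x → x ≈ 0#
q^-fixed n {x} h = agree⇒≈ λ N m l → trans (go N m l) (sym (0-at m))
  where
  go : ∀ N → Ord N x
  go zero m ()
  go (suc N) = ord-≈ (≈-sym h) (ord-≤ (s≤s (ℕP.m≤n+m N n)) (ord-q^* (suc n) (go N)))

V-zero : ∀ N → V (suc (suc N)) ≈ 0#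
V-zero N = q^-fixed N (V-fixed (suc N))

-- the theta sum against sₖ reduces to the single term V 1
εψ₂ : ε * ψ₂ ≈ V 1
εψ₂ = begin
  ε * ψ₂ ≈⟨ ≈-sym (∑ℤ-* ε (decℤ-*ʳ (λ _ → ε) dec-tri) dec-tri) ⟩
  ∑ℤ (λ k → ε * q^ tri k) (decℤ-*ʳ (λ _ → ε) dec-tri)
    ≈⟨ ∑ℤ-cong _ dsum (λ k → ≈-trans (solve 3 (λ s e t → e :* t := con 1ℚ :* (e :* t)) ≈-refl (σ k) ε (q^ tri k)) (≈-trans (*-cong (≈-sym (σ² k)) ≈-refl)
         (≈-trans (solve 3 (λ s e t → (s :* s) :* (e :* t) := :- con ½ :* (s :* t) :+ (s :* t) :* (con ½ :+ s :* e)) ≈-refl (σ k) ε (q^ tri k))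
           (+-cong ≈-refl (≈-trans (*-cong ≈-refl (≈-sym (sₖ-val k))) (distribˡ _ _ _)))))) ⟩
  ∑ℤ (λ k → (- κ ½) * (σ k * q^ tri k) + ((σ k * q^ tri k) * S₁ (ℤ.pred k) + (σ k * q^ tri k) * S₁ (~ k))) dsum
    ≈⟨ ≈-trans (∑ℤ-+ dsum d₀ (decℤ-+ d₁ d₂)) (+-cong (≈-trans (∑ℤ-* _ _ dec-σtri) (≈-trans (*-cong ≈-refl alternating-tri) (zeroʳ _))) (∑ℤ-+ _ d₁ d₂)) ⟩
  0# + (∑ℤ (λ k → (σ k * q^ tri k) * S₁ (ℤ.pred k)) d₁ + ∑ℤ (λ k → (σ k * q^ tri k) * S₁ (~ k)) d₂)
    ≈⟨ +-cong ≈-refl (+-cong (≈-sym (theta-tail σℕ ℤ.pred abs-pred dec-σtri)) (≈-sym (theta-tail σℕ ~_ abs-~′ dec-σtri))) ⟩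
  0# + (∑ (λ N → σℕ N * ∑ℤ (λ k → (σ k * q^ tri k) * ρ (ℤ.pred k ⊟ N)) (decℤ-*ˡ (λ k → ρ (ℤ.pred k ⊟ N)) dec-σtri)) (dec-theta σℕ ℤ.pred abs-pred dec-σtri)
      + ∑ (λ N → σℕ N * ∑ℤ (λ k → (σ k * q^ tri k) * ρ (~ k ⊟ N)) (decℤ-*ˡ (λ k → ρ (~ k ⊟ N)) dec-σtri)) (dec-theta σℕ ~_ abs-~′ dec-σtri))
    ≈⟨ +-cong ≈-refl (+-cong (∑-suc _ (dec-suc (dec-theta σℕ ℤ.pred abs-pred dec-σtri))) (∑-0 _ λ N → ≈-trans (*-cong ≈-refl (second N)) (zeroʳ _))) ⟩
  0# + ((1# * V 1 + ∑ (λ N → σℕ (suc N) * V (suc (suc N))) (dec-suc (dec-theta σℕ ℤ.pred abs-pred dec-σtri))) + 0#)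
    ≈⟨ +-cong ≈-refl (+-cong (+-cong ≈-refl (∑-0 _ λ N → ≈-trans (*-cong ≈-refl (V-zero N)) (zeroʳ _))) ≈-refl) ⟩
  0# + ((1# * V 1 + 0#) + 0#) ≈⟨ solve 1 (λ v → con 0ℚ :+ ((con 1ℚ :* v :+ con 0ℚ) :+ con 0ℚ) := v) ≈-refl (V 1) ⟩
  V 1 ∎
  where
  open SR
  σ² : ∀ k → σ k * σ k ≈ 1#
  σ² = λ { (+ n) → go n ; -[1+ n ] → ≈-trans (solve 1 (λ x → (:- x) :* (:- x) := x :* x) ≈-refl (σℕ n)) (go n) }
    where
    go : ∀ n → σℕ n * σℕ n ≈ 1#
    go zero = *-identityˡ _
    go (suc n) = ≈-trans (solve 1 (λ x → (:- x) :* (:- x) := x :* x) ≈-refl (σℕ n)) (go n)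
  ∑-0 : ∀ {u} d → (∀ n → u n ≈ 0#) → ∑ u d ≈ 0#
  ∑-0 {u} d h = ≈-trans (∑-cong d (dec-⊗ʳ (λ _ → 0#) d) (λ n → ≈-trans (h n) (≈-sym (zeroˡ _)))) (≈-trans (∑-⊗ 0# _ d) (zeroˡ _))
  d₀ : Decℤ (λ k → (- κ ½) * (σ k * q^ tri k))
  d₀ = decℤ-*ʳ (λ _ → - κ ½) dec-σtri
  d₁ : Decℤ (λ k → (σ k * q^ tri k) * S₁ (ℤ.pred k))
  d₁ = decℤ-*ˡ (λ k → S₁ (ℤ.pred k)) dec-σtri
  d₂ : Decℤ (λ k → (σ k * q^ tri k) * S₁ (~ k))
  d₂ = decℤ-*ˡ (λ k → S₁ (~ k)) dec-σtri
  dsum = decℤ-+ d₀ (decℤ-+ d₁ d₂)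
  -- Reflection by k ↦ -1 - k and two shifts turn this sum into - V (N + 2).
  second : ∀ N → ∑ℤ (λ k → (σ k * q^ tri k) * ρ (~ k ⊟ N)) (decℤ-*ˡ (λ k → ρ (~ k ⊟ N)) dec-σtri) ≈ 0#
  second N = begin
    ∑ℤ (λ k → (σ k * q^ tri k) * ρ (~ k ⊟ N)) e₀ ≈⟨ ∑ℤ-~ e₀ (dec-~∘ e₀) ⟩
    ∑ℤ (λ k → (σ (~ k) * q^ tri (~ k)) * ρ (~ (~ k) ⊟ N)) (dec-~∘ e₀)
      ≈⟨ ∑ℤ-cong _ (decℤ-neg e₂) (λ k → ≈-trans (*-cong (*-cong (≈-trans (σ-~ k) (-‿cong (≈-sym (σ₂ k)))) (q^-cong (tri-~ k))) (≡⇒≈ (cong ρ (trans (cong (_⊟ N) (~-~ k)) (sym (arg k))))))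
           (solve 3 (λ x y z → (:- x :* y) :* z := :- ((x :* y) :* z)) ≈-refl _ _ _)) ⟩
    ∑ℤ (λ k → - ((σ (ℤ.suc (ℤ.suc k)) * q^ tri (ℤ.suc (ℤ.suc k))) * ρ (ℤ.suc (ℤ.suc k) ⊟ suc (suc N)))) (decℤ-neg e₂)
      ≈⟨ ≈-trans (∑ℤ-neg _ e₂) (-‿cong (≈-sym (≈-trans (∑ℤ-shift _ (dec-suc∘ eV)) (∑ℤ-shift (dec-suc∘ eV) e₂)))) ⟩
    - V (suc (suc N)) ≈⟨ -‿cong (V-zero N) ⟩
    - 0# ≈⟨ solve 0 (:- con 0ℚ := con 0ℚ) ≈-refl ⟩
    0# ∎
    where
    e₀ : Decℤ (λ k → (σ k * q^ tri k) * ρ (~ k ⊟ N))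
    e₀ = decℤ-*ˡ (λ k → ρ (~ k ⊟ N)) dec-σtri
    eV : Decℤ (λ k → (σ k * q^ tri k) * ρ (k ⊟ suc (suc N)))
    eV = decℤ-*ˡ (λ k → ρ (k ⊟ suc (suc N))) dec-σtri
    e₂ : Decℤ (λ k → (σ (ℤ.suc (ℤ.suc k)) * q^ tri (ℤ.suc (ℤ.suc k))) * ρ (ℤ.suc (ℤ.suc k) ⊟ suc (suc N)))
    e₂ = dec-suc∘ (dec-suc∘ eV)
    σ₂ : ∀ k → σ (ℤ.suc (ℤ.suc k)) ≈ σ k
    σ₂ k = ≈-trans (σ-suc (ℤ.suc k)) (≈-trans (-‿cong (σ-suc k)) (solve 1 (λ x → :- (:- x) := x) ≈-refl (σ k)))
    arg : ∀ k → ℤ.suc (ℤ.suc k) ⊟ suc (suc N) ≡ k ⊟ N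
    arg k = cong (_⊟ N) (trans (cong ℤ.pred (pred-suc (ℤ.suc k))) (pred-suc k))

-- partial theta tails t n = Σ_{l > n} (-1)^l q^(l(l-1)/2)
t : ℕ → Series
t n = (- σℕ n) * q^ T (suc n) * r n

dec-t : Dec t
dec-t = dec-ord λ n → ord-⊗ˡ (r n) (ord-⊗ʳ (- σℕ n) (ord-≤ (ℕP.m≤m+n n (T n)) (q^-ord (T (suc n)))))

t-diff : ∀ n → t n - t (suc n) ≈ (- σℕ n) * q^ T (suc n)
t-diff n = begin
  (- σℕ n) * q^ T (suc n) * r n - (- - σℕ n) * q^ T (suc (suc n)) * r (suc n)
    ≈⟨ +-cong (*-cong ≈-refl (r-rec n)) (-‿cong (*-cong (*-cong ≈-refl (≈-sym (q^-+ (suc n) (T (suc n))))) ≈-refl)) ⟩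
  (- σℕ n) * q^ T (suc n) * (1# - q^ suc n * r (suc n)) - (- - σℕ n) * (q^ suc n * q^ T (suc n)) * r (suc n)
    ≈⟨ solve 4 (λ s p x y → (:- s) :* p :* (con 1ℚ :- x :* y) :- (:- (:- s)) :* (x :* p) :* y := (:- s) :* p) ≈-refl (σℕ n) (q^ T (suc n)) (q^ suc n) (r (suc n)) ⟩
  (- σℕ n) * q^ T (suc n) ∎
  where open SR

-- Together with its theta coefficient, ρ_(k-1) is a tail of the alternating series over triangular
-- numbers: k = n + 1 gives `t n`, k = 0 gives `t 1`, and k = -1 - n gives `t (n + 2)`.
V₁-t : V 1 ≈ ∑ t dec-t + ∑ (λ n → t (suc n)) (dec-suc dec-t)
V₁-t = begin
  V 1 ≈⟨ ∑ℤ-is _ _ ⟩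
  ∑ (fold g) df ≈⟨ ∑-suc df (dec-suc df) ⟩
  fold g 0 + ∑ (λ n → fold g (suc n)) (dec-suc df)
    ≈⟨ +-cong (+-cong (≈-trans (*-cong ≈-refl (r-rec′ 0)) (solve 2 (λ p x → (con 1ℚ :* p) :* x := p :* x) ≈-refl (q^ 0) (q^ 1 * r 1))) (neg 0))
         (≈-trans (∑-cong _ (dec-⊕ dec-t d₃) (λ n → +-cong ≈-refl (neg (suc n)))) (∑-⊕ _ dec-t d₃)) ⟩
  (q^ 0 * (q^ 1 * r 1) + t 2) + (∑ t dec-t + ∑ (λ n → t (suc (suc (suc n)))) d₃)
    ≈⟨ +-cong (+-cong (≈-trans (*-cong q^-0 ≈-refl) (solve 2 (λ x y → con 1ℚ :* (x :* y) := (:- (:- con 1ℚ)) :* x :* y) ≈-refl (q^ 1) (r 1))) ≈-refl) ≈-refl ⟩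
  (t 1 + t 2) + (∑ t dec-t + ∑ (λ n → t (suc (suc (suc n)))) d₃)
    ≈⟨ solve 4 (λ a b c d → (a :+ b) :+ (c :+ d) := c :+ (a :+ (b :+ d))) ≈-refl _ _ _ _ ⟩
  ∑ t dec-t + (t 1 + (t 2 + ∑ (λ n → t (suc (suc (suc n)))) d₃))
    ≈⟨ +-cong ≈-refl (≈-sym (≈-trans (∑-suc _ d₂) (+-cong ≈-refl (∑-suc d₂ d₃)))) ⟩
  ∑ t dec-t + ∑ (λ n → t (suc n)) (dec-suc dec-t) ∎
  where
  open SR
  g : ℤ → Series
  g k = (σ k * q^ tri k) * ρ (k ⊟ 1)
  df : Dec (fold g)
  df = dec-fold (decℤ-*ˡ (λ k → ρ (k ⊟ 1)) dec-σtri)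
  d₂ : Dec (λ n → t (suc (suc n)))
  d₂ = dec-suc (dec-suc dec-t)
  d₃ : Dec (λ n → t (suc (suc (suc n))))
  d₃ = dec-suc d₂
  neg : ∀ n → g -[1+ n ] ≈ t (suc (suc n))
  neg n = ≈-trans (*-cong ≈-refl (r-rec′ (suc n))) (≈-trans
    (solve 4 (λ s p x y → ((:- s) :* p) :* (x :* y) := (:- (:- (:- s))) :* (x :* p) :* y) ≈-refl (σℕ n) (q^ T (suc (suc n))) (q^ suc (suc n)) (r (suc (suc n))))
    (*-cong (*-cong ≈-refl (q^-+ (suc (suc n)) (T (suc (suc n))))) ≈-refl))

-- Abel summation. The coefficients of `X` without their weights are differences of the tails `t`;
-- the weights 1 + 2n grow by 2, so the unweighted tails remain.
X-V₁ : X ≈ - (κ 2ℚ * V 1)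
X-V₁ = begin
  X ≈⟨ ∑ℤ-is _ _ ⟩
  ∑ (fold g) df ≈⟨ ≈-trans (∑-⊕ df d⁺ d⁻) (+-cong (∑-suc d⁺ (dec-suc d⁺)) ≈-refl) ⟩
  (g (+ 0) + ∑ (λ n → g (+ suc n)) (dec-suc d⁺)) + ∑ (λ n → g -[1+ n ]) d⁻
    ≈⟨ +-cong (+-cong (≈-trans (*-cong ≈-refl q^-0) (solve 0 ((con 1ℚ :* (con 1ℚ :- con 2ℚ :* con 0ℚ)) :* con 1ℚ := con 1ℚ) ≈-refl)) (∑-cong _ dτ pos)) (∑-cong _ (dec-suc dτ) neg) ⟩
  (1# + ∑ τ dτ) + ∑ (λ n → τ (suc n)) (dec-suc dτ)
    ≈⟨ +-cong (+-cong (≈-sym τ0) ≈-refl) ≈-refl ⟩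
  (τ 0 + ∑ τ dτ) + ∑ (λ n → τ (suc n)) (dec-suc dτ)
    ≈⟨ solve 3 (λ a b c → (a :+ b) :+ c := b :+ (a :+ c)) ≈-refl _ _ _ ⟩
  ∑ τ dτ + (τ 0 + ∑ (λ n → τ (suc n)) (dec-suc dτ)) ≈⟨ +-cong ≈-refl (≈-sym (∑-suc dτ (dec-suc dτ))) ⟩
  ∑ τ dτ + ∑ τ dτ ≈⟨ +-cong ττ ττ ⟩
  - (s₀ + s₁) + - (s₀ + s₁) ≈⟨ solve 1 (λ x → :- x :+ :- x := :- (con 2ℚ :* x)) ≈-refl _ ⟩
  - (κ 2ℚ * (s₀ + s₁)) ≈⟨ -‿cong (*-cong ≈-refl (≈-sym V₁-t)) ⟩
  - (κ 2ℚ * V 1) ∎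
  where
  open SR
  g : ℤ → Series
  g k = (σ k * lin 2ℚ k) * q^ tri k
  dX : Decℤ g
  dX = decℤ-*ʳ _ dec-tri
  df : Dec (fold g)
  df = dec-fold dX
  d⁺ : Dec (λ n → g (+ n))
  d⁺ N = proj₁ (dX N) , λ n l → proj₂ (dX N) (+ n) l
  d⁻ : Dec (λ n → g -[1+ n ])
  d⁻ N = proj₁ (dX N) , λ n l → proj₂ (dX N) -[1+ n ] (ℕP.m≤n⇒m≤1+n l)
  w : ℕ → Series
  w n = 1# + κ 2ℚ * ιℕ n
  τ : ℕ → Series
  τ n = w n * (t (suc n) - t n)
  s₀ = ∑ t dec-t
  s₁ = ∑ (λ n → t (suc n)) (dec-suc dec-t)
  dw : Dec (λ n → w n * t (suc n))
  dw = dec-⊗ʳ w (dec-suc dec-t)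
  dw′ : Dec (λ n → w n * t n)
  dw′ = dec-⊗ʳ w dec-t
  dneg : ∀ {u} → Dec u → Dec (λ n → - u n)
  dneg d N = proj₁ (d N) , λ n l → ord-- (proj₂ (d N) n l)
  dτ : Dec τ
  dτ = dec-⊗ʳ w (dec-⊕ (dec-suc dec-t) (dneg dec-t))
  val : ∀ n → t (suc n) - t n ≈ σℕ n * q^ T (suc n)
  val n = ≈-trans (solve 2 (λ x y → x :- y := :- (y :- x)) ≈-refl _ _) (≈-trans (-‿cong (t-diff n)) (solve 2 (λ x y → :- ((:- x) :* y) := x :* y) ≈-refl _ _))
  pos : ∀ n → g (+ suc n) ≈ τ n
  pos n = ≈-trans (solve 3 (λ s i p → (:- s :* (con 1ℚ :- con 2ℚ :* (i :+ con 1ℚ))) :* p := (con 1ℚ :+ con 2ℚ :* i) :* (s :* p)) ≈-refl (σℕ n) (ιℕ n) _) (*-cong ≈-refl (≈-sym (val n)))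
  neg : ∀ n → g -[1+ n ] ≈ τ (suc n)
  neg n = ≈-trans (solve 3 (λ s i p → (:- s :* (con 1ℚ :- con 2ℚ :* (:- (i :+ con 1ℚ)))) :* p := (con 1ℚ :+ con 2ℚ :* (i :+ con 1ℚ)) :* (:- s :* p)) ≈-refl (σℕ n) (ιℕ n) _) (*-cong ≈-refl (≈-sym (val (suc n))))
  τ0 : τ 0 ≈ 1#
  τ0 = ≈-trans (*-cong ≈-refl (≈-trans (val 0) (*-cong ≈-refl q^-0))) (solve 0 ((con 1ℚ :+ con 2ℚ :* con 0ℚ) :* (con 1ℚ :* con 1ℚ) := con 1ℚ) ≈-refl)
  ττ : ∑ τ dτ ≈ - (s₀ + s₁)
  ττ = begin
    ∑ τ dτ ≈⟨ ∑-cong dτ (dec-⊕ dw (dneg dw′)) (λ n → solve 3 (λ w a b → w :* (a :- b) := w :* a :+ :- (w :* b)) ≈-refl (w n) (t (suc n)) (t n)) ⟩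
    ∑ (λ n → w n * t (suc n) + - (w n * t n)) (dec-⊕ dw (dneg dw′))
      ≈⟨ ≈-trans (∑-⊕ _ dw (dneg dw′)) (+-cong ≈-refl (≈-trans (∑-cong _ (dec-⊗ʳ (λ _ → - 1#) dw′) (λ n → solve 1 (λ x → :- x := :- con 1ℚ :* x) ≈-refl _)) (≈-trans (∑-⊗ _ _ dw′) (*-cong ≈-refl (∑-suc dw′ (dec-suc dw′)))))) ⟩
    ∑ (λ n → w n * t (suc n)) dw + (- 1#) * (w 0 * t 0 + ∑ (λ n → w (suc n) * t (suc n)) (dec-suc dw′))
      ≈⟨ +-cong ≈-refl (*-cong ≈-refl (+-cong ≈-refl (≈-trans (∑-cong _ (dec-⊕ dw d2) (λ n → solve 2 (λ i x → (con 1ℚ :+ con 2ℚ :* (i :+ con 1ℚ)) :* x := (con 1ℚ :+ con 2ℚ :* i) :* x :+ con 2ℚ :* x) ≈-refl (ιℕ n) (t (suc n))))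
           (≈-trans (∑-⊕ _ dw d2) (+-cong ≈-refl (∑-⊗ _ _ (dec-suc dec-t))))))) ⟩
    y + (- 1#) * (w 0 * t 0 + (y + κ 2ℚ * s₁))
      ≈⟨ solve 3 (λ y a s → y :+ :- con 1ℚ :* ((con 1ℚ :+ con 2ℚ :* con 0ℚ) :* a :+ (y :+ con 2ℚ :* s)) := :- ((a :+ s) :+ s)) ≈-refl y (t 0) s₁ ⟩
    - ((t 0 + s₁) + s₁) ≈⟨ -‿cong (+-cong (≈-sym (∑-suc dec-t (dec-suc dec-t))) ≈-refl) ⟩
    - (s₀ + s₁) ∎
    where
    y = ∑ (λ n → w n * t (suc n)) dw
    d2 : Dec (λ n → κ 2ℚ * t (suc n))
    d2 = dec-⊗ʳ (λ _ → κ 2ℚ) (dec-suc dec-t)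

-- That is 1 - 4 Σ (-1)^i ρ_(-1-i). Summed over i first, it is 1 + 4 Σ (-1)^j q^(j(j+1)/2) / (1 +
-- q^j), j ≥ 1: the Lambert series of the two squares theorem.
η : Series
η = - (κ 2ℚ * ε)

jacobi : X ≈ η * ψ₂
jacobi = ≈-trans X-V₁ (≈-trans (-‿cong (*-cong ≈-refl (≈-sym εψ₂))) (solve 2 (λ e p → :- (con 2ℚ :* (e :* p)) := :- (con 2ℚ :* e) :* p) ≈-refl ε ψ₂))

-- Products of theta series

abs-translate : ∀ n k → ∣ k ∣ ≤ ∣ n ℤ.+ k ∣ ℕ.+ ∣ n ∣
abs-translate n k = subst (λ z → ∣ z ∣ ≤ ∣ n ℤ.+ k ∣ ℕ.+ ∣ n ∣) (ℤR.solve 2 (λ n k → (n ⊞ k) ⊖′ n ⩵ k) refl n k) (ℤP.∣i-j∣≤∣i∣+∣j∣ (n ℤ.+ k) n)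

dec-translate : ∀ {g} n → Decℤ g → Decℤ (λ k → g (n ℤ.+ k))
dec-translate n = decℤ-∘ (λ k → n ℤ.+ k) ∣ n ∣ (abs-translate n)

∑ℤ-translate : ∀ {g} n d d′ → ∑ℤ g d ≈ ∑ℤ (λ k → g (n ℤ.+ k)) d′
∑ℤ-translate {g} n d d′ = ≈-trans (diff-zero (≈-trans (+-cong (≈-sym base) ≈-refl) (go n))) (∑ℤ-cong _ _ λ k → ≈-refl)
  where
  F : ℤ → Series
  F n = ∑ℤ (λ k → g (n ℤ.+ k)) (dec-translate n d)
  base : F (+ 0) ≈ ∑ℤ g d
  base = ∑ℤ-cong _ _ λ k → ≡⇒≈ (cong g (ℤP.+-identityˡ k))
  step : ∀ n → F (ℤ.suc n) ≈ F n
  step n = ≈-sym (≈-trans (∑ℤ-shift _ (dec-suc∘ (dec-translate n d))) (∑ℤ-cong _ _ λ k →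
    ≡⇒≈ (cong g (ℤR.solve 2 (λ n k → n ⊞ (c′ (+ 1) ⊞ k) ⩵ (c′ (+ 1) ⊞ n) ⊞ k) refl n k))))
  go : ∀ n → F (+ 0) - F n ≈ 0#
  go = suc-constant {λ n → F (+ 0) - F n} (λ n → +-cong ≈-refl (-‿cong (step n))) (-‿inverseʳ _)

σ-+ : ∀ i j → σ (i ℤ.+ j) ≈ σ i * σ j
σ-+ i j = diff-zero (suc-alternating {λ i → σ (i ℤ.+ j) - σ i * σ j}
  (λ i → ≈-trans (+-cong (+-cong (≈-trans (≡⇒≈ (cong σ (ℤP.+-assoc (+ 1) i j))) (σ-suc (i ℤ.+ j))) (-‿cong (*-cong (σ-suc i) ≈-refl))) ≈-refl)
    (solve 3 (λ x s t → (:- x :- (:- s) :* t) :+ (x :- s :* t) := con 0ℚ) ≈-refl (σ (i ℤ.+ j)) (σ i) (σ j)))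
  (≈-trans (+-cong (≡⇒≈ (cong σ (ℤP.+-identityˡ j))) ≈-refl) (solve 1 (λ x → x :- con 1ℚ :* x := con 0ℚ) ≈-refl (σ j))) i)

σ-sq : ∀ k → σ k * σ k ≈ 1#
σ-sq = λ { (+ n) → go n ; -[1+ n ] → ≈-trans (solve 1 (λ x → (:- x) :* (:- x) := x :* x) ≈-refl (σℕ n)) (go n) }
  where
  go : ∀ n → σℕ n * σℕ n ≈ 1#
  go zero = *-identityˡ _
  go (suc n) = ≈-trans (solve 1 (λ x → (:- x) :* (:- x) := x :* x) ≈-refl (σℕ n)) (go n)

σ-dbl : ∀ k → σ (dbl k) ≈ 1#
σ-dbl k = ≈-trans (≡⇒≈ (cong σ (dbl-is k))) (≈-trans (σ-+ k k) (σ-sq k))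

dbl⁺-suc : ∀ k → dbl⁺ k ≡ ℤ.suc (dbl k)
dbl⁺-suc (+ n) = refl
dbl⁺-suc -[1+ n ] = refl

σ-dbl⁺ : ∀ k → σ (dbl⁺ k) ≈ - 1#
σ-dbl⁺ k = ≈-trans (≡⇒≈ (cong σ (dbl⁺-suc k))) (≈-trans (σ-suc (dbl k)) (-‿cong (σ-dbl k)))

Proper : (ℤ → ℤ → ℤ) → Set
Proper f = ∀ i j → ∣ j ∣ ≤ ∣ f i j ∣ ℕ.+ ∣ i ∣

dec-proper : ∀ {h₁ h₂} (f : ℤ → ℤ → ℤ) → Proper f → Decℤ h₁ → Decℤ h₂ → Decℤ² (λ i j → h₁ i * h₂ (f i j))
dec-proper {h₁} {h₂} f pf d₁ d₂ N = M₁ ℕ.+ M₂ , go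
  where
  M₁ = proj₁ (d₁ N)
  M₂ = proj₁ (d₂ N)
  go : ∀ i j → M₁ ℕ.+ M₂ ≤ ∣ i ∣ ⊎ M₁ ℕ.+ M₂ ≤ ∣ j ∣ → Ord N (h₁ i * h₂ (f i j))
  go i j (inj₁ l) = ord-⊗ˡ _ (proj₂ (d₁ N) i (ℕP.≤-trans (ℕP.m≤m+n M₁ M₂) l))
  go i j (inj₂ l) with M₁ ℕP.≤? ∣ i ∣
  ... | yes p = ord-⊗ˡ _ (proj₂ (d₁ N) i p)
  ... | no p = ord-⊗ʳ (h₁ i) (proj₂ (d₂ N) (f i j) (ℕP.+-cancelˡ-≤ M₁ _ _ (ℕP.≤-trans l (ℕP.≤-trans (pf i j)
        (ℕP.≤-trans (ℕP.+-monoʳ-≤ ∣ f i j ∣ (ℕP.<⇒≤ (ℕP.≰⇒> p))) (ℕP.≤-reflexive (ℕP.+-comm ∣ f i j ∣ M₁)))))))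

proper-dbl : Proper (λ i j → i ℤ.+ dbl j)
proper-dbl i j = ℕP.≤-trans (ℕP.≤-trans (abs-dbl j) (ℕP.≤-reflexive (ℕP.+-identityʳ _))) (abs-translate i (dbl j))

proper-dbl⁺ : Proper (λ i j → i ℤ.+ dbl⁺ j)
proper-dbl⁺ i j = ℕP.≤-trans (ℕP.≤-trans (abs-dbl⁺ j) (ℕP.≤-reflexive (ℕP.+-identityʳ _))) (abs-translate i (dbl⁺ j))

-- The pairs of indices are sorted by the parity of their difference. Those with difference 2j can
-- later be centred as (i - j, i + j), where a quadratic exponent separates.
∑ℤ-product : ∀ {h₁ h₂} (d₁ : Decℤ h₁) (d₂ : Decℤ h₂) →
  let De = dec-proper (λ i j → i ℤ.+ dbl j) proper-dbl d₁ d₂ ; Do = dec-proper (λ i j → i ℤ.+ dbl⁺ j) proper-dbl⁺ d₁ d₂ in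
  ∑ℤ h₁ d₁ * ∑ℤ h₂ d₂ ≈ ∑ℤ (λ i → ∑ℤ (λ j → h₁ i * h₂ (i ℤ.+ dbl j)) (rowℤ De i)) (rowsℤ De)
                     + ∑ℤ (λ i → ∑ℤ (λ j → h₁ i * h₂ (i ℤ.+ dbl⁺ j)) (rowℤ Do i)) (rowsℤ Do)
∑ℤ-product {h₁} {h₂} d₁ d₂ = begin
  ∑ℤ h₁ d₁ * ∑ℤ h₂ d₂ ≈⟨ *-comm _ _ ⟩
  ∑ℤ h₂ d₂ * ∑ℤ h₁ d₁ ≈⟨ ≈-sym (∑ℤ-* (∑ℤ h₂ d₂) (decℤ-*ʳ (λ _ → ∑ℤ h₂ d₂) d₁) d₁) ⟩
  ∑ℤ (λ i → ∑ℤ h₂ d₂ * h₁ i) (decℤ-*ʳ (λ _ → ∑ℤ h₂ d₂) d₁)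
    ≈⟨ ∑ℤ-cong _ (decℤ-+ (rowsℤ De) (rowsℤ Do)) (λ i → ≈-trans (*-comm _ _)
        (≈-trans (*-cong ≈-refl (≈-trans (∑ℤ-translate i d₂ (dec-translate i d₂)) (∑ℤ-split₂ (dec-translate i d₂) (de i) (do′ i))))
          (≈-trans (distribˡ _ _ _) (+-cong (≈-sym (∑ℤ-* (h₁ i) (rowℤ De i) (de i))) (≈-sym (∑ℤ-* (h₁ i) (rowℤ Do i) (do′ i))))))) ⟩
  ∑ℤ (λ i → ∑ℤ (λ j → h₁ i * h₂ (i ℤ.+ dbl j)) (rowℤ De i) + ∑ℤ (λ j → h₁ i * h₂ (i ℤ.+ dbl⁺ j)) (rowℤ Do i)) (decℤ-+ (rowsℤ De) (rowsℤ Do))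
    ≈⟨ ∑ℤ-+ _ (rowsℤ De) (rowsℤ Do) ⟩
  _ ∎
  where
  open SR
  De = dec-proper (λ i j → i ℤ.+ dbl j) proper-dbl d₁ d₂
  Do = dec-proper (λ i j → i ℤ.+ dbl⁺ j) proper-dbl⁺ d₁ d₂
  de : ∀ i → Decℤ (λ j → h₂ (i ℤ.+ dbl j))
  de i = decℤ-∘ dbl 0 abs-dbl (dec-translate i d₂)
  do′ : ∀ i → Decℤ (λ j → h₂ (i ℤ.+ dbl⁺ j))
  do′ i = decℤ-∘ dbl⁺ 0 abs-dbl⁺ (dec-translate i d₂)

-- Only one factor carries signs, so exchanging the two indices negates every term with odd
-- difference, and these cancel. On the even ones `split` diagonalises the exponent.
module ThetaProduct (e g h : ℤ → ℕ) (de : Decℤ (λ k → q^ e k)) (dg : Decℤ (λ k → q^ g k)) (dh : Decℤ (λ k → q^ h k))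
  (split : ∀ i j → e (i ℤ.- j) ℕ.+ e (i ℤ.+ j) ≡ g i ℕ.+ h j) where

  private
    dσ : Decℤ (λ k → σ k * q^ e k)
    dσ = decℤ-*ʳ σ de
    De = dec-proper (λ i j → i ℤ.+ dbl j) proper-dbl de dσ
    Do = dec-proper (λ i j → i ℤ.+ dbl⁺ j) proper-dbl⁺ de dσ
    term-o : ℤ → ℤ → Series
    term-o i j = q^ e i * (σ (i ℤ.+ dbl⁺ j) * q^ e (i ℤ.+ dbl⁺ j))
    odd : Series
    odd = ∑ℤ (λ i → ∑ℤ (term-o i) (rowℤ Do i)) (rowsℤ Do)

    DoT : Decℤ² (λ j i → term-o i j)
    DoT = transposeℤ Do

    odd-neg : odd ≈ - odd
    odd-neg = begin
      odd ≈⟨ ∑ℤ-swap Do DoT ⟩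
      ∑ℤ (λ j → ∑ℤ (λ i → term-o i j) (rowℤ DoT j)) (rowsℤ DoT) ≈⟨ ∑ℤ-cong _ d₁ (λ j → ∑ℤ-translate (ℤ.- dbl⁺ j) (rowℤ DoT j) (dec-translate (ℤ.- dbl⁺ j) (rowℤ DoT j))) ⟩
      ∑ℤ (λ j → ∑ℤ (λ i → term-o (ℤ.- dbl⁺ j ℤ.+ i) j) (dec-translate (ℤ.- dbl⁺ j) (rowℤ DoT j))) d₁
        ≈⟨ ∑ℤ-cong _ (decℤ-neg (dec-~∘ (rowsℤ DoT))) (λ j → ≈-trans (∑ℤ-cong _ (decℤ-neg (rowℤ DoT (~ j))) (flip j)) (∑ℤ-neg _ (rowℤ DoT (~ j)))) ⟩
      ∑ℤ (λ j → - ∑ℤ (λ i → term-o i (~ j)) (rowℤ DoT (~ j))) (decℤ-neg (dec-~∘ (rowsℤ DoT)))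
        ≈⟨ ≈-trans (∑ℤ-neg _ (dec-~∘ (rowsℤ DoT))) (-‿cong (≈-sym (∑ℤ-~ (rowsℤ DoT) (dec-~∘ (rowsℤ DoT))))) ⟩
      - ∑ℤ (λ j → ∑ℤ (λ i → term-o i j) (rowℤ DoT j)) (rowsℤ DoT) ≈⟨ -‿cong (≈-sym (∑ℤ-swap Do DoT)) ⟩
      - odd ∎
      where
      open SR
      d₁ : Decℤ (λ j → ∑ℤ (λ i → term-o (ℤ.- dbl⁺ j ℤ.+ i) j) (dec-translate (ℤ.- dbl⁺ j) (rowℤ DoT j)))
      d₁ = decℤ-≈ (λ j → ∑ℤ-translate (ℤ.- dbl⁺ j) (rowℤ DoT j) (dec-translate (ℤ.- dbl⁺ j) (rowℤ DoT j))) (rowsℤ DoT)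
      dbl~ : ∀ j → ℤ.- dbl⁺ j ≡ dbl⁺ (~ j)
      dbl~ j = trans (cong ℤ.-_ (dbl⁺-is j)) (trans (ℤR.solve 1 (λ j → ℤR.:- (j ⊞ j ⊞ c′ (+ 1)) ⩵ (((ℤR.:- j) ⊖′ c′ (+ 1)) ⊞ ((ℤR.:- j) ⊖′ c′ (+ 1))) ⊞ c′ (+ 1)) refl j)
         (trans (cong (λ z → z ℤ.+ z ℤ.+ + 1) (sym (~-is j))) (sym (dbl⁺-is (~ j)))))
      back : ∀ j i → ℤ.- dbl⁺ j ℤ.+ i ℤ.+ dbl⁺ j ≡ i
      back j i = ℤR.solve 2 (λ x i → ℤR.:- x ⊞ i ⊞ x ⩵ i) refl (dbl⁺ j) i
      fwd : ∀ j i → ℤ.- dbl⁺ j ℤ.+ i ≡ i ℤ.+ dbl⁺ (~ j)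
      fwd j i = trans (cong (λ z → z ℤ.+ i) (dbl~ j)) (ℤP.+-comm (dbl⁺ (~ j)) i)
      flip : ∀ j i → term-o (ℤ.- dbl⁺ j ℤ.+ i) j ≈ - term-o i (~ j)
      flip j i = begin
        q^ e (ℤ.- dbl⁺ j ℤ.+ i) * (σ (ℤ.- dbl⁺ j ℤ.+ i ℤ.+ dbl⁺ j) * q^ e (ℤ.- dbl⁺ j ℤ.+ i ℤ.+ dbl⁺ j))
          ≈⟨ ≡⇒≈ (cong₂ (λ x y → q^ e x * (σ y * q^ e y)) (fwd j i) (back j i)) ⟩
        q^ e (i ℤ.+ dbl⁺ (~ j)) * (σ i * q^ e i) ≈⟨ solve 3 (λ x s y → x :* (s :* y) := :- (y :* ((s :* :- con 1ℚ) :* x))) ≈-refl _ _ _ ⟩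
        - (q^ e i * ((σ i * - 1#) * q^ e (i ℤ.+ dbl⁺ (~ j)))) ≈⟨ -‿cong (*-cong ≈-refl (*-cong (≈-trans (*-cong ≈-refl (≈-sym (σ-dbl⁺ (~ j)))) (≈-sym (σ-+ i (dbl⁺ (~ j))))) ≈-refl)) ⟩
        - term-o i (~ j) ∎

  theta-product : ∑ℤ (λ k → q^ e k) de * ∑ℤ (λ k → σ k * q^ e k) (decℤ-*ʳ σ de) ≈ ∑ℤ (λ k → σ k * q^ g k) (decℤ-*ʳ σ dg) * ∑ℤ (λ k → σ k * q^ h k) (decℤ-*ʳ σ dh)
  theta-product = begin
    _ ≈⟨ ∑ℤ-product de dσ ⟩
    ∑ℤ (λ i → ∑ℤ (term-e i) (rowℤ De i)) (rowsℤ De) + odd ≈⟨ +-cong (∑ℤ-swap De DeT) (self-neg odd-neg) ⟩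
    ∑ℤ (λ j → ∑ℤ (λ i → term-e i j) (rowℤ DeT j)) (rowsℤ DeT) + 0# ≈⟨ +-identityʳ _ ⟩
    ∑ℤ (λ j → ∑ℤ (λ i → term-e i j) (rowℤ DeT j)) (rowsℤ DeT)
      ≈⟨ ∑ℤ-cong _ (decℤ-*ʳ (λ _ → G) dh′) (λ j → ≈-trans (∑ℤ-translate (ℤ.- j) (rowℤ DeT j) (dec-translate (ℤ.- j) (rowℤ DeT j)))
           (≈-trans (∑ℤ-cong _ (decℤ-*ʳ (λ _ → σ j * q^ h j) dg′) (even j)) (≈-trans (∑ℤ-* _ _ dg′) (*-comm _ _)))) ⟩
    ∑ℤ (λ j → G * (σ j * q^ h j)) (decℤ-*ʳ (λ _ → G) dh′) ≈⟨ ∑ℤ-* _ _ dh′ ⟩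
    G * ∑ℤ (λ k → σ k * q^ h k) dh′ ∎
    where
    open SR
    term-e : ℤ → ℤ → Series
    term-e i j = q^ e i * (σ (i ℤ.+ dbl j) * q^ e (i ℤ.+ dbl j))
    DeT : Decℤ² (λ j i → term-e i j)
    DeT = transposeℤ De
    dg′ : Decℤ (λ k → σ k * q^ g k)
    dg′ = decℤ-*ʳ σ dg
    dh′ : Decℤ (λ k → σ k * q^ h k)
    dh′ = decℤ-*ʳ σ dh
    G = ∑ℤ (λ k → σ k * q^ g k) dg′
    even : ∀ j i → term-e (ℤ.- j ℤ.+ i) j ≈ (σ j * q^ h j) * (σ i * q^ g i)
    even j i = begin
      q^ e (ℤ.- j ℤ.+ i) * (σ (ℤ.- j ℤ.+ i ℤ.+ dbl j) * q^ e (ℤ.- j ℤ.+ i ℤ.+ dbl j))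
        ≈⟨ ≡⇒≈ (cong₂ (λ x y → q^ e x * (σ y * q^ e y)) (ℤP.+-comm (ℤ.- j) i) (trans (cong (λ z → ℤ.- j ℤ.+ i ℤ.+ z) (dbl-is j)) (ℤR.solve 2 (λ i j → ℤR.:- j ⊞ i ⊞ (j ⊞ j) ⩵ i ⊞ j) refl i j))) ⟩
      q^ e (i ℤ.- j) * (σ (i ℤ.+ j) * q^ e (i ℤ.+ j)) ≈⟨ solve 3 (λ x s y → x :* (s :* y) := s :* (x :* y)) ≈-refl _ _ _ ⟩
      σ (i ℤ.+ j) * (q^ e (i ℤ.- j) * q^ e (i ℤ.+ j)) ≈⟨ *-cong (σ-+ i j) (≈-trans (q^-+ _ _) (≈-trans (q^-cong (split i j)) (≈-sym (q^-+ _ _)))) ⟩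
      (σ i * σ j) * (q^ g i * q^ h j) ≈⟨ solve 4 (λ a b c d → (a :* b) :* (c :* d) := (b :* d) :* (a :* c)) ≈-refl _ _ _ _ ⟩
      (σ j * q^ h j) * (σ i * q^ g i) ∎

opaque
  unfolding κ

  -- substitution q ↦ q²
  𝐃 : Series → Series
  𝐃 f zero = f 0
  𝐃 f (suc zero) = 0ℚ
  𝐃 f (suc (suc n)) = 𝐃 (shift f) n

  𝐃-≡ : ∀ {f g : Series} → (∀ n → f n ≡ g n) → ∀ n → 𝐃 f n ≡ 𝐃 g n
  𝐃-≡ h zero = h 0
  𝐃-≡ h (suc zero) = refl
  𝐃-≡ h (suc (suc n)) = 𝐃-≡ (λ m → h (suc m)) n

  𝐃-cong : ∀ {f g} → f ≈ g → 𝐃 f ≈ 𝐃 g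
  𝐃-cong p = mk (𝐃-≡ (at p))

  𝐃-agree : ∀ {N f g} → Agree N f g → Agree N (𝐃 f) (𝐃 g)
  𝐃-agree h zero l = h 0 l
  𝐃-agree h (suc zero) l = refl
  𝐃-agree {suc N} {f} {g} h (suc (suc n)) (s≤s l) = 𝐃-agree {N} {shift f} {shift g} (λ m m<N → h (suc m) (s≤s m<N)) n (ℕP.≤-trans (ℕP.n≤1+n (suc n)) l)

  𝐃-lin : ∀ c (f g : Series) n → 𝐃 (λ m → c ℚ.* f m ℚ.+ g m) n ≡ c ℚ.* 𝐃 f n ℚ.+ 𝐃 g n
  𝐃-lin c f g zero = refl
  𝐃-lin c f g (suc zero) = sym (trans (ℚP.+-identityʳ _) (ℚP.*-zeroʳ c))
  𝐃-lin c f g (suc (suc n)) = 𝐃-lin c (shift f) (shift g) n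

  𝐃-+ : ∀ f g → 𝐃 (f + g) ≈ 𝐃 f + 𝐃 g
  𝐃-+ f g = mk λ n → trans (𝐃-≡ (λ m → trans (+-at f g m) (cong (ℚ._+ g m) (sym (ℚP.*-identityˡ (f m))))) n)
    (trans (𝐃-lin 1ℚ f g n) (trans (cong (ℚ._+ 𝐃 g n) (ℚP.*-identityˡ (𝐃 f n))) (sym (+-at (𝐃 f) (𝐃 g) n))))

  𝐃-* : ∀ f g → 𝐃 (f * g) ≈ 𝐃 f * 𝐃 g
  𝐃-* f g = mk (go f)
    where
    go : ∀ f n → 𝐃 (f * g) n ≡ (𝐃 f * 𝐃 g) n
    go f zero = trans (*-at-0 f g) (sym (*-at-0 (𝐃 f) (𝐃 g)))
    go f (suc zero) = sym (trans (*-at-suc (𝐃 f) (𝐃 g) 0) (trans (cong₂ ℚ._+_ (ℚP.*-zeroʳ (f 0)) (trans (*-at-0 (shift (𝐃 f)) (𝐃 g)) (ℚP.*-zeroˡ (g 0)))) refl))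
    go f (suc (suc n)) = trans (𝐃-≡ (λ m → *-at-suc f g m) n) (trans (𝐃-lin (f 0) (shift g) (shift f * g) n)
      (trans (cong (f 0 ℚ.* 𝐃 (shift g) n ℚ.+_) (go (shift f) n))
        (sym (trans (*-at-suc (𝐃 f) (𝐃 g) (suc n)) (cong (f 0 ℚ.* 𝐃 (shift g) n ℚ.+_)
          (trans (*-at-suc (shift (𝐃 f)) (𝐃 g) n) (trans (cong (ℚ._+ (𝐃 (shift f) * 𝐃 g) n) (ℚP.*-zeroˡ (𝐃 g (suc n)))) (ℚP.+-identityˡ _))))))))

  𝐃-κ : ∀ c → 𝐃 (κ c) ≈ κ c
  𝐃-κ c = mk λ { zero → refl ; (suc zero) → sym (ℚP.*-zeroʳ c) ; (suc (suc n)) → trans (trans (𝐃-≡ {g = λ _ → 0ℚ} (λ m → ℚP.*-zeroʳ c) n) (zeroes n)) (sym (ℚP.*-zeroʳ c)) }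
    where
    zeroes : ∀ n → 𝐃 (λ _ → 0ℚ) n ≡ 0ℚ
    zeroes zero = refl
    zeroes (suc zero) = refl
    zeroes (suc (suc n)) = zeroes n

  𝐃-at-0 : ∀ f → 𝐃 f 0 ≡ f 0
  𝐃-at-0 f = refl

  -- Infinite descent: the coefficient at n > 0 is 0 or equals the coefficient at n/2.
  𝐃-fixed : ∀ {f} → f ≈ 𝐃 f → f ≈ κ (f 0)
  𝐃-fixed {f} h = mk (<-rec _ go)
    where
    half : ∀ (f : Series) (c : ℚ) n → (∀ m → m ≤ n → f (suc m) ≡ 0ℚ) → 𝐃 f (suc (suc n)) ≡ 0ℚ
    half f c zero k = k 0 z≤n
    half f c (suc zero) k = refl
    half f c (suc (suc n)) k = half (shift f) c n λ m l → k (suc m) (s≤s (ℕP.m≤n⇒m≤1+n l))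
    go : ∀ n → (∀ {m} → m < n → f m ≡ κ (f 0) m) → f n ≡ κ (f 0) n
    go zero _ = sym (ℚP.*-identityʳ (f 0))
    go (suc zero) _ = trans (at h 1) (sym (ℚP.*-zeroʳ (f 0)))
    go (suc (suc n)) ih = trans (at h (suc (suc n))) (trans (half f 0ℚ n λ m l → trans (ih (s≤s (s≤s l))) (ℚP.*-zeroʳ (f 0))) (sym (ℚP.*-zeroʳ (f 0))))

𝐃-neg : ∀ f → 𝐃 (- f) ≈ - 𝐃 f
𝐃-neg f = neg-term _ _ (≈-trans (≈-sym (𝐃-+ (- f) f)) (≈-trans (𝐃-cong (-‿inverseˡ f)) (𝐃-κ 0ℚ)))

opaque
  unfolding 𝐃 q^_

  𝐃-q : 𝐃 (q^ 1) ≈ q^ 2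
  𝐃-q = mk λ { zero → refl ; (suc zero) → refl ; (suc (suc n)) → at 𝐃-q⁰ n }
    where
    𝐃-q⁰ : 𝐃 (q^ 0) ≈ q^ 0
    𝐃-q⁰ = ≈-trans (𝐃-cong q^-0) (≈-trans (𝐃-κ 1ℚ) (≈-sym q^-0))

𝐃-q^ : ∀ e → 𝐃 (q^ e) ≈ q^ (e ℕ.+ e)
𝐃-q^ zero = ≈-trans (𝐃-cong q^-0) (≈-trans (𝐃-κ 1ℚ) (≈-sym q^-0))
𝐃-q^ (suc e) = begin
  𝐃 (q^ suc e) ≈⟨ ≈-trans (𝐃-cong (≈-sym (q^-+ 1 e))) (𝐃-* _ _) ⟩
  𝐃 (q^ 1) * 𝐃 (q^ e) ≈⟨ *-cong 𝐃-q (𝐃-q^ e) ⟩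
  q^ 2 * q^ (e ℕ.+ e) ≈⟨ ≈-trans (q^-+ 2 (e ℕ.+ e)) (q^-cong (cong suc (sym (ℕP.+-suc e e)))) ⟩
  q^ (suc e ℕ.+ suc e) ∎
  where open SR

𝐃-⟶ : ∀ {s F} → s ⟶ F → (λ n → 𝐃 (s n)) ⟶ 𝐃 F
𝐃-⟶ {s} {F} h N = let (M , k) = h N in M , λ L l → 𝐃-agree {N} {F} {s L} (k L l)

psum-𝐃 : ∀ u L → 𝐃 (psum L u) ≈ psum L (λ n → 𝐃 (u n))
psum-𝐃 u zero = 𝐃-κ 0ℚ
psum-𝐃 u (suc L) = ≈-trans (𝐃-+ _ _) (+-cong (psum-𝐃 u L) ≈-refl)

𝐃-∑ : ∀ {u} d d′ → 𝐃 (∑ u d) ≈ ∑ (λ n → 𝐃 (u n)) d′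
𝐃-∑ {u} d d′ = ≈-sym (∑-unique d′ (⟶-cong (psum-𝐃 u) ≈-refl (𝐃-⟶ (∑-has u d))))

𝐃-ord : ∀ {N f} → Ord N f → Ord N (𝐃 f)
𝐃-ord {N} {f} o n l = trans (𝐃-agree {N} {f} {0#} (λ m m<N → trans (o m m<N) (sym (0-at m))) n l) (trans (at (𝐃-κ 0ℚ) n) (0-at n))

dec-𝐃 : ∀ {g} → Dec g → Dec (λ k → 𝐃 (g k))
dec-𝐃 d N = proj₁ (d N) , λ k l → 𝐃-ord (proj₂ (d N) k l)

decℤ-𝐃 : ∀ {g} → Decℤ g → Decℤ (λ k → 𝐃 (g k))
decℤ-𝐃 d N = proj₁ (d N) , λ k l → 𝐃-ord (proj₂ (d N) k l)

𝐃-∑ℤ : ∀ {g} d d′ → 𝐃 (∑ℤ g d) ≈ ∑ℤ (λ k → 𝐃 (g k)) d′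
𝐃-∑ℤ {g} d d′ = ≈-trans (𝐃-cong (∑ℤ-is g d)) (≈-trans (𝐃-∑ (dec-fold d) (dec-≈ (λ n → ≈-sym (𝐃-+ _ _)) (dec-fold d′)))
  (≈-trans (∑-cong _ _ (λ n → 𝐃-+ _ _)) (≈-sym (∑ℤ-is _ d′))))

𝐃-σ : ∀ k → 𝐃 (σ k) ≈ σ k
𝐃-σ = λ { (+ n) → go n ; -[1+ n ] → ≈-trans (𝐃-neg (σℕ n)) (-‿cong (go n)) }
  where
  go : ∀ n → 𝐃 (σℕ n) ≈ σℕ n
  go zero = 𝐃-κ 1ℚ
  go (suc n) = ≈-trans (𝐃-neg (σℕ n)) (-‿cong (go n))

infixl 8 _⊡_
_⊡_ : ∀ {n} → ℤR.Polynomial n → ℤR.Polynomial n → ℤR.Polynomial n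
_⊡_ = ℤR._:*_

sq-is : ∀ k → + sq k ≡ k ℤ.* k
sq-is k = trans (cong (λ z → + tri k ℤ.+ z) (tri-suc k)) (trans (ℤR.solve 2 (λ k t → t ⊞ (k ⊞ t) ⩵ (t ⊞ t) ⊞ k) refl k (+ tri k))
  (trans (cong (λ z → z ℤ.+ k) (tri-double k)) (ℤR.solve 1 (λ k → (k ⊡ k ⊖′ k) ⊞ k ⩵ k ⊡ k) refl k)))

E₁-is : ∀ k → + E₁ k ≡ + tri k ℤ.+ k ℤ.* k
E₁-is k = cong (λ z → + tri k ℤ.+ z) (sq-is k)

φ̂ c̃₁ 𝒫₊ : Series
φ̂ = ∑ℤ (λ k → q^ sq k) dec-sq
c̃₁ = ∑ℤ (λ k → σ k * q^ E₁ k) (decℤ-*ʳ σ dec-E₁)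
𝒫₊ = ∑ℤ (λ k → lin 6ℚ k * q^ E₁ k) (decℤ-*ʳ _ dec-E₁)

dec-2sq : Decℤ (λ k → q^ (sq k ℕ.+ sq k))
dec-2sq = decℤ-q (λ k → sq k ℕ.+ sq k) 1 λ k → bound-+ {k} {sq k} _ (bound-+ {k} {tri k} _ (tri-bound k))

dec-3sq : Decℤ (λ k → q^ (sq k ℕ.+ (sq k ℕ.+ sq k)))
dec-3sq = decℤ-q (λ k → sq k ℕ.+ (sq k ℕ.+ sq k)) 1 λ k → bound-+ {k} {sq k} _ (bound-+ {k} {tri k} _ (tri-bound k))

dec-2E₁ : Decℤ (λ k → q^ (E₁ k ℕ.+ E₁ k))
dec-2E₁ = decℤ-q (λ k → E₁ k ℕ.+ E₁ k) 1 λ k → bound-+ {k} {E₁ k} _ (bound-+ {k} {tri k} _ (tri-bound k))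

𝐃-signed : ∀ {e : ℤ → ℕ} (d : Decℤ (λ k → q^ e k)) (d₂ : Decℤ (λ k → q^ (e k ℕ.+ e k))) →
  ∑ℤ (λ k → σ k * q^ (e k ℕ.+ e k)) (decℤ-*ʳ σ d₂) ≈ 𝐃 (∑ℤ (λ k → σ k * q^ e k) (decℤ-*ʳ σ d))
𝐃-signed {e} d d₂ = ≈-sym (≈-trans (𝐃-∑ℤ _ (decℤ-𝐃 (decℤ-*ʳ σ d))) (∑ℤ-cong _ _ λ k → ≈-trans (𝐃-* _ _) (*-cong (𝐃-σ k) (𝐃-q^ (e k)))))

φ̂φ : φ̂ * φ ≈ 𝐃 φ * 𝐃 φ
φ̂φ = ≈-trans (ThetaProduct.theta-product sq (λ k → sq k ℕ.+ sq k) (λ k → sq k ℕ.+ sq k) dec-sq dec-2sq dec-2sq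
  (λ i j → ℤP.+-injective (trans (cong₂ ℤ._+_ (sq-is (i ℤ.- j)) (sq-is (i ℤ.+ j)))
    (trans (ℤR.solve 2 (λ i j → (i ⊖′ j) ⊡ (i ⊖′ j) ⊞ (i ⊞ j) ⊡ (i ⊞ j) ⩵ (i ⊡ i ⊞ i ⊡ i) ⊞ (j ⊡ j ⊞ j ⊡ j)) refl i j)
      (sym (cong₂ ℤ._+_ (cong₂ ℤ._+_ (sq-is i) (sq-is i)) (cong₂ ℤ._+_ (sq-is j) (sq-is j))))))))
  (*-cong (𝐃-signed dec-sq dec-2sq) (𝐃-signed dec-sq dec-2sq))

tri-± : ∀ i j → + tri (i ℤ.- j) ℤ.+ + tri (i ℤ.+ j) ≡ (+ tri i ℤ.+ + tri i) ℤ.+ j ℤ.* j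
tri-± i j = halve _ _ (trans (ℤR.solve 2 (λ x y → (x ⊞ y) ⊞ (x ⊞ y) ⩵ (x ⊞ x) ⊞ (y ⊞ y)) refl (+ tri (i ℤ.- j)) (+ tri (i ℤ.+ j)))
  (trans (cong₂ ℤ._+_ (tri-double (i ℤ.- j)) (tri-double (i ℤ.+ j)))
  (trans (ℤR.solve 2 (λ i j → ((i ⊖′ j) ⊡ (i ⊖′ j) ⊖′ (i ⊖′ j)) ⊞ ((i ⊞ j) ⊡ (i ⊞ j) ⊖′ (i ⊞ j)) ⩵ ((i ⊡ i ⊖′ i) ⊞ j ⊡ j) ⊞ ((i ⊡ i ⊖′ i) ⊞ j ⊡ j)) refl i j)
    (sym (cong (λ z → (z ℤ.+ j ℤ.* j) ℤ.+ (z ℤ.+ j ℤ.* j)) (tri-double i))))))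

c₁c̃₁ : c₁ * c̃₁ ≈ 𝐃 c̃₁ * 𝐒 φ
c₁c̃₁ = ≈-trans (ThetaProduct.theta-product E₁ (λ k → E₁ k ℕ.+ E₁ k) (λ k → sq k ℕ.+ (sq k ℕ.+ sq k)) dec-E₁ dec-2E₁ dec-3sq
  (λ i j → ℤP.+-injective (trans (cong₂ ℤ._+_ (E₁-is (i ℤ.- j)) (E₁-is (i ℤ.+ j)))
    (trans (ℤR.solve 4 (λ x y i j → (x ⊞ (i ⊖′ j) ⊡ (i ⊖′ j)) ⊞ (y ⊞ (i ⊞ j) ⊡ (i ⊞ j)) ⩵ (x ⊞ y) ⊞ ((i ⊡ i ⊞ i ⊡ i) ⊞ (j ⊡ j ⊞ j ⊡ j))) refl (+ tri (i ℤ.- j)) (+ tri (i ℤ.+ j)) i j)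
    (trans (cong (λ z → z ℤ.+ ((i ℤ.* i ℤ.+ i ℤ.* i) ℤ.+ (j ℤ.* j ℤ.+ j ℤ.* j))) (tri-± i j))
    (trans (ℤR.solve 3 (λ t i j → ((t ⊞ t) ⊞ j ⊡ j) ⊞ ((i ⊡ i ⊞ i ⊡ i) ⊞ (j ⊡ j ⊞ j ⊡ j)) ⩵ ((t ⊞ i ⊡ i) ⊞ (t ⊞ i ⊡ i)) ⊞ (j ⊡ j ⊞ (j ⊡ j ⊞ j ⊡ j))) refl (+ tri i) i j)
      (sym (cong₂ ℤ._+_ (cong₂ ℤ._+_ (E₁-is i) (E₁-is i)) (cong₂ ℤ._+_ (sq-is j) (cong₂ ℤ._+_ (sq-is j) (sq-is j))))))))))) 
  (*-cong (𝐃-signed dec-E₁ dec-2E₁)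
    (≈-trans (∑ℤ-cong _ (decℤ-*ʳ σ (decℤ-𝐒 dec-sq)) (λ k → *-cong ≈-refl (q^-𝐒 (sq k) refl))) (≈-sym (𝐒-weight dec-sq 𝐒-σ))))

-- The constant of the alternating recursion under q ↦ q²

dec-φ : Decℤ (λ k → σ k * q^ sq k)
dec-φ = decℤ-*ʳ σ dec-sq

W : ℕ → Series
W N = ∑ℤ (λ k → (σ k * q^ sq k) * ρ (ℤ.pred k ⊟ N)) (decℤ-*ˡ (λ k → ρ (ℤ.pred k ⊟ N)) dec-φ)

alternating-2tri : ∀ d → ∑ℤ (λ k → σ k * q^ (tri k ℕ.+ tri k)) d ≈ 0#
alternating-2tri d = ≈-trans (≈-sym (≈-trans (𝐃-∑ℤ dec-σtri (decℤ-𝐃 dec-σtri)) (∑ℤ-cong _ d λ k → ≈-trans (𝐃-* _ _) (*-cong (𝐃-σ k) (𝐃-q^ (tri k))))))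
  (≈-trans (𝐃-cong alternating-tri) (𝐃-κ 0ℚ))

-- A shift and two steps of ρ. The first inhomogeneous term is Σ (-1)^k q^(k(k-1)), whose terms
-- cancel in pairs; the second one is a multiple of φ.
W-rec : ∀ N → W N ≈ q^ (suc N ℕ.+ suc N) * φ - q^ (suc N ℕ.+ suc N) * W (suc N)
W-rec N = begin
  W N ≈⟨ ∑ℤ-shift dW (dec-suc∘ dW) ⟩
  ∑ℤ (λ k → (σ (ℤ.suc k) * q^ sq (ℤ.suc k)) * ρ (ℤ.pred (ℤ.suc k) ⊟ N)) (dec-suc∘ dW)
    ≈⟨ ∑ℤ-cong _ dsum step ⟩
  ∑ℤ (λ k → q^ suc N * (σ (ℤ.suc k) * q^ (tri (ℤ.suc k) ℕ.+ tri (ℤ.suc k))) + (Q * (σ k * q^ sq k) + - Q * ((σ k * q^ sq k) * ρ (ℤ.pred k ⊟ suc N)))) dsum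
    ≈⟨ ≈-trans (∑ℤ-+ dsum d₁ (decℤ-+ d₂ d₃)) (+-cong (∑ℤ-* _ _ (dec-suc∘ d2tri)) (≈-trans (∑ℤ-+ _ d₂ d₃) (+-cong (∑ℤ-* _ _ dec-φ) (∑ℤ-* _ _ dW′)))) ⟩
  q^ suc N * ∑ℤ (λ k → σ (ℤ.suc k) * q^ (tri (ℤ.suc k) ℕ.+ tri (ℤ.suc k))) (dec-suc∘ d2tri) + (Q * φ + - Q * W (suc N))
    ≈⟨ +-cong (≈-trans (*-cong ≈-refl (≈-trans (≈-sym (∑ℤ-shift d2tri (dec-suc∘ d2tri))) (alternating-2tri d2tri))) (zeroʳ _)) ≈-refl ⟩
  0# + (Q * φ + - Q * W (suc N)) ≈⟨ solve 3 (λ x y z → con 0ℚ :+ (x :* y :+ :- x :* z) := x :* y :- x :* z) ≈-refl Q φ (W (suc N)) ⟩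
  Q * φ - Q * W (suc N) ∎
  where
  open SR
  Q = q^ (suc N ℕ.+ suc N)
  dW : Decℤ (λ k → (σ k * q^ sq k) * ρ (ℤ.pred k ⊟ N))
  dW = decℤ-*ˡ (λ k → ρ (ℤ.pred k ⊟ N)) dec-φ
  dW′ : Decℤ (λ k → (σ k * q^ sq k) * ρ (ℤ.pred k ⊟ suc N))
  dW′ = decℤ-*ˡ (λ k → ρ (ℤ.pred k ⊟ suc N)) dec-φ
  d2tri : Decℤ (λ k → σ k * q^ (tri k ℕ.+ tri k))
  d2tri = decℤ-*ʳ σ (decℤ-q (λ k → tri k ℕ.+ tri k) 1 λ k → bound-+ {k} {tri k} _ (tri-bound k))
  d₁ : Decℤ (λ k → q^ suc N * (σ (ℤ.suc k) * q^ (tri (ℤ.suc k) ℕ.+ tri (ℤ.suc k))))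
  d₁ = decℤ-*ʳ (λ _ → q^ suc N) (dec-suc∘ d2tri)
  d₂ : Decℤ (λ k → Q * (σ k * q^ sq k))
  d₂ = decℤ-*ʳ (λ _ → Q) dec-φ
  d₃ : Decℤ (λ k → - Q * ((σ k * q^ sq k) * ρ (ℤ.pred k ⊟ suc N)))
  d₃ = decℤ-*ʳ (λ _ → - Q) dW′
  dsum = decℤ-+ d₁ (decℤ-+ d₂ d₃)
  step : ∀ k → (σ (ℤ.suc k) * q^ sq (ℤ.suc k)) * ρ (ℤ.pred (ℤ.suc k) ⊟ N) ≈
     q^ suc N * (σ (ℤ.suc k) * q^ (tri (ℤ.suc k) ℕ.+ tri (ℤ.suc k))) + (Q * (σ k * q^ sq k) + - Q * ((σ k * q^ sq k) * ρ (ℤ.pred k ⊟ suc N)))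
  step k = begin
    (σ (ℤ.suc k) * q^ sq (ℤ.suc k)) * ρ (ℤ.pred (ℤ.suc k) ⊟ N)
      ≈⟨ ≈-trans (*-assoc _ _ _) (*-cong ≈-refl (*-cong ≈-refl (≡⇒≈ (cong (λ z → ρ (z ⊟ N)) (pred-suc k))))) ⟩
    σ (ℤ.suc k) * (q^ sq (ℤ.suc k) * ρ (k ⊟ N))
      ≈⟨ *-cong ≈-refl (≈-trans (ρ-pred (k ⊟ N) _ b′ p₁) (+-cong ≈-refl (-‿cong (≈-trans (ρ-pred (ℤ.pred (k ⊟ N)) b′ d′ p₂) (+-cong ≈-refl (-‿cong (*-cong ≈-refl (≡⇒≈ (cong ρ (trans (cong ℤ.pred (⊟-pred k N)) (⊟-pred k (suc N))))))))))))  ⟩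
    σ (ℤ.suc k) * (q^ b′ - (q^ d′ - q^ d′ * ρ (k ⊟ suc (suc N))))
      ≈⟨ *-cong ≈-refl (+-cong (≈-trans (q^-cong (ℕP.+-comm (tri (ℤ.suc k) ℕ.+ tri (ℤ.suc k)) (suc N))) (≈-sym (q^-+ _ _))) (-‿cong (+-cong e (-‿cong (*-cong e ≈-refl))))) ⟩
    σ (ℤ.suc k) * (q^ suc N * q^ (tri (ℤ.suc k) ℕ.+ tri (ℤ.suc k)) - (Q * q^ sq k - (Q * q^ sq k) * ρ (k ⊟ suc (suc N))))
      ≈⟨ solve 6 (λ s n t q u x → s :* (n :* t :- (q :* u :- (q :* u) :* x)) := n :* (s :* t) :+ (q :* ((:- s) :* u) :+ :- q :* (((:- s) :* u) :* x))) ≈-refl (σ (ℤ.suc k)) (q^ suc N) _ Q (q^ sq k) _ ⟩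
    q^ suc N * (σ (ℤ.suc k) * q^ (tri (ℤ.suc k) ℕ.+ tri (ℤ.suc k))) + (Q * ((- σ (ℤ.suc k)) * q^ sq k) + - Q * (((- σ (ℤ.suc k)) * q^ sq k) * ρ (k ⊟ suc (suc N))))
      ≈⟨ +-cong ≈-refl (+-cong (*-cong ≈-refl (*-cong s′ ≈-refl)) (*-cong ≈-refl (*-cong (*-cong s′ ≈-refl) ≈-refl))) ⟩
    _ ∎
    where
    b′ = tri (ℤ.suc k) ℕ.+ tri (ℤ.suc k) ℕ.+ suc N
    d′ = sq k ℕ.+ (suc N ℕ.+ suc N)
    e : q^ d′ ≈ Q * q^ sq k
    e = ≈-trans (q^-cong (ℕP.+-comm (sq k) (suc N ℕ.+ suc N))) (≈-sym (q^-+ _ _))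
    s′ : - σ (ℤ.suc k) ≈ σ k
    s′ = ≈-trans (-‿cong (σ-suc k)) (solve 1 (λ x → :- (:- x) := x) ≈-refl (σ k))
    p₁ : + sq (ℤ.suc k) ≡ + b′ ℤ.+ (k ⊟ N)
    p₁ = trans (trans (cong (λ z → + tri (ℤ.suc k) ℤ.+ z) (tri-suc (ℤ.suc k)))
        (ℤR.solve 3 (λ k s n → s ⊞ ((c′ (+ 1) ⊞ k) ⊞ s) ⩵ (s ⊞ s ⊞ (c′ (+ 1) ⊞ n)) ⊞ (k ⊖′ n)) refl k (+ tri (ℤ.suc k)) (+ N)))
      (cong (λ z → + b′ ℤ.+ z) (sym (⊟-is k N)))
    p₂ : + b′ ≡ + d′ ℤ.+ ℤ.pred (k ⊟ N)
    p₂ = trans (by-tri₁ (λ s → (s ℤ.+ s ℤ.+ (+ 1 ℤ.+ + N)) ≡ ((+ tri k ℤ.+ s) ℤ.+ ((+ 1 ℤ.+ + N) ℤ.+ (+ 1 ℤ.+ + N))) ℤ.+ (k ℤ.- (+ 1 ℤ.+ + N))) k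
        (ℤR.solve 3 (λ k t n → ((k ⊞ t) ⊞ (k ⊞ t) ⊞ (c′ (+ 1) ⊞ n)) ⩵ ((t ⊞ (k ⊞ t)) ⊞ ((c′ (+ 1) ⊞ n) ⊞ (c′ (+ 1) ⊞ n))) ⊞ (k ⊖′ (c′ (+ 1) ⊞ n))) refl k (+ tri k) (+ N)))
      (cong (λ z → + d′ ℤ.+ z) (sym (trans (⊟-pred k N) (⊟-is k (suc N)))))

-- Divided by φ, `W-rec` is the recursion of ρ at negative indices with q² for q. By `contraction`
-- it has only one solution.
W-val : ∀ N → W N ≈ φ * 𝐃 (ρ -[1+ N ])
W-val N = diff-zero (contraction (λ N → W N - φ * 𝐃 (ρ -[1+ N ])) suc (λ N → N ℕ.+ suc N) rec N)
  where
  open SR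
  rec : ∀ N → (W N - φ * 𝐃 (ρ -[1+ N ])) + q^ (suc N ℕ.+ suc N) * (W (suc N) - φ * 𝐃 (ρ -[1+ suc N ])) ≈ 0#
  rec N = begin
    (W N - φ * 𝐃 (ρ -[1+ N ])) + q^ (suc N ℕ.+ suc N) * (W (suc N) - φ * 𝐃 (ρ -[1+ suc N ]))
      ≈⟨ +-cong (+-cong (W-rec N) (-‿cong (*-cong ≈-refl
          (≈-trans (𝐃-cong (r-rec′ N)) (≈-trans (𝐃-* _ _) (*-cong (𝐃-q^ (suc N)) ≈-refl))))))
        (*-cong ≈-refl (+-cong ≈-refl (-‿cong (*-cong ≈-refl (≈-trans (𝐃-+ _ _) (+-cong (𝐃-κ 1ℚ) (𝐃-neg _))))))) ⟩
    _ ≈⟨ solve 4 (λ q f w x → (q :* f :- q :* w :- f :* (q :* x)) :+ q :* (w :- f :* (con 1ℚ :+ :- x)) := con 0ℚ) ≈-refl (q^ (suc N ℕ.+ suc N)) φ (W (suc N)) (𝐃 (r (suc N))) ⟩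
    0# ∎

sq-neg : ∀ k → sq (ℤ.suc (~ k)) ≡ sq k
sq-neg k = trans (cong₂ ℕ._+_ (tri-suc-~ k) (trans (sym (tri-~ (~ k))) (cong tri (~-~ k)))) (ℕP.+-comm (tri (ℤ.suc k)) (tri k))

-- The sum of (-1)^k q^(k²) sₖ in two ways. By `sₖ-val` the constant ½ meets φ, while the signs of
-- the other term cancel and ε meets `φ̂`. By `W-val` each tail is φ times the tail at q², which
-- brings back ε as 𝐃 ε.
εφ̂ : ε * φ̂ ≈ φ * 𝐃 ε
εφ̂ = begin
  ε * φ̂ ≈⟨ ≈-sym (∑ℤ-* ε (decℤ-*ʳ (λ _ → ε) dec-sq) dec-sq) ⟩
  ∑ℤ (λ k → ε * q^ sq k) (decℤ-*ʳ (λ _ → ε) dec-sq)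
    ≈⟨ ∑ℤ-cong _ dsum (λ k → ≈-trans (solve 2 (λ e t → e :* t := con 1ℚ :* (e :* t)) ≈-refl ε (q^ sq k)) (≈-trans (*-cong (≈-sym (σ-sq k)) ≈-refl)
         (≈-trans (solve 3 (λ s e t → (s :* s) :* (e :* t) := :- con ½ :* (s :* t) :+ (s :* t) :* (con ½ :+ s :* e)) ≈-refl (σ k) ε (q^ sq k))
           (+-cong ≈-refl (≈-trans (*-cong ≈-refl (≈-sym (sₖ-val k))) (distribˡ _ _ _)))))) ⟩
  ∑ℤ (λ k → (- κ ½) * (σ k * q^ sq k) + ((σ k * q^ sq k) * S₁ (ℤ.pred k) + (σ k * q^ sq k) * S₁ (~ k))) dsum
    ≈⟨ ≈-trans (∑ℤ-+ dsum d₀ (decℤ-+ d₁ d₂)) (+-cong (∑ℤ-* _ _ dec-φ) (≈-trans (∑ℤ-+ _ d₁ d₂) (+-cong half (≈-trans reflect half)))) ⟩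
  (- κ ½) * φ + (φ * 𝐃 s + φ * 𝐃 s) ≈⟨ solve 2 (λ f x → (:- con ½) :* f :+ (f :* x :+ f :* x) := f :* ((x :+ x) :+ :- con ½)) ≈-refl φ (𝐃 s) ⟩
  φ * ((𝐃 s + 𝐃 s) + - κ ½) ≈⟨ *-cong ≈-refl (≈-sym (≈-trans (𝐃-+ _ _) (+-cong (𝐃-+ _ _) (≈-trans (𝐃-neg _) (-‿cong (𝐃-κ ½)))))) ⟩
  φ * 𝐃 ε ∎
  where
  open SR
  s = S₁ -[1+ 0 ]
  d₀ : Decℤ (λ k → (- κ ½) * (σ k * q^ sq k))
  d₀ = decℤ-*ʳ (λ _ → - κ ½) dec-φ
  d₁ : Decℤ (λ k → (σ k * q^ sq k) * S₁ (ℤ.pred k))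
  d₁ = decℤ-*ˡ (λ k → S₁ (ℤ.pred k)) dec-φ
  d₂ : Decℤ (λ k → (σ k * q^ sq k) * S₁ (~ k))
  d₂ = decℤ-*ˡ (λ k → S₁ (~ k)) dec-φ
  dsum = decℤ-+ d₀ (decℤ-+ d₁ d₂)
  reflect : ∑ℤ (λ k → (σ k * q^ sq k) * S₁ (~ k)) d₂ ≈ ∑ℤ (λ k → (σ k * q^ sq k) * S₁ (ℤ.pred k)) d₁
  reflect = ≈-sym (≈-trans (∑ℤ-neg′ d₁ (dec-neg∘ d₁)) (∑ℤ-cong _ _ λ k → *-cong (*-cong (σ-neg k) (q^-cong (sq-neg k))) (≡⇒≈ (cong S₁ (pred-suc (~ k))))))
  half : ∑ℤ (λ k → (σ k * q^ sq k) * S₁ (ℤ.pred k)) d₁ ≈ φ * 𝐃 s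
  half = begin
    ∑ℤ (λ k → (σ k * q^ sq k) * S₁ (ℤ.pred k)) d₁ ≈⟨ ≈-sym (theta-tail σℕ ℤ.pred abs-pred dec-φ) ⟩
    ∑ (λ N → σℕ N * W N) (dec-theta σℕ ℤ.pred abs-pred dec-φ)
      ≈⟨ ∑-cong _ (dec-⊗ʳ (λ _ → φ) d𝐃) (λ N → ≈-trans (*-cong ≈-refl (≈-trans (W-val N) (*-cong ≈-refl (𝐃-cong (≡⇒≈ (cong ρ (sym (trans (neg-⊟ 0 N) (cong -[1+_] (ℕP.+-identityʳ N))))))))))
           (≈-trans (solve 3 (λ s f x → s :* (f :* x) := f :* (s :* x)) ≈-refl (σℕ N) φ _) (*-cong ≈-refl (≈-sym (≈-trans (𝐃-* _ _) (*-cong (𝐃-σ (+ N)) ≈-refl)))))) ⟩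
    ∑ (λ N → φ * 𝐃 (σℕ N * ρ (-[1+ 0 ] ⊟ N))) (dec-⊗ʳ (λ _ → φ) d𝐃) ≈⟨ ∑-⊗ φ _ d𝐃 ⟩
    φ * ∑ (λ N → 𝐃 (σℕ N * ρ (-[1+ 0 ] ⊟ N))) d𝐃 ≈⟨ *-cong ≈-refl (≈-sym (≈-trans (𝐃-cong (tail-is σℕ -[1+ 0 ])) (𝐃-∑ _ d𝐃))) ⟩
    φ * 𝐃 s ∎
    where
    d𝐃 : Dec (λ N → 𝐃 (σℕ N * ρ (-[1+ 0 ] ⊟ N)))
    d𝐃 = dec-𝐃 (dec-ρ σℕ -[1+ 0 ])

opaque
  unfolding ∑ℤ ∑ _+_

  φ-unit : Unit φ
  φ-unit = refl

  b-unit : Unit b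
  b-unit = refl

  c₁-unit : Unit c₁
  c₁-unit = refl

  c̃₁-unit : Unit c̃₁
  c̃₁-unit = refl

  κ-at-0 : ∀ c → κ c 0 ≡ c
  κ-at-0 c = ℚP.*-identityʳ c

η-unit : Unit η
η-unit = trans (at (solve 1 (λ s → :- (con 2ℚ :* ((s :+ s) :- con ½)) := con 1ℚ :+ :- con (+ 4 ℚ./ 1) :* s) ≈-refl s) 0)
  (trans (+-at 1# _ 0) (trans (cong₂ ℚ._+_ 1-at-0 (trans (*-at-0 (- κ (+ 4 ℚ./ 1)) s) (trans (cong ((- κ (+ 4 ℚ./ 1)) 0 ℚ.*_) s-0) (ℚP.*-zeroʳ ((- κ (+ 4 ℚ./ 1)) 0))))) refl))
  where
  s = S₁ -[1+ 0 ]
  s-0 : s 0 ≡ 0ℚ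
  s-0 = trans (at (tail-is σℕ -[1+ 0 ]) 0) (∑-ord (dec-ρ σℕ -[1+ 0 ]) 1 (λ i → ord-⊗ʳ (σℕ i) (subst (λ z → Ord 1 (ρ z)) (sym (neg-⊟ 0 i)) (ord-≤ (s≤s z≤n) (ρ-ord (i ℕ.+ 0))))) 0 (s≤s z≤n))

𝐃-unit : ∀ {f} → Unit f → Unit (𝐃 f)
𝐃-unit {f} u = trans (𝐃-at-0 f) u

-- `εφ̂` and `φ̂φ` together say that η/φ² is unchanged by q ↦ q², hence constant. The inverse of φ
-- is a parameter here; the overpartitions will supply it.
η-φ² : ∀ P̄ → φ * P̄ ≈ 1# → η ≈ φ * φ
η-φ² P̄ h = begin
  η ≈⟨ ≈-trans (solve 1 (λ e → e := (con 1ℚ :* con 1ℚ) :* e) ≈-refl η) (*-cong (*-cong (≈-sym h) (≈-sym h)) ≈-refl) ⟩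
  ((φ * P̄) * (φ * P̄)) * η ≈⟨ solve 3 (λ f p e → ((f :* p) :* (f :* p)) :* e := (e :* (p :* p)) :* (f :* f)) ≈-refl φ P̄ η ⟩
  F * (φ * φ) ≈⟨ *-cong (≈-trans (𝐃-fixed F-fixed) (≡⇒≈ (cong κ F-unit))) ≈-refl ⟩
  1# * (φ * φ) ≈⟨ *-identityˡ _ ⟩
  φ * φ ∎
  where
  open SR
  F = η * (P̄ * P̄)
  u = (φ * φ) * (𝐃 φ * 𝐃 φ)
  ηφ̂ : η * φ̂ ≈ φ * 𝐃 η
  ηφ̂ = ≈-trans (solve 2 (λ e f → (:- (con 2ℚ :* e)) :* f := :- con 2ℚ :* (e :* f)) ≈-refl ε φ̂) (≈-trans (*-cong ≈-refl εφ̂)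
    (≈-trans (solve 2 (λ f x → :- con 2ℚ :* (f :* x) := f :* (:- (con 2ℚ :* x))) ≈-refl φ (𝐃 ε)) (*-cong ≈-refl (≈-sym (≈-trans (𝐃-neg _) (-‿cong (≈-trans (𝐃-* _ _) (*-cong (𝐃-κ 2ℚ) ≈-refl))))))))
  P̄-unit : Unit P̄
  P̄-unit = trans (sym (ℚP.*-identityˡ (P̄ 0))) (trans (cong (ℚ._* P̄ 0) (sym φ-unit)) (trans (sym (*-at-0 φ P̄)) (trans (at h 0) 1-at-0)))
  F-unit : Unit F
  F-unit = unit-* {η} {P̄ * P̄} η-unit (unit-* {P̄} {P̄} P̄-unit P̄-unit)
  h′ : 𝐃 φ * 𝐃 P̄ ≈ 1#
  h′ = ≈-trans (≈-sym (𝐃-* _ _)) (≈-trans (𝐃-cong h) (𝐃-κ 1ℚ))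
  F-fixed : F ≈ 𝐃 F
  F-fixed = unit-cancel {u} (unit-* {φ * φ} {𝐃 φ * 𝐃 φ} (unit-* {φ} {φ} φ-unit φ-unit) (unit-* {𝐃 φ} {𝐃 φ} (𝐃-unit φ-unit) (𝐃-unit φ-unit))) (begin
    ((φ * φ) * (𝐃 φ * 𝐃 φ)) * (η * (P̄ * P̄)) ≈⟨ solve 4 (λ f d e p → ((f :* f) :* d) :* (e :* (p :* p)) := ((f :* p) :* (f :* p)) :* (e :* d)) ≈-refl φ (𝐃 φ * 𝐃 φ) η P̄ ⟩
    ((φ * P̄) * (φ * P̄)) * (η * (𝐃 φ * 𝐃 φ)) ≈⟨ *-cong (*-cong h h) (*-cong ≈-refl (≈-sym φ̂φ)) ⟩
    (1# * 1#) * (η * (φ̂ * φ)) ≈⟨ solve 3 (λ e a f → (con 1ℚ :* con 1ℚ) :* (e :* (a :* f)) := f :* (e :* a)) ≈-refl η φ̂ φ ⟩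
    φ * (η * φ̂) ≈⟨ *-cong ≈-refl ηφ̂ ⟩
    φ * (φ * 𝐃 η) ≈⟨ solve 2 (λ f e → f :* (f :* e) := (con 1ℚ :* con 1ℚ) :* ((f :* f) :* e)) ≈-refl φ (𝐃 η) ⟩
    (1# * 1#) * ((φ * φ) * 𝐃 η) ≈⟨ *-cong (*-cong (≈-sym h′) (≈-sym h′)) ≈-refl ⟩
    ((𝐃 φ * 𝐃 P̄) * (𝐃 φ * 𝐃 P̄)) * ((φ * φ) * 𝐃 η) ≈⟨ solve 4 (λ d p f e → ((d :* p) :* (d :* p)) :* ((f :* f) :* e) := ((f :* f) :* (d :* d)) :* (e :* (p :* p))) ≈-refl (𝐃 φ) (𝐃 P̄) φ (𝐃 η) ⟩
    ((φ * φ) * (𝐃 φ * 𝐃 φ)) * (𝐃 η * (𝐃 P̄ * 𝐃 P̄)) ≈⟨ *-cong ≈-refl (≈-sym (≈-trans (𝐃-* _ _) (*-cong ≈-refl (𝐃-* _ _)))) ⟩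
    ((φ * φ) * (𝐃 φ * 𝐃 φ)) * 𝐃 F ∎)

-- A product of theta series with linear weights

ι-+ : ∀ i j → ι (i ℤ.+ j) ≈ ι i + ι j
ι-+ i j = diff-zero (suc-constant {λ i → ι (i ℤ.+ j) - (ι i + ι j)}
  (λ i → ≈-trans (+-cong (≈-trans (≡⇒≈ (cong ι (ℤP.+-assoc (+ 1) i j))) (ι-suc (i ℤ.+ j))) (-‿cong (+-cong (ι-suc i) ≈-refl)))
    (solve 3 (λ x s t → (x :+ con 1ℚ) :- ((s :+ con 1ℚ) :+ t) := x :- (s :+ t)) ≈-refl (ι (i ℤ.+ j)) (ι i) (ι j)))
  (≈-trans (+-cong (≡⇒≈ (cong ι (ℤP.+-identityˡ j))) ≈-refl) (solve 1 (λ x → x :- (con 0ℚ :+ x) := con 0ℚ) ≈-refl (ι j))) i)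

ι-dbl : ∀ k → ι (dbl k) ≈ κ 2ℚ * ι k
ι-dbl k = ≈-trans (≡⇒≈ (cong ι (dbl-is k))) (≈-trans (ι-+ k k) (solve 1 (λ x → x :+ x := con 2ℚ :* x) ≈-refl (ι k)))

ι-dbl⁺ : ∀ k → ι (dbl⁺ k) ≈ κ 2ℚ * ι k + 1#
ι-dbl⁺ k = ≈-trans (≡⇒≈ (cong ι (dbl⁺-suc k))) (≈-trans (ι-suc (dbl k)) (+-cong (ι-dbl k) ≈-refl))

decℤ²-sub : ∀ {f g : ℤ → ℤ → Series} → Decℤ² f → Decℤ² g → Decℤ² (λ i j → f i j - g i j)
decℤ²-sub d e N = let (m , p) = d N ; (m′ , p′) = e N in m ℕ.⊔ m′ , λ
  { i j (inj₁ l) → ord-⊕ (p i j (inj₁ (ℕP.≤-trans (ℕP.m≤m⊔n m m′) l))) (ord-- (p′ i j (inj₁ (ℕP.≤-trans (ℕP.m≤n⊔m m m′) l))))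
  ; i j (inj₂ l) → ord-⊕ (p i j (inj₂ (ℕP.≤-trans (ℕP.m≤m⊔n m m′) l))) (ord-- (p′ i j (inj₂ (ℕP.≤-trans (ℕP.m≤n⊔m m m′) l)))) }

∑∑ : (g : ℤ → ℤ → Series) → Decℤ² g → Series
∑∑ g d = ∑ℤ (λ i → ∑ℤ (g i) (rowℤ d i)) (rowsℤ d)

∑∑-sub : ∀ {f g} (d : Decℤ² f) (e : Decℤ² g) → ∑∑ f d - ∑∑ g e ≈ ∑∑ (λ i j → f i j - g i j) (decℤ²-sub d e)
∑∑-sub {f} {g} d e = ≈-sym (≈-trans
  (∑ℤ-cong _ (decℤ-+ (rowsℤ d) (decℤ-neg (rowsℤ e))) (λ i → ≈-trans (∑ℤ-+ _ (rowℤ d i) (decℤ-neg (rowℤ e i))) (+-cong ≈-refl (∑ℤ-neg _ (rowℤ e i)))))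
  (≈-trans (∑ℤ-+ _ (rowsℤ d) (decℤ-neg (rowsℤ e))) (+-cong ≈-refl (∑ℤ-neg _ (rowsℤ e)))))

∑∑-antisym : ∀ {g} (d : Decℤ² g) → (∀ i j → g i j ≈ - g j i) → ∑∑ g d ≈ 0#
∑∑-antisym {g} d h = self-neg (≈-trans (∑ℤ-cong _ (decℤ-neg (rowsℤ (transposeℤ d))) (λ i → ≈-trans (∑ℤ-cong _ (decℤ-neg (rowℤ (transposeℤ d) i)) (h i)) (∑ℤ-neg _ (rowℤ (transposeℤ d) i))))
  (≈-trans (∑ℤ-neg _ (rowsℤ (transposeℤ d))) (-‿cong (≈-sym (∑ℤ-swap d (transposeℤ d))))))

∑∑-antisym′ : ∀ {g} (d : Decℤ² g) → (∀ i j → g (ℤ.suc (~ (j ℤ.+ i))) j ≈ - g i j) → ∑∑ g d ≈ 0#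
∑∑-antisym′ {g} d h = ≈-trans (∑ℤ-swap d dT) (≈-trans
  (∑ℤ-cong _ (decℤ-*ʳ (λ _ → 0#) (rowsℤ dT)) (λ j → ≈-trans (inner j) (≈-sym (zeroˡ (∑ℤ (λ i → g i j) (rowℤ dT j))))))
  (≈-trans (∑ℤ-* _ _ (rowsℤ dT)) (zeroˡ _)))
  where
  dT = transposeℤ d
  inner : ∀ j → ∑ℤ (λ i → g i j) (rowℤ dT j) ≈ 0#
  inner j = self-neg (≈-trans (∑ℤ-neg′ (rowℤ dT j) (dec-neg∘ (rowℤ dT j))) (≈-trans (∑ℤ-translate j (dec-neg∘ (rowℤ dT j)) (dec-translate j (dec-neg∘ (rowℤ dT j))))
    (≈-trans (∑ℤ-cong _ (decℤ-neg (rowℤ dT j)) (λ i → h i j)) (∑ℤ-neg _ (rowℤ dT j)))))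

suc~ : ∀ k → ℤ.suc (~ k) ≡ ℤ.- k
suc~ k = trans (cong ℤ.suc (~-is k)) (ℤR.solve 1 (λ k → c′ (+ 1) ⊞ (ℤR.:- k ⊖′ c′ (+ 1)) ⩵ ℤR.:- k) refl k)

-- the quadratic form x²/8 + y²/24 with x, y odd has an automorphism of order three
ψ₂𝒫₊ : 𝒫₊ * ψ₂ ≈ c̃₁ * X
ψ₂𝒫₊ = diff-zero (begin
  𝒫₊ * ψ₂ - c̃₁ * X ≈⟨ +-cong (∑ℤ-product dp dec-tri) (-‿cong (∑ℤ-product dc dx)) ⟩
  (∑∑ Ae dAe + ∑∑ Ao dAo) - (∑∑ Be dBe + ∑∑ Bo dBo) ≈⟨ solve 4 (λ a b c d → (a :+ b) :- (c :+ d) := (a :- c) :+ (b :- d)) ≈-refl _ _ _ _ ⟩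
  (∑∑ Ae dAe - ∑∑ Be dBe) + (∑∑ Ao dAo - ∑∑ Bo dBo) ≈⟨ +-cong (≈-trans (∑∑-sub dAe dBe) (∑∑-antisym _ even)) (≈-trans (∑∑-sub dAo dBo) (∑∑-antisym′ _ odd)) ⟩
  0# + 0# ≈⟨ +-identityˡ _ ⟩
  0# ∎)
  where
  open SR
  dp : Decℤ (λ k → lin 6ℚ k * q^ E₁ k)
  dp = decℤ-*ʳ (lin 6ℚ) dec-E₁
  dc : Decℤ (λ k → σ k * q^ E₁ k)
  dc = decℤ-*ʳ σ dec-E₁
  dx : Decℤ (λ k → (σ k * lin 2ℚ k) * q^ tri k)
  dx = decℤ-*ʳ _ dec-tri
  Ae Ao Be Bo : ℤ → ℤ → Series
  Ae i j = (lin 6ℚ i * q^ E₁ i) * q^ tri (i ℤ.+ dbl j)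
  Ao i j = (lin 6ℚ i * q^ E₁ i) * q^ tri (i ℤ.+ dbl⁺ j)
  Be i j = (σ i * q^ E₁ i) * ((σ (i ℤ.+ dbl j) * lin 2ℚ (i ℤ.+ dbl j)) * q^ tri (i ℤ.+ dbl j))
  Bo i j = (σ i * q^ E₁ i) * ((σ (i ℤ.+ dbl⁺ j) * lin 2ℚ (i ℤ.+ dbl⁺ j)) * q^ tri (i ℤ.+ dbl⁺ j))
  dAe = dec-proper (λ i j → i ℤ.+ dbl j) proper-dbl dp dec-tri
  dAo = dec-proper (λ i j → i ℤ.+ dbl⁺ j) proper-dbl⁺ dp dec-tri
  dBe = dec-proper (λ i j → i ℤ.+ dbl j) proper-dbl dc dx
  dBo = dec-proper (λ i j → i ℤ.+ dbl⁺ j) proper-dbl⁺ dc dx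
  4ℚ = + 4 ℚ./ 1
  tri-add-dbl : ∀ i j → + tri (i ℤ.+ dbl j) ≡ + tri i ℤ.+ 4× (+ tri j) ℤ.+ (j ℤ.+ (i ℤ.+ i) ℤ.* j)
  tri-add-dbl i j = halve _ _ (trans (tri-double (i ℤ.+ dbl j)) (trans (cong (λ z → (i ℤ.+ z) ℤ.* (i ℤ.+ z) ℤ.- (i ℤ.+ z)) (dbl-is j))
    (trans (ℤR.solve 2 (λ i j → (i ⊞ (j ⊞ j)) ⊡ (i ⊞ (j ⊞ j)) ⊖′ (i ⊞ (j ⊞ j)) ⩵ (i ⊡ i ⊖′ i) ⊞ c′ (+ 4) ⊡ (j ⊡ j ⊖′ j) ⊞ ((j ⊞ (i ⊞ i) ⊡ j) ⊞ (j ⊞ (i ⊞ i) ⊡ j))) refl i j)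
    (trans (cong₂ (λ x y → x ℤ.+ + 4 ℤ.* y ℤ.+ ((j ℤ.+ (i ℤ.+ i) ℤ.* j) ℤ.+ (j ℤ.+ (i ℤ.+ i) ℤ.* j))) (sym (tri-double i)) (sym (tri-double j)))
      (ℤR.solve 3 (λ s t x → (s ⊞ s) ⊞ c′ (+ 4) ⊡ (t ⊞ t) ⊞ (x ⊞ x) ⩵ (s ⊞ ((t ⊞ t) ⊞ (t ⊞ t)) ⊞ x) ⊞ (s ⊞ ((t ⊞ t) ⊞ (t ⊞ t)) ⊞ x)) refl (+ tri i) (+ tri j) (j ℤ.+ (i ℤ.+ i) ℤ.* j))))))
  Ee : ℤ → ℤ → ℕ
  Ee i j = E₁ i ℕ.+ tri (i ℤ.+ dbl j)
  Eo : ℤ → ℤ → ℕ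
  Eo i j = E₁ i ℕ.+ tri (i ℤ.+ dbl⁺ j)
  Ee-is : ∀ i j → + Ee i j ≡ 4× (+ tri i) ℤ.+ 4× (+ tri j) ℤ.+ (i ℤ.+ j ℤ.+ (i ℤ.+ i) ℤ.* j)
  Ee-is i j = trans (cong₂ ℤ._+_ (by-tri₁ (λ s → + tri i ℤ.+ (+ tri i ℤ.+ s) ≡ + tri i ℤ.+ (+ tri i ℤ.+ (i ℤ.+ + tri i))) i refl) (tri-add-dbl i j))
    (ℤR.solve 4 (λ i j s t → (s ⊞ (s ⊞ (i ⊞ s))) ⊞ (s ⊞ ((t ⊞ t) ⊞ (t ⊞ t)) ⊞ (j ⊞ (i ⊞ i) ⊡ j)) ⩵ ((s ⊞ s) ⊞ (s ⊞ s)) ⊞ ((t ⊞ t) ⊞ (t ⊞ t)) ⊞ (i ⊞ j ⊞ (i ⊞ i) ⊡ j)) refl i j (+ tri i) (+ tri j))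
  Ee-sym : ∀ i j → Ee i j ≡ Ee j i
  Ee-sym i j = ℤP.+-injective (trans (Ee-is i j) (trans (ℤR.solve 4 (λ s t i j → s ⊞ t ⊞ (i ⊞ j ⊞ (i ⊞ i) ⊡ j) ⩵ t ⊞ s ⊞ (j ⊞ i ⊞ (j ⊞ j) ⊡ i)) refl (4× (+ tri i)) (4× (+ tri j)) i j) (sym (Ee-is j i))))
  -- At difference 2j the signs cancel and the weights differ by (1 - 6i) - (1 - 2(i + 2j)) = 4(j -
  -- i), which is antisymmetric against a symmetric exponent.
  even-val : ∀ i j → Ae i j - Be i j ≈ (κ 4ℚ * (ι j - ι i)) * q^ Ee i j
  even-val i j = ≈-trans (+-cong ≈-refl (-‿cong (*-cong ≈-refl (*-cong (*-cong (≈-trans (σ-+ i (dbl j)) (*-cong ≈-refl (σ-dbl j))) (+-cong ≈-refl (-‿cong (*-cong ≈-refl (≈-trans (ι-+ i (dbl j)) (+-cong ≈-refl (ι-dbl j))))))) ≈-refl))))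
    (≈-trans (solve 5 (λ i j s p t → ((con 1ℚ :- con 6ℚ :* i) :* p) :* t :- (s :* p) :* (((s :* con 1ℚ) :* (con 1ℚ :- con 2ℚ :* (i :+ con 2ℚ :* j))) :* t)
        := ((con 1ℚ :- con 6ℚ :* i) :- (s :* s) :* (con 1ℚ :- con 2ℚ :* (i :+ con 2ℚ :* j))) :* (p :* t)) ≈-refl (ι i) (ι j) (σ i) (q^ E₁ i) (q^ tri (i ℤ.+ dbl j)))
      (*-cong (≈-trans (+-cong ≈-refl (-‿cong (*-cong (σ-sq i) ≈-refl))) (solve 2 (λ i j → (con 1ℚ :- con 6ℚ :* i) :- con 1ℚ :* (con 1ℚ :- con 2ℚ :* (i :+ con 2ℚ :* j)) := con 4ℚ :* (j :- i)) ≈-refl (ι i) (ι j))) (q^-+ _ _)))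
  even : ∀ i j → Ae i j - Be i j ≈ - (Ae j i - Be j i)
  even i j = ≈-trans (even-val i j) (≈-trans (*-cong ≈-refl (q^-cong (Ee-sym i j))) (≈-trans (solve 3 (λ i j x → (con 4ℚ :* (j :- i)) :* x := :- ((con 4ℚ :* (i :- j)) :* x)) ≈-refl (ι i) (ι j) _) (-‿cong (≈-sym (even-val j i)))))
  -- At odd difference the weights add up to -4(2i + j). The map i ↦ -(i + j) reverses this factor
  -- and preserves the exponent.
  odd-val : ∀ i j → Ao i j - Bo i j ≈ (- κ 4ℚ * (κ 2ℚ * ι i + ι j)) * q^ Eo i j
  odd-val i j = ≈-trans (+-cong ≈-refl (-‿cong (*-cong ≈-refl (*-cong (*-cong (≈-trans (σ-+ i (dbl⁺ j)) (*-cong ≈-refl (σ-dbl⁺ j))) (+-cong ≈-refl (-‿cong (*-cong ≈-refl (≈-trans (ι-+ i (dbl⁺ j)) (+-cong ≈-refl (ι-dbl⁺ j))))))) ≈-refl))))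
    (≈-trans (solve 5 (λ i j s p t → ((con 1ℚ :- con 6ℚ :* i) :* p) :* t :- (s :* p) :* (((s :* :- con 1ℚ) :* (con 1ℚ :- con 2ℚ :* (i :+ (con 2ℚ :* j :+ con 1ℚ)))) :* t)
        := ((con 1ℚ :- con 6ℚ :* i) :+ (s :* s) :* (con 1ℚ :- con 2ℚ :* (i :+ (con 2ℚ :* j :+ con 1ℚ)))) :* (p :* t)) ≈-refl (ι i) (ι j) (σ i) (q^ E₁ i) (q^ tri (i ℤ.+ dbl⁺ j)))
      (*-cong (≈-trans (+-cong ≈-refl (*-cong (σ-sq i) ≈-refl)) (solve 2 (λ i j → (con 1ℚ :- con 6ℚ :* i) :+ con 1ℚ :* (con 1ℚ :- con 2ℚ :* (i :+ (con 2ℚ :* j :+ con 1ℚ))) := :- con 4ℚ :* (con 2ℚ :* i :+ j)) ≈-refl (ι i) (ι j))) (q^-+ _ _)))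
  Eo-double : ∀ i j → + Eo i j ℤ.+ + Eo i j ≡ + 4 ℤ.* (i ℤ.* i ℤ.+ i ℤ.* j ℤ.+ j ℤ.* j) ℤ.+ (j ℤ.+ j)
  Eo-double i j = trans (trans (ℤR.solve 2 (λ x y → (x ⊞ y) ⊞ (x ⊞ y) ⩵ (x ⊞ x) ⊞ (y ⊞ y)) refl (+ E₁ i) (+ tri (i ℤ.+ dbl⁺ j)))
      (cong₂ ℤ._+_ (trans (cong₂ ℤ._+_ (E₁-is i) (E₁-is i)) (trans (ℤR.solve 2 (λ t s → (t ⊞ s) ⊞ (t ⊞ s) ⩵ (t ⊞ t) ⊞ (s ⊞ s)) refl (+ tri i) (i ℤ.* i)) (cong (λ z → z ℤ.+ (i ℤ.* i ℤ.+ i ℤ.* i)) (tri-double i))))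
        (trans (tri-double (i ℤ.+ dbl⁺ j)) (cong (λ z → (i ℤ.+ z) ℤ.* (i ℤ.+ z) ℤ.- (i ℤ.+ z)) (dbl⁺-is j)))))
    (ℤR.solve 2 (λ i j → ((i ⊡ i ⊖′ i) ⊞ (i ⊡ i ⊞ i ⊡ i)) ⊞ ((i ⊞ (j ⊞ j ⊞ c′ (+ 1))) ⊡ (i ⊞ (j ⊞ j ⊞ c′ (+ 1))) ⊖′ (i ⊞ (j ⊞ j ⊞ c′ (+ 1)))) ⩵ c′ (+ 4) ⊡ (i ⊡ i ⊞ i ⊡ j ⊞ j ⊡ j) ⊞ (j ⊞ j)) refl i j)
  Eo-sym : ∀ i j → Eo (ℤ.suc (~ (j ℤ.+ i))) j ≡ Eo i j
  Eo-sym i j = ℤP.+-injective (halve _ _ (trans (Eo-double (ℤ.suc (~ (j ℤ.+ i))) j) (trans (cong (λ z → + 4 ℤ.* (z ℤ.* z ℤ.+ z ℤ.* j ℤ.+ j ℤ.* j) ℤ.+ (j ℤ.+ j)) (suc~ (j ℤ.+ i)))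
    (trans (ℤR.solve 2 (λ i j → let z = ℤR.:- (j ⊞ i) in c′ (+ 4) ⊡ (z ⊡ z ⊞ z ⊡ j ⊞ j ⊡ j) ⊞ (j ⊞ j) ⩵ c′ (+ 4) ⊡ (i ⊡ i ⊞ i ⊡ j ⊞ j ⊡ j) ⊞ (j ⊞ j)) refl i j) (sym (Eo-double i j))))))
  odd : ∀ i j → Ao (ℤ.suc (~ (j ℤ.+ i))) j - Bo (ℤ.suc (~ (j ℤ.+ i))) j ≈ - (Ao i j - Bo i j)
  odd i j = ≈-trans (odd-val (ℤ.suc (~ (j ℤ.+ i))) j) (≈-trans (*-cong (*-cong ≈-refl (+-cong (*-cong ≈-refl (≈-trans (ι-neg (j ℤ.+ i)) (-‿cong (ι-+ j i)))) ≈-refl)) (q^-cong (Eo-sym i j)))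
    (≈-trans (solve 3 (λ i j x → (:- con 4ℚ :* (con 2ℚ :* (:- (j :+ i)) :+ j)) :* x := :- ((:- con 4ℚ :* (con 2ℚ :* i :+ j)) :* x)) ≈-refl (ι i) (ι j) _) (-‿cong (≈-sym (odd-val i j)))))

-- Overpartitions in a box and the rank

-- generating function of the overpartitions with parts at most l and at most j parts
Box : ℕ → ℕ → Series
Box zero j = 1#
Box (suc l) zero = 1#
Box (suc l) (suc j) = Box l (suc j) + q^ suc l * (Box (suc l) j + Box l j)

Box-0 : ∀ l → Box l 0 ≈ 1#
Box-0 zero = ≈-refl
Box-0 (suc l) = ≈-refl

q^suc : ∀ n → q^ suc n ≈ q^ 1 * q^ n
q^suc n = ≈-sym (q^-+ 1 n)

-- The defining recursion removes a copy of the largest part, a row of the diagram; this one removes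
-- a column. Under induction the two reductions commute.
Box-conj : ∀ l j → Box (suc l) (suc j) ≈ Box (suc l) j + q^ suc j * (Box l (suc j) + Box l j)
Box-conj zero zero = solve 1 (λ x → con 1ℚ :+ x :* (con 1ℚ :+ con 1ℚ) := con 1ℚ :+ x :* (con 1ℚ :+ con 1ℚ)) ≈-refl (q^ 1)
Box-conj zero (suc j) = begin
  1# + q^ 1 * (Box 1 (suc j) + 1#) ≈⟨ +-cong ≈-refl (*-cong ≈-refl (+-cong (Box-conj zero j) ≈-refl)) ⟩
  1# + q^ 1 * ((Box 1 j + q^ suc j * (1# + 1#)) + 1#)
    ≈⟨ solve 3 (λ q b y → con 1ℚ :+ q :* ((b :+ y :* (con 1ℚ :+ con 1ℚ)) :+ con 1ℚ) := (con 1ℚ :+ q :* (b :+ con 1ℚ)) :+ (q :* y) :* (con 1ℚ :+ con 1ℚ)) ≈-refl (q^ 1) (Box 1 j) (q^ suc j) ⟩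
  (1# + q^ 1 * (Box 1 j + 1#)) + (q^ 1 * q^ suc j) * (1# + 1#) ≈⟨ +-cong ≈-refl (*-cong (≈-sym (q^suc (suc j))) ≈-refl) ⟩
  Box 1 (suc j) + q^ suc (suc j) * (1# + 1#) ∎
  where open SR
Box-conj (suc l) zero = begin
  Box (suc l) 1 + q^ suc (suc l) * (1# + 1#) ≈⟨ +-cong (Box-conj l zero) (*-cong (q^suc (suc l)) ≈-refl) ⟩
  (1# + q^ 1 * (Box l 1 + Box l 0)) + (q^ 1 * q^ suc l) * (1# + 1#) ≈⟨ +-cong (+-cong ≈-refl (*-cong ≈-refl (+-cong ≈-refl (Box-0 l)))) ≈-refl ⟩
  (1# + q^ 1 * (Box l 1 + 1#)) + (q^ 1 * q^ suc l) * (1# + 1#)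
    ≈⟨ solve 3 (λ q b x → (con 1ℚ :+ q :* (b :+ con 1ℚ)) :+ (q :* x) :* (con 1ℚ :+ con 1ℚ) := con 1ℚ :+ q :* ((b :+ x :* (con 1ℚ :+ con 1ℚ)) :+ con 1ℚ)) ≈-refl (q^ 1) (Box l 1) (q^ suc l) ⟩
  1# + q^ 1 * ((Box l 1 + q^ suc l * (1# + 1#)) + 1#) ≈⟨ +-cong ≈-refl (*-cong ≈-refl (+-cong (+-cong ≈-refl (*-cong ≈-refl (+-cong ≈-refl (≈-sym (Box-0 l))))) ≈-refl)) ⟩
  1# + q^ 1 * (Box (suc l) 1 + 1#) ∎
  where open SR
Box-conj (suc l) (suc j) = begin
  Box (suc l) (suc (suc j)) + x * (Box (suc (suc l)) (suc j) + Box (suc l) (suc j))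
    ≈⟨ +-cong (Box-conj l (suc j)) (*-cong (q^suc (suc l)) (+-cong (Box-conj (suc l) j) (Box-conj l j))) ⟩
  (Box (suc l) (suc j) + y * (Box l (suc (suc j)) + Box l (suc j)))
    + (q^ 1 * x′) * ((Box (suc (suc l)) j + y′ * (Box (suc l) (suc j) + Box (suc l) j)) + (Box (suc l) j + y′ * (Box l (suc j) + Box l j)))
    ≈⟨ +-cong (+-cong ≈-refl (*-cong (q^suc (suc j)) ≈-refl)) ≈-refl ⟩
  (Box (suc l) (suc j) + (q^ 1 * y′) * (Box l (suc (suc j)) + Box l (suc j)))
    + (q^ 1 * x′) * ((Box (suc (suc l)) j + y′ * (Box (suc l) (suc j) + Box (suc l) j)) + (Box (suc l) j + y′ * (Box l (suc j) + Box l j)))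
    ≈⟨ solve 10 (λ q x y a b c d e f g → (a :+ (q :* y) :* (b :+ c)) :+ (q :* x) :* ((d :+ y :* (a :+ e)) :+ (e :+ y :* (c :+ f)))
        := (a :+ (q :* x) :* (d :+ e)) :+ (q :* y) :* ((b :+ x :* (a :+ c)) :+ (c :+ x :* (e :+ f)))) ≈-refl
        (q^ 1) x′ y′ (Box (suc l) (suc j)) (Box l (suc (suc j))) (Box l (suc j)) (Box (suc (suc l)) j) (Box (suc l) j) (Box l j) 1# ⟩
  (Box (suc l) (suc j) + (q^ 1 * x′) * (Box (suc (suc l)) j + Box (suc l) j))
    + (q^ 1 * y′) * ((Box l (suc (suc j)) + x′ * (Box (suc l) (suc j) + Box l (suc j))) + (Box l (suc j) + x′ * (Box (suc l) j + Box l j)))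
    ≈⟨ +-cong (+-cong ≈-refl (*-cong (≈-sym (q^suc (suc l))) ≈-refl)) (*-cong (≈-sym (q^suc (suc j))) ≈-refl) ⟩
  Box (suc (suc l)) (suc j) + y * (Box (suc l) (suc (suc j)) + Box (suc l) (suc j)) ∎
  where
  open SR
  x = q^ suc (suc l)
  y = q^ suc (suc j)
  x′ = q^ suc l
  y′ = q^ suc j

-- Conjugation of overpartitions at the level of generating functions: the two recursions exchange
-- the sides of the box.
Box-sym : ∀ l j → Box l j ≈ Box j l
Box-sym zero zero = ≈-refl
Box-sym zero (suc j) = ≈-refl
Box-sym (suc l) zero = ≈-refl
Box-sym (suc l) (suc j) = ≈-trans (+-cong (Box-sym l (suc j)) (*-cong ≈-refl (+-cong (Box-sym (suc l) j) (Box-sym l j)))) (≈-sym (Box-conj j l))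

-- overpartitions with largest part suc l and exactly suc k parts
Part : ℕ → ℕ → Series
Part l k = (Box (suc l) (suc k) - Box l (suc k)) - (Box (suc l) k - Box l k)

Part-sym : ∀ l k → Part l k ≈ Part k l
Part-sym l k = ≈-trans (+-cong (+-cong (Box-sym (suc l) (suc k)) (-‿cong (Box-sym l (suc k)))) (-‿cong (+-cong (Box-sym (suc l) k) (-‿cong (Box-sym l k)))))
  (solve 4 (λ a b c d → (a :- b) :- (c :- d) := (a :- c) :- (b :- d)) ≈-refl _ _ _ _)

Box-diff : ∀ l j → Box (suc l) (suc j) - Box l (suc j) ≈ q^ suc l * (Box (suc l) j + Box l j)
Box-diff l j = solve 2 (λ a b → (a :+ b) :- a := b) ≈-refl _ _

Box-diff-ord : ∀ l j → Ord (suc l) (Box (suc l) j - Box l j)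
Box-diff-ord l zero = ord-≈ (≈-sym (zero-diff (≈-sym (Box-0 l)))) ord-0#
Box-diff-ord l (suc j) = ord-≈ (≈-sym (Box-diff l j)) (ord-q^ (suc l) _)

Part-ord : ∀ l k → Ord (suc l) (Part l k)
Part-ord l k = ord-⊕ (Box-diff-ord l (suc k)) (ord-- (Box-diff-ord l k))

-- G d : overpartitions of rank d (without the empty one);  rk m : nonempty overpartitions of rank at least m
rk-term : ℕ → ℕ → Series
rk-term m i = Box (suc (i ℕ.+ m)) (suc i) - Box (i ℕ.+ m) (suc i)

rk-term-ord : ∀ m i → Ord (i ℕ.+ m) (rk-term m i)
rk-term-ord m i = ord-≤ (ℕP.n≤1+n _) (Box-diff-ord (i ℕ.+ m) (suc i))

dec-rk : ∀ m → Dec (rk-term m)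
dec-rk m = dec-ord λ i → ord-≤ (ℕP.m≤m+n i m) (rk-term-ord m i)

rk : ℕ → Series
rk m = ∑ (rk-term m) (dec-rk m)

rk-ord : ∀ m → Ord m (rk m)
rk-ord m = ∑-ord (dec-rk m) m λ i → ord-≤ (ℕP.m≤n+m m i) (rk-term-ord m i)

dec-G : ∀ d → Dec (λ k → Part (k ℕ.+ d) k)
dec-G d = dec-ord λ k → ord-≤ (ℕP.≤-trans (ℕP.m≤m+n k d) (ℕP.n≤1+n _)) (Part-ord (k ℕ.+ d) k)

G : ℕ → Series
G d = ∑ (λ k → Part (k ℕ.+ d) k) (dec-G d)

dneg : ∀ {u} → Dec u → Dec (λ n → - u n)
dneg d N = proj₁ (d N) , λ n l → ord-- (proj₂ (d N) n l)

∑-neg : ∀ {u} d d₁ → ∑ (λ n → - u n) d ≈ - ∑ u d₁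
∑-neg {u} d d₁ = ≈-trans (∑-cong d (dec-⊗ʳ (λ _ → - 1#) d₁) λ n → solve 1 (λ x → :- x := :- con 1ℚ :* x) ≈-refl (u n))
  (≈-trans (∑-⊗ (- 1#) _ d₁) (solve 1 (λ x → :- con 1ℚ :* x := :- x) ≈-refl _))

G-rk : ∀ m → G m ≈ rk m - rk (suc m)
G-rk m = begin
  G m ≈⟨ ≈-trans (∑-⊕ (dec-G m) (dec-rk m) (dneg d′)) (+-cong ≈-refl (∑-neg _ d′)) ⟩
  rk m - ∑ u d′ ≈⟨ +-cong ≈-refl (-‿cong (≈-trans (∑-suc d′ (dec-suc d′)) (≈-trans (+-cong (zero-diff (≈-sym (Box-0 m))) (∑-cong _ (dec-rk (suc m)) λ i →
       ≡⇒≈ (cong (λ z → Box (suc z) (suc i) - Box z (suc i)) (sym (ℕP.+-suc i m))))) (+-identityˡ _)))) ⟩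
  rk m - rk (suc m) ∎
  where
  open SR
  u : ℕ → Series
  u k = Box (suc (k ℕ.+ m)) k - Box (k ℕ.+ m) k
  d′ : Dec u
  d′ = dec-ord λ k → ord-≤ (ℕP.≤-trans (ℕP.m≤m+n k m) (ℕP.n≤1+n _)) (Box-diff-ord (k ℕ.+ m) k)

-- Averaging the two neighbouring rank functions brings together the four adjacent boxes of `D₂`,
-- for which `diagonal` telescopes.
v : ℕ → Series
v m = κ ½ * (rk m + rk (suc m))

-- By the symmetry of the rank, rank at least 1 is as frequent as rank at most -1; together with
-- rank at least 0 this exhausts the nonempty overpartitions.
P̄ : Series
P̄ = 1# + κ 2ℚ * v 0

P̄-is : P̄ ≈ 1# + (rk 0 + rk 1)
P̄-is = solve 1 (λ x → con 1ℚ :+ con 2ℚ :* (con ½ :* x) := con 1ℚ :+ x) ≈-refl _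

-- The box grows by a column and then by a row. After `Box-sym` the increments are the J-th terms of
-- `rk 0` and `rk 1`.
Box-⟶-step : ∀ J → Box (suc J) J ≈ 1# + (psum J (rk-term 0) + psum J (rk-term 1))
Box-⟶-step zero = solve 0 (con 1ℚ := con 1ℚ :+ (con 0ℚ :+ con 0ℚ)) ≈-refl
Box-⟶-step (suc J) = begin
  Box (suc (suc J)) (suc J)
    ≈⟨ solve 3 (λ a b c → a := c :+ ((b :- c) :+ (a :- b))) ≈-refl _ (Box (suc J) (suc J)) (Box (suc J) J) ⟩
  Box (suc J) J + ((Box (suc J) (suc J) - Box (suc J) J) + (Box (suc (suc J)) (suc J) - Box (suc J) (suc J)))
    ≈⟨ +-cong (Box-⟶-step J) (+-cong (+-cong (≡⇒≈ (cong (λ z → Box (suc z) (suc J)) (sym (ℕP.+-identityʳ J)))) (-‿cong (≈-trans (Box-sym (suc J) J) (≡⇒≈ (cong (λ z → Box z (suc J)) (sym (ℕP.+-identityʳ J)))))))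
         (≡⇒≈ (cong (λ z → Box (suc z) (suc J) - Box z (suc J)) (ℕP.+-comm 1 J)))) ⟩
  (1# + (psum J (rk-term 0) + psum J (rk-term 1))) + (rk-term 0 J + rk-term 1 J)
    ≈⟨ solve 4 (λ a b c d → (con 1ℚ :+ (a :+ b)) :+ (c :+ d) := con 1ℚ :+ ((a :+ c) :+ (b :+ d))) ≈-refl _ _ _ _ ⟩
  1# + (psum (suc J) (rk-term 0) + psum (suc J) (rk-term 1)) ∎
  where open SR

Box-⟶ : (λ J → Box (suc J) J) ⟶ P̄
Box-⟶ = ⟶-cong (λ J → ≈-sym (Box-⟶-step J)) (≈-sym P̄-is) (⟶-⊕ (⟶-const 1#) (⟶-⊕ (∑-has (rk-term 0) (dec-rk 0)) (∑-has (rk-term 1) (dec-rk 1))))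

Box-shift-ord : ∀ d l j → Ord (suc l) (Box (d ℕ.+ l) j - Box l j)
Box-shift-ord zero l j = ord-≈ (≈-sym (-‿inverseʳ _)) ord-0#
Box-shift-ord (suc d) l j = ord-≈ (solve 3 (λ a b c → (a :- b) :+ (b :- c) := a :- c) ≈-refl _ (Box (d ℕ.+ l) j) _)
  (ord-⊕ (ord-≤ (s≤s (ℕP.m≤n+m l d)) (Box-diff-ord (d ℕ.+ l) j)) (Box-shift-ord d l j))

Box-⟶′ : ∀ d → (λ J → Box (d ℕ.+ suc J) J) ⟶ P̄
Box-⟶′ d = ⟶-cong (λ J → solve 2 (λ a b → b :+ (a :- b) := a) ≈-refl _ (Box (suc J) J)) (+-identityʳ P̄)
  (⟶-⊕ Box-⟶ (⟶-0 λ N → N , λ L l → ord-≤ (ℕP.≤-trans l (ℕP.m≤n⇒m≤1+n (ℕP.n≤1+n L))) (Box-shift-ord d (suc L) L)))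

-- D₂ l j is twice the q-Delannoy sum; the diagonal differences of Box telescope into them
D₂ : ℕ → ℕ → Series
D₂ l zero = 1# + 1#
D₂ l (suc j) = (Box (suc l) (suc j) + Box l (suc j)) + (Box (suc l) j + Box l j)

-- The box is taken twice, so that one copy can be expanded by rows and then columns and the other
-- by columns alone; in the total the boundary boxes assemble to `D₂`.
diagonal : ∀ l j → Box (suc (suc l)) (suc j) + Box (suc (suc l)) (suc j) ≈ (Box (suc l) j + Box (suc l) j) + (q^ suc j * D₂ l (suc j) + q^ suc (suc l) * D₂ (suc l) j)
diagonal l j = begin
  Box (suc (suc l)) (suc j) + Box (suc (suc l)) (suc j) ≈⟨ +-cong (+-cong (Box-conj l j) ≈-refl) (Box-conj (suc l) j) ⟩
  ((Box (suc l) j + y * (Box l (suc j) + Box l j)) + x * (Box (suc (suc l)) j + Box (suc l) j)) + (Box (suc (suc l)) j + y * (Box (suc l) (suc j) + Box (suc l) j))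
    ≈⟨ final j ⟩
  _ ∎
  where
  open SR
  x = q^ suc (suc l)
  y = q^ suc j
  final : ∀ j → ((Box (suc l) j + q^ suc j * (Box l (suc j) + Box l j)) + x * (Box (suc (suc l)) j + Box (suc l) j)) + (Box (suc (suc l)) j + q^ suc j * (Box (suc l) (suc j) + Box (suc l) j))
    ≈ (Box (suc l) j + Box (suc l) j) + (q^ suc j * D₂ l (suc j) + x * D₂ (suc l) j)
  final zero = solve 5 (λ x y a b c → ((con 1ℚ :+ y :* (a :+ b)) :+ x :* (con 1ℚ :+ con 1ℚ)) :+ (con 1ℚ :+ y :* (c :+ con 1ℚ))
      := (con 1ℚ :+ con 1ℚ) :+ (y :* ((c :+ a) :+ (con 1ℚ :+ b)) :+ x :* (con 1ℚ :+ con 1ℚ))) ≈-refl x (q^ 1) (Box l 1) (Box l 0) (Box (suc l) 1)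
  final (suc j) = solve 8 (λ x y a b c d e f → ((a :+ y :* (b :+ c)) :+ x :* ((a :+ x :* (d :+ e)) :+ a)) :+ ((a :+ x :* (d :+ e)) :+ y :* (f :+ a))
      := (a :+ a) :+ (y :* ((f :+ b) :+ (a :+ c)) :+ x :* (((a :+ x :* (d :+ e)) :+ a) :+ (d :+ e)))) ≈-refl
      x (q^ suc (suc j)) (Box (suc l) (suc j)) (Box l (suc (suc j))) (Box l (suc j)) (Box (suc (suc l)) j) (Box (suc l) j) (Box (suc l) (suc (suc j)))

u-term : ℕ → ℕ → Series
u-term m j = q^ j * D₂ (j ℕ.+ m) j

dec-u : ∀ m → Dec (u-term m)
dec-u m = dec-ord λ j → ord-q^ j _

u : ℕ → Series
u m = ∑ (u-term m) (dec-u m)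

v-u : ∀ m → v m ≈ κ ½ * (q^ suc m * u m)
v-u m = *-cong ≈-refl (begin
  rk m + rk (suc m) ≈⟨ +-cong (∑-suc (dec-rk m) (dec-suc (dec-rk m))) ≈-refl ⟩
  (rk-term m 0 + ∑ (λ i → rk-term m (suc i)) (dec-suc (dec-rk m))) + rk (suc m)
    ≈⟨ ≈-trans (+-assoc _ _ _) (+-cong (≈-trans (Box-diff m 0) (*-cong ≈-refl (+-cong ≈-refl (Box-0 m)))) (≈-sym (∑-⊕ (dec-⊕ (dec-suc (dec-rk m)) (dec-rk (suc m))) (dec-suc (dec-rk m)) (dec-rk (suc m))))) ⟩
  q^ suc m * (1# + 1#) + ∑ (λ i → rk-term m (suc i) + rk-term (suc m) i) (dec-⊕ (dec-suc (dec-rk m)) (dec-rk (suc m)))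
    ≈⟨ +-cong (*-cong ≈-refl (≈-sym (q^0* _))) (≈-trans (∑-cong _ (dec-⊗ʳ (λ _ → q^ suc m) (dec-suc (dec-u m))) step) (∑-⊗ _ _ (dec-suc (dec-u m)))) ⟩
  q^ suc m * u-term m 0 + q^ suc m * ∑ (λ i → u-term m (suc i)) (dec-suc (dec-u m)) ≈⟨ ≈-sym (distribˡ _ _ _) ⟩
  q^ suc m * (u-term m 0 + ∑ (λ i → u-term m (suc i)) (dec-suc (dec-u m))) ≈⟨ *-cong ≈-refl (≈-sym (∑-suc (dec-u m) (dec-suc (dec-u m)))) ⟩
  q^ suc m * u m ∎)
  where
  open SR
  step : ∀ i → rk-term m (suc i) + rk-term (suc m) i ≈ q^ suc m * u-term m (suc i)
  step i = begin
    rk-term m (suc i) + rk-term (suc m) i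
      ≈⟨ +-cong (Box-diff (suc (i ℕ.+ m)) (suc i)) (≈-trans (≡⇒≈ (cong (λ z → Box (suc z) (suc i) - Box z (suc i)) (ℕP.+-suc i m))) (Box-diff (suc (i ℕ.+ m)) i)) ⟩
    Q * (Box (suc (suc (i ℕ.+ m))) (suc i) + Box (suc (i ℕ.+ m)) (suc i)) + Q * (Box (suc (suc (i ℕ.+ m))) i + Box (suc (i ℕ.+ m)) i) ≈⟨ ≈-sym (distribˡ _ _ _) ⟩
    Q * D₂ (suc i ℕ.+ m) (suc i) ≈⟨ *-cong (≈-trans (q^-cong (cong suc (ℕP.+-comm (suc i) m))) (≈-sym (q^-+ (suc m) (suc i)))) ≈-refl ⟩
    (q^ suc m * q^ suc i) * D₂ (suc i ℕ.+ m) (suc i) ≈⟨ *-assoc _ _ _ ⟩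
    q^ suc m * u-term m (suc i) ∎
    where Q = q^ suc (suc (i ℕ.+ m))

u-psum : ∀ m J → psum (suc J) (u-term m) + q^ suc (suc (suc m)) * psum J (u-term (suc (suc m))) ≈ Box (J ℕ.+ suc (suc m)) J + Box (J ℕ.+ suc (suc m)) J
u-psum m zero = ≈-trans (+-cong (+-cong ≈-refl (q^0* _)) ≈-refl) (solve 1 (λ x → (con 0ℚ :+ (con 1ℚ :+ con 1ℚ)) :+ x :* con 0ℚ := con 1ℚ :+ con 1ℚ) ≈-refl _)
u-psum m (suc J) = begin
  (psum (suc J) (u-term m) + u-term m (suc J)) + q^ suc (suc (suc m)) * (psum J (u-term (suc (suc m))) + u-term (suc (suc m)) J)
    ≈⟨ solve 5 (λ a b q c d → (a :+ b) :+ q :* (c :+ d) := (a :+ q :* c) :+ (b :+ q :* d)) ≈-refl _ _ _ _ _ ⟩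
  (psum (suc J) (u-term m) + q^ suc (suc (suc m)) * psum J (u-term (suc (suc m)))) + (u-term m (suc J) + q^ suc (suc (suc m)) * u-term (suc (suc m)) J)
    ≈⟨ +-cong (u-psum m J) (+-cong ≈-refl (≈-trans (≈-sym (*-assoc _ _ _)) (*-cong (≈-trans (q^-+ _ _) (q^-cong e₁)) (≡⇒≈ (cong (λ z → D₂ z J) e₂))))) ⟩
  (Box (J ℕ.+ suc (suc m)) J + Box (J ℕ.+ suc (suc m)) J) + (q^ suc J * D₂ (suc (J ℕ.+ m)) (suc J) + q^ suc (suc (suc (J ℕ.+ m))) * D₂ (suc (suc (J ℕ.+ m))) J)
    ≈⟨ +-cong (≡⇒≈ (cong (λ z → Box z J + Box z J) e₂)) ≈-refl ⟩
  (Box (suc (suc (J ℕ.+ m))) J + Box (suc (suc (J ℕ.+ m))) J) + (q^ suc J * D₂ (suc (J ℕ.+ m)) (suc J) + q^ suc (suc (suc (J ℕ.+ m))) * D₂ (suc (suc (J ℕ.+ m))) J)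
    ≈⟨ ≈-sym (diagonal (suc (J ℕ.+ m)) J) ⟩
  Box (suc (suc (suc (J ℕ.+ m)))) (suc J) + Box (suc (suc (suc (J ℕ.+ m)))) (suc J) ≈⟨ ≡⇒≈ (cong (λ z → Box (suc z) (suc J) + Box (suc z) (suc J)) (sym e₂)) ⟩
  Box (suc J ℕ.+ suc (suc m)) (suc J) + Box (suc J ℕ.+ suc (suc m)) (suc J) ∎
  where
  open SR
  e₂ : J ℕ.+ suc (suc m) ≡ suc (suc (J ℕ.+ m))
  e₂ = trans (ℕP.+-suc J (suc m)) (cong suc (ℕP.+-suc J m))
  e₁ : suc (suc (suc m)) ℕ.+ J ≡ suc (suc (suc (J ℕ.+ m)))
  e₁ = cong (suc ∘ suc ∘ suc) (ℕP.+-comm m J)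

u-rec : ∀ m → u m + q^ suc (suc (suc m)) * u (suc (suc m)) ≈ P̄ + P̄
u-rec m = ⟶-unique
  (⟶-⊕ (⟶-subseq suc ℕP.n≤1+n (∑-has (u-term m) (dec-u m))) (⟶-⊗ (⟶-const _) (∑-has (u-term (suc (suc m))) (dec-u (suc (suc m))))))
  (⟶-cong (λ J → ≈-sym (≈-trans (u-psum m J) (≡⇒≈ (cong (λ z → Box z J + Box z J) (trans (ℕP.+-comm J (suc (suc m))) (sym (ℕP.+-suc (suc m) J)))))))
    ≈-refl (⟶-⊕ (Box-⟶′ (suc m)) (Box-⟶′ (suc m))))

v-rec : ∀ m → v m ≈ q^ suc m * (P̄ - v (suc (suc m)))
v-rec m = begin
  v m ≈⟨ v-u m ⟩
  κ ½ * (q^ suc m * u m) ≈⟨ *-cong ≈-refl (*-cong ≈-refl (≈-trans (solve 2 (λ a b → a := (a :+ b) :- b) ≈-refl _ _) (+-cong (u-rec m) ≈-refl))) ⟩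
  κ ½ * (q^ suc m * ((P̄ + P̄) - q^ suc (suc (suc m)) * u (suc (suc m))))
    ≈⟨ solve 3 (λ q p x → con ½ :* (q :* ((p :+ p) :- x)) := q :* (p :- con ½ :* x)) ≈-refl _ P̄ _ ⟩
  q^ suc m * (P̄ - κ ½ * (q^ suc (suc (suc m)) * u (suc (suc m)))) ≈⟨ *-cong ≈-refl (+-cong ≈-refl (-‿cong (≈-sym (v-u (suc (suc m)))))) ⟩
  q^ suc m * (P̄ - v (suc (suc m))) ∎
  where open SR

-- Obtained by iterating `v-rec` with P̄ divided out: the exponents (m+1) + (m+3) + ... with n + 1
-- summands add up to (n+1)² + (n+1)m.
θ-term : ℕ → ℕ → Series
θ-term m n = σℕ n * q^ (sq (+ suc n) ℕ.+ suc n ℕ.* m)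

dec-θ : ∀ m → Dec (θ-term m)
dec-θ m = dec-ord λ n → ord-⊗ʳ (σℕ n) (ord-≤ (ℕP.≤-trans (ℕP.m≤m+n n (T n)) (ℕP.≤-trans (ℕP.m≤m+n (T (suc n)) _) (ℕP.m≤m+n _ _))) (q^-ord _))

θ : ℕ → Series
θ m = ∑ (θ-term m) (dec-θ m)

θ-rec : ∀ m → θ m ≈ q^ suc m * (1# - θ (suc (suc m)))
θ-rec m = begin
  θ m ≈⟨ ∑-suc (dec-θ m) (dec-suc (dec-θ m)) ⟩
  θ-term m 0 + ∑ (λ n → θ-term m (suc n)) (dec-suc (dec-θ m))
    ≈⟨ +-cong (≈-trans (*-identityˡ _) (q^-cong (cong suc (ℕP.*-identityˡ m)))) (≈-trans (∑-cong _ (dec-⊗ʳ (λ _ → - q^ suc m) (dec-θ (suc (suc m)))) step) (∑-⊗ _ _ (dec-θ (suc (suc m))))) ⟩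
  q^ suc m + (- q^ suc m) * θ (suc (suc m)) ≈⟨ solve 2 (λ q x → q :+ (:- q) :* x := q :* (con 1ℚ :- x)) ≈-refl _ _ ⟩
  q^ suc m * (1# - θ (suc (suc m))) ∎
  where
  open SR
  step : ∀ n → θ-term m (suc n) ≈ (- q^ suc m) * θ-term (suc (suc m)) n
  step n = ≈-trans (*-cong ≈-refl (≈-sym (q^*q^ {suc m} {sq (+ suc n) ℕ.+ suc n ℕ.* suc (suc m)}
      (ℕR.solve 3 (λ m n t → (ℕR.con 1 ℕR.:+ m) ℕR.:+ ((n ℕR.:+ t ℕR.:+ ((ℕR.con 1 ℕR.:+ n) ℕR.:+ (n ℕR.:+ t))) ℕR.:+ ((ℕR.con 1 ℕR.:+ n) ℕR.:* (ℕR.con 2 ℕR.:+ m)))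
         ℕR.:= ((ℕR.con 1 ℕR.:+ n) ℕR.:+ (n ℕR.:+ t)) ℕR.:+ ((ℕR.con 2 ℕR.:+ n) ℕR.:+ ((ℕR.con 1 ℕR.:+ n) ℕR.:+ (n ℕR.:+ t))) ℕR.:+ ((ℕR.con 2 ℕR.:+ n) ℕR.:* m)) refl m n (T n)))))
    (solve 3 (λ s q x → (:- s) :* (q :* x) := (:- q) :* (s :* x)) ≈-refl (σℕ n) (q^ suc m) _)

v-θ : ∀ m → v m ≈ P̄ * θ m
v-θ m = diff-zero (contraction (λ m → v m - P̄ * θ m) (λ m → suc (suc m)) (λ m → m)
  (λ m → ≈-trans (+-cong (+-cong (v-rec m) (-‿cong (*-cong ≈-refl (θ-rec m)))) ≈-refl)
    (solve 4 (λ q p x t → (q :* (p :- x) :- p :* (q :* (con 1ℚ :- t))) :+ q :* (x :- p :* t) := con 0ℚ) ≈-refl (q^ suc m) P̄ (v (suc (suc m))) (θ (suc (suc m))))) m)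

φ-θ : φ ≈ 1# - κ 2ℚ * θ 0
φ-θ = begin
  φ ≈⟨ ∑ℤ-is _ _ ⟩
  ∑ (fold (λ k → σ k * q^ sq k)) df ≈⟨ ≈-trans (∑-⊕ df d⁺ d⁻) (+-cong (∑-suc d⁺ (dec-suc d⁺)) ≈-refl) ⟩
  (1# * q^ 0 + ∑ (λ n → - σℕ n * q^ sq (+ suc n)) (dec-suc d⁺)) + ∑ (λ n → - σℕ n * q^ sq -[1+ n ]) d⁻
    ≈⟨ +-cong (+-cong (≈-trans (*-identityˡ _) q^-0) (≈-trans (∑-cong _ (dneg (dec-θ 0)) (λ n → ≈-trans (*-cong ≈-refl (q^-cong (pad n))) (nl n))) (∑-neg _ (dec-θ 0))))
         (≈-trans (∑-cong _ (dneg (dec-θ 0)) (λ n → ≈-trans (*-cong ≈-refl (q^-cong (trans (sq-neg-suc n) (pad n)))) (nl n))) (∑-neg _ (dec-θ 0))) ⟩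
  (1# + - θ 0) + - θ 0 ≈⟨ solve 1 (λ x → (con 1ℚ :+ :- x) :+ :- x := con 1ℚ :- con 2ℚ :* x) ≈-refl (θ 0) ⟩
  1# - κ 2ℚ * θ 0 ∎
  where
  open SR
  df = dec-fold dec-φ
  d⁺ : Dec (λ n → σℕ n * q^ sq (+ n))
  d⁺ N = proj₁ (dec-φ N) , λ n l → proj₂ (dec-φ N) (+ n) l
  d⁻ : Dec (λ n → - σℕ n * q^ sq -[1+ n ])
  d⁻ N = proj₁ (dec-φ N) , λ n l → proj₂ (dec-φ N) -[1+ n ] (ℕP.m≤n⇒m≤1+n l)
  nl : ∀ n → - σℕ n * q^ (sq (+ suc n) ℕ.+ suc n ℕ.* 0) ≈ - θ-term 0 n
  nl n = solve 2 (λ a b → :- a :* b := :- (a :* b)) ≈-refl _ _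
  pad : ∀ n → sq (+ suc n) ≡ sq (+ suc n) ℕ.+ suc n ℕ.* 0
  pad n = sym (trans (cong (λ z → sq (+ suc n) ℕ.+ z) (ℕP.*-zeroʳ (suc n))) (ℕP.+-identityʳ _))
  sq-neg-suc : ∀ n → sq -[1+ n ] ≡ sq (+ suc n)
  sq-neg-suc n = trans (cong sq (sym (neg1 n))) (sq-neg (+ suc n))
    where
    neg1 : ∀ n → ℤ.suc (~ (+ suc n)) ≡ -[1+ n ]
    neg1 n = refl

-- The case m = 0 of `v-θ` closes on `P̄` itself, so the reciprocal of φ is found from the rank
-- functions, with no product expansion.
φP̄ : φ * P̄ ≈ 1#
φP̄ = begin
  φ * P̄ ≈⟨ *-cong φ-θ ≈-refl ⟩
  (1# - κ 2ℚ * θ 0) * P̄ ≈⟨ solve 2 (λ t p → (con 1ℚ :- con 2ℚ :* t) :* p := p :- con 2ℚ :* (p :* t)) ≈-refl (θ 0) P̄ ⟩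
  P̄ - κ 2ℚ * (P̄ * θ 0) ≈⟨ +-cong ≈-refl (-‿cong (*-cong ≈-refl (≈-sym (v-θ 0)))) ⟩
  (1# + κ 2ℚ * v 0) - κ 2ℚ * v 0 ≈⟨ solve 1 (λ x → (con 1ℚ :+ x) :- x := con 1ℚ) ≈-refl _ ⟩
  1# ∎
  where open SR

-- Abel summation turns weights f on the ranks into weights cf f on v
cf : (ℕ → ℚ) → ℕ → ℚ
cf f zero = 0ℚ
cf f (suc m) = (2ℚ ℚ.* f (suc m) ℚ.- 2ℚ ℚ.* f m) ℚ.- cf f m

v-ord : ∀ m → Ord m (v m)
v-ord m = ord-⊗ʳ (κ ½) (ord-⊕ (rk-ord m) (ord-≤ (ℕP.n≤1+n m) (rk-ord (suc m))))

dec-v : Dec v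
dec-v = dec-ord v-ord

dec-G′ : Dec G
dec-G′ = dec-ord λ m → ord-≈ (≈-sym (G-rk m)) (ord-⊕ (rk-ord m) (ord-- (ord-≤ (ℕP.n≤1+n m) (rk-ord (suc m)))))

dec-κv : (f : ℕ → ℚ) → Dec (λ d → κ (cf f (suc d)) * v (suc d))
dec-κv f = dec-⊗ʳ (λ d → κ (cf f (suc d))) (dec-suc dec-v)

dec-κG : (f : ℕ → ℚ) → Dec (λ d → κ (f (suc d)) * G (suc d))
dec-κG f = dec-⊗ʳ (λ d → κ (f (suc d))) (dec-suc dec-G′)

rank-sum : (f : ℕ → ℚ) → Series
rank-sum f = κ (f 0) * P̄ + κ 2ℚ * ∑ (λ d → κ (cf f (suc d)) * v (suc d)) (dec-κv f)

rank-sum-G : ∀ f → κ (f 0) * (1# + G 0) + κ 2ℚ * ∑ (λ d → κ (f (suc d)) * G (suc d)) (dec-κG f) ≈ rank-sum f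
rank-sum-G f = begin
  κ (f 0) * (1# + G 0) + κ 2ℚ * SG
    ≈⟨ +-cong (*-cong ≈-refl (+-cong ≈-refl (G-rk 0))) (solve 2 (λ a b → con 2ℚ :* a := con 2ℚ :* b :+ (con 2ℚ :* (a :- b))) ≈-refl SG SV) ⟩
  κ (f 0) * (1# + (rk 0 - rk 1)) + (κ 2ℚ * SV + κ 2ℚ * (SG - SV)) ≈⟨ +-cong ≈-refl (+-cong ≈-refl tele) ⟩
  κ (f 0) * (1# + (rk 0 - rk 1)) + (κ 2ℚ * SV + κ 2ℚ * κ (f 0) * rk 1)
    ≈⟨ solve 4 (λ f a b s → f :* (con 1ℚ :+ (a :- b)) :+ (con 2ℚ :* s :+ con 2ℚ :* f :* b) := f :* (con 1ℚ :+ (a :+ b)) :+ con 2ℚ :* s) ≈-refl (κ (f 0)) (rk 0) (rk 1) SV ⟩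
  κ (f 0) * (1# + (rk 0 + rk 1)) + κ 2ℚ * SV ≈⟨ +-cong (*-cong ≈-refl (≈-sym P̄-is)) ≈-refl ⟩
  rank-sum f ∎
  where
  open SR
  SG = ∑ (λ d → κ (f (suc d)) * G (suc d)) (dec-κG f)
  SV = ∑ (λ d → κ (cf f (suc d)) * v (suc d)) (dec-κv f)
  -- The telescoping remainder: by the choice of `cf`, the d-th discrepancy is h (d+1) - h (d+2).
  -- What survives is h 1, equal to 2 f(0) rk 1.
  h : ℕ → Series
  h d = κ (2ℚ ℚ.* f d ℚ.- cf f d) * rk d
  dec-h : Dec h
  dec-h = dec-⊗ʳ (λ d → κ (2ℚ ℚ.* f d ℚ.- cf f d)) (dec-ord rk-ord)
  d₁ : Dec (λ d → h (suc d))
  d₁ = dec-suc dec-h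
  d₂ : Dec (λ d → h (suc (suc d)))
  d₂ = dec-suc d₁
  κ-sub : ∀ a b → κ (a ℚ.- b) ≈ κ a - κ b
  κ-sub a b = ≈-trans (κ-+ a (ℚ.- b)) (+-cong ≈-refl (κ-neg b))
  hcoef : ∀ d → κ (2ℚ ℚ.* f d ℚ.- cf f d) ≈ κ 2ℚ * κ (f d) - κ (cf f d)
  hcoef d = ≈-trans (κ-sub _ _) (+-cong (κ-* 2ℚ (f d)) ≈-refl)
  cfcoef : ∀ d → κ (cf f (suc d)) ≈ (κ 2ℚ * κ (f (suc d)) - κ 2ℚ * κ (f d)) - κ (cf f d)
  cfcoef d = ≈-trans (κ-sub _ _) (+-cong (≈-trans (κ-sub _ _) (+-cong (κ-* 2ℚ _) (-‿cong (κ-* 2ℚ _)))) ≈-refl)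
  termwise : ∀ d → κ 2ℚ * (κ (f (suc d)) * G (suc d) + - (κ (cf f (suc d)) * v (suc d))) ≈ h (suc d) + - h (suc (suc d))
  termwise d = begin
    κ 2ℚ * (κ (f (suc d)) * G (suc d) + - (κ (cf f (suc d)) * v (suc d)))
      ≈⟨ *-cong ≈-refl (+-cong (*-cong ≈-refl (G-rk (suc d))) ≈-refl) ⟩
    κ 2ℚ * (κ (f (suc d)) * (rk (suc d) - rk (suc (suc d))) + - (κ (cf f (suc d)) * (κ ½ * (rk (suc d) + rk (suc (suc d))))))
      ≈⟨ solve 5 (λ f f′ c a b → con 2ℚ :* (f :* (a :- b) :+ :- (c :* (con ½ :* (a :+ b)))) := (con 2ℚ :* f :- c) :* a :+ :- ((con 2ℚ :* f′ :- ((con 2ℚ :* f′ :- con 2ℚ :* f) :- c)) :* b)) ≈-refl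
           (κ (f (suc d))) (κ (f (suc (suc d)))) (κ (cf f (suc d))) (rk (suc d)) (rk (suc (suc d))) ⟩
    (κ 2ℚ * κ (f (suc d)) - κ (cf f (suc d))) * rk (suc d) + - ((κ 2ℚ * κ (f (suc (suc d))) - ((κ 2ℚ * κ (f (suc (suc d))) - κ 2ℚ * κ (f (suc d))) - κ (cf f (suc d)))) * rk (suc (suc d)))
      ≈⟨ +-cong (*-cong (≈-sym (hcoef (suc d))) ≈-refl) (-‿cong (*-cong (≈-trans (+-cong ≈-refl (-‿cong (≈-sym (cfcoef (suc d))))) (≈-sym (hcoef (suc (suc d))))) ≈-refl)) ⟩
    h (suc d) + - h (suc (suc d)) ∎
  tele : κ 2ℚ * (SG - SV) ≈ κ 2ℚ * κ (f 0) * rk 1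
  tele = begin
    κ 2ℚ * (SG - SV) ≈⟨ *-cong ≈-refl (≈-trans (+-cong ≈-refl (≈-sym (∑-neg (dneg (dec-κv f)) (dec-κv f)))) (≈-sym (∑-⊕ (dec-⊕ (dec-κG f) (dneg (dec-κv f))) _ _))) ⟩
    κ 2ℚ * ∑ (λ d → κ (f (suc d)) * G (suc d) + - (κ (cf f (suc d)) * v (suc d))) (dec-⊕ (dec-κG f) (dneg (dec-κv f)))
      ≈⟨ ≈-trans (≈-sym (∑-⊗ _ (dec-⊗ʳ (λ _ → κ 2ℚ) (dec-⊕ (dec-κG f) (dneg (dec-κv f)))) _)) (∑-cong _ (dec-⊕ d₁ (dneg d₂)) termwise) ⟩
    ∑ (λ d → h (suc d) + - h (suc (suc d))) (dec-⊕ d₁ (dneg d₂)) ≈⟨ ≈-trans (∑-⊕ _ d₁ (dneg d₂)) (+-cong (∑-suc d₁ d₂) (∑-neg _ d₂)) ⟩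
    (h 1 + ∑ (λ d → h (suc (suc d))) d₂) + - ∑ (λ d → h (suc (suc d))) d₂ ≈⟨ solve 2 (λ a b → (a :+ b) :+ :- b := a) ≈-refl _ _ ⟩
    h 1 ≈⟨ *-cong (≈-trans (hcoef 1) (+-cong ≈-refl (-‿cong (cfcoef 0)))) ≈-refl ⟩
    (κ 2ℚ * κ (f 1) - ((κ 2ℚ * κ (f 1) - κ 2ℚ * κ (f 0)) - 0#)) * rk 1 ≈⟨ solve 3 (λ a b r → (con 2ℚ :* a :- ((con 2ℚ :* a :- con 2ℚ :* b) :- con 0ℚ)) :* r := con 2ℚ :* b :* r) ≈-refl (κ (f 1)) (κ (f 0)) (rk 1) ⟩
    κ 2ℚ * κ (f 0) * rk 1 ∎

-- Double sums along diagonals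

∑-drop : ∀ {u} k d d′ → ∑ u d ≈ psum k u + ∑ (λ n → u (k ℕ.+ n)) d′
∑-drop zero d d′ = ≈-trans (∑-cong d d′ λ n → ≈-refl) (≈-sym (+-identityˡ _))
∑-drop {u} (suc k) d d′ = ≈-trans (∑-suc d (dec-suc d)) (≈-trans (+-cong ≈-refl (∑-drop k (dec-suc d) d′))
  (≈-trans (≈-sym (+-assoc _ _ _)) (+-cong (≈-sym (psum-suc u k)) ≈-refl)))

-- `g l k` for l < k and 0 otherwise. The recursion runs along the diagonal, so rows and columns are
-- both summed by peeling off first terms.
below : (ℕ → ℕ → Series) → ℕ → ℕ → Series
below g l zero = 0#
below g zero (suc k) = g zero (suc k)
below g (suc l) (suc k) = below (λ i j → g (suc i) (suc j)) l k

below-ord : ∀ {g} N → ∀ l k → Ord N (g l k) → Ord N (below g l k)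
below-ord N l zero o = ord-0#
below-ord N zero (suc k) o = o
below-ord N (suc l) (suc k) o = below-ord N l k o

below-sum : ∀ g k → ∀ d → ∑ (λ l → below g l k) d ≈ psum k (λ l → g l k)
below-sum g zero d = ≈-trans (∑-cong d (dec-⊗ʳ (λ _ → 0#) d) λ n → ≈-sym (zeroˡ _)) (≈-trans (∑-⊗ 0# _ d) (zeroˡ _))
below-sum g (suc k) d = ≈-trans (∑-suc d (dec-suc d)) (≈-trans (+-cong ≈-refl (below-sum (λ i j → g (suc i) (suc j)) k (dec-suc d))) (≈-sym (psum-suc (λ l → g l (suc k)) k)))

below-row : ∀ g l → ∀ d d′ → ∑ (λ k → below g l k) d ≈ ∑ (λ n → g l (l ℕ.+ suc n)) d′
below-row g zero d d′ = ≈-trans (∑-suc d d′) (+-identityˡ _)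
below-row g (suc l) d d′ = ≈-trans (∑-suc d (dec-suc d)) (≈-trans (+-identityˡ _) (below-row (λ i j → g (suc i) (suc j)) l (dec-suc d) d′))

dec²-diag₀ : ∀ {g} → Dec² g → Dec² (λ k d → g (k ℕ.+ d) k)
dec²-diag₀ {g} D N = proj₁ (D N) , λ { k d (inj₁ l) → proj₂ (D N) _ k (inj₂ l) ; k d (inj₂ l) → proj₂ (D N) _ k (inj₁ (ℕP.≤-trans l (ℕP.m≤n+m d k))) }

dec²-diag₁ : ∀ {g} → Dec² g → Dec² (λ l d → g l (l ℕ.+ suc d))
dec²-diag₁ {g} D N = proj₁ (D N) , λ { l d (inj₁ p) → proj₂ (D N) l _ (inj₁ p) ; l d (inj₂ p) → proj₂ (D N) l _ (inj₂ (ℕP.≤-trans p (ℕP.≤-trans (ℕP.n≤1+n d) (ℕP.m≤n+m (suc d) l)))) }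

dec²-below : ∀ {g} → Dec² g → Dec² (below g)
dec²-below {g} D N = proj₁ (D N) , λ i j p → below-ord N i j (proj₂ (D N) i j p)

∑-diagonals : ∀ {g} (D : Dec² g) →
  ∑ (λ l → ∑ (g l) (row D l)) (rows D) ≈
  ∑ (λ d → ∑ (λ k → g (k ℕ.+ d) k) (row (transpose (dec²-diag₀ D)) d)) (rows (transpose (dec²-diag₀ D)))
  + ∑ (λ d → ∑ (λ l → g l (l ℕ.+ suc d)) (row (transpose (dec²-diag₁ D)) d)) (rows (transpose (dec²-diag₁ D)))
∑-diagonals {g} D = begin
  ∑ (λ l → ∑ (g l) (row D l)) (rows D) ≈⟨ ∑-swap D (transpose D) ⟩
  ∑ (λ k → ∑ (λ l → g l k) (row (transpose D) k)) (rows (transpose D))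
    ≈⟨ ∑-cong _ (dec-⊕ (rows DT) (rows D₀)) (λ k → ≈-trans (∑-drop k (row (transpose D) k) (row D₀ k)) (+-cong (≈-sym (below-sum g k (row DT k))) ≈-refl)) ⟩
  ∑ (λ k → ∑ (λ l → below g l k) (row DT k) + ∑ (λ d → g (k ℕ.+ d) k) (row D₀ k)) (dec-⊕ (rows DT) (rows D₀)) ≈⟨ ≈-trans (∑-⊕ _ (rows DT) (rows D₀)) (+-comm _ _) ⟩
  ∑ (λ k → ∑ (λ d → g (k ℕ.+ d) k) (row D₀ k)) (rows D₀) + ∑ (λ k → ∑ (λ l → below g l k) (row DT k)) (rows DT)
    ≈⟨ +-cong (∑-swap D₀ (transpose D₀)) (≈-trans (∑-swap DT (dec²-below D)) (≈-trans (∑-cong _ (rows (dec²-diag₁ D)) (λ l → below-row g l (row (dec²-below D) l) (row (dec²-diag₁ D) l))) (∑-swap (dec²-diag₁ D) (transpose (dec²-diag₁ D))))) ⟩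
  _ ∎
  where
  open SR
  D₀ = dec²-diag₀ D
  DT : Dec² (λ k l → below g l k)
  DT = transpose (dec²-below D)

Part-dec² : Dec² Part
Part-dec² N = N , λ
  { l k (inj₁ p) → ord-≤ (ℕP.m≤n⇒m≤1+n p) (Part-ord l k)
  ; l k (inj₂ p) → ord-≈ (Part-sym k l) (ord-≤ (ℕP.m≤n⇒m≤1+n p) (Part-ord k l)) }

fPart : (ℕ → ℚ) → ℕ → ℕ → Series
fPart f l k = κ (f ℕ.∣ l - k ∣) * Part l k

fPart-dec² : ∀ f → Dec² (fPart f)
fPart-dec² f N = N , λ l k p → ord-⊗ʳ (κ (f ℕ.∣ l - k ∣)) (proj₂ (Part-dec² N) l k p)

rank-sum-Part : ∀ f → κ (f 0) + ∑ (λ l → ∑ (fPart f l) (row (fPart-dec² f) l)) (rows (fPart-dec² f)) ≈ rank-sum f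
rank-sum-Part f = ≈-trans (+-cong ≈-refl (∑-diagonals Df)) (≈-trans (+-cong ≈-refl (+-cong
    (≈-trans (∑-cong (rows (transpose (dec²-diag₀ Df))) d₀ (λ d → ≈-trans (∑-cong _ (dec-⊗ʳ (λ _ → κ (f d)) (dec-G d)) (λ k → *-cong (≡⇒≈ (cong (λ z → κ (f z)) (dist₁ k d))) ≈-refl)) (∑-⊗ _ _ (dec-G d)))) (∑-suc d₀ (dec-κG f)))
    (∑-cong (rows (transpose (dec²-diag₁ Df))) (dec-κG f) (λ d → ≈-trans (∑-cong _ (dec-⊗ʳ (λ _ → κ (f (suc d))) (dec-G (suc d))) (λ k → *-cong (≡⇒≈ (cong (λ z → κ (f z)) (dist₂ k (suc d)))) (Part-sym _ _))) (∑-⊗ _ _ (dec-G (suc d)))))))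
  (≈-trans (solve 3 (λ f g s → f :+ ((f :* g :+ s) :+ s) := f :* (con 1ℚ :+ g) :+ con 2ℚ :* s) ≈-refl (κ (f 0)) (G 0) _) (rank-sum-G f)))
  where
  Df = fPart-dec² f
  d₀ : Dec (λ d → κ (f d) * G d)
  d₀ = dec-⊗ʳ (λ d → κ (f d)) dec-G′
  dist₁ : ∀ k d → ℕ.∣ k ℕ.+ d - k ∣ ≡ d
  dist₁ k d = trans (ℕP.∣-∣-comm (k ℕ.+ d) k) (ℕP.∣m-m+n∣≡n k d)
  dist₂ : ∀ k d → ℕ.∣ k - k ℕ.+ d ∣ ≡ d
  dist₂ k d = ℕP.∣m-m+n∣≡n k d

-- Counting overpartitions by rank

weigh : (Overpartition → ℚ) → List Overpartition → ℚ
weigh F L = sumℚ (map F L)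

weigh-++ : ∀ F xs ys → weigh F (xs ++ ys) ≡ weigh F xs ℚ.+ weigh F ys
weigh-++ F [] ys = sym (ℚP.+-identityˡ _)
weigh-++ F (x ∷ xs) ys = trans (cong (F x ℚ.+_) (weigh-++ F xs ys)) (sym (ℚP.+-assoc (F x) _ _))

weigh-concatMap : ∀ {X : Set} F (h : X → List Overpartition) xs → weigh F (concatMap h xs) ≡ sumℚ (map (λ x → weigh F (h x)) xs)
weigh-concatMap F h [] = refl
weigh-concatMap F h (x ∷ xs) = trans (weigh-++ F (h x) (concatMap h xs)) (cong (weigh F (h x) ℚ.+_) (weigh-concatMap F h xs))

weigh-cong : ∀ {F F′ L} → All (λ π → F π ≡ F′ π) L → weigh F L ≡ weigh F′ L
weigh-cong [] = refl
weigh-cong (p ∷ ps) = cong₂ ℚ._+_ p (weigh-cong ps)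

weigh-map : ∀ F b L → weigh F (map (b ∷_) L) ≡ weigh (λ π → F (b ∷ π)) L
weigh-map F b L = cong sumℚ (sym (LP.map-∘ L))

∑<-cong : ∀ n {f g : ℕ → ℚ} → (∀ k → f k ≡ g k) → ∑< n f ≡ ∑< n g
∑<-cong zero h = refl
∑<-cong (suc n) h = cong₂ ℚ._+_ (h 0) (∑<-cong n (h ∘ suc))

∑<-0 : ∀ n {f : ℕ → ℚ} → (∀ k → f k ≡ 0ℚ) → ∑< n f ≡ 0ℚ
∑<-0 zero h = refl
∑<-0 (suc n) h = trans (cong₂ ℚ._+_ (h 0) (∑<-0 n (h ∘ suc))) refl

∑<-trim : ∀ a b {f : ℕ → ℚ} → (∀ k → b ≤ k → f k ≡ 0ℚ) → ∑< (b ℕ.+ a) f ≡ ∑< b f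
∑<-trim a zero h = ∑<-0 a (λ k → h k z≤n)
∑<-trim a (suc b) {f} h = cong (f 0 ℚ.+_) (∑<-trim a b (λ k l → h (suc k) (s≤s l)))

∑<-double : ∀ n (f : ℕ → ℚ) → ∑< n (λ k → 2ℚ ℚ.* f k) ≡ 2ℚ ℚ.* ∑< n f
∑<-double zero f = refl
∑<-double (suc n) f = trans (cong (2ℚ ℚ.* f 0 ℚ.+_) (∑<-double n (f ∘ suc))) (sym (ℚP.*-distribˡ-+ 2ℚ (f 0) _))

bounded : ∀ m n → All (λ π → largestPart π ≤ m) (gen m n)
bounded zero zero = z≤n ∷ []
bounded zero (suc n) = []
bounded (suc m) n = AllP.++⁺ (All.map ℕP.m≤n⇒m≤1+n (bounded m n)) (AllP.concat⁺ (AllP.map⁺ (AllP.applyUpTo⁺₂ _ n block)))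
  where
  block : ∀ k → All (λ π → largestPart π ≤ suc m) (if (suc k ℕ.* suc m ≤ᵇ n)
      then concatMap (λ b → map (blk (suc m) (suc k) b ∷_) (gen m (n ∸ suc k ℕ.* suc m))) (false ∷ true ∷ []) else [])
  block k with suc k ℕ.* suc m ≤ᵇ n
  ... | false = []
  ... | true = AllP.concat⁺ (AllP.map⁺ {f = λ b → map (blk (suc m) (suc k) b ∷_) (gen m (n ∸ suc k ℕ.* suc m))} (each false ∷ each true ∷ []))
    where
    each : ∀ b → All (λ π → largestPart π ≤ suc m) (map (blk (suc m) (suc k) b ∷_) (gen m (n ∸ suc k ℕ.* suc m)))
    each b = AllP.map⁺ (All.map (λ l → ℕP.⊔-lub ℕP.≤-refl (ℕP.m≤n⇒m≤1+n l)) (bounded m (n ∸ suc k ℕ.* suc m)))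

-- overpartitions with parts at most m, weighted by the number of parts
Hn : ℕ → (ℕ → ℚ) → Series
Hn m ω n = weigh (λ π → ω (numParts π)) (gen m n)

-- weighted count of the part suc m occurring suc k times, for all k
Tn-term : ℕ → (ℕ → ℚ) → ℕ → ℕ → ℚ
Tn-term m ω n k = if (suc k ℕ.* suc m ≤ᵇ n) then Hn m (λ p → ω (suc k ℕ.+ p)) (n ∸ suc k ℕ.* suc m) else 0ℚ

Tn : ℕ → (ℕ → ℚ) → Series
Tn m ω n = ∑< n (Tn-term m ω n)

weigh-gen : ∀ (χ : ℕ → ℕ → ℚ) m n → weigh (λ π → χ (largestPart π) (numParts π)) (gen (suc m) n) ≡
  weigh (λ π → χ (largestPart π) (numParts π)) (gen m n) ℚ.+ 2ℚ ℚ.* Tn m (χ (suc m)) n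
weigh-gen χ m n = trans (weigh-++ F (gen m n) _) (cong (weigh F (gen m n) ℚ.+_)
  (trans (weigh-concatMap F _ (upTo n)) (trans (sum-map-upTo _ n) (trans (∑<-cong n block) (∑<-double n _)))))
  where
  F : Overpartition → ℚ
  F π = χ (largestPart π) (numParts π)
  twofold : ∀ x → x ℚ.+ (x ℚ.+ 0ℚ) ≡ 2ℚ ℚ.* x
  twofold = ℚR.solve 1 (λ x → x ℚR.:+ (x ℚR.:+ ℚR.con 0ℚ) ℚR.:= ℚR.con 2ℚ ℚR.:* x) refl
  block : ∀ k → weigh F (if (suc k ℕ.* suc m ≤ᵇ n)
      then concatMap (λ b → map (blk (suc m) (suc k) b ∷_) (gen m (n ∸ suc k ℕ.* suc m))) (false ∷ true ∷ []) else [])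
      ≡ 2ℚ ℚ.* Tn-term m (χ (suc m)) n k
  block k with suc k ℕ.* suc m ≤ᵇ n
  ... | false = refl
  ... | true = trans (weigh-concatMap F (λ b → map (blk (suc m) (suc k) b ∷_) L) (false ∷ true ∷ [])) (trans
        (cong₂ (λ x y → x ℚ.+ (y ℚ.+ 0ℚ)) (each false) (each true)) (twofold (weigh (λ π → χ (suc m) (suc k ℕ.+ numParts π)) L)))
    where
    L = gen m (n ∸ suc k ℕ.* suc m)
    each : ∀ b → weigh F (map (blk (suc m) (suc k) b ∷_) L) ≡ weigh (λ π → χ (suc m) (suc k ℕ.+ numParts π)) L
    each b = trans (weigh-map F _ L) (weigh-cong (All.map (λ {π} l → cong (λ z → χ z (suc k ℕ.+ numParts π)) (ℕP.m≥n⇒m⊔n≡m (ℕP.m≤n⇒m≤1+n l))) (bounded m (n ∸ suc k ℕ.* suc m))))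

≤ᵇ-true : ∀ {a b} → a ≤ b → (a ≤ᵇ b) ≡ true
≤ᵇ-true {a} {b} l with a ≤ᵇ b | ℕP.≤⇒≤ᵇ l
... | true | _ = refl

≤ᵇ-false : ∀ {a b} → b < a → (a ≤ᵇ b) ≡ false
≤ᵇ-false {a} {b} l with a ≤ᵇ b in eq
... | false = refl
... | true with () ← ℕP.<⇒≱ l (ℕP.≤ᵇ⇒≤ a b (subst IsTrue (sym eq) _))

Tn-small : ∀ m ω n → n < suc m → Tn m ω n ≡ 0ℚ
Tn-small m ω n l = ∑<-0 n λ k → cong (λ b → if b then Hn m (λ p → ω (suc k ℕ.+ p)) (n ∸ suc k ℕ.* suc m) else 0ℚ)
  (≤ᵇ-false (ℕP.<-≤-trans l (ℕP.m≤m+n (suc m) (k ℕ.* suc m))))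

-- One copy of the part is removed. The range of multiplicities depends on the size, so the terms in
-- which the part no longer fits are trimmed off.
Tn-shift : ∀ m ω n → Tn m ω (suc m ℕ.+ n) ≡ Hn m (ω ∘ suc) n ℚ.+ Tn m (ω ∘ suc) n
Tn-shift m ω n = cong₂ ℚ._+_ head (trans (cong (λ z → ∑< z (λ k → Tn-term m ω (suc m ℕ.+ n) (suc k))) (ℕP.+-comm m n))
  (trans (∑<-cong (n ℕ.+ m) step) (∑<-trim m n zeroes)))
  where
  head : Tn-term m ω (suc m ℕ.+ n) 0 ≡ Hn m (ω ∘ suc) n
  head = trans (cong (λ b → if b then Hn m (ω ∘ suc) (suc m ℕ.+ n ∸ 1 ℕ.* suc m) else 0ℚ)
      (≤ᵇ-true (ℕP.≤-trans (ℕP.≤-reflexive (ℕP.*-identityˡ (suc m))) (ℕP.m≤m+n (suc m) n))))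
    (cong (Hn m (ω ∘ suc)) (trans (cong (λ z → suc m ℕ.+ n ∸ z) (ℕP.*-identityˡ (suc m))) (ℕP.m+n∸m≡n (suc m) n)))
  zeroes : ∀ k → n ≤ k → Tn-term m (ω ∘ suc) n k ≡ 0ℚ
  zeroes k l = cong (λ b → if b then Hn m (λ p → ω (suc (suc k ℕ.+ p))) (n ∸ suc k ℕ.* suc m) else 0ℚ)
    (≤ᵇ-false (ℕP.<-≤-trans (s≤s l) (ℕP.m≤m*n (suc k) (suc m))))
  step : ∀ k → Tn-term m ω (suc m ℕ.+ n) (suc k) ≡ Tn-term m (ω ∘ suc) n k
  step k with suc k ℕ.* suc m ℕP.≤? n
  ... | yes p rewrite ≤ᵇ-true p | ≤ᵇ-true (ℕP.+-monoʳ-≤ (suc m) p) = cong (Hn m (λ p → ω (suc (suc k) ℕ.+ p))) (ℕP.[m+n]∸[m+o]≡n∸o (suc m) n (suc k ℕ.* suc m))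
  ... | no p rewrite ≤ᵇ-false (ℕP.≰⇒> p) | ≤ᵇ-false (ℕP.+-monoʳ-< (suc m) (ℕP.≰⇒> p)) = refl

q^-small : ∀ e f n → n < e → (q^ e * f) n ≡ 0ℚ
q^-small e f n l = ord-q^ e f n l

-- After removal of one copy of the part m + 1, either none is left or the same count recurs; the
-- number of parts, and with it the weight, moves by one.
Tn-rec : ∀ m ω → Tn m ω ≈ q^ suc m * (Hn m (ω ∘ suc) + Tn m (ω ∘ suc))
Tn-rec m ω = mk go
  where
  go : ∀ n → Tn m ω n ≡ (q^ suc m * (Hn m (ω ∘ suc) + Tn m (ω ∘ suc))) n
  go n with suc m ℕP.≤? n
  ... | no p = trans (Tn-small m ω n (ℕP.≰⇒> p)) (sym (q^-small (suc m) _ n (ℕP.≰⇒> p)))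
  ... | yes p = trans (cong (Tn m ω) (sym e)) (trans (Tn-shift m ω (n ∸ suc m)) (trans (sym (+-at (Hn m (ω ∘ suc)) (Tn m (ω ∘ suc)) (n ∸ suc m)))
      (trans (sym (q^-at-+ (suc m) _ (n ∸ suc m))) (cong (q^ suc m * (Hn m (ω ∘ suc) + Tn m (ω ∘ suc))) e))))
    where e = ℕP.m+[n∸m]≡n p

κ2-at : ∀ a n → (κ 2ℚ * a) n ≡ 2ℚ ℚ.* a n
κ2-at a n = κ-at 2ℚ a n

Hn-suc : ∀ m ω → Hn (suc m) ω ≈ Hn m ω + κ 2ℚ * Tn m ω
Hn-suc m ω = mk λ n → trans (weigh-gen (λ _ → ω) m n) (sym (trans (+-at (Hn m ω) (κ 2ℚ * Tn m ω) n) (cong (Hn m ω n ℚ.+_) (κ2-at (Tn m ω) n))))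

-- The recursion of `Box`, with the shift of the weight in the role of the bound on the number of
-- parts.
Hn-rec : ∀ m ω → Hn (suc m) ω ≈ Hn m ω + q^ suc m * (Hn (suc m) (ω ∘ suc) + Hn m (ω ∘ suc))
Hn-rec m ω = begin
  Hn (suc m) ω ≈⟨ Hn-suc m ω ⟩
  Hn m ω + κ 2ℚ * Tn m ω ≈⟨ +-cong ≈-refl (*-cong ≈-refl (Tn-rec m ω)) ⟩
  Hn m ω + κ 2ℚ * (q^ suc m * (h + t′)) ≈⟨ solve 4 (λ a q h t → a :+ con 2ℚ :* (q :* (h :+ t)) := a :+ q :* ((h :+ con 2ℚ :* t) :+ h)) ≈-refl (Hn m ω) (q^ suc m) h t′ ⟩
  Hn m ω + q^ suc m * ((h + κ 2ℚ * t′) + h) ≈⟨ +-cong ≈-refl (*-cong ≈-refl (+-cong (≈-sym (Hn-suc m (ω ∘ suc))) ≈-refl)) ⟩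
  Hn m ω + q^ suc m * (Hn (suc m) (ω ∘ suc) + h) ∎
  where
  open SR
  h = Hn m (ω ∘ suc)
  t′ = Tn m (ω ∘ suc)

-- overpartitions with parts at most l and exactly k parts
bx : ℕ → ℕ → Series
bx l zero = 1#
bx l (suc k) = Box l (suc k) - Box l k

bx-ord : ∀ l k → Ord k (bx l k)
bx-ord l zero n ()
bx-ord zero (suc k) = ord-≈ (≈-sym (-‿inverseʳ _)) ord-0#
bx-ord (suc l) (suc k) = ord-≈ (≈-sym (≈-trans (+-cong (Box-conj l k) ≈-refl) (solve 2 (λ a b → (a :+ b) :- a := b) ≈-refl (Box (suc l) k) _))) (ord-q^ (suc k) _)

bx-rec : ∀ l k → bx (suc l) (suc k) ≈ bx l (suc k) + q^ suc l * (bx (suc l) k + bx l k)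
bx-rec l zero = ≈-trans (+-cong ≈-refl (-‿cong (≈-sym (Box-0 l)))) (≈-trans (solve 4 (λ a q c b → (a :+ q :* (con 1ℚ :+ b)) :- b := (a :- b) :+ q :* (con 1ℚ :+ b)) ≈-refl (Box l 1) (q^ suc l) 1# (Box l 0))
  (+-cong ≈-refl (*-cong ≈-refl (+-cong ≈-refl (Box-0 l)))))
bx-rec l (suc k) = solve 6 (λ q a b c d e → (a :+ q :* ((c :+ q :* (d :+ e)) :+ c)) :- (c :+ q :* (d :+ e)) := (a :- c) :+ q :* (((c :+ q :* (d :+ e)) :- d) :+ (c :- e))) ≈-refl
  (q^ suc l) (Box l (suc (suc k))) 1# (Box l (suc k)) (Box (suc l) k) (Box l k)

dec-bx : ∀ (ω : ℕ → ℚ) l → Dec (λ k → κ (ω k) * bx l k)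
dec-bx ω l = dec-⊗ʳ (λ k → κ (ω k)) (dec-ord (bx-ord l))

Bs : ℕ → (ℕ → ℚ) → Series
Bs l ω = ∑ (λ k → κ (ω k) * bx l k) (dec-bx ω l)

Bs-rec : ∀ m ω → Bs (suc m) ω ≈ Bs m ω + q^ suc m * (Bs (suc m) (ω ∘ suc) + Bs m (ω ∘ suc))
Bs-rec m ω = begin
  Bs (suc m) ω ≈⟨ ∑-suc (dec-bx ω (suc m)) d₁ ⟩
  κ (ω 0) * 1# + ∑ (λ k → κ (ω (suc k)) * bx (suc m) (suc k)) d₁
    ≈⟨ +-cong ≈-refl (≈-trans (∑-cong _ (dec-⊕ d₂ (dec-⊗ʳ (λ _ → q^ suc m) (dec-⊕ (dec-bx (ω ∘ suc) (suc m)) (dec-bx (ω ∘ suc) m))))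
        (λ k → ≈-trans (*-cong ≈-refl (bx-rec m k)) (solve 5 (λ w a q b c → w :* (a :+ q :* (b :+ c)) := w :* a :+ q :* (w :* b :+ w :* c)) ≈-refl (κ (ω (suc k))) _ (q^ suc m) (bx (suc m) k) (bx m k))))
      (≈-trans (∑-⊕ _ d₂ (dec-⊗ʳ (λ _ → q^ suc m) (dec-⊕ (dec-bx (ω ∘ suc) (suc m)) (dec-bx (ω ∘ suc) m)))) (+-cong ≈-refl (≈-trans (∑-⊗ _ _ (dec-⊕ (dec-bx (ω ∘ suc) (suc m)) (dec-bx (ω ∘ suc) m))) (*-cong ≈-refl (∑-⊕ _ _ _)))))) ⟩
  κ (ω 0) * 1# + (∑ (λ k → κ (ω (suc k)) * bx m (suc k)) d₂ + q^ suc m * (Bs (suc m) (ω ∘ suc) + Bs m (ω ∘ suc))) ≈⟨ ≈-sym (+-assoc _ _ _) ⟩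
  (κ (ω 0) * 1# + ∑ (λ k → κ (ω (suc k)) * bx m (suc k)) d₂) + q^ suc m * (Bs (suc m) (ω ∘ suc) + Bs m (ω ∘ suc))
    ≈⟨ +-cong (≈-sym (∑-suc (dec-bx ω m) d₂)) ≈-refl ⟩
  Bs m ω + q^ suc m * (Bs (suc m) (ω ∘ suc) + Bs m (ω ∘ suc)) ∎
  where
  open SR
  d₁ : Dec (λ k → κ (ω (suc k)) * bx (suc m) (suc k))
  d₁ = dec-suc (dec-bx ω (suc m))
  d₂ : Dec (λ k → κ (ω (suc k)) * bx m (suc k))
  d₂ = dec-suc (dec-bx ω m)

-- Both sides obey one recursion, in which the difference for ω is q^(l+1) times the difference for
-- the shifted weight. It therefore has arbitrarily high order, provided that the induction covers
-- all weights at once.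
Hn-Bs : ∀ l ω → Hn l ω ≈ Bs l ω
Hn-Bs zero ω = ≈-trans base (≈-sym (≈-trans (∑-suc (dec-bx ω 0) (dec-suc (dec-bx ω 0))) (≈-trans (+-cong (*-comm _ _) (≈-trans (∑-cong _ (dec-⊗ʳ (λ _ → 0#) (dec-suc (dec-bx ω 0))) (λ k → ≈-trans (*-cong ≈-refl (-‿inverseʳ 1#)) (≈-trans (zeroʳ _) (≈-sym (zeroˡ _))))) (≈-trans (∑-⊗ 0# _ (dec-suc (dec-bx ω 0))) (zeroˡ _)))) (≈-trans (+-identityʳ _) (*-identityˡ _)))))
  where
  base : Hn 0 ω ≈ κ (ω 0)
  base = mk λ { zero → trans (ℚP.+-identityʳ (ω 0)) (sym (κ-at-0 (ω 0))) ; (suc n) → sym (trans (cong (λ z → z) (trans (sym (at (≈-trans (*-comm (κ (ω 0)) 1#) (*-identityˡ _)) (suc n))) (trans (κ-at (ω 0) 1# (suc n)) (cong (ω 0 ℚ.*_) (1-at-suc n))))) (ℚP.*-zeroʳ (ω 0))) }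
    where
    1-at-suc : ∀ n → 1# (suc n) ≡ 0ℚ
    1-at-suc n = trans (sym (at one-is-1 (suc n))) refl
Hn-Bs (suc l) ω = agree⇒≈ λ N n n<N → ord-diff (go N ω) n n<N
  where
  ord-diff : ∀ {N a b} → Ord N (a - b) → Agree N a b
  ord-diff {N} {a} {b} o n n<N = trans (at (solve 2 (λ a b → a := (a :- b) :+ b) ≈-refl a b) n) (trans (+-at (a - b) b n) (trans (cong (ℚ._+ b n) (o n n<N)) (ℚP.+-identityˡ (b n))))
  go : ∀ N ω → Ord N (Hn (suc l) ω - Bs (suc l) ω)
  go zero ω n ()
  go (suc N) ω = ord-≈ (≈-sym (begin
      Hn (suc l) ω - Bs (suc l) ω ≈⟨ +-cong (≈-trans (Hn-rec l ω) (+-cong (Hn-Bs l ω) (*-cong ≈-refl (+-cong ≈-refl (Hn-Bs l (ω ∘ suc)))))) (-‿cong (Bs-rec l ω)) ⟩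
      (Bs l ω + q^ suc l * (Hn (suc l) (ω ∘ suc) + Bs l (ω ∘ suc))) - (Bs l ω + q^ suc l * (Bs (suc l) (ω ∘ suc) + Bs l (ω ∘ suc)))
        ≈⟨ solve 5 (λ a q h b c → (a :+ q :* (h :+ c)) :- (a :+ q :* (b :+ c)) := q :* (h :- b)) ≈-refl _ (q^ suc l) _ _ _ ⟩
      q^ suc l * (Hn (suc l) (ω ∘ suc) - Bs (suc l) (ω ∘ suc)) ∎))
    (ord-≤ (s≤s (ℕP.m≤n+m N l)) (ord-q^* (suc l) (go N (ω ∘ suc))))
    where open SR

module Rank (g : ℤ → ℚ) where
  gPart : ℕ → ℕ → Series
  gPart l k = κ (g (+ l ℤ.- + k)) * Part l k

  gPart-dec² : Dec² gPart
  gPart-dec² N = N , λ l k p → ord-⊗ʳ (κ (g (+ l ℤ.- + k))) (proj₂ (Part-dec² N) l k p)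

  rank-diff : ∀ l k → + suc l ℤ.- + suc k ≡ + l ℤ.- + k
  rank-diff l k = trans (ℤP.m-n≡m⊖n (suc l) (suc k)) (trans (ℤP.[1+m]⊖[1+n]≡m⊖n l k) (sym (ℤP.m-n≡m⊖n l k)))

  new-largest : ∀ l → κ 2ℚ * Tn l (λ k → g (+ suc l ℤ.- + k)) ≈ ∑ (gPart l) (row gPart-dec² l)
  new-largest l = begin
    κ 2ℚ * Tn l ω ≈⟨ solve 2 (λ a b → b := (a :+ b) :- a) ≈-refl (Hn l ω) _ ⟩
    (Hn l ω + κ 2ℚ * Tn l ω) - Hn l ω ≈⟨ +-cong (≈-trans (≈-sym (Hn-suc l ω)) (≈-trans (Hn-Bs (suc l) ω) (∑-suc (dec-bx ω (suc l)) d₁))) (-‿cong (≈-trans (Hn-Bs l ω) (∑-suc (dec-bx ω l) d₂))) ⟩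
    (κ (ω 0) * 1# + ∑ u₁ d₁) - (κ (ω 0) * 1# + ∑ u₂ d₂) ≈⟨ solve 3 (λ a b c → (a :+ b) :- (a :+ c) := b :- c) ≈-refl _ _ _ ⟩
    ∑ u₁ d₁ - ∑ u₂ d₂ ≈⟨ ≈-sym (≈-trans (∑-⊕ (dec-⊕ d₁ (dneg d₂)) d₁ (dneg d₂)) (+-cong ≈-refl (∑-neg _ d₂))) ⟩
    ∑ (λ k → u₁ k + - u₂ k) (dec-⊕ d₁ (dneg d₂))
      ≈⟨ ∑-cong _ _ (λ k → ≈-trans (solve 5 (λ w a b c d → w :* (a :- b) :+ :- (w :* (c :- d)) := w :* ((a :- c) :- (b :- d))) ≈-refl _ (Box (suc l) (suc k)) (Box (suc l) k) (Box l (suc k)) (Box l k))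
           (*-cong (≡⇒≈ (cong (λ z → κ (g z)) (rank-diff l k))) ≈-refl)) ⟩
    ∑ (gPart l) (row gPart-dec² l) ∎
    where
    open SR
    ω : ℕ → ℚ
    ω k = g (+ suc l ℤ.- + k)
    u₁ u₂ : ℕ → Series
    u₁ k = κ (ω (suc k)) * bx (suc l) (suc k)
    u₂ k = κ (ω (suc k)) * bx l (suc k)
    d₁ : Dec u₁
    d₁ = dec-suc (dec-bx ω (suc l))
    d₂ : Dec u₂
    d₂ = dec-suc (dec-bx ω l)

  weigh-rank : ∀ m n → weigh (λ π → g (rank π)) (gen m n) ≡ (κ (g (+ 0)) + psum m (λ l → ∑ (gPart l) (row gPart-dec² l))) n
  weigh-rank zero zero = trans (ℚP.+-identityʳ (g (+ 0))) (sym (trans (+-at (κ (g (+ 0))) 0# 0) (trans (cong₂ ℚ._+_ (κ-at-0 (g (+ 0))) (0-at 0)) (ℚP.+-identityʳ (g (+ 0))))))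
  weigh-rank zero (suc n) = sym (trans (+-at (κ (g (+ 0))) 0# (suc n)) (trans (cong₂ ℚ._+_ (trans (sym (at (≈-trans (*-comm (κ (g (+ 0))) 1#) (*-identityˡ _)) (suc n))) (trans (κ-at (g (+ 0)) 1# (suc n)) (trans (cong (g (+ 0) ℚ.*_) (sym (at one-is-1 (suc n)))) (ℚP.*-zeroʳ (g (+ 0)))))) (0-at (suc n))) refl))
  weigh-rank (suc m) n = trans (weigh-gen (λ l k → g (+ l ℤ.- + k)) m n) (trans (cong₂ ℚ._+_ (weigh-rank m n) (trans (sym (κ2-at (Tn m (λ k → g (+ suc m ℤ.- + k))) n)) (at (new-largest m) n)))
    (trans (sym (+-at _ _ n)) (at (+-assoc (κ (g (+ 0))) (psum m (λ l → ∑ (gPart l) (row gPart-dec² l))) _) n)))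

  total : Series
  total n = weigh (λ π → g (rank π)) (overpartitions n)

  row-ord : ∀ l → Ord (suc l) (∑ (gPart l) (row gPart-dec² l))
  row-ord l = ∑-ord _ (suc l) λ k → ord-⊗ʳ (κ (g (+ l ℤ.- + k))) (Part-ord l k)

  total-is : total ≈ κ (g (+ 0)) + ∑ (λ l → ∑ (gPart l) (row gPart-dec² l)) (rows gPart-dec²)
  total-is = mk λ n → trans (weigh-rank n n) (trans (+-at _ _ n) (trans (cong (κ (g (+ 0)) n ℚ.+_) (rest n)) (sym (+-at _ _ n))))
    where
    rest : ∀ n → psum n (λ l → ∑ (gPart l) (row gPart-dec² l)) n ≡ ∑ (λ l → ∑ (gPart l) (row gPart-dec² l)) (rows gPart-dec²) n
    rest n = trans (sym (ℚP.+-identityʳ _)) (trans (cong (psum n (λ l → ∑ (gPart l) (row gPart-dec² l)) n ℚ.+_) (sym (row-ord n n ℕP.≤-refl)))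
      (trans (sym (+-at _ _ n)) (sym (∑-approx _ (rows gPart-dec²) (suc n) (suc n) ℕP.≤-refl n ℕP.≤-refl))))

even-part : (ℤ → ℚ) → ℕ → ℚ
even-part g m = ½ ℚ.* (g (+ m) ℚ.+ g (ℤ.- + m))

-- Since `Part` is symmetric, the sum may be averaged with its transpose. This replaces g by its
-- even part, which depends only on the distance of l and k.
total-rank-sum : ∀ g → Rank.total g ≈ rank-sum (even-part g)
total-rank-sum g = begin
  Rank.total g ≈⟨ total-is ⟩
  κ (g (+ 0)) + S ≈⟨ solve 2 (λ a s → a :+ s := a :+ con ½ :* (s :+ s)) ≈-refl _ S ⟩
  κ (g (+ 0)) + κ ½ * (S + S) ≈⟨ +-cong (≡⇒≈ (cong κ (ℚR.solve 1 (λ x → x ℚR.:= ℚR.con ½ ℚR.:* (x ℚR.:+ x)) refl (g (+ 0))))) (*-cong ≈-refl (+-cong ≈-refl (∑-swap gPart-dec² (transpose gPart-dec²)))) ⟩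
  κ (f 0) + κ ½ * (S + ∑ (λ l → ∑ (λ k → gPart k l) (row (transpose gPart-dec²) l)) (rows (transpose gPart-dec²)))
    ≈⟨ +-cong ≈-refl (≈-trans (*-cong ≈-refl (≈-sym (∑-⊕ d₁ _ _))) (≈-trans (≈-sym (∑-⊗ _ (dec-⊗ʳ (λ _ → κ ½) d₁) d₁)) (∑-cong _ (rows (fPart-dec² f)) inner))) ⟩
  κ (f 0) + ∑ (λ l → ∑ (fPart f l) (row (fPart-dec² f) l)) (rows (fPart-dec² f)) ≈⟨ rank-sum-Part f ⟩
  rank-sum f ∎
  where
  open SR
  open Rank g
  f = even-part g
  S = ∑ (λ l → ∑ (gPart l) (row gPart-dec² l)) (rows gPart-dec²)
  d₁ : Dec (λ l → ∑ (gPart l) (row gPart-dec² l) + ∑ (λ k → gPart k l) (row (transpose gPart-dec²) l))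
  d₁ = dec-⊕ (rows gPart-dec²) (rows (transpose gPart-dec²))
  sym-diff : ∀ l k → g (+ l ℤ.- + k) ℚ.+ g (+ k ℤ.- + l) ≡ g (+ ℕ.∣ l - k ∣) ℚ.+ g (ℤ.- + ℕ.∣ l - k ∣)
  sym-diff zero k = trans (ℚP.+-comm (g (+ 0 ℤ.- + k)) (g (+ k ℤ.- + 0))) (cong₂ (λ x y → g x ℚ.+ g y) (ℤP.+-identityʳ (+ k)) (ℤP.+-identityˡ (ℤ.- + k)))
  sym-diff (suc l) zero = cong₂ (λ x y → g x ℚ.+ g y) (ℤP.+-identityʳ (+ suc l)) (ℤP.+-identityˡ (ℤ.- + suc l))
  sym-diff (suc l) (suc k) = trans (cong₂ (λ x y → g x ℚ.+ g y) (rank-diff l k) (rank-diff k l)) (sym-diff l k)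
  inner : ∀ l → κ ½ * (∑ (gPart l) (row gPart-dec² l) + ∑ (λ k → gPart k l) (row (transpose gPart-dec²) l)) ≈ ∑ (fPart f l) (row (fPart-dec² f) l)
  inner l = ≈-trans (*-cong ≈-refl (≈-sym (∑-⊕ d₂ _ _))) (≈-trans (≈-sym (∑-⊗ _ (dec-⊗ʳ (λ _ → κ ½) d₂) d₂)) (∑-cong _ _ λ k →
    ≈-trans (*-cong ≈-refl (+-cong ≈-refl (*-cong ≈-refl (Part-sym k l)))) (≈-trans (solve 4 (λ h a b x → h :* (a :* x :+ b :* x) := (h :* (a :+ b)) :* x) ≈-refl (κ ½) _ _ (Part l k))
      (*-cong (≈-trans (*-cong ≈-refl (≈-sym (κ-+ _ _))) (≈-trans (≈-sym (κ-* ½ _)) (≡⇒≈ (cong (λ z → κ (½ ℚ.* z)) (sym-diff l k))))) ≈-refl))))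
    where
    d₂ : Dec (λ k → gPart l k + gPart k l)
    d₂ = dec-⊕ (row gPart-dec² l) (row (transpose gPart-dec²) l)

-- Trisection of the rank functions

a : Series
a = 𝐒 φ

comp₀-κ* : ∀ c f → comp₀ (κ c * f) ≈ κ c * comp₀ f
comp₀-κ* c f = ≈-trans (comp₀-cong (*-cong (≈-sym (𝐒-κ c)) ≈-refl)) (comp₀-𝐒* (κ c) f)
comp₁-κ* : ∀ c f → comp₁ (κ c * f) ≈ κ c * comp₁ f
comp₁-κ* c f = ≈-trans (comp₁-cong (*-cong (≈-sym (𝐒-κ c)) ≈-refl)) (comp₁-𝐒* (κ c) f)
comp₂-κ* : ∀ c f → comp₂ (κ c * f) ≈ κ c * comp₂ f
comp₂-κ* c f = ≈-trans (comp₂-cong (*-cong (≈-sym (𝐒-κ c)) ≈-refl)) (comp₂-𝐒* (κ c) f)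

-- Squares are never 2 modulo 3, so each component of a product with φ involves only two components
-- of the other factor.
φ* : ∀ f → φ * f ≈ 𝐒 a * f - κ 2ℚ * (q^ 1 * (𝐒 b * f))
φ* f = ≈-trans (*-cong φ-dissection ≈-refl) (solve 4 (λ a q b f → (a :- con 2ℚ :* (q :* b)) :* f := a :* f :- con 2ℚ :* (q :* (b :* f))) ≈-refl (𝐒 a) (q^ 1) (𝐒 b) f)

φ*₀ : ∀ f → comp₀ (φ * f) ≈ a * comp₀ f - κ 2ℚ * (q^ 1 * (b * comp₂ f))
φ*₀ f = ≈-trans (comp₀-cong (φ* f)) (≈-trans (comp₀-+ _ _) (+-cong (comp₀-𝐒* a f) (≈-trans (comp₀-neg _) (-‿cong (≈-trans (comp₀-κ* 2ℚ _) (*-cong ≈-refl (≈-trans (comp₀-q* _) (*-cong ≈-refl (comp₂-𝐒* b f)))))))))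
φ*₁ : ∀ f → comp₁ (φ * f) ≈ a * comp₁ f - κ 2ℚ * (b * comp₀ f)
φ*₁ f = ≈-trans (comp₁-cong (φ* f)) (≈-trans (comp₁-+ _ _) (+-cong (comp₁-𝐒* a f) (≈-trans (comp₁-neg _) (-‿cong (≈-trans (comp₁-κ* 2ℚ _) (*-cong ≈-refl (≈-trans (comp₁-q* _) (comp₀-𝐒* b f))))))))
φ*₂ : ∀ f → comp₂ (φ * f) ≈ a * comp₂ f - κ 2ℚ * (b * comp₁ f)
φ*₂ f = ≈-trans (comp₂-cong (φ* f)) (≈-trans (comp₂-+ _ _) (+-cong (comp₂-𝐒* a f) (≈-trans (comp₂-neg _) (-‿cong (≈-trans (comp₂-κ* 2ℚ _) (*-cong ≈-refl (≈-trans (comp₂-q* _) (comp₁-𝐒* b f))))))))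

comp₁-κ : ∀ c → comp₁ (κ c) ≈ 0#
comp₁-κ c = ≈-trans (comp₁-cong (≈-sym (𝐒-κ c))) (comp₁-𝐒 (κ c))
comp₂-κ : ∀ c → comp₂ (κ c) ≈ 0#
comp₂-κ c = ≈-trans (comp₂-cong (≈-sym (𝐒-κ c))) (comp₂-𝐒 (κ c))
comp₀-κ : ∀ c → comp₀ (κ c) ≈ κ c
comp₀-κ c = ≈-trans (comp₀-cong (≈-sym (𝐒-κ c))) (comp₀-𝐒 (κ c))

P₀ P₁ P₂ : Series
P₀ = comp₀ P̄
P₁ = comp₁ P̄
P₂ = comp₂ P̄

a-unit : Unit a
a-unit = trans (𝐒-at-0 φ) φ-unit
  where
  opaque
    unfolding 𝐒
    𝐒-at-0 : ∀ f → 𝐒 f 0 ≡ f 0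
    𝐒-at-0 f = refl

aP₀ : a * P₀ ≈ 1# + κ 2ℚ * (q^ 1 * (b * P₂))
aP₀ = ≈-trans (solve 2 (λ x y → x := (x :- y) :+ y) ≈-refl _ (κ 2ℚ * (q^ 1 * (b * P₂)))) (+-cong (≈-trans (≈-sym (φ*₀ P̄)) (≈-trans (comp₀-cong φP̄) (comp₀-κ 1ℚ))) ≈-refl)

aP₁ : a * P₁ ≈ κ 2ℚ * (b * P₀)
aP₁ = diff-zero (≈-trans (≈-sym (φ*₁ P̄)) (≈-trans (comp₁-cong φP̄) (comp₁-κ 1ℚ)))

aP₂ : a * P₂ ≈ κ 2ℚ * (b * P₁)
aP₂ = diff-zero (≈-trans (≈-sym (φ*₂ P̄)) (≈-trans (comp₂-cong φP̄) (comp₂-κ 1ℚ)))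

η≈φφ : η ≈ φ * φ
η≈φφ = η-φ² P̄ φP̄

ψ₂-comp₀ : comp₀ ψ₂ ≈ κ 2ℚ * c₁
ψ₂-comp₀ = ≈-trans (comp₀-cong ψ₂-dissection) (≈-trans (comp₀-+ _ _) (≈-trans (+-cong (≈-trans (comp₀-κ* 2ℚ _) (*-cong ≈-refl (comp₀-𝐒 c₁))) (≈-trans (comp₀-q* _) (≈-trans (*-cong ≈-refl (comp₂-𝐒 c₀)) (zeroʳ _)))) (+-identityʳ _)))
ψ₂-comp₁ : comp₁ ψ₂ ≈ c₀
ψ₂-comp₁ = ≈-trans (comp₁-cong ψ₂-dissection) (≈-trans (comp₁-+ _ _) (≈-trans (+-cong (≈-trans (comp₁-κ* 2ℚ _) (≈-trans (*-cong ≈-refl (comp₁-𝐒 c₁)) (zeroʳ _))) (≈-trans (comp₁-q* _) (comp₀-𝐒 c₀))) (+-identityˡ _)))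
ψ₂-comp₂ : comp₂ ψ₂ ≈ 0#
ψ₂-comp₂ = ≈-trans (comp₂-cong ψ₂-dissection) (≈-trans (comp₂-+ _ _) (≈-trans (+-cong (≈-trans (comp₂-κ* 2ℚ _) (≈-trans (*-cong ≈-refl (comp₂-𝐒 c₁)) (zeroʳ _))) (≈-trans (comp₂-q* _) (comp₁-𝐒 c₀))) (+-identityˡ _)))

X-comp₀ : comp₀ X ≈ κ 2ℚ * 𝒫₋
X-comp₀ = ≈-trans (comp₀-cong X-dissection) (≈-trans (comp₀-+ _ _) (≈-trans (+-cong (≈-trans (comp₀-κ* 2ℚ _) (*-cong ≈-refl (comp₀-𝐒 𝒫₋)))
  (≈-trans (comp₀-neg _) (-‿cong (≈-trans (comp₀-κ* 3ℚ _) (≈-trans (*-cong ≈-refl (≈-trans (comp₀-q* _) (≈-trans (*-cong ≈-refl (comp₂-𝐒 (𝐒 X))) (zeroʳ _)))) (zeroʳ _)))))) (solve 1 (λ x → x :- con 0ℚ := x) ≈-refl _)))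
X-comp₁ : comp₁ X ≈ - (κ 3ℚ * 𝐒 X)
X-comp₁ = ≈-trans (comp₁-cong X-dissection) (≈-trans (comp₁-+ _ _) (≈-trans (+-cong (≈-trans (comp₁-κ* 2ℚ _) (≈-trans (*-cong ≈-refl (comp₁-𝐒 𝒫₋)) (zeroʳ _)))
  (≈-trans (comp₁-neg _) (-‿cong (≈-trans (comp₁-κ* 3ℚ _) (*-cong ≈-refl (≈-trans (comp₁-q* _) (comp₀-𝐒 (𝐒 X)))))))) (+-identityˡ _)))
X-comp₂ : comp₂ X ≈ 0#
X-comp₂ = ≈-trans (comp₂-cong X-dissection) (≈-trans (comp₂-+ _ _) (≈-trans (+-cong (≈-trans (comp₂-κ* 2ℚ _) (≈-trans (*-cong ≈-refl (comp₂-𝐒 𝒫₋)) (zeroʳ _)))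
  (≈-trans (comp₂-neg _) (-‿cong (≈-trans (comp₂-κ* 3ℚ _) (≈-trans (*-cong ≈-refl (≈-trans (comp₂-q* _) (comp₁-𝐒 (𝐒 X)))) (zeroʳ _)))))) (solve 0 (con 0ℚ :- con 0ℚ := con 0ℚ) ≈-refl)))

X-φφψ₂ : X ≈ φ * (φ * ψ₂)
X-φφψ₂ = ≈-trans jacobi (≈-trans (*-cong η≈φφ ≈-refl) (*-assoc _ _ _))

ψφ₀ : comp₀ (φ * ψ₂) ≈ κ 2ℚ * (a * c₁)
ψφ₀ = ≈-trans (φ*₀ ψ₂) (≈-trans (+-cong (*-cong ≈-refl ψ₂-comp₀) (-‿cong (*-cong ≈-refl (*-cong ≈-refl (*-cong ≈-refl ψ₂-comp₂)))))
  (solve 4 (λ a b c q → a :* (con 2ℚ :* c) :- con 2ℚ :* (q :* (b :* con 0ℚ)) := con 2ℚ :* (a :* c)) ≈-refl a b c₁ (q^ 1)))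
ψφ₁ : comp₁ (φ * ψ₂) ≈ a * c₀ - κ 2ℚ * (b * (κ 2ℚ * c₁))
ψφ₁ = ≈-trans (φ*₁ ψ₂) (+-cong (*-cong ≈-refl ψ₂-comp₁) (-‿cong (*-cong ≈-refl (*-cong ≈-refl ψ₂-comp₀))))
ψφ₂ : comp₂ (φ * ψ₂) ≈ - (κ 2ℚ * (b * c₀))
ψφ₂ = ≈-trans (φ*₂ ψ₂) (≈-trans (+-cong (*-cong ≈-refl ψ₂-comp₂) (-‿cong (*-cong ≈-refl (*-cong ≈-refl ψ₂-comp₁)))) (solve 2 (λ a b → a :* con 0ℚ :- b := :- b) ≈-refl a _))

4ℚ 8ℚ : ℚ
4ℚ = + 4 ℚ./ 1
8ℚ = + 8 ℚ./ 1

-- Triangular numbers are never 2 modulo 3, so this component of X = φ² ψ₂ is zero; computed from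
-- the right side it is -4 a b c₀ + 8 b² c₁.
ac₀ : a * c₀ ≈ κ 2ℚ * (b * c₁)
ac₀ = unit-cancel {b} b-unit (diff-zero (begin
  b * (a * c₀) - b * (κ 2ℚ * (b * c₁))
    ≈⟨ solve 4 (λ a b c d → b :* (a :* c) :- b :* (con 2ℚ :* (b :* d)) := :- con ¼ :* (a :* (:- (con 2ℚ :* (b :* c))) :- con 2ℚ :* (b :* (a :* c :- con 2ℚ :* (b :* (con 2ℚ :* d)))))) ≈-refl a b c₀ c₁ ⟩
  - κ ¼ * (a * (- (κ 2ℚ * (b * c₀))) - κ 2ℚ * (b * (a * c₀ - κ 2ℚ * (b * (κ 2ℚ * c₁)))))
    ≈⟨ *-cong ≈-refl (≈-trans (≈-sym (≈-trans (φ*₂ (φ * ψ₂)) (+-cong (*-cong ≈-refl ψφ₂) (-‿cong (*-cong ≈-refl (*-cong ≈-refl ψφ₁)))))) (≈-trans (≈-sym (comp₂-cong X-φφψ₂)) X-comp₂)) ⟩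
  - κ ¼ * 0# ≈⟨ zeroʳ _ ⟩
  0# ∎))
  where open SR

𝒫₋-val : κ 2ℚ * 𝒫₋ ≈ κ 2ℚ * (a * (a * c₁)) + κ 4ℚ * (q^ 1 * (b * (b * c₀)))
𝒫₋-val = ≈-trans (≈-sym X-comp₀) (≈-trans (comp₀-cong X-φφψ₂) (≈-trans (φ*₀ (φ * ψ₂)) (≈-trans (+-cong (*-cong ≈-refl ψφ₀) (-‿cong (*-cong ≈-refl (*-cong ≈-refl (*-cong ≈-refl ψφ₂)))))
  (solve 5 (λ a b c d q → a :* (con 2ℚ :* (a :* c)) :- con 2ℚ :* (q :* (b :* (:- (con 2ℚ :* (b :* d))))) := con 2ℚ :* (a :* (a :* c)) :+ con 4ℚ :* (q :* (b :* (b :* d)))) ≈-refl a b c₁ c₀ (q^ 1)))))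

-- The exponents congruent to 1 in X = φ² ψ₂: the right side gives a² c₀ - 8 a b c₁, which `ac₀`
-- turns into -3 a² c₀.
𝐒X-val : 𝐒 X ≈ a * (a * c₀)
𝐒X-val = begin
  𝐒 X ≈⟨ solve 1 (λ x → x := :- con (+ 1 ℚ./ 3) :* (:- (con 3ℚ :* x))) ≈-refl (𝐒 X) ⟩
  - κ (+ 1 ℚ./ 3) * (- (κ 3ℚ * 𝐒 X)) ≈⟨ *-cong ≈-refl (≈-trans (≈-sym X-comp₁) (≈-trans (comp₁-cong X-φφψ₂) (≈-trans (φ*₁ (φ * ψ₂)) (+-cong (*-cong ≈-refl ψφ₁) (-‿cong (*-cong ≈-refl (*-cong ≈-refl ψφ₀))))))) ⟩
  - κ (+ 1 ℚ./ 3) * (a * (a * c₀ - κ 2ℚ * (b * (κ 2ℚ * c₁))) - κ 2ℚ * (b * (κ 2ℚ * (a * c₁))))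
    ≈⟨ solve 4 (λ a b c d → :- con (+ 1 ℚ./ 3) :* (a :* (a :* c :- con 2ℚ :* (b :* (con 2ℚ :* d))) :- con 2ℚ :* (b :* (con 2ℚ :* (a :* d))))
         := :- con (+ 1 ℚ./ 3) :* (a :* (a :* c) :- con 4ℚ :* (a :* (con 2ℚ :* (b :* d))))) ≈-refl a b c₀ c₁ ⟩
  - κ (+ 1 ℚ./ 3) * (a * (a * c₀) - κ 4ℚ * (a * (κ 2ℚ * (b * c₁)))) ≈⟨ *-cong ≈-refl (+-cong ≈-refl (-‿cong (*-cong ≈-refl (*-cong ≈-refl (≈-sym ac₀))))) ⟩
  - κ (+ 1 ℚ./ 3) * (a * (a * c₀) - κ 4ℚ * (a * (a * c₀))) ≈⟨ solve 1 (λ x → :- con (+ 1 ℚ./ 3) :* (x :- con 4ℚ :* x) := x) ≈-refl _ ⟩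
  a * (a * c₀) ∎
  where open SR

-- The compatibility on which the comparison with `U₁` and `U₂` rests: it makes the inhomogeneous
-- terms of the two recursions proportional.
c₁P₁ : c₁ * P₁ ≈ c₀ * P₀
c₁P₁ = unit-cancel {a} a-unit (≈-trans (solve 3 (λ a c p → a :* (c :* p) := c :* (a :* p)) ≈-refl a c₁ P₁) (≈-trans (*-cong ≈-refl aP₁)
  (≈-trans (solve 3 (λ c b p → c :* (con 2ℚ :* (b :* p)) := (con 2ℚ :* (b :* c)) :* p) ≈-refl c₁ b P₀) (≈-trans (*-cong (≈-sym ac₀) ≈-refl) (*-assoc _ _ _)))))

a𝐒P̄ : a * 𝐒 P̄ ≈ 1#
a𝐒P̄ = ≈-trans (≈-sym (𝐒-* φ P̄)) (≈-trans (𝐒-cong φP̄) (𝐒-κ 1ℚ))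

-- The counterpart of `c₁P₁` for m divisible by 3, valid only after P₀ has been lowered by 𝐒 P̄ =
-- 1/a.
c₁P₀-𝐒P̄ : c₁ * (P₀ - 𝐒 P̄) ≈ q^ 1 * (c₀ * P₂)
c₁P₀-𝐒P̄ = unit-cancel {a} a-unit (begin
  a * (c₁ * (P₀ - 𝐒 P̄)) ≈⟨ solve 4 (λ a c p s → a :* (c :* (p :- s)) := c :* (a :* p :- a :* s)) ≈-refl a c₁ P₀ (𝐒 P̄) ⟩
  c₁ * (a * P₀ - a * 𝐒 P̄) ≈⟨ *-cong ≈-refl (+-cong aP₀ (-‿cong a𝐒P̄)) ⟩
  c₁ * ((1# + κ 2ℚ * (q^ 1 * (b * P₂))) - 1#) ≈⟨ solve 4 (λ c q b p → c :* ((con 1ℚ :+ con 2ℚ :* (q :* (b :* p))) :- con 1ℚ) := (con 2ℚ :* (b :* c)) :* (q :* p)) ≈-refl c₁ (q^ 1) b P₂ ⟩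
  (κ 2ℚ * (b * c₁)) * (q^ 1 * P₂) ≈⟨ *-cong (≈-sym ac₀) ≈-refl ⟩
  (a * c₀) * (q^ 1 * P₂) ≈⟨ solve 4 (λ a c q p → (a :* c) :* (q :* p) := a :* (q :* (c :* p))) ≈-refl a c₀ (q^ 1) P₂ ⟩
  a * (q^ 1 * (c₀ * P₂)) ∎)
  where open SR

v-three : ∀ j → v j ≈ q^ suc j * P̄ - q^ (suc j ℕ.+ (3 ℕ.+ j)) * P̄ + q^ (suc j ℕ.+ (3 ℕ.+ j) ℕ.+ (5 ℕ.+ j)) * P̄ - q^ (suc j ℕ.+ (3 ℕ.+ j) ℕ.+ (5 ℕ.+ j)) * v (6 ℕ.+ j)
v-three j = begin
  v j ≈⟨ ≈-trans (v-rec j) (*-cong ≈-refl (+-cong ≈-refl (-‿cong (≈-trans (v-rec (2 ℕ.+ j)) (*-cong ≈-refl (+-cong ≈-refl (-‿cong (v-rec (4 ℕ.+ j))))))))) ⟩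
  q^ suc j * (P̄ - q^ (3 ℕ.+ j) * (P̄ - q^ (5 ℕ.+ j) * (P̄ - v (6 ℕ.+ j))))
    ≈⟨ solve 5 (λ x y z p w → x :* (p :- y :* (p :- z :* (p :- w))) := x :* p :- (x :* y) :* p :+ ((x :* y) :* z) :* p :- ((x :* y) :* z) :* w) ≈-refl (q^ suc j) (q^ (3 ℕ.+ j)) (q^ (5 ℕ.+ j)) P̄ (v (6 ℕ.+ j)) ⟩
  q^ suc j * P̄ - (q^ suc j * q^ (3 ℕ.+ j)) * P̄ + ((q^ suc j * q^ (3 ℕ.+ j)) * q^ (5 ℕ.+ j)) * P̄ - ((q^ suc j * q^ (3 ℕ.+ j)) * q^ (5 ℕ.+ j)) * v (6 ℕ.+ j)
    ≈⟨ +-cong (+-cong (+-cong ≈-refl (-‿cong (*-cong xy ≈-refl))) (*-cong xyz ≈-refl)) (-‿cong (*-cong xyz ≈-refl)) ⟩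
  _ ∎
  where
  open SR
  xy = q^-+ (suc j) (3 ℕ.+ j)
  xyz = ≈-trans (*-cong xy ≈-refl) (q^-+ _ (5 ℕ.+ j))

comp₀-4 : ∀ w x y z → comp₀ (w - x + y - z) ≈ comp₀ w - comp₀ x + comp₀ y - comp₀ z
comp₀-4 w x y z = ≈-trans (comp₀-+ _ _) (+-cong (≈-trans (comp₀-+ _ _) (+-cong (≈-trans (comp₀-+ _ _) (+-cong ≈-refl (comp₀-neg x))) ≈-refl)) (comp₀-neg z))

comp₀-e₀ : ∀ {e} m f → e ≡ thrice m → comp₀ (q^ e * f) ≈ q^ m * comp₀ f
comp₀-e₀ m f refl = comp₀-q^thrice m f
comp₀-e₁ : ∀ {e} m f → e ≡ suc (thrice m) → comp₀ (q^ e * f) ≈ q^ suc m * comp₂ f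
comp₀-e₁ m f refl = comp₀-q^thrice⁺ m f
comp₀-e₂ : ∀ {e} m f → e ≡ suc (suc (thrice m)) → comp₀ (q^ e * f) ≈ q^ suc m * comp₁ f
comp₀-e₂ m f refl = comp₀-q^thrice⁺⁺ m f

y : ℕ → Series
y j = comp₀ (v j)

private
  thr : ∀ n {e} → e ≡ n ℕ.+ (n ℕ.+ n) → e ≡ thrice n
  thr n h = trans h (sym (thrice-is n))

  sixth : ∀ N i → 6 ℕ.+ (i ℕ.+ thrice N) ≡ i ℕ.+ thrice (suc (suc N))
  sixth N i = trans (sym (ℕP.+-assoc 6 i (thrice N))) (trans (cong (ℕ._+ thrice N) (ℕP.+-comm 6 i)) (ℕP.+-assoc i 6 (thrice N)))

y₁-rec : ∀ N → y (suc (thrice N)) ≈ q^ suc N * P₁ - q^ (N ℕ.+ N ℕ.+ 2) * P₀ + q^ (N ℕ.+ (N ℕ.+ N) ℕ.+ 4) * P₀ - q^ (N ℕ.+ (N ℕ.+ N) ℕ.+ 4) * y (suc (thrice (suc (suc N))))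
y₁-rec N = ≈-trans (comp₀-cong (v-three (suc (thrice N)))) (≈-trans (comp₀-4 _ _ _ _) (+-cong (+-cong (+-cong (comp₀-e₂ N _ refl) (-‿cong (comp₀-e₀ _ _ e₁))) (comp₀-e₀ _ _ e₂)) (-‿cong (≈-trans (comp₀-e₀ _ _ e₂) (*-cong ≈-refl (≡⇒≈ (cong y (sixth N 1))))))))
  where
  e₁ : suc (suc (thrice N)) ℕ.+ (3 ℕ.+ suc (thrice N)) ≡ thrice (N ℕ.+ N ℕ.+ 2)
  e₁ = thr (N ℕ.+ N ℕ.+ 2) (trans (cong (λ t → suc (suc t) ℕ.+ (3 ℕ.+ suc t)) (thrice-is N)) (ℕR.solve 1 (λ n → let t = n ℕR.:+ (n ℕR.:+ n) ; m = n ℕR.:+ n ℕR.:+ ℕR.con 2 in (ℕR.con 2 ℕR.:+ t) ℕR.:+ (ℕR.con 4 ℕR.:+ t) ℕR.:= m ℕR.:+ (m ℕR.:+ m)) refl N))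
  e₂ : suc (suc (thrice N)) ℕ.+ (3 ℕ.+ suc (thrice N)) ℕ.+ (5 ℕ.+ suc (thrice N)) ≡ thrice (N ℕ.+ (N ℕ.+ N) ℕ.+ 4)
  e₂ = thr (N ℕ.+ (N ℕ.+ N) ℕ.+ 4) (trans (cong (λ t → suc (suc t) ℕ.+ (3 ℕ.+ suc t) ℕ.+ (5 ℕ.+ suc t)) (thrice-is N)) (ℕR.solve 1 (λ n → let t = n ℕR.:+ (n ℕR.:+ n) ; m = n ℕR.:+ (n ℕR.:+ n) ℕR.:+ ℕR.con 4 in (ℕR.con 2 ℕR.:+ t) ℕR.:+ (ℕR.con 4 ℕR.:+ t) ℕR.:+ (ℕR.con 6 ℕR.:+ t) ℕR.:= m ℕR.:+ (m ℕR.:+ m)) refl N))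

y₂-rec : ∀ N → y (suc (suc (thrice N))) ≈ q^ suc N * P₀ - q^ (N ℕ.+ N ℕ.+ 3) * P₁ + q^ (N ℕ.+ (N ℕ.+ N) ℕ.+ 5) * P₀ - q^ (N ℕ.+ (N ℕ.+ N) ℕ.+ 5) * y (suc (suc (thrice (suc (suc N)))))
y₂-rec N = ≈-trans (comp₀-cong (v-three (suc (suc (thrice N))))) (≈-trans (comp₀-4 _ _ _ _) (+-cong (+-cong (+-cong (comp₀-e₀ (suc N) _ refl) (-‿cong (≈-trans (comp₀-e₂ _ _ e₁) (*-cong (q^-cong (sym (ℕP.+-suc (N ℕ.+ N) 2))) ≈-refl)))) (comp₀-e₀ _ _ e₂)) (-‿cong (≈-trans (comp₀-e₀ _ _ e₂) (*-cong ≈-refl (≡⇒≈ (cong y (sixth N 2))))))))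
  where
  e₁ : suc (suc (suc (thrice N))) ℕ.+ (3 ℕ.+ suc (suc (thrice N))) ≡ suc (suc (thrice (N ℕ.+ N ℕ.+ 2)))
  e₁ = trans (cong (λ t → suc (suc (suc t)) ℕ.+ (3 ℕ.+ suc (suc t))) (thrice-is N)) (trans (ℕR.solve 1 (λ n → let t = n ℕR.:+ (n ℕR.:+ n) ; m = n ℕR.:+ n ℕR.:+ ℕR.con 2 in (ℕR.con 3 ℕR.:+ t) ℕR.:+ (ℕR.con 5 ℕR.:+ t) ℕR.:= ℕR.con 2 ℕR.:+ (m ℕR.:+ (m ℕR.:+ m))) refl N) (cong (suc ∘ suc) (sym (thrice-is (N ℕ.+ N ℕ.+ 2)))))
  e₂ : suc (suc (suc (thrice N))) ℕ.+ (3 ℕ.+ suc (suc (thrice N))) ℕ.+ (5 ℕ.+ suc (suc (thrice N))) ≡ thrice (N ℕ.+ (N ℕ.+ N) ℕ.+ 5)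
  e₂ = thr (N ℕ.+ (N ℕ.+ N) ℕ.+ 5) (trans (cong (λ t → suc (suc (suc t)) ℕ.+ (3 ℕ.+ suc (suc t)) ℕ.+ (5 ℕ.+ suc (suc t))) (thrice-is N)) (ℕR.solve 1 (λ n → let t = n ℕR.:+ (n ℕR.:+ n) ; m = n ℕR.:+ (n ℕR.:+ n) ℕR.:+ ℕR.con 5 in (ℕR.con 3 ℕR.:+ t) ℕR.:+ (ℕR.con 5 ℕR.:+ t) ℕR.:+ (ℕR.con 7 ℕR.:+ t) ℕR.:= m ℕR.:+ (m ℕR.:+ m)) refl N))

y₀-rec : ∀ N → y (thrice N) ≈ q^ suc N * P₂ - q^ (N ℕ.+ N ℕ.+ 2) * P₂ + q^ (N ℕ.+ (N ℕ.+ N) ℕ.+ 3) * P₀ - q^ (N ℕ.+ (N ℕ.+ N) ℕ.+ 3) * y (thrice (suc (suc N)))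
y₀-rec N = ≈-trans (comp₀-cong (v-three (thrice N))) (≈-trans (comp₀-4 _ _ _ _) (+-cong (+-cong (+-cong (comp₀-e₁ N _ refl) (-‿cong (≈-trans (comp₀-e₁ _ _ e₁) (*-cong (q^-cong (sym (ℕP.+-suc (N ℕ.+ N) 1))) ≈-refl)))) (comp₀-e₀ _ _ e₂)) (-‿cong (comp₀-e₀ _ _ e₂))))
  where
  e₁ : suc (thrice N) ℕ.+ (3 ℕ.+ thrice N) ≡ suc (thrice (N ℕ.+ N ℕ.+ 1))
  e₁ = trans (cong (λ t → suc t ℕ.+ (3 ℕ.+ t)) (thrice-is N)) (trans (ℕR.solve 1 (λ n → let t = n ℕR.:+ (n ℕR.:+ n) ; m = n ℕR.:+ n ℕR.:+ ℕR.con 1 in (ℕR.con 1 ℕR.:+ t) ℕR.:+ (ℕR.con 3 ℕR.:+ t) ℕR.:= ℕR.con 1 ℕR.:+ (m ℕR.:+ (m ℕR.:+ m))) refl N) (cong suc (sym (thrice-is (N ℕ.+ N ℕ.+ 1)))))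
  e₂ : suc (thrice N) ℕ.+ (3 ℕ.+ thrice N) ℕ.+ (5 ℕ.+ thrice N) ≡ thrice (N ℕ.+ (N ℕ.+ N) ℕ.+ 3)
  e₂ = thr (N ℕ.+ (N ℕ.+ N) ℕ.+ 3) (trans (cong (λ t → suc t ℕ.+ (3 ℕ.+ t) ℕ.+ (5 ℕ.+ t)) (thrice-is N)) (ℕR.solve 1 (λ n → let t = n ℕR.:+ (n ℕR.:+ n) ; m = n ℕR.:+ (n ℕR.:+ n) ℕR.:+ ℕR.con 3 in (ℕR.con 1 ℕR.:+ t) ℕR.:+ (ℕR.con 3 ℕR.:+ t) ℕR.:+ (ℕR.con 5 ℕR.:+ t) ℕR.:= m ℕR.:+ (m ℕR.:+ m)) refl N))

suc-exp : ∀ m i → q^ (m ℕ.+ suc i) ≈ q^ suc (m ℕ.+ i)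
suc-exp m i = q^-cong (ℕP.+-suc m i)

y₁-U : ∀ N → c₁ * y (suc (thrice N)) ≈ P₀ * U₁ N
y₁-U N = diff-zero (contraction (λ N → c₁ * y (suc (thrice N)) - P₀ * U₁ N) (suc ∘ suc) (λ N → N ℕ.+ (N ℕ.+ N) ℕ.+ 3) rec N)
  where
  rec : ∀ N → (c₁ * y (suc (thrice N)) - P₀ * U₁ N) + q^ suc (N ℕ.+ (N ℕ.+ N) ℕ.+ 3) * (c₁ * y (suc (thrice (suc (suc N)))) - P₀ * U₁ (suc (suc N))) ≈ 0#
  rec N = ≈-trans (+-cong (+-cong (*-cong ≈-refl (y₁-rec N)) (-‿cong (*-cong ≈-refl (U₁-rec N)))) (*-cong (≈-sym (suc-exp _ 3)) ≈-refl))
    (≈-trans (solve 9 (λ c c0 p0 p1 x y z w u → (c :* (x :* p1 :- y :* p0 :+ z :* p0 :- z :* w) :- p0 :* (x :* c0 :- y :* c :+ z :* c :- z :* u)) :+ z :* (c :* w :- p0 :* u) := x :* (c :* p1 :- c0 :* p0)) ≈-refl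
      c₁ c₀ P₀ P₁ (q^ suc N) (q^ (N ℕ.+ N ℕ.+ 2)) (q^ (N ℕ.+ (N ℕ.+ N) ℕ.+ 4)) (y (suc (thrice (suc (suc N))))) (U₁ (suc (suc N))))
      (≈-trans (*-cong ≈-refl (zero-diff c₁P₁)) (zeroʳ _)))

y₂-U : ∀ N → c₁ * y (suc (suc (thrice N))) ≈ P₀ * U₂ N
y₂-U N = diff-zero (contraction (λ N → c₁ * y (suc (suc (thrice N))) - P₀ * U₂ N) (suc ∘ suc) (λ N → N ℕ.+ (N ℕ.+ N) ℕ.+ 4) rec N)
  where
  rec : ∀ N → (c₁ * y (suc (suc (thrice N))) - P₀ * U₂ N) + q^ suc (N ℕ.+ (N ℕ.+ N) ℕ.+ 4) * (c₁ * y (suc (suc (thrice (suc (suc N))))) - P₀ * U₂ (suc (suc N))) ≈ 0#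
  rec N = ≈-trans (+-cong (+-cong (*-cong ≈-refl (y₂-rec N)) (-‿cong (*-cong ≈-refl (U₂-rec N)))) (*-cong (≈-sym (suc-exp _ 4)) ≈-refl))
    (≈-trans (solve 9 (λ c c0 p0 p1 x y z w u → (c :* (x :* p0 :- y :* p1 :+ z :* p0 :- z :* w) :- p0 :* (x :* c :- y :* c0 :+ z :* c :- z :* u)) :+ z :* (c :* w :- p0 :* u) := :- y :* (c :* p1 :- c0 :* p0)) ≈-refl
      c₁ c₀ P₀ P₁ (q^ suc N) (q^ (N ℕ.+ N ℕ.+ 3)) (q^ (N ℕ.+ (N ℕ.+ N) ℕ.+ 5)) (y (suc (suc (thrice (suc (suc N)))))) (U₂ (suc (suc N))))
      (≈-trans (*-cong ≈-refl (zero-diff c₁P₁)) (zeroʳ _)))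

𝐒v-rec : ∀ N → 𝐒 (v N) ≈ q^ (N ℕ.+ (N ℕ.+ N) ℕ.+ 3) * (𝐒 P̄ - 𝐒 (v (suc (suc N))))
𝐒v-rec N = ≈-trans (𝐒-cong (v-rec N)) (≈-trans (𝐒-* _ _) (*-cong (≈-trans (𝐒-q^ (suc N)) (q^-cong (trans (thrice-is (suc N)) (ℕR.solve 1 (λ n → (ℕR.con 1 ℕR.:+ n) ℕR.:+ ((ℕR.con 1 ℕR.:+ n) ℕR.:+ (ℕR.con 1 ℕR.:+ n)) ℕR.:= n ℕR.:+ (n ℕR.:+ n) ℕR.:+ ℕR.con 3) refl N)))) (≈-trans (𝐒-+ _ _) (+-cong ≈-refl (𝐒-neg _)))))

-- 𝐒 (v N) obeys the recursion whose only inhomogeneous term is the third one, with 𝐒 P̄ for P₀. Its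
-- subtraction makes exactly the correction that `c₁P₀-𝐒P̄` asks for.
y₀-U : ∀ N → c₁ * (y (thrice N) - 𝐒 (v N)) ≈ (q^ 1 * P₂) * U₀ N
y₀-U N = diff-zero (contraction (λ N → c₁ * (y (thrice N) - 𝐒 (v N)) - (q^ 1 * P₂) * U₀ N) (suc ∘ suc) (λ N → N ℕ.+ (N ℕ.+ N) ℕ.+ 2) rec N)
  where
  rec : ∀ N → (c₁ * (y (thrice N) - 𝐒 (v N)) - (q^ 1 * P₂) * U₀ N) + q^ suc (N ℕ.+ (N ℕ.+ N) ℕ.+ 2) * (c₁ * (y (thrice (suc (suc N))) - 𝐒 (v (suc (suc N)))) - (q^ 1 * P₂) * U₀ (suc (suc N))) ≈ 0#
  rec N = ≈-trans (+-cong (+-cong (*-cong ≈-refl (+-cong (≈-trans (y₀-rec N) (+-cong (+-cong (+-cong (*-cong (q^suc N) ≈-refl) (-‿cong (*-cong (≈-trans (suc-exp (N ℕ.+ N) 1) (q^suc (N ℕ.+ N ℕ.+ 1))) ≈-refl))) ≈-refl) ≈-refl)) (-‿cong (𝐒v-rec N)))) (-‿cong (*-cong ≈-refl (U₀-rec N)))) (*-cong (≈-sym (suc-exp _ 2)) ≈-refl))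
    (≈-trans (solve 12 (λ c c0 p0 p2 q x y z w u s t →
        (c :* (((q :* x) :* p2 :- (q :* y) :* p2 :+ z :* p0 :- z :* w) :- z :* (s :- t)) :- (q :* p2) :* (x :* c :- y :* c :+ z :* c0 :- z :* u)) :+ z :* (c :* (w :- t) :- (q :* p2) :* u) := z :* (c :* (p0 :- s) :- q :* (c0 :* p2))) ≈-refl
      c₁ c₀ P₀ P₂ (q^ 1) (q^ N) (q^ (N ℕ.+ N ℕ.+ 1)) (q^ (N ℕ.+ (N ℕ.+ N) ℕ.+ 3)) (y (thrice (suc (suc N)))) (U₀ (suc (suc N))) (𝐒 P̄) (𝐒 (v (suc (suc N)))))
      (≈-trans (*-cong ≈-refl (zero-diff c₁P₀-𝐒P̄)) (zeroʳ _)))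

-- Rank sums at the sixth roots of unity

dec-y : Dec y
dec-y N = thrice N , λ j l n n<N → trans (comp₀-at (v j) n) (v-ord j (thrice n) (ℕP.<-≤-trans (thrice-< n<N) l))
  where
  thrice-< : ∀ {m n} → m < n → thrice m < thrice n
  thrice-< {zero} {suc n} (s≤s z≤n) = s≤s z≤n
  thrice-< {suc m} {suc n} (s≤s l) = s≤s (s≤s (s≤s (thrice-< l)))

dec-y₀ : Dec (λ n → y (thrice (suc n)))
dec-y₀ = dec-sub (λ n → thrice (suc n)) (λ n → ℕP.≤-trans (≤-thrice n) (ℕP.m≤n+m (thrice n) 3)) dec-y
dec-y₁ : Dec (λ n → y (suc (thrice n)))
dec-y₁ = dec-sub (λ n → suc (thrice n)) (λ n → ℕP.m≤n⇒m≤1+n (≤-thrice n)) dec-y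
dec-y₂ : Dec (λ n → y (suc (suc (thrice n))))
dec-y₂ = dec-sub (λ n → suc (suc (thrice n))) (λ n → ℕP.m≤n⇒m≤1+n (ℕP.m≤n⇒m≤1+n (≤-thrice n))) dec-y

dec-𝐒v : Dec (λ n → 𝐒 (v (suc n)))
dec-𝐒v = dec-ord λ n → ord-≤ (ℕP.n≤1+n n) (𝐒-ord (v-ord (suc n)))

Y₀ Y₁ Y₂ : (ℕ → Series) → Series
Y₀ w = ∑ (λ n → w n * y (thrice (suc n))) (dec-⊗ʳ w dec-y₀)
Y₁ w = ∑ (λ n → w n * y (suc (thrice n))) (dec-⊗ʳ w dec-y₁)
Y₂ w = ∑ (λ n → w n * y (suc (suc (thrice n)))) (dec-⊗ʳ w dec-y₂)

comp₀-rank-sum : ∀ f {w₀ w₁ w₂ : ℕ → Series} → (∀ n → κ (cf f (thrice (suc n))) ≈ w₀ n) →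
  (∀ n → κ (cf f (suc (thrice n))) ≈ w₁ n) → (∀ n → κ (cf f (suc (suc (thrice n)))) ≈ w₂ n) →
  comp₀ (rank-sum f) ≈ κ (f 0) * P₀ + κ 2ℚ * (Y₁ w₁ + Y₂ w₂ + Y₀ w₀)
comp₀-rank-sum f {w₀} {w₁} {w₂} h₀ h₁ h₂ = ≈-trans (comp₀-+ _ _) (+-cong (comp₀-κ* (f 0) P̄) (≈-trans (comp₀-κ* 2ℚ _) (*-cong ≈-refl
  (≈-trans (comp₀-∑ (dec-κv f) d) (≈-trans (∑-cong d d′ (λ n → comp₀-κ* _ _)) (≈-trans (∑-split₃ d′ d₁ d₂ d₀)
    (+-cong (+-cong (∑-cong _ _ λ n → *-cong (h₁ n) ≈-refl) (∑-cong _ _ λ n → *-cong (h₂ n) ≈-refl)) (∑-cong _ _ λ n → *-cong (h₀ n) ≈-refl))))))))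
  where
  d′ : Dec (λ n → κ (cf f (suc n)) * y (suc n))
  d′ = dec-⊗ʳ (λ n → κ (cf f (suc n))) (dec-suc dec-y)
  d : Dec (λ n → comp₀ (κ (cf f (suc n)) * v (suc n)))
  d = dec-≈ (λ n → ≈-sym (comp₀-κ* _ _)) d′
  d₁ : Dec (λ n → κ (cf f (suc (thrice n))) * y (suc (thrice n)))
  d₁ = dec-⊗ʳ (λ n → κ (cf f (suc (thrice n)))) dec-y₁
  d₂ : Dec (λ n → κ (cf f (suc (suc (thrice n)))) * y (suc (suc (thrice n))))
  d₂ = dec-⊗ʳ (λ n → κ (cf f (suc (suc (thrice n))))) dec-y₂
  d₀ : Dec (λ n → κ (cf f (thrice (suc n))) * y (thrice (suc n)))
  d₀ = dec-⊗ʳ (λ n → κ (cf f (thrice (suc n)))) dec-y₀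

∑-0 : ∀ {u} d → (∀ n → u n ≈ 0#) → ∑ u d ≈ 0#
∑-0 d h = agree⇒≈ λ N n n<N → trans (∑-ord d N (λ m → ord-≈ (≈-sym (h m)) ord-0#) n n<N) (sym (0-at n))

tail-* : ∀ c w k → tail (λ i → c * w i) k ≈ c * tail w k
tail-* c w k = ≈-trans (tail-is _ k) (≈-trans (∑-cong _ (dec-⊗ʳ (λ _ → c) (dec-ρ w k)) λ i → *-assoc c (w i) (ρ (k ⊟ i))) (≈-trans (∑-⊗ c _ (dec-ρ w k)) (*-cong ≈-refl (≈-sym (tail-is w k)))))

T₁ T₂ T₀ : (ℕ → Series) → Series
T₁ w = ∑ℤ (λ k → q^ E₁ k * tail w (ℤ.pred k)) (decℤ-*ˡ (λ k → tail w (ℤ.pred k)) dec-E₁)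
T₂ w = ∑ℤ (λ k → q^ E₁ k * tail w (~ k)) (decℤ-*ˡ (λ k → tail w (~ k)) dec-E₁)
T₀ w = ∑ℤ (λ k → q^ E₀ (ℤ.suc k) * tail w (ℤ.pred k)) (decℤ-*ˡ (λ k → tail w (ℤ.pred k)) (dec-suc∘ dec-E₀))

private
  pull : ∀ {u t : ℕ → Series} {p : Series} (w : ℕ → Series) c d (d′ : Dec (λ n → w n * t n)) → (∀ n → c * u n ≈ p * t n) → c * ∑ (λ n → w n * u n) d ≈ p * ∑ (λ n → w n * t n) d′
  pull {u} {t} {p} w c d d′ h = ≈-trans (≈-sym (∑-⊗ c (dec-⊗ʳ (λ _ → c) d) d)) (≈-trans (∑-cong _ (dec-⊗ʳ (λ _ → p) d′) λ n →
    ≈-trans (solve 3 (λ c w u → c :* (w :* u) := w :* (c :* u)) ≈-refl c (w n) (u n)) (≈-trans (*-cong ≈-refl (h n)) (solve 3 (λ p w u → w :* (p :* u) := p :* (w :* u)) ≈-refl p (w n) (t n))))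
    (∑-⊗ p _ d′))

Y₁-val : ∀ w → c₁ * Y₁ w ≈ P₀ * T₁ w
Y₁-val w = ≈-trans (pull w c₁ _ (dec-theta w ℤ.pred abs-pred dec-E₁) y₁-U) (*-cong ≈-refl (theta-tail w ℤ.pred abs-pred dec-E₁))

Y₂-val : ∀ w → c₁ * Y₂ w ≈ P₀ * T₂ w
Y₂-val w = ≈-trans (pull w c₁ _ (dec-theta w ~_ abs-~′ dec-E₁) (λ n → ≈-trans (y₂-U n) (*-cong ≈-refl (reflect n)))) (*-cong ≈-refl (theta-tail w ~_ abs-~′ dec-E₁))
  where
  -- The reflection k ↦ -k carries `E₁′` to `E₁` and the index k - 1 to -1 - k. The class 2 thus
  -- sits on the same theta exponents as the class 1, with reflected indices.
  reflect : ∀ n → U₂ n ≈ ∑ℤ (λ k → q^ E₁ k * ρ (~ k ⊟ n)) (decℤ-*ˡ (λ k → ρ (~ k ⊟ n)) dec-E₁)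
  reflect n = ≈-trans (∑ℤ-neg′ d (dec-neg∘ d)) (∑ℤ-cong _ _ λ k → *-cong (q^-cong (E₁′-neg k)) (≡⇒≈ (cong (λ z → ρ (z ⊟ n)) (pred-suc (~ k)))))
    where
    d : Decℤ (λ k → q^ E₁′ k * ρ (k ⊟ suc n))
    d = decℤ-*ˡ (λ k → ρ (k ⊟ suc n)) dec-E₁′

dec-Y₀′ : ∀ w → Dec (λ n → w n * (y (thrice (suc n)) - 𝐒 (v (suc n))))
dec-Y₀′ w = dec-⊗ʳ w (dec-⊕ dec-y₀ (dneg dec-𝐒v))

Y₀-val : ∀ w → c₁ * ∑ (λ n → w n * (y (thrice (suc n)) - 𝐒 (v (suc n)))) (dec-Y₀′ w) ≈ (q^ 1 * P₂) * T₀ w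
Y₀-val w = ≈-trans (pull w c₁ _ (dec-theta w ℤ.pred abs-pred (dec-suc∘ dec-E₀)) (λ n → ≈-trans (y₀-U (suc n)) (*-cong ≈-refl (move n)))) (*-cong ≈-refl (theta-tail w ℤ.pred abs-pred (dec-suc∘ dec-E₀)))
  where
  move : ∀ n → U₀ (suc n) ≈ ∑ℤ (λ k → q^ E₀ (ℤ.suc k) * ρ (ℤ.pred k ⊟ n)) (decℤ-*ˡ (λ k → ρ (ℤ.pred k ⊟ n)) (dec-suc∘ dec-E₀))
  move n = ≈-trans (∑ℤ-shift d (dec-suc∘ d)) (∑ℤ-cong _ _ λ k → *-cong ≈-refl (≡⇒≈ (cong (λ z → ρ (ℤ.pred z ⊟ n)) (pred-suc k))))
    where
    d : Decℤ (λ k → q^ E₀ k * ρ (k ⊟ suc (suc n)))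
    d = decℤ-*ˡ (λ k → ρ (k ⊟ suc (suc n))) dec-E₀

∑ℤ-sum-weights : ∀ {h} (d : Decℤ h) (f g e : ℤ → Series) → (∀ k → f k + g k ≈ e k) →
  ∑ℤ (λ k → h k * f k) (decℤ-*ˡ f d) + ∑ℤ (λ k → h k * g k) (decℤ-*ˡ g d) ≈ ∑ℤ (λ k → e k * h k) (decℤ-*ʳ e d)
∑ℤ-sum-weights d f g e p = ≈-trans (≈-sym (∑ℤ-+ (decℤ-+ (decℤ-*ˡ f d) (decℤ-*ˡ g d)) _ _)) (∑ℤ-cong _ _ λ k → ≈-trans (≈-sym (distribˡ _ _ _)) (≈-trans (*-comm _ _) (*-cong (p k) ≈-refl)))

-- the even functions m ↦ cos(2πm/3), cos(πm/3), cos(πm)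
cos₃ cos₆ cos₂ : ℕ → ℚ
cos₃ 0 = 1ℚ
cos₃ 1 = ℚ.- ½
cos₃ 2 = ℚ.- ½
cos₃ (suc (suc (suc m))) = cos₃ m
cos₆ 0 = 1ℚ
cos₆ 1 = ½
cos₆ 2 = ℚ.- ½
cos₆ (suc (suc (suc m))) = ℚ.- cos₆ m
cos₂ zero = 1ℚ
cos₂ (suc m) = ℚ.- cos₂ m

cos₃-thrice : ∀ n → cos₃ (thrice n) ≡ 1ℚ × cos₃ (suc (thrice n)) ≡ ℚ.- ½ × cos₃ (suc (suc (thrice n))) ≡ ℚ.- ½
cos₃-thrice zero = refl , refl , refl
cos₃-thrice (suc n) = cos₃-thrice n

cf₃ : ∀ n → cf cos₃ (thrice n) ≡ 0ℚ × cf cos₃ (suc (thrice n)) ≡ ℚ.- 3ℚ × cf cos₃ (suc (suc (thrice n))) ≡ 3ℚ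
cf₃ n = c₀′ n , c₁″ n , c₂′ n
  where
  c₀′ : ∀ n → cf cos₃ (thrice n) ≡ 0ℚ
  c₁″ : ∀ n → cf cos₃ (suc (thrice n)) ≡ ℚ.- 3ℚ
  c₂′ : ∀ n → cf cos₃ (suc (suc (thrice n))) ≡ 3ℚ
  c₀′ zero = refl
  c₀′ (suc n) = cong₂ ℚ._-_ (cong₂ (λ a b → 2ℚ ℚ.* a ℚ.- 2ℚ ℚ.* b) (proj₁ (cos₃-thrice n)) (proj₂ (proj₂ (cos₃-thrice n)))) (c₂′ n)
  c₁″ n = cong₂ ℚ._-_ (cong₂ (λ a b → 2ℚ ℚ.* a ℚ.- 2ℚ ℚ.* b) (proj₁ (proj₂ (cos₃-thrice n))) (proj₁ (cos₃-thrice n))) (c₀′ n)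
  c₂′ n = cong₂ ℚ._-_ (cong₂ (λ a b → 2ℚ ℚ.* a ℚ.- 2ℚ ℚ.* b) (proj₂ (proj₂ (cos₃-thrice n))) (proj₁ (proj₂ (cos₃-thrice n)))) (c₁″ n)

κcos₂ : ∀ n → κ (cos₂ n) ≈ σℕ n
κcos₂ zero = ≈-refl
κcos₂ (suc n) = ≈-trans (κ-neg _) (-‿cong (κcos₂ n))

cos₆-thrice : ∀ n → cos₆ (thrice n) ≡ cos₂ n × cos₆ (suc (thrice n)) ≡ ½ ℚ.* cos₂ n × cos₆ (suc (suc (thrice n))) ≡ (ℚ.- ½) ℚ.* cos₂ n
cos₆-thrice zero = refl , refl , refl
cos₆-thrice (suc n) = let (p , r , s) = cos₆-thrice n in cong ℚ.-_ p , trans (cong ℚ.-_ r) (ℚP.neg-distribʳ-* ½ (cos₂ n)) , trans (cong ℚ.-_ s) (ℚP.neg-distribʳ-* (ℚ.- ½) (cos₂ n))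

cf₆ : ∀ n → cf cos₆ (thrice n) ≡ 0ℚ × cf cos₆ (suc (thrice n)) ≡ ℚ.- cos₂ n × cf cos₆ (suc (suc (thrice n))) ≡ ℚ.- cos₂ n
cf₆ n = d₀ n , d₁ n , d₂ n
  where
  d₀ : ∀ n → cf cos₆ (thrice n) ≡ 0ℚ
  d₁ : ∀ n → cf cos₆ (suc (thrice n)) ≡ ℚ.- cos₂ n
  d₂ : ∀ n → cf cos₆ (suc (suc (thrice n))) ≡ ℚ.- cos₂ n
  d₀ zero = refl
  d₀ (suc n) = trans (cong₂ ℚ._-_ (cong₂ (λ a b → 2ℚ ℚ.* a ℚ.- 2ℚ ℚ.* b) (proj₁ (cos₆-thrice (suc n))) (proj₂ (proj₂ (cos₆-thrice n)))) (d₂ n))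
    (ℚR.solve 1 (λ s → (ℚR.con 2ℚ ℚR.:* (ℚR.:- s) ℚR.:- ℚR.con 2ℚ ℚR.:* (ℚR.con (ℚ.- ½) ℚR.:* s)) ℚR.:- (ℚR.:- s) ℚR.:= ℚR.con 0ℚ) refl (cos₂ n))
  d₁ n = trans (cong₂ ℚ._-_ (cong₂ (λ a b → 2ℚ ℚ.* a ℚ.- 2ℚ ℚ.* b) (proj₁ (proj₂ (cos₆-thrice n))) (proj₁ (cos₆-thrice n))) (d₀ n))
    (ℚR.solve 1 (λ s → (ℚR.con 2ℚ ℚR.:* (ℚR.con ½ ℚR.:* s) ℚR.:- ℚR.con 2ℚ ℚR.:* s) ℚR.:- ℚR.con 0ℚ ℚR.:= ℚR.:- s) refl (cos₂ n))
  d₂ n = trans (cong₂ ℚ._-_ (cong₂ (λ a b → 2ℚ ℚ.* a ℚ.- 2ℚ ℚ.* b) (proj₂ (proj₂ (cos₆-thrice n))) (proj₁ (proj₂ (cos₆-thrice n)))) (d₁ n))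
    (ℚR.solve 1 (λ s → (ℚR.con 2ℚ ℚR.:* (ℚR.con (ℚ.- ½) ℚR.:* s) ℚR.:- ℚR.con 2ℚ ℚR.:* (ℚR.con ½ ℚR.:* s)) ℚR.:- (ℚR.:- s) ℚR.:= ℚR.:- s) refl (cos₂ n))

cf₂ : ∀ n → κ (cf cos₂ n) ≈ κ 4ℚ * (σℕ n * ιℕ n)
cf₂ zero = solve 0 (con 0ℚ := con 4ℚ :* (con 1ℚ :* con 0ℚ)) ≈-refl
cf₂ (suc n) = begin
  κ ((2ℚ ℚ.* (ℚ.- cos₂ n) ℚ.- 2ℚ ℚ.* cos₂ n) ℚ.- cf cos₂ n) ≈⟨ ≡⇒≈ (cong κ (ℚR.solve 2 (λ s c → (ℚR.con 2ℚ ℚR.:* (ℚR.:- s) ℚR.:- ℚR.con 2ℚ ℚR.:* s) ℚR.:- c ℚR.:= ℚR.:- (ℚR.con 4ℚ ℚR.:* s ℚR.:+ c)) refl (cos₂ n) (cf cos₂ n))) ⟩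
  κ (ℚ.- (4ℚ ℚ.* cos₂ n ℚ.+ cf cos₂ n)) ≈⟨ ≈-trans (κ-neg _) (-‿cong (≈-trans (κ-+ _ _) (+-cong (≈-trans (κ-* _ _) (*-cong ≈-refl (κcos₂ n))) (cf₂ n)))) ⟩
  - (κ 4ℚ * σℕ n + κ 4ℚ * (σℕ n * ιℕ n)) ≈⟨ solve 2 (λ s i → :- (con 4ℚ :* s :+ con 4ℚ :* (s :* i)) := con 4ℚ :* (:- s :* (i :+ con 1ℚ))) ≈-refl (σℕ n) (ιℕ n) ⟩
  κ 4ℚ * (- σℕ n * (ιℕ n + 1#)) ∎
  where open SR

-- The weights are -3 and 3 on the classes 1 and 2 and zero on multiples of 3, so the tails enter
-- through their difference, which is k by `Dₖ-val`.
R₃-val : c₁ * comp₀ (rank-sum cos₃) ≈ P₀ * 𝒫₊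
R₃-val = begin
  c₁ * comp₀ (rank-sum cos₃) ≈⟨ *-cong ≈-refl (comp₀-rank-sum cos₃ {λ _ → 0#} {λ _ → - κ 3ℚ * 1#} {λ _ → κ 3ℚ * 1#} (λ n → ≡⇒≈ (cong κ (proj₁ (cf₃ (suc n)))))
      (λ n → ≈-trans (≡⇒≈ (cong κ (proj₁ (proj₂ (cf₃ n))))) (≈-trans (κ-neg 3ℚ) (≈-sym (solve 0 (:- con 3ℚ :* con 1ℚ := :- con 3ℚ) ≈-refl))))
      (λ n → ≈-trans (≡⇒≈ (cong κ (proj₂ (proj₂ (cf₃ n))))) (≈-sym (solve 0 (con 3ℚ :* con 1ℚ := con 3ℚ) ≈-refl)))) ⟩
  c₁ * (κ 1ℚ * P₀ + κ 2ℚ * (Y₁ (λ _ → - κ 3ℚ * 1#) + Y₂ (λ _ → κ 3ℚ * 1#) + Y₀ (λ _ → 0#)))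
    ≈⟨ *-cong ≈-refl (+-cong ≈-refl (*-cong ≈-refl (+-cong ≈-refl (∑-0 _ λ n → zeroˡ _)))) ⟩
  c₁ * (κ 1ℚ * P₀ + κ 2ℚ * (Y₁ (λ _ → - κ 3ℚ * 1#) + Y₂ (λ _ → κ 3ℚ * 1#) + 0#))
    ≈⟨ solve 4 (λ c p x y → c :* (con 1ℚ :* p :+ con 2ℚ :* (x :+ y :+ con 0ℚ)) := p :* c :+ con 2ℚ :* (c :* x :+ c :* y)) ≈-refl c₁ P₀ _ _ ⟩
  P₀ * c₁ + κ 2ℚ * (c₁ * Y₁ (λ _ → - κ 3ℚ * 1#) + c₁ * Y₂ (λ _ → κ 3ℚ * 1#)) ≈⟨ +-cong ≈-refl (*-cong ≈-refl (+-cong (Y₁-val _) (Y₂-val _))) ⟩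
  P₀ * c₁ + κ 2ℚ * (P₀ * T₁ (λ _ → - κ 3ℚ * 1#) + P₀ * T₂ (λ _ → κ 3ℚ * 1#)) ≈⟨ solve 4 (λ p c x y → p :* c :+ con 2ℚ :* (p :* x :+ p :* y) := p :* (c :+ con 2ℚ :* (x :+ y))) ≈-refl P₀ c₁ _ _ ⟩
  P₀ * (c₁ + κ 2ℚ * (T₁ (λ _ → - κ 3ℚ * 1#) + T₂ (λ _ → κ 3ℚ * 1#)))
    ≈⟨ *-cong ≈-refl (+-cong ≈-refl (*-cong ≈-refl (∑ℤ-sum-weights dec-E₁ (λ k → tail (λ _ → - κ 3ℚ * 1#) (ℤ.pred k)) (λ k → tail (λ _ → κ 3ℚ * 1#) (~ k)) (λ k → - κ 3ℚ * ι k) (λ k → ≈-trans (+-cong (tail-* _ _ _) (tail-* _ _ _))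
        (≈-trans (solve 2 (λ x y → :- con 3ℚ :* x :+ con 3ℚ :* y := :- con 3ℚ :* (x :- y)) ≈-refl (S₃ (ℤ.pred k)) (S₃ (~ k))) (*-cong ≈-refl (Dₖ-val k))))))) ⟩
  P₀ * (c₁ + κ 2ℚ * ∑ℤ (λ k → (- κ 3ℚ * ι k) * q^ E₁ k) dι) ≈⟨ *-cong ≈-refl (+-cong ≈-refl (≈-sym (∑ℤ-* (κ 2ℚ) (decℤ-*ʳ (λ _ → κ 2ℚ) dι) dι))) ⟩
  P₀ * (c₁ + ∑ℤ (λ k → κ 2ℚ * ((- κ 3ℚ * ι k) * q^ E₁ k)) (decℤ-*ʳ (λ _ → κ 2ℚ) dι)) ≈⟨ *-cong ≈-refl (≈-sym (∑ℤ-+ (decℤ-+ dec-E₁ (decℤ-*ʳ (λ _ → κ 2ℚ) dι)) _ _)) ⟩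
  P₀ * ∑ℤ (λ k → q^ E₁ k + κ 2ℚ * ((- κ 3ℚ * ι k) * q^ E₁ k)) (decℤ-+ dec-E₁ (decℤ-*ʳ (λ _ → κ 2ℚ) dι))
    ≈⟨ *-cong ≈-refl (∑ℤ-cong _ _ λ k → solve 2 (λ i q → q :+ con 2ℚ :* ((:- con 3ℚ :* i) :* q) := (con 1ℚ :- con 6ℚ :* i) :* q) ≈-refl (ι k) (q^ E₁ k)) ⟩
  P₀ * 𝒫₊ ∎
  where
  open SR
  dι : Decℤ (λ k → (- κ 3ℚ * ι k) * q^ E₁ k)
  dι = decℤ-*ʳ (λ k → - κ 3ℚ * ι k) dec-E₁

-- Here both classes have the same alternating weights and the tails add up to ½ + (-1)^k ε. The ½
-- cancels the leading `c₁`, and -2ε remains against the pentagonal series with signs.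
R₆-val : c₁ * comp₀ (rank-sum cos₆) ≈ P₀ * (c̃₁ * η)
R₆-val = begin
  c₁ * comp₀ (rank-sum cos₆) ≈⟨ *-cong ≈-refl (comp₀-rank-sum cos₆ {λ _ → 0#} {w} {w} (λ n → ≡⇒≈ (cong κ (proj₁ (cf₆ (suc n)))))
      (λ n → wt n (proj₁ (proj₂ (cf₆ n)))) (λ n → wt n (proj₂ (proj₂ (cf₆ n))))) ⟩
  c₁ * (κ 1ℚ * P₀ + κ 2ℚ * (Y₁ w + Y₂ w + Y₀ (λ _ → 0#))) ≈⟨ *-cong ≈-refl (+-cong ≈-refl (*-cong ≈-refl (+-cong ≈-refl (∑-0 _ λ n → zeroˡ _)))) ⟩
  c₁ * (κ 1ℚ * P₀ + κ 2ℚ * (Y₁ w + Y₂ w + 0#))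
    ≈⟨ solve 4 (λ c p x y → c :* (con 1ℚ :* p :+ con 2ℚ :* (x :+ y :+ con 0ℚ)) := p :* c :+ con 2ℚ :* (c :* x :+ c :* y)) ≈-refl c₁ P₀ _ _ ⟩
  P₀ * c₁ + κ 2ℚ * (c₁ * Y₁ w + c₁ * Y₂ w) ≈⟨ +-cong ≈-refl (*-cong ≈-refl (+-cong (Y₁-val _) (Y₂-val _))) ⟩
  P₀ * c₁ + κ 2ℚ * (P₀ * T₁ w + P₀ * T₂ w) ≈⟨ solve 4 (λ p c x y → p :* c :+ con 2ℚ :* (p :* x :+ p :* y) := p :* (c :+ con 2ℚ :* (x :+ y))) ≈-refl P₀ c₁ _ _ ⟩
  P₀ * (c₁ + κ 2ℚ * (T₁ w + T₂ w))
    ≈⟨ *-cong ≈-refl (+-cong ≈-refl (*-cong ≈-refl (∑ℤ-sum-weights dec-E₁ (λ k → tail w (ℤ.pred k)) (λ k → tail w (~ k)) (λ k → - κ ½ + - ε * σ k) (λ k → ≈-trans (+-cong (tail-* _ _ _) (tail-* _ _ _))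
        (≈-trans (solve 2 (λ x y → :- con 1ℚ :* x :+ :- con 1ℚ :* y := :- (x :+ y)) ≈-refl (S₁ (ℤ.pred k)) (S₁ (~ k))) (≈-trans (-‿cong (sₖ-val k)) (solve 2 (λ s e → :- (con ½ :+ s :* e) := :- con ½ :+ :- e :* s) ≈-refl (σ k) ε))))))) ⟩
  P₀ * (c₁ + κ 2ℚ * ∑ℤ (λ k → (- κ ½ + - ε * σ k) * q^ E₁ k) (decℤ-*ʳ (λ k → - κ ½ + - ε * σ k) dec-E₁))
    ≈⟨ *-cong ≈-refl (+-cong ≈-refl (*-cong ≈-refl (≈-trans (∑ℤ-cong _ (decℤ-+ h₁ h₂) (λ k → solve 3 (λ e s q → (:- con ½ :+ :- e :* s) :* q := :- con ½ :* q :+ :- e :* (s :* q)) ≈-refl ε (σ k) (q^ E₁ k)))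
        (≈-trans (∑ℤ-+ _ h₁ h₂) (+-cong (∑ℤ-* _ h₁ dec-E₁) (∑ℤ-* _ h₂ (decℤ-*ʳ σ dec-E₁))))))) ⟩
  P₀ * (c₁ + κ 2ℚ * (- κ ½ * c₁ + - ε * c̃₁)) ≈⟨ *-cong ≈-refl (solve 3 (λ c e d → c :+ con 2ℚ :* (:- con ½ :* c :+ :- e :* d) := d :* (:- (con 2ℚ :* e))) ≈-refl c₁ ε c̃₁) ⟩
  P₀ * (c̃₁ * η) ∎
  where
  open SR
  w : ℕ → Series
  w n = - 1# * σℕ n
  h₁ : Decℤ (λ k → - κ ½ * q^ E₁ k)
  h₁ = decℤ-*ʳ (λ _ → - κ ½) dec-E₁
  h₂ : Decℤ (λ k → - ε * (σ k * q^ E₁ k))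
  h₂ = decℤ-*ʳ (λ _ → - ε) (decℤ-*ʳ σ dec-E₁)
  wt : ∀ n {c} → c ≡ ℚ.- cos₂ n → κ c ≈ w n
  wt n refl = ≈-trans (κ-neg _) (≈-trans (-‿cong (κcos₂ n)) (solve 1 (λ s → :- s := :- con 1ℚ :* s) ≈-refl (σℕ n)))

-- The rank sum at -1

ι-thrice : ∀ n → ιℕ (thrice n) ≈ κ 3ℚ * ιℕ n
ι-thrice zero = solve 0 (con 0ℚ := con 3ℚ :* con 0ℚ) ≈-refl
ι-thrice (suc n) = ≈-trans (+-cong (+-cong (+-cong (ι-thrice n) ≈-refl) ≈-refl) ≈-refl) (solve 1 (λ i → con 3ℚ :* i :+ con 1ℚ :+ con 1ℚ :+ con 1ℚ := con 3ℚ :* (i :+ con 1ℚ)) ≈-refl (ιℕ n))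

σ-thrice : ∀ n → σℕ (thrice n) ≈ σℕ n
σ-thrice zero = ≈-refl
σ-thrice (suc n) = ≈-trans (-‿cong (-‿cong (-‿cong (σ-thrice n)))) (solve 1 (λ s → :- (:- (:- s)) := :- s) ≈-refl (σℕ n))

private
  w₀ w₁ w₂ : ℕ → Series
  w₀ n = κ (+ 12 ℚ./ 1) * (σℕ (suc n) * ιℕ (suc n))
  w₁ n = - κ (+ 12 ℚ./ 1) * (σℕ n * ιℕ n) + - κ 4ℚ * σℕ n
  w₂ n = κ (+ 12 ℚ./ 1) * (σℕ n * ιℕ n) + κ 8ℚ * σℕ n

  w₃ : ℕ → Series
  w₃ n = σℕ (suc n) * ιℕ (suc n)

cf₂-0 : ∀ n → κ (cf cos₂ (thrice (suc n))) ≈ w₀ n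
cf₂-0 n = ≈-trans (cf₂ (thrice (suc n))) (≈-trans (*-cong ≈-refl (*-cong (σ-thrice (suc n)) (ι-thrice (suc n)))) (solve 2 (λ s i → con 4ℚ :* (s :* (con 3ℚ :* i)) := con (+ 12 ℚ./ 1) :* (s :* i)) ≈-refl (σℕ (suc n)) (ιℕ (suc n))))
cf₂-1 : ∀ n → κ (cf cos₂ (suc (thrice n))) ≈ w₁ n
cf₂-1 n = ≈-trans (cf₂ (suc (thrice n))) (≈-trans (*-cong ≈-refl (*-cong (-‿cong (σ-thrice n)) (+-cong (ι-thrice n) ≈-refl))) (solve 2 (λ s i → con 4ℚ :* (:- s :* (con 3ℚ :* i :+ con 1ℚ)) := :- con (+ 12 ℚ./ 1) :* (s :* i) :+ :- con 4ℚ :* s) ≈-refl (σℕ n) (ιℕ n)))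
cf₂-2 : ∀ n → κ (cf cos₂ (suc (suc (thrice n)))) ≈ w₂ n
cf₂-2 n = ≈-trans (cf₂ (suc (suc (thrice n)))) (≈-trans (*-cong ≈-refl (*-cong (-‿cong (-‿cong (σ-thrice n))) (+-cong (+-cong (ι-thrice n) ≈-refl) ≈-refl))) (solve 2 (λ s i → con 4ℚ :* (:- (:- s) :* (con 3ℚ :* i :+ con 1ℚ :+ con 1ℚ)) := con (+ 12 ℚ./ 1) :* (s :* i) :+ con 8ℚ :* s) ≈-refl (σℕ n) (ιℕ n)))

tail-lin : ∀ c w d w′ k → tail (λ n → c * w n + d * w′ n) k ≈ c * tail w k + d * tail w′ k
tail-lin c w d w′ k = ≈-trans (tail-⊕ _ _ k) (+-cong (tail-* c w k) (tail-* d w′ k))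

T₁₂-val : T₁ w₁ + T₂ w₂ ≈ c₁ + κ 2ℚ * (ε * 𝒫₋)
T₁₂-val = ≈-trans (∑ℤ-sum-weights dec-E₁ (λ k → tail w₁ (ℤ.pred k)) (λ k → tail w₂ (~ k)) (λ k → κ 4ℚ * Aₖ k) (λ k →
    ≈-trans (+-cong (tail-lin _ _ _ _ _) (tail-lin _ _ _ _ _)) (solve 4 (λ s₂ s₁ t₂ t₁ → (:- con (+ 12 ℚ./ 1) :* s₂ :+ :- con 4ℚ :* s₁) :+ (con (+ 12 ℚ./ 1) :* t₂ :+ con 8ℚ :* t₁)
       := con 4ℚ :* ((con 3ℚ :* t₂ :+ con 2ℚ :* t₁) :- (con 3ℚ :* s₂ :+ s₁))) ≈-refl (S₂ (ℤ.pred k)) (S₁ (ℤ.pred k)) (S₂ (~ k)) (S₁ (~ k)))))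
  (≈-trans (∑ℤ-cong _ (decℤ-+ dec-E₁ h) (λ k → ≈-trans (*-cong (*-cong ≈-refl (Aₖ-val k)) ≈-refl) (solve 4 (λ s e i q → (con 4ℚ :* (con ¼ :+ con ½ :* (s :* e :* (con 1ℚ :- con 6ℚ :* i)))) :* q := q :+ (con 2ℚ :* e) :* ((s :* (con 1ℚ :- con 6ℚ :* i)) :* q)) ≈-refl (σ k) ε (ι k) (q^ E₁ k))))
  (≈-trans (∑ℤ-+ _ dec-E₁ h) (+-cong ≈-refl (≈-trans (∑ℤ-* _ h (decℤ-*ʳ _ dec-E₁)) (*-assoc _ _ _)))))
  where
  h : Decℤ (λ k → (κ 2ℚ * ε) * ((σ k * lin 6ℚ k) * q^ E₁ k))
  h = decℤ-*ʳ (λ _ → κ 2ℚ * ε) (decℤ-*ʳ (λ k → σ k * lin 6ℚ k) dec-E₁)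

tail-u : ∀ k → tail w₃ (ℤ.pred k) ≈ S₂ k
tail-u k = ≈-sym (≈-trans (tail-pred _ k) (solve 2 (λ r s → (con 1ℚ :* con 0ℚ) :* r :+ s := s) ≈-refl (ρ k) _))

-- E₀ (suc k) is invariant under k ↦ -1 - k, so S₂ may be replaced by its symmetrisation.
T₀u-val : κ 2ℚ * T₀ w₃ ≈ - κ ¼ * c₀ - κ ½ * (ε * 𝐒 X)
T₀u-val = begin
  κ 2ℚ * T₀ w₃ ≈⟨ solve 1 (λ x → con 2ℚ :* x := x :+ x) ≈-refl _ ⟩
  T₀ w₃ + T₀ w₃ ≈⟨ +-cong to-S₂ (≈-trans to-S₂ reflect) ⟩
  ∑ℤ (λ k → e k * S₂ k) _ + ∑ℤ (λ k → e k * S₂ (~ k)) _ ≈⟨ ∑ℤ-sum-weights de S₂ (λ k → S₂ (~ k)) Bₖ (λ k → ≈-refl) ⟩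
  ∑ℤ (λ k → Bₖ k * e k) _ ≈⟨ ∑ℤ-cong _ (decℤ-+ h₁ h₂) (λ k → ≈-trans (*-cong (Bₖ-val k) ≈-refl) (≈-trans
       (solve 4 (λ s e i q → (:- con ¼ :- s :* e :* (i :+ con ½)) :* q := :- con ¼ :* q :+ (:- con ½ :* e) :* (((:- s) :* (con 1ℚ :- con 2ℚ :* (i :+ con 1ℚ))) :* q)) ≈-refl (σ k) ε (ι k) (e k))
       (+-cong ≈-refl (*-cong ≈-refl (*-cong (*-cong (≈-sym (σ-suc k)) (+-cong ≈-refl (-‿cong (*-cong ≈-refl (≈-sym (ι-suc k)))))) ≈-refl))))) ⟩
  ∑ℤ (λ k → - κ ¼ * e k + (- κ ½ * ε) * g (ℤ.suc k)) (decℤ-+ h₁ h₂) ≈⟨ ≈-trans (∑ℤ-+ _ h₁ h₂) (+-cong (∑ℤ-* _ h₁ de) (∑ℤ-* _ h₂ (dec-suc∘ dg))) ⟩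
  - κ ¼ * ∑ℤ e de + (- κ ½ * ε) * ∑ℤ (λ k → g (ℤ.suc k)) (dec-suc∘ dg) ≈⟨ +-cong (*-cong ≈-refl (≈-sym (∑ℤ-shift dec-E₀ de))) (*-cong ≈-refl (≈-trans (≈-sym (∑ℤ-shift dg (dec-suc∘ dg))) g-X)) ⟩
  - κ ¼ * c₀ + (- κ ½ * ε) * 𝐒 X ≈⟨ solve 3 (λ c e x → :- con ¼ :* c :+ (:- con ½ :* e) :* x := :- con ¼ :* c :- con ½ :* (e :* x)) ≈-refl c₀ ε (𝐒 X) ⟩
  - κ ¼ * c₀ - κ ½ * (ε * 𝐒 X) ∎
  where
  open SR
  e : ℤ → Series
  e k = q^ E₀ (ℤ.suc k)
  de : Decℤ e
  de = dec-suc∘ dec-E₀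
  g : ℤ → Series
  g k = (σ k * lin 2ℚ k) * q^ E₀ k
  dg : Decℤ g
  dg = decℤ-*ʳ (λ k → σ k * lin 2ℚ k) dec-E₀
  h₁ : Decℤ (λ k → - κ ¼ * e k)
  h₁ = decℤ-*ʳ (λ _ → - κ ¼) de
  h₂ : Decℤ (λ k → (- κ ½ * ε) * g (ℤ.suc k))
  h₂ = decℤ-*ʳ (λ _ → - κ ½ * ε) (dec-suc∘ dg)
  g-X : ∑ℤ g dg ≈ 𝐒 X
  g-X = ≈-sym (≈-trans (𝐒-∑ℤ _ (decℤ-𝐒 (decℤ-*ʳ _ dec-tri))) (∑ℤ-cong _ dg λ k → ≈-trans (𝐒-* _ _) (*-cong (𝐒-σlin 2ℚ k) (≈-sym (q^-𝐒 (tri k) refl)))))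
  to-S₂ : T₀ w₃ ≈ ∑ℤ (λ k → e k * S₂ k) (decℤ-*ˡ S₂ de)
  to-S₂ = ∑ℤ-cong _ _ λ k → *-cong ≈-refl (tail-u k)
  reflect : ∑ℤ (λ k → e k * S₂ k) (decℤ-*ˡ S₂ de) ≈ ∑ℤ (λ k → e k * S₂ (~ k)) (decℤ-*ˡ (λ k → S₂ (~ k)) de)
  reflect = ≈-trans (∑ℤ-~ _ (dec-~∘ (decℤ-*ˡ S₂ de))) (∑ℤ-cong _ _ λ k → *-cong (q^-cong (cong (λ t → t ℕ.+ (t ℕ.+ t)) (tri-suc-~ k))) ≈-refl)

T₀-val : T₀ w₀ ≈ - κ (+ 3 ℚ./ 2) * c₀ - κ 3ℚ * (ε * 𝐒 X)
T₀-val = begin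
  T₀ w₀ ≈⟨ ∑ℤ-cong _ (decℤ-*ʳ (λ _ → κ (+ 12 ℚ./ 1)) d) (λ k → ≈-trans (*-cong ≈-refl (tail-* _ _ _)) (solve 2 (λ q t → q :* (con (+ 12 ℚ./ 1) :* t) := con (+ 12 ℚ./ 1) :* (q :* t)) ≈-refl (q^ E₀ (ℤ.suc k)) (tail w₃ (ℤ.pred k)))) ⟩
  _ ≈⟨ ∑ℤ-* _ _ d ⟩
  κ (+ 12 ℚ./ 1) * T₀ w₃ ≈⟨ solve 1 (λ x → con (+ 12 ℚ./ 1) :* x := con 6ℚ :* (con 2ℚ :* x)) ≈-refl (T₀ w₃) ⟩
  κ 6ℚ * (κ 2ℚ * T₀ w₃) ≈⟨ *-cong ≈-refl T₀u-val ⟩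
  κ 6ℚ * (- κ ¼ * c₀ - κ ½ * (ε * 𝐒 X)) ≈⟨ solve 2 (λ c x → con 6ℚ :* (:- con ¼ :* c :- con ½ :* x) := :- con (+ 3 ℚ./ 2) :* c :- con 3ℚ :* x) ≈-refl c₀ _ ⟩
  - κ (+ 3 ℚ./ 2) * c₀ - κ 3ℚ * (ε * 𝐒 X) ∎
  where
  open SR
  d : Decℤ (λ k → q^ E₀ (ℤ.suc k) * tail w₃ (ℤ.pred k))
  d = decℤ-*ˡ (λ k → tail w₃ (ℤ.pred k)) (dec-suc∘ dec-E₀)

-- The weight of m = 3d is three times that of d, since it is linear up to a sign of equal parity.
-- Subtracting three times the rank sum at q³ therefore turns each y (3d) into y (3d) - 𝐒 (v d), the
-- quantity that `y₀-U` evaluates.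
R₂-defect : Series
R₂-defect = comp₀ (rank-sum cos₂) - κ 3ℚ * 𝐒 (rank-sum cos₂)

R₂-expand : R₂-defect ≈ (P₀ - κ 3ℚ * 𝐒 P̄) + κ 2ℚ * (Y₁ w₁ + Y₂ w₂ + ∑ (λ n → w₀ n * (y (thrice (suc n)) - 𝐒 (v (suc n)))) (dec-Y₀′ w₀))
R₂-expand = begin
  R₂-defect ≈⟨ +-cong (comp₀-rank-sum cos₂ cf₂-0 cf₂-1 cf₂-2) (-‿cong (*-cong ≈-refl 𝐒R)) ⟩
  (κ 1ℚ * P₀ + κ 2ℚ * (Y₁ w₁ + Y₂ w₂ + Y₀ w₀)) - κ 3ℚ * (κ 1ℚ * 𝐒 P̄ + κ 2ℚ * (κ 4ℚ * ∑ (λ n → w₃ n * 𝐒 (v (suc n))) du))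
    ≈⟨ solve 6 (λ p s a b c d → (con 1ℚ :* p :+ con 2ℚ :* (a :+ b :+ c)) :- con 3ℚ :* (con 1ℚ :* s :+ con 2ℚ :* (con 4ℚ :* d)) := (p :- con 3ℚ :* s) :+ con 2ℚ :* (a :+ b :+ (c :+ :- con (+ 12 ℚ./ 1) :* d))) ≈-refl P₀ (𝐒 P̄) (Y₁ w₁) (Y₂ w₂) (Y₀ w₀) _ ⟩
  (P₀ - κ 3ℚ * 𝐒 P̄) + κ 2ℚ * (Y₁ w₁ + Y₂ w₂ + (Y₀ w₀ + - κ (+ 12 ℚ./ 1) * ∑ (λ n → w₃ n * 𝐒 (v (suc n))) du))
    ≈⟨ +-cong ≈-refl (*-cong ≈-refl (+-cong ≈-refl (≈-trans (+-cong ≈-refl (≈-sym (∑-⊗ _ du′ du))) (≈-trans (≈-sym (∑-⊕ (dec-⊕ (dec-⊗ʳ w₀ dec-y₀) du′) _ _)) (∑-cong _ _ λ n →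
         solve 3 (λ w₃ y v → (con (+ 12 ℚ./ 1) :* w₃) :* y :+ (:- con (+ 12 ℚ./ 1)) :* (w₃ :* v) := (con (+ 12 ℚ./ 1) :* w₃) :* (y :- v)) ≈-refl (w₃ n) (y (thrice (suc n))) (𝐒 (v (suc n)))))))) ⟩
  _ ∎
  where
  open SR
  du : Dec (λ n → w₃ n * 𝐒 (v (suc n)))
  du = dec-⊗ʳ w₃ dec-𝐒v
  du′ : Dec (λ n → - κ (+ 12 ℚ./ 1) * (w₃ n * 𝐒 (v (suc n))))
  du′ = dec-⊗ʳ (λ _ → - κ (+ 12 ℚ./ 1)) du
  d₁ : Dec (λ n → κ 4ℚ * (w₃ n * 𝐒 (v (suc n))))
  d₁ = dec-⊗ʳ (λ _ → κ 4ℚ) du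
  termwise : ∀ n → 𝐒 (κ (cf cos₂ (suc n)) * v (suc n)) ≈ κ 4ℚ * (w₃ n * 𝐒 (v (suc n)))
  termwise n = ≈-trans (𝐒-* _ _) (≈-trans (*-cong (≈-trans (𝐒-κ _) (cf₂ (suc n))) ≈-refl) (*-assoc _ _ _))
  𝐒R : 𝐒 (rank-sum cos₂) ≈ κ 1ℚ * 𝐒 P̄ + κ 2ℚ * (κ 4ℚ * ∑ (λ n → w₃ n * 𝐒 (v (suc n))) du)
  𝐒R = ≈-trans (𝐒-+ _ _) (+-cong (≈-trans (𝐒-* _ _) (*-cong (𝐒-κ 1ℚ) ≈-refl)) (≈-trans (𝐒-* _ _) (*-cong (𝐒-κ 2ℚ)
    (≈-trans (𝐒-∑ (dec-κv cos₂) (dec-≈ (λ n → ≈-sym (termwise n)) d₁)) (≈-trans (∑-cong _ d₁ termwise) (∑-⊗ _ _ du))))))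

R₂-theta : c₁ * R₂-defect ≈ κ 4ℚ * (ε * (P₀ * 𝒫₋)) - κ 6ℚ * (ε * (q^ 1 * (P₂ * 𝐒 X)))
R₂-theta = begin
  c₁ * R₂-defect ≈⟨ *-cong ≈-refl R₂-expand ⟩
  c₁ * ((P₀ - κ 3ℚ * 𝐒 P̄) + κ 2ℚ * (Y₁ w₁ + Y₂ w₂ + Z)) ≈⟨ solve 6 (λ c p s a b d → c :* ((p :- con 3ℚ :* s) :+ con 2ℚ :* (a :+ b :+ d)) := c :* (p :- con 3ℚ :* s) :+ con 2ℚ :* (c :* a :+ c :* b :+ c :* d)) ≈-refl c₁ P₀ (𝐒 P̄) _ _ Z ⟩
  c₁ * (P₀ - κ 3ℚ * 𝐒 P̄) + κ 2ℚ * (c₁ * Y₁ w₁ + c₁ * Y₂ w₂ + c₁ * Z) ≈⟨ +-cong ≈-refl (*-cong ≈-refl (+-cong (≈-trans (+-cong (Y₁-val w₁) (Y₂-val w₂)) (≈-trans (≈-sym (distribˡ _ _ _)) (*-cong ≈-refl T₁₂-val))) (≈-trans (Y₀-val w₀) (*-cong ≈-refl T₀-val)))) ⟩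
  c₁ * (P₀ - κ 3ℚ * 𝐒 P̄) + κ 2ℚ * (P₀ * (c₁ + κ 2ℚ * (ε * 𝒫₋)) + (q^ 1 * P₂) * (- κ (+ 3 ℚ./ 2) * c₀ - κ 3ℚ * (ε * 𝐒 X)))
    -- The terms free of ε are collected into 3 (c₁ (P₀ - 𝐒 P̄) - q c₀ P₂), which is zero.
    ≈⟨ solve 9 (λ c p s e m q r d x → c :* (p :- con 3ℚ :* s) :+ con 2ℚ :* (p :* (c :+ con 2ℚ :* (e :* m)) :+ (q :* r) :* (:- con (+ 3 ℚ./ 2) :* d :- con 3ℚ :* (e :* x)))
         := (con 4ℚ :* (e :* (p :* m)) :- con 6ℚ :* (e :* (q :* (r :* x)))) :+ con 3ℚ :* (c :* (p :- s) :- q :* (d :* r))) ≈-refl c₁ P₀ (𝐒 P̄) ε 𝒫₋ (q^ 1) P₂ c₀ (𝐒 X) ⟩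
  (κ 4ℚ * (ε * (P₀ * 𝒫₋)) - κ 6ℚ * (ε * (q^ 1 * (P₂ * 𝐒 X)))) + κ 3ℚ * (c₁ * (P₀ - 𝐒 P̄) - q^ 1 * (c₀ * P₂))
    ≈⟨ ≈-trans (+-cong ≈-refl (≈-trans (*-cong ≈-refl (zero-diff c₁P₀-𝐒P̄)) (zeroʳ _))) (+-identityʳ _) ⟩
  κ 4ℚ * (ε * (P₀ * 𝒫₋)) - κ 6ℚ * (ε * (q^ 1 * (P₂ * 𝐒 X))) ∎
  where
  open SR
  Z = ∑ (λ n → w₀ n * (y (thrice (suc n)) - 𝐒 (v (suc n)))) (dec-Y₀′ w₀)

-- Elimination: once `𝒫₋` and 𝐒 X are expressed by `a`, `b`, `c₀`, `c₁`, the linear relations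
-- between P₀, P₁, P₂ leave the constant term of a P₀ as the only contribution.
theta-bracket : κ 4ℚ * (P₀ * 𝒫₋) - κ 6ℚ * (q^ 1 * (P₂ * 𝐒 X)) ≈ κ 4ℚ * (a * c₁)
theta-bracket = begin
  κ 4ℚ * (P₀ * 𝒫₋) - κ 6ℚ * (q^ 1 * (P₂ * 𝐒 X)) ≈⟨ +-cong (solve 2 (λ p m → con 4ℚ :* (p :* m) := con 2ℚ :* (p :* (con 2ℚ :* m))) ≈-refl P₀ 𝒫₋) (-‿cong (*-cong ≈-refl (*-cong ≈-refl (*-cong ≈-refl 𝐒X-val)))) ⟩
  κ 2ℚ * (P₀ * (κ 2ℚ * 𝒫₋)) - κ 6ℚ * (q^ 1 * (P₂ * (a * (a * c₀)))) ≈⟨ +-cong (*-cong ≈-refl (*-cong ≈-refl 𝒫₋-val)) (-‿cong (solve 4 (λ q p a c → con 6ℚ :* (q :* (p :* (a :* (a :* c)))) := con 6ℚ :* ((a :* (a :* p)) :* (q :* c))) ≈-refl (q^ 1) P₂ a c₀)) ⟩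
  κ 2ℚ * (P₀ * (κ 2ℚ * (a * (a * c₁)) + κ 4ℚ * (q^ 1 * (b * (b * c₀))))) - κ 6ℚ * ((a * (a * P₂)) * (q^ 1 * c₀)) ≈⟨ +-cong ≈-refl (-‿cong (*-cong ≈-refl (*-cong aaP₂ ≈-refl))) ⟩
  κ 2ℚ * (P₀ * (κ 2ℚ * (a * (a * c₁)) + κ 4ℚ * (q^ 1 * (b * (b * c₀))))) - κ 6ℚ * ((κ 4ℚ * (b * (b * P₀))) * (q^ 1 * c₀))
    ≈⟨ solve 6 (λ p a c q b d → con 2ℚ :* (p :* (con 2ℚ :* (a :* (a :* c)) :+ con 4ℚ :* (q :* (b :* (b :* d))))) :- con 6ℚ :* ((con 4ℚ :* (b :* (b :* p))) :* (q :* d))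
         := con 4ℚ :* ((a :* c) :* (a :* p) :- (con 4ℚ :* (b :* (b :* p))) :* (q :* d))) ≈-refl P₀ a c₁ (q^ 1) b c₀ ⟩
  κ 4ℚ * ((a * c₁) * (a * P₀) - (κ 4ℚ * (b * (b * P₀))) * (q^ 1 * c₀)) ≈⟨ *-cong ≈-refl (+-cong (*-cong ≈-refl aP₀) (-‿cong (*-cong (≈-sym aaP₂) ≈-refl))) ⟩
  κ 4ℚ * ((a * c₁) * (1# + κ 2ℚ * (q^ 1 * (b * P₂))) - (a * (a * P₂)) * (q^ 1 * c₀))
    ≈⟨ solve 6 (λ a c q b p d → con 4ℚ :* ((a :* c) :* (con 1ℚ :+ con 2ℚ :* (q :* (b :* p))) :- (a :* (a :* p)) :* (q :* d)) := con 4ℚ :* (a :* c) :+ con 4ℚ :* ((a :* (p :* q)) :* (con 2ℚ :* (b :* c) :- a :* d))) ≈-refl a c₁ (q^ 1) b P₂ c₀ ⟩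
  κ 4ℚ * (a * c₁) + κ 4ℚ * ((a * (P₂ * q^ 1)) * (κ 2ℚ * (b * c₁) - a * c₀)) ≈⟨ ≈-trans (+-cong ≈-refl (≈-trans (*-cong ≈-refl (≈-trans (*-cong ≈-refl (zero-diff (≈-sym ac₀))) (zeroʳ _))) (zeroʳ _))) (+-identityʳ _) ⟩
  κ 4ℚ * (a * c₁) ∎
  where
  open SR
  aaP₂ : a * (a * P₂) ≈ κ 4ℚ * (b * (b * P₀))
  aaP₂ = ≈-trans (*-cong ≈-refl aP₂) (≈-trans (solve 3 (λ a b p → a :* (con 2ℚ :* (b :* p)) := con 2ℚ :* (b :* (a :* p))) ≈-refl a b P₁) (≈-trans (*-cong ≈-refl (*-cong ≈-refl aP₁)) (solve 2 (λ b p → con 2ℚ :* (b :* (con 2ℚ :* (b :* p))) := con 4ℚ :* (b :* (b :* p))) ≈-refl b P₀)))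

R₂-val : comp₀ (rank-sum cos₂) ≈ κ 3ℚ * 𝐒 (rank-sum cos₂) - κ 2ℚ * (φ * (φ * a))
R₂-val = ≈-trans (solve 2 (λ x s → x := s :+ (x :- s)) ≈-refl (comp₀ (rank-sum cos₂)) (κ 3ℚ * 𝐒 (rank-sum cos₂))) (+-cong ≈-refl (unit-cancel {c₁} c₁-unit (begin
  c₁ * R₂-defect ≈⟨ R₂-theta ⟩
  κ 4ℚ * (ε * (P₀ * 𝒫₋)) - κ 6ℚ * (ε * (q^ 1 * (P₂ * 𝐒 X))) ≈⟨ solve 3 (λ e x y → con 4ℚ :* (e :* x) :- con 6ℚ :* (e :* y) := e :* (con 4ℚ :* x :- con 6ℚ :* y)) ≈-refl ε _ _ ⟩
  ε * (κ 4ℚ * (P₀ * 𝒫₋) - κ 6ℚ * (q^ 1 * (P₂ * 𝐒 X))) ≈⟨ *-cong ≈-refl theta-bracket ⟩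
  ε * (κ 4ℚ * (a * c₁)) ≈⟨ solve 3 (λ e a c → e :* (con 4ℚ :* (a :* c)) := :- (con 2ℚ :* ((:- (con 2ℚ :* e)) :* (a :* c)))) ≈-refl ε a c₁ ⟩
  - (κ 2ℚ * (η * (a * c₁))) ≈⟨ -‿cong (*-cong ≈-refl (*-cong η≈φφ ≈-refl)) ⟩
  - (κ 2ℚ * ((φ * φ) * (a * c₁))) ≈⟨ solve 3 (λ p a c → :- (con 2ℚ :* ((p :* p) :* (a :* c))) := c :* (:- (con 2ℚ :* (p :* (p :* a))))) ≈-refl φ a c₁ ⟩
  c₁ * (- (κ 2ℚ * (φ * (φ * a)))) ∎)))
  where open SR

𝒫₊-val : 𝒫₊ ≈ c̃₁ * (φ * φ)
-- k = 0 and k = 1 both contribute 1 to the constant term of `ψ₂`; the ½ makes it cancellable.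
𝒫₊-val = unit-cancel {κ ½ * ψ₂} half-unit (begin
  (κ ½ * ψ₂) * 𝒫₊ ≈⟨ solve 2 (λ s p → (con ½ :* s) :* p := con ½ :* (p :* s)) ≈-refl ψ₂ 𝒫₊ ⟩
  κ ½ * (𝒫₊ * ψ₂) ≈⟨ *-cong ≈-refl (≈-trans ψ₂𝒫₊ (*-cong ≈-refl X-φφψ₂)) ⟩
  κ ½ * (c̃₁ * (φ * (φ * ψ₂))) ≈⟨ solve 3 (λ c p s → con ½ :* (c :* (p :* (p :* s))) := (con ½ :* s) :* (c :* (p :* p))) ≈-refl c̃₁ φ ψ₂ ⟩
  (κ ½ * ψ₂) * (c̃₁ * (φ * φ)) ∎)
  where
  open SR
  opaque
    unfolding ∑ℤ ∑ _+_ _*_ κ -_ q^_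
    ψ₂-0 : ψ₂ 0 ≡ 2ℚ
    ψ₂-0 = refl
  half-unit : Unit (κ ½ * ψ₂)
  half-unit = trans (κ-at ½ ψ₂ 0) (cong (½ ℚ.*_) ψ₂-0)

-- Infinite products

∏ : ℕ → (ℕ → Series) → Series
∏ zero u = 1#
∏ (suc L) u = ∏ L u * u L

∏-cong : ∀ {u v} L → (∀ n → u n ≈ v n) → ∏ L u ≈ ∏ L v
∏-cong zero h = ≈-refl
∏-cong (suc L) h = *-cong (∏-cong L h) (h L)

∏-* : ∀ u v L → ∏ L (λ n → u n * v n) ≈ ∏ L u * ∏ L v
∏-* u v zero = ≈-sym (*-identityˡ 1#)
∏-* u v (suc L) = ≈-trans (*-cong (∏-* u v L) ≈-refl) (solve 4 (λ a b c d → (a :* b) :* (c :* d) := (a :* c) :* (b :* d)) ≈-refl (∏ L u) (∏ L v) (u L) (v L))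

∏-front : ∀ u L → ∏ (suc L) u ≈ u 0 * ∏ L (λ n → u (suc n))
∏-front u zero = *-comm _ _
∏-front u (suc L) = ≈-trans (*-cong (∏-front u L) ≈-refl) (*-assoc _ _ _)

∏-twice : ∀ u L → ∏ L (λ n → u (twice n)) * ∏ L (λ n → u (suc (twice n))) ≈ ∏ (twice L) u
∏-twice u zero = *-identityˡ 1#
∏-twice u (suc L) = ≈-trans (solve 4 (λ a b c d → (a :* b) :* (c :* d) := ((a :* c) :* b) :* d) ≈-refl (∏ L (λ n → u (twice n))) (u (twice L)) (∏ L (λ n → u (suc (twice n)))) (u (suc (twice L)))) (*-cong (*-cong (∏-twice u L) ≈-refl) ≈-refl)

∏-thrice : ∀ u L → ∏ L (λ n → u (thrice n)) * ∏ L (λ n → u (suc (thrice n))) * ∏ L (λ n → u (suc (suc (thrice n)))) ≈ ∏ (thrice L) u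
∏-thrice u zero = solve 0 (con 1ℚ :* con 1ℚ :* con 1ℚ := con 1ℚ) ≈-refl
∏-thrice u (suc L) = ≈-trans (solve 6 (λ a x b y c z → (a :* x) :* (b :* y) :* (c :* z) := (((a :* b) :* c) :* x) :* y :* z) ≈-refl _ (u (thrice L)) _ (u (suc (thrice L))) _ (u (suc (suc (thrice L))))) (*-cong (*-cong (*-cong (∏-thrice u L) ≈-refl) ≈-refl) ≈-refl)

factor : ℕ → ℕ → ℕ → Series
factor a m k = 1# - q^ (a ℕ.+ m ℕ.* k)

pochFin-∏ : ∀ a m K → pochFin a m K ≈ ∏ (suc K) (factor a m)
pochFin-∏ a m zero = ≈-trans (≈-trans (⊖-is-− _ _) (+-cong one-is-1 (-‿cong (≈-trans (mono-is-q^ a) (q^-cong (sym (trans (cong (a ℕ.+_) (ℕP.*-zeroʳ m)) (ℕP.+-identityʳ a)))))))) (≈-sym (*-identityˡ _))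
pochFin-∏ a m (suc K) = ≈-trans (⊗-is-* _ _) (*-cong (pochFin-∏ a m K) (≈-trans (⊖-is-− _ _) (+-cong one-is-1 (-‿cong (mono-is-q^ _)))))

∏-stable : ∀ u K → (∀ k → K ≤ k → Ord K (u k - 1#)) → ∀ L → K ≤ L → Agree K (∏ K u) (∏ L u)
∏-stable u K h L K≤L = subst (λ z → Agree K (∏ K u) (∏ z u)) (ℕP.m+[n∸m]≡n K≤L) (go (L ∸ K))
  where
  go : ∀ i → Agree K (∏ K u) (∏ (K ℕ.+ i) u)
  go zero = subst (λ z → Agree K (∏ K u) (∏ z u)) (sym (ℕP.+-identityʳ K)) (λ n _ → refl)
  go (suc i) = subst (λ z → Agree K (∏ K u) (∏ z u)) (sym (ℕP.+-suc K i)) (agree-trans (go i)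
    (agree-trans (≈⇒agree K (≈-sym (*-identityʳ _))) (agree-⊗ {K} {∏ (K ℕ.+ i) u} (λ n _ → refl) (unit (h (K ℕ.+ i) (ℕP.m≤m+n K i))))))
    where
    unit : ∀ {f} → Ord K (f - 1#) → Agree K 1# f
    unit {f} o = agree-trans (≈⇒agree K (≈-sym (+-identityʳ 1#))) (agree-trans (agree-⊕ {K} {1#} {1#} {0#} {f - 1#} (λ n _ → refl) (λ n l → trans (0-at n) (sym (o n l))))
      (≈⇒agree K (solve 1 (λ f → con 1ℚ :+ (f :- con 1ℚ) := f) ≈-refl f)))

-- The N-th coefficient of `P` is taken from a product of N + 1 factors. All later factors are 1 up
-- to exponents beyond N, so this diagonal choice is the limit.
P-⟶ : ∀ a m → (λ L → ∏ L (factor (suc a) (suc m))) ⟶ P (suc a) (suc m)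
P-⟶ a m N = N , λ L N≤L n n<N → trans (at (pochFin-∏ (suc a) (suc m) n) n)
  (∏-stable (factor (suc a) (suc m)) (suc n) (λ k l → ord-≈ (solve 1 (λ q → :- q := (con 1ℚ :- q) :- con 1ℚ) ≈-refl (q^ (suc a ℕ.+ suc m ℕ.* k)))
      (ord-- (ord-≤ (s≤s (ℕP.≤-trans (ℕP.≤-trans (ℕP.n≤1+n n) l) (ℕP.≤-trans (ℕP.m≤m+n k (m ℕ.* k)) (ℕP.m≤n+m _ a)))) (q^-ord _)))) L (ℕP.≤-trans n<N N≤L) n ℕP.≤-refl)

P-split₂ : ∀ a m → P (suc a) (suc m) ≈ P (suc a) (suc m ℕ.+ suc m) * P (suc a ℕ.+ suc m) (suc m ℕ.+ suc m)
P-split₂ a m = ⟶-unique (⟶-subseq twice ≤-twice (P-⟶ a m)) (⟶-cong (λ L → ≈-trans (*-cong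
    (∏-cong L λ n → +-cong ≈-refl (-‿cong (q^-cong (cong (suc a ℕ.+_) (even n)))))
    (∏-cong L λ n → +-cong ≈-refl (-‿cong (q^-cong (odd n)))))
    (∏-twice (factor (suc a) (suc m)) L)) ≈-refl (⟶-⊗ (P-⟶ a (m ℕ.+ suc m)) (P-⟶ (a ℕ.+ suc m) (m ℕ.+ suc m))))
  where
  even : ∀ n → (suc m ℕ.+ suc m) ℕ.* n ≡ suc m ℕ.* twice n
  even n = trans (ℕR.solve 2 (λ m n → (m ℕR.:+ m) ℕR.:* n ℕR.:= m ℕR.:* (n ℕR.:+ n)) refl (suc m) n) (cong (suc m ℕ.*_) (sym (twice-is n)))
  odd : ∀ n → (suc a ℕ.+ suc m) ℕ.+ (suc m ℕ.+ suc m) ℕ.* n ≡ suc a ℕ.+ suc m ℕ.* suc (twice n)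
  odd n = trans (cong ((suc a ℕ.+ suc m) ℕ.+_) (even n)) (trans (ℕP.+-assoc (suc a) (suc m) _) (cong (suc a ℕ.+_) (sym (ℕP.*-suc (suc m) (twice n)))))

P-split₃ : ∀ a m → let M = suc m ℕ.+ (suc m ℕ.+ suc m) in
  P (suc a) (suc m) ≈ P (suc a) M * P (suc a ℕ.+ suc m) M * P (suc a ℕ.+ (suc m ℕ.+ suc m)) M
P-split₃ a m = ⟶-unique (⟶-subseq thrice ≤-thrice (P-⟶ a m)) (⟶-cong (λ L → ≈-trans (*-cong (*-cong
    (∏-cong L λ n → +-cong ≈-refl (-‿cong (q^-cong (cong (suc a ℕ.+_) (e₀ n)))))
    (∏-cong L λ n → +-cong ≈-refl (-‿cong (q^-cong (e₁ n)))))
    (∏-cong L λ n → +-cong ≈-refl (-‿cong (q^-cong (e₂ n)))))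
    (∏-thrice (factor (suc a) (suc m)) L)) ≈-refl (⟶-⊗ (⟶-⊗ (P-⟶ a (m ℕ.+ (suc m ℕ.+ suc m))) (P-⟶ (a ℕ.+ suc m) (m ℕ.+ (suc m ℕ.+ suc m)))) (P-⟶ (a ℕ.+ (suc m ℕ.+ suc m)) (m ℕ.+ (suc m ℕ.+ suc m)))))
  where
  e₀ : ∀ n → (suc m ℕ.+ (suc m ℕ.+ suc m)) ℕ.* n ≡ suc m ℕ.* thrice n
  e₀ n = trans (ℕR.solve 2 (λ m n → (m ℕR.:+ (m ℕR.:+ m)) ℕR.:* n ℕR.:= m ℕR.:* (n ℕR.:+ (n ℕR.:+ n))) refl (suc m) n) (cong (suc m ℕ.*_) (sym (thrice-is n)))
  e₁ : ∀ n → (suc a ℕ.+ suc m) ℕ.+ (suc m ℕ.+ (suc m ℕ.+ suc m)) ℕ.* n ≡ suc a ℕ.+ suc m ℕ.* suc (thrice n)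
  e₁ n = trans (cong ((suc a ℕ.+ suc m) ℕ.+_) (e₀ n)) (trans (ℕP.+-assoc (suc a) (suc m) _) (cong (suc a ℕ.+_) (sym (ℕP.*-suc (suc m) (thrice n)))))
  e₂ : ∀ n → (suc a ℕ.+ (suc m ℕ.+ suc m)) ℕ.+ (suc m ℕ.+ (suc m ℕ.+ suc m)) ℕ.* n ≡ suc a ℕ.+ suc m ℕ.* suc (suc (thrice n))
  e₂ n = trans (cong ((suc a ℕ.+ (suc m ℕ.+ suc m)) ℕ.+_) (e₀ n)) (ℕR.solve 3 (λ a m n → (a ℕR.:+ (m ℕR.:+ m)) ℕR.:+ m ℕR.:* n ℕR.:= a ℕR.:+ m ℕR.:* (ℕR.con 2 ℕR.:+ n)) refl (suc a) (suc m) (thrice n))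

J₁ : Series
J₁ = P 1 1

Aₗ Bₗ : ℕ → Series
Aₗ L = ∏ L (λ k → 1# - q^ suc k)
Bₗ L = ∏ L (λ k → 1# + q^ suc k)

J₁-⟶ : Aₗ ⟶ J₁
J₁-⟶ = ⟶-cong (λ L → ∏-cong L λ n → +-cong ≈-refl (-‿cong (q^-cong (cong suc (ℕP.*-identityˡ n))))) ≈-refl (P-⟶ 0 0)

𝐃-∏ : ∀ u L → 𝐃 (∏ L u) ≈ ∏ L (λ n → 𝐃 (u n))
𝐃-∏ u zero = 𝐃-κ 1ℚ
𝐃-∏ u (suc L) = ≈-trans (𝐃-* _ _) (*-cong (𝐃-∏ u L) ≈-refl)

𝐒-∏ : ∀ u L → 𝐒 (∏ L u) ≈ ∏ L (λ n → 𝐒 (u n))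
𝐒-∏ u zero = 𝐒-κ 1ℚ
𝐒-∏ u (suc L) = ≈-trans (𝐒-* _ _) (*-cong (𝐒-∏ u L) ≈-refl)

𝐃-1-q^ : ∀ e → 𝐃 (1# - q^ e) ≈ 1# - q^ (e ℕ.+ e)
𝐃-1-q^ e = ≈-trans (𝐃-+ _ _) (+-cong (𝐃-κ 1ℚ) (≈-trans (𝐃-neg _) (-‿cong (𝐃-q^ e))))

𝐒-1-q^ : ∀ e → 𝐒 (1# - q^ e) ≈ 1# - q^ thrice e
𝐒-1-q^ e = ≈-trans (𝐒-+ _ _) (+-cong (𝐒-κ 1ℚ) (≈-trans (𝐒-neg _) (-‿cong (𝐒-q^ e))))

𝐃P : ∀ a m → 𝐃 (P (suc a) (suc m)) ≈ P (suc a ℕ.+ suc a) (suc m ℕ.+ suc m)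
𝐃P a m = ⟶-unique (𝐃-⟶ (P-⟶ a m)) (⟶-cong (λ L → ≈-sym (≈-trans (𝐃-∏ _ L) (∏-cong L λ n → ≈-trans (𝐃-1-q^ _) (+-cong ≈-refl (-‿cong (q^-cong
  (ℕR.solve 3 (λ a m n → (a ℕR.:+ m ℕR.:* n) ℕR.:+ (a ℕR.:+ m ℕR.:* n) ℕR.:= (a ℕR.:+ a) ℕR.:+ (m ℕR.:+ m) ℕR.:* n) refl (suc a) (suc m) n))))))) ≈-refl (P-⟶ (a ℕ.+ suc a) (m ℕ.+ suc m)))

𝐒P : ∀ a m → 𝐒 (P (suc a) (suc m)) ≈ P (suc a ℕ.+ (suc a ℕ.+ suc a)) (suc m ℕ.+ (suc m ℕ.+ suc m))
𝐒P a m = ⟶-unique (𝐒-⟶ (P-⟶ a m)) (⟶-cong (λ L → ≈-sym (≈-trans (𝐒-∏ _ L) (∏-cong L λ n → ≈-trans (𝐒-1-q^ _) (+-cong ≈-refl (-‿cong (q^-cong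
  (trans (thrice-is _) (ℕR.solve 3 (λ a m n → let e = a ℕR.:+ m ℕR.:* n in e ℕR.:+ (e ℕR.:+ e) ℕR.:= (a ℕR.:+ (a ℕR.:+ a)) ℕR.:+ (m ℕR.:+ (m ℕR.:+ m)) ℕR.:* n) refl (suc a) (suc m) n)))))))) ≈-refl (P-⟶ (a ℕ.+ (suc a ℕ.+ suc a)) (m ℕ.+ (suc m ℕ.+ suc m))))

AB-𝐃 : ∀ L → Aₗ L * Bₗ L ≈ 𝐃 (Aₗ L)
AB-𝐃 L = ≈-trans (≈-sym (∏-* _ _ L)) (≈-trans (∏-cong L λ k → ≈-trans (solve 1 (λ q → (con 1ℚ :- q) :* (con 1ℚ :+ q) := con 1ℚ :- q :* q) ≈-refl (q^ suc k))
  (≈-trans (+-cong ≈-refl (-‿cong (q^-+ (suc k) (suc k)))) (≈-sym (𝐃-1-q^ (suc k))))) (≈-sym (𝐃-∏ _ L)))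

-- Without a bound on the number of parts, the parts up to l contribute the product of (1 + q^k)/(1
-- - q^k). The bound j + 1 affects only exponents larger than j.
Box-product : ∀ l j → Ord (suc j) (Aₗ l * Box l (suc j) - Bₗ l)
Box-product zero j = ord-≈ (solve 0 (con 0ℚ := con 1ℚ :* con 1ℚ :- con 1ℚ) ≈-refl) ord-0#
Box-product (suc l) j = ord-≈ (≈-sym (solve 7 (λ A B Q x y z w → (A :* (con 1ℚ :- Q)) :* (x :+ Q :* (y :+ z)) :- B :* (con 1ℚ :+ Q)
      := (con 1ℚ :+ Q) :* (A :* x :- B) :+ :- (A :* Q) :* (((x :+ Q :* (y :+ z)) :- y) :+ (x :- z))) ≈-refl (Aₗ l) (Bₗ l) (q^ suc l) (Box l (suc j)) (Box (suc l) j) (Box l j) 1#))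
  (ord-⊕ (ord-⊗ʳ _ (Box-product l j)) (ord-⊗ʳ _ (ord-⊕ (side (suc l)) (side l))))
  where
  side : ∀ l → Ord (suc j) (Box l (suc j) - Box l j)
  side l = ord-≈ (+-cong (Box-sym (suc j) l) (-‿cong (Box-sym j l))) (Box-diff-ord j l)

-- The passage from counting to infinite products: in the limit of large boxes J₁ P̄ is the product
-- of the 1 + q^k, and multiplying by J₁ once more gives the product of the 1 - q^(2k).
J₁²P̄ : J₁ * J₁ * P̄ ≈ 𝐃 J₁
J₁²P̄ = ⟶-unique (⟶-⊗ (⟶-⊗ A′ A′) (⟶-subseq suc (λ n → ℕP.n≤1+n n) Box-⟶))
  (⟶-cong (λ J → solve 3 (λ A x B → A :* B :+ A :* (A :* x :- B) := (A :* A) :* x) ≈-refl (Aₗ (suc (suc J))) (Box (suc (suc J)) (suc J)) (Bₗ (suc (suc J))))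
    (+-identityʳ _)
    (⟶-⊕ (⟶-cong (λ J → ≈-sym (AB-𝐃 (suc (suc J)))) ≈-refl (𝐃-⟶ A′))
      (⟶-0 λ N → N , λ L l → ord-⊗ʳ _ (ord-≤ (ℕP.m≤n⇒m≤1+n l) (Box-product (suc (suc L)) L)))))
  where
  A′ : (λ J → Aₗ (suc (suc J))) ⟶ J₁
  A′ = ⟶-subseq (λ n → suc (suc n)) (λ n → ℕP.m≤n⇒m≤1+n (ℕP.n≤1+n n)) J₁-⟶

-- Shanks' identity and the cubic norm

-- (q)_{s+i} / (q)_s
ratio : ℕ → ℕ → Series
ratio s i = ∏ i (λ j → 1# - q^ suc (s ℕ.+ j))

shanks : ℕ → ℕ → Series
shanks s i = σℕ s * (ratio s i * q^ (s ℕ.* (s ℕ.+ i) ℕ.+ T (suc s)))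

-- The remainder left by the terms up to s, combined with the change of the term s + 1, is a
-- remainder of the same shape one place further.
shanks-step : ∀ s i → let N = suc s ℕ.+ i in
  (shanks (suc s) (suc i) - shanks (suc s) i) - shanks s (suc i) * q^ (suc N ℕ.+ s) ≈ - (shanks (suc s) i * q^ (suc N ℕ.+ suc s))
shanks-step s i = begin
  (shanks (suc s) (suc i) - shanks (suc s) i) - shanks s (suc i) * q^ (suc N ℕ.+ s)
    ≈⟨ +-cong (+-cong (*-cong ≈-refl (≈-trans (*-cong ≈-refl (≈-sym (q^*q^ e₁))) ≈-refl)) ≈-refl) (-‿cong (≈-trans (solve 5 (λ s u v e f → (s :* (u :* e)) :* f := (s :* u) :* (e :* f)) ≈-refl (σℕ s) (ratio s (suc i)) 0# (q^ (s ℕ.* (s ℕ.+ suc i) ℕ.+ T (suc s))) (q^ (suc N ℕ.+ s)))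
        (*-cong (*-cong ≈-refl (≈-trans (∏-front _ i) (*-cong (+-cong ≈-refl (-‿cong (q^-cong (cong suc (ℕP.+-identityʳ s))))) (∏-cong i λ j → +-cong ≈-refl (-‿cong (q^-cong (cong suc (ℕP.+-suc s j)))))))) (q^*q^ e₂)))) ⟩
  ((- σℕ s) * ((Q * (1# - q^ suc N)) * (q^ suc s * E)) - (- σℕ s) * (Q * E)) - (σℕ s * ((1# - q^ suc s) * Q)) * E
    ≈⟨ solve 5 (λ s Q E x y → (:- s :* ((Q :* (con 1ℚ :- x)) :* (y :* E)) :- :- s :* (Q :* E)) :- (s :* ((con 1ℚ :- y) :* Q)) :* E := :- ((:- s :* (Q :* E)) :* (x :* y))) ≈-refl (σℕ s) Q E (q^ suc N) (q^ suc s) ⟩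
  - (((- σℕ s) * (Q * E)) * (q^ suc N * q^ suc s)) ≈⟨ -‿cong (*-cong ≈-refl (q^-+ (suc N) (suc s))) ⟩
  - (shanks (suc s) i * q^ (suc N ℕ.+ suc s)) ∎
  where
  open SR
  N = suc s ℕ.+ i
  Q = ratio (suc s) i
  E = q^ (suc s ℕ.* (suc s ℕ.+ i) ℕ.+ T (suc (suc s)))
  e₁ : suc s ℕ.+ (suc s ℕ.* (suc s ℕ.+ i) ℕ.+ T (suc (suc s))) ≡ suc s ℕ.* (suc s ℕ.+ suc i) ℕ.+ T (suc (suc s))
  e₁ = ℕR.solve 3 (λ s i t → (ℕR.con 1 ℕR.:+ s) ℕR.:+ ((ℕR.con 1 ℕR.:+ s) ℕR.:* ((ℕR.con 1 ℕR.:+ s) ℕR.:+ i) ℕR.:+ t) ℕR.:= (ℕR.con 1 ℕR.:+ s) ℕR.:* ((ℕR.con 1 ℕR.:+ s) ℕR.:+ (ℕR.con 1 ℕR.:+ i)) ℕR.:+ t) refl s i (T (suc (suc s)))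
  e₂ : s ℕ.* (s ℕ.+ suc i) ℕ.+ T (suc s) ℕ.+ (suc N ℕ.+ s) ≡ suc s ℕ.* (suc s ℕ.+ i) ℕ.+ T (suc (suc s))
  e₂ = ℕR.solve 3 (λ s i t → s ℕR.:* (s ℕR.:+ (ℕR.con 1 ℕR.:+ i)) ℕR.:+ t ℕR.:+ (ℕR.con 1 ℕR.:+ (ℕR.con 1 ℕR.:+ s ℕR.:+ i) ℕR.:+ s) ℕR.:= (ℕR.con 1 ℕR.:+ s) ℕR.:* ((ℕR.con 1 ℕR.:+ s) ℕR.:+ i) ℕR.:+ ((ℕR.con 1 ℕR.:+ s) ℕR.:+ t)) refl s i (T (suc s))

-- Shanks' finite form of the pentagonal number theorem: S N = Σ_{s ≤ N} (-1)^s ((q)_N / (q)_s) q^{sN + s(s+1)/2}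
shanks-diff : ∀ s i → let N = s ℕ.+ i in
  psum (suc s) (λ r → shanks r (suc N ∸ r)) - psum (suc s) (λ r → shanks r (N ∸ r)) ≈ - (shanks s i * q^ (suc N ℕ.+ s))
shanks-diff zero i = begin
  (0# + shanks 0 (suc i)) - (0# + shanks 0 i) ≈⟨ +-cong (+-cong ≈-refl (*-cong ≈-refl (*-cong ≈-refl q^-0))) (-‿cong (+-cong ≈-refl (*-cong ≈-refl (*-cong ≈-refl q^-0)))) ⟩
  (0# + 1# * ((ratio 0 i * (1# - q^ suc i)) * 1#)) - (0# + 1# * (ratio 0 i * 1#)) ≈⟨ solve 2 (λ u q → (con 0ℚ :+ con 1ℚ :* ((u :* (con 1ℚ :- q)) :* con 1ℚ)) :- (con 0ℚ :+ con 1ℚ :* (u :* con 1ℚ)) := :- ((con 1ℚ :* (u :* con 1ℚ)) :* q)) ≈-refl (ratio 0 i) (q^ suc i) ⟩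
  - ((1# * (ratio 0 i * 1#)) * q^ suc i) ≈⟨ -‿cong (*-cong (*-cong ≈-refl (*-cong ≈-refl (≈-sym q^-0))) (q^-cong (sym (ℕP.+-identityʳ (suc i))))) ⟩
  - (shanks 0 i * q^ (suc i ℕ.+ 0)) ∎
  where open SR
shanks-diff (suc s) i = begin
  (psum (suc s) _ + shanks (suc s) (suc N ∸ suc s)) - (psum (suc s) _ + shanks (suc s) (N ∸ suc s))
    ≈⟨ +-cong (+-cong ≈-refl (≡⇒≈ (cong (shanks (suc s)) (trans (cong (_∸ s) (sym (ℕP.+-suc s i))) (ℕP.m+n∸m≡n s (suc i)))))) (-‿cong (+-cong ≈-refl (≡⇒≈ (cong (shanks (suc s)) (ℕP.m+n∸m≡n s i))))) ⟩
  (psum (suc s) _ + shanks (suc s) (suc i)) - (psum (suc s) _ + shanks (suc s) i)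
    ≈⟨ solve 4 (λ a b c d → (a :+ b) :- (c :+ d) := (a :- c) :+ (b :- d)) ≈-refl _ _ _ _ ⟩
  (psum (suc s) (λ r → shanks r (suc N ∸ r)) - psum (suc s) (λ r → shanks r (N ∸ r))) + (shanks (suc s) (suc i) - shanks (suc s) i)
    ≈⟨ +-cong (subst (λ M → psum (suc s) (λ r → shanks r (suc M ∸ r)) - psum (suc s) (λ r → shanks r (M ∸ r)) ≈ - (shanks s (suc i) * q^ (suc M ℕ.+ s))) (ℕP.+-suc s i) (shanks-diff s (suc i))) ≈-refl ⟩
  - (shanks s (suc i) * q^ (suc N ℕ.+ s)) + (shanks (suc s) (suc i) - shanks (suc s) i) ≈⟨ +-comm _ _ ⟩
  (shanks (suc s) (suc i) - shanks (suc s) i) - shanks s (suc i) * q^ (suc N ℕ.+ s) ≈⟨ shanks-step s i ⟩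
  - (shanks (suc s) i * q^ (suc N ℕ.+ suc s)) ∎
  where
  open SR
  N = suc s ℕ.+ i

shanks-sum : ℕ → Series
shanks-sum N = psum (suc N) (λ s → shanks s (N ∸ s))

shanks-top : ∀ N M → M ≡ 0 → shanks N M ≈ σℕ N * q^ (N ℕ.* N ℕ.+ T (suc N))
shanks-top N _ refl = *-cong ≈-refl (≈-trans (*-identityˡ _) (q^-cong (cong (λ z → N ℕ.* z ℕ.+ T (suc N)) (ℕP.+-identityʳ N))))

exp⁺ : ∀ N → N ℕ.* N ℕ.+ T (suc N) ℕ.+ (suc N ℕ.+ N) ≡ E₁ (+ suc N)
exp⁺ N = trans (ℕR.solve 2 (λ n t → n ℕR.:* n ℕR.:+ t ℕR.:+ (ℕR.con 1 ℕR.:+ n ℕR.:+ n) ℕR.:= t ℕR.:+ (ℕR.con 1 ℕR.:+ n) ℕR.:* (ℕR.con 1 ℕR.:+ n)) refl N (T (suc N)))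
  (cong (T (suc N) ℕ.+_) (ℤP.+-injective (trans (ℤP.pos-* (suc N) (suc N)) (sym (sq-is (+ suc N))))))

exp⁻ : ∀ N → suc N ℕ.* suc N ℕ.+ T (suc (suc N)) ≡ E₁ -[1+ N ]
exp⁻ N = trans (ℕP.+-comm (suc N ℕ.* suc N) _) (cong (T (suc (suc N)) ℕ.+_) (ℤP.+-injective (trans (ℤP.pos-* (suc N) (suc N)) (sym (sq-is -[1+ N ])))))

-- From N to N + 1 two pentagonal terms are gained: the remainder of `shanks-diff` is the one at k =
-- N + 1, and the new last summand is the one at k = -1 - N.
shanks-theta : ∀ N → shanks-sum N ≈ psum N (fold (λ k → σ k * q^ E₁ k)) + σ (+ N) * q^ E₁ (+ N)
shanks-theta zero = +-cong ≈-refl (*-cong ≈-refl (*-identityˡ _))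
shanks-theta (suc N) = begin
  psum (suc N) (λ s → shanks s (suc N ∸ s)) + shanks (suc N) (suc N ∸ suc N)
    ≈⟨ +-cong (solve 2 (λ x y → x := y :+ (x :- y)) ≈-refl _ (shanks-sum N)) (≈-trans (shanks-top (suc N) _ (ℕP.n∸n≡0 (suc N))) (*-cong ≈-refl (q^-cong (exp⁻ N)))) ⟩
  (shanks-sum N + (psum (suc N) (λ s → shanks s (suc N ∸ s)) - shanks-sum N)) + σ -[1+ N ] * q^ E₁ -[1+ N ]
    ≈⟨ +-cong (+-cong (shanks-theta N) (≈-trans (subst (λ M → psum (suc N) (λ r → shanks r (suc M ∸ r)) - psum (suc N) (λ r → shanks r (M ∸ r)) ≈ - (shanks N 0 * q^ (suc M ℕ.+ N))) (ℕP.+-identityʳ N) (shanks-diff N 0))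
        (≈-trans (-‿cong (≈-trans (*-cong (shanks-top N 0 refl) ≈-refl) (≈-trans (*-assoc _ _ _) (*-cong ≈-refl (q^*q^ (exp⁺ N)))))) (solve 2 (λ s q → :- (s :* q) := :- s :* q) ≈-refl (σℕ N) (q^ E₁ (+ suc N)))))) ≈-refl ⟩
  ((psum N (fold g) + g (+ N)) + g (+ suc N)) + g -[1+ N ] ≈⟨ solve 4 (λ a b c d → ((a :+ b) :+ c) :+ d := (a :+ (b :+ d)) :+ c) ≈-refl (psum N (fold g)) (g (+ N)) (g (+ suc N)) (g -[1+ N ]) ⟩
  (psum N (fold g) + fold g N) + g (+ suc N) ∎
  where
  open SR
  g : ℤ → Series
  g k = σ k * q^ E₁ k

-- In `shanks-sum` the summand s = 0 tends to the product and every other summand has order at least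
-- N; by `shanks-theta` the same sums tend to the pentagonal series.
pentagonal : c̃₁ ≈ J₁
pentagonal = ⟶-unique {shanks-sum} (⟶-cong (λ N → ≈-sym (shanks-theta N)) (≈-trans (+-identityʳ _) (≈-sym (∑ℤ-is _ d))) (⟶-⊕ (∑-has _ (dec-fold d)) (⟶-0 λ N → proj₁ (d N) , λ L l → proj₂ (d N) (+ L) l)))
  (⟶-cong (λ N → ≈-sym (≈-trans (psum-suc (λ s → shanks s (N ∸ s)) N) (+-cong (≈-trans (*-identityˡ _) (≈-trans (*-cong ≈-refl q^-0) (*-identityʳ _))) ≈-refl))) (+-identityʳ _)
    (⟶-⊕ J₁-⟶ (⟶-0 λ N → N , λ L l → psum-ord L (λ s → ord-⊗ʳ _ (ord-⊗ʳ _ (ord-≤ (ℕP.≤-trans l (big L s)) (q^-ord _)))))))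
  where
  d : Decℤ (λ k → σ k * q^ E₁ k)
  d = decℤ-*ʳ σ dec-E₁
  big : ∀ L s → L ≤ suc s ℕ.* (suc s ℕ.+ (L ∸ suc s)) ℕ.+ T (suc (suc s))
  big L s = ℕP.≤-trans (ℕP.≤-trans (ℕP.m≤n+m∸n L (suc s)) (ℕP.m≤m+n _ (s ℕ.* (suc s ℕ.+ (L ∸ suc s))))) (ℕP.m≤m+n _ (T (suc (suc s))))
  psum-ord : ∀ {N u} L → (∀ s → Ord N (u s)) → Ord N (psum L u)
  psum-ord zero h = ord-0#
  psum-ord (suc L) h = ord-⊕ (psum-ord L h) (h L)

opaque
  unfolding comp₀ comp₁ comp₂

  comp₁-⟶ : ∀ {s F} → s ⟶ F → (λ n → comp₁ (s n)) ⟶ comp₁ F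
  comp₁-⟶ {s} {F} h = comp₀-⟶ {λ n → shift (s n)} {shift F} λ N → let (M , k) = h (suc N) in M , λ L l n n<N → k L l (suc n) (s≤s n<N)

  comp₂-⟶ : ∀ {s F} → s ⟶ F → (λ n → comp₂ (s n)) ⟶ comp₂ F
  comp₂-⟶ {s} {F} h = comp₀-⟶ {λ n → shift (shift (s n))} {shift (shift F)} λ N → let (M , k) = h (suc (suc N)) in M , λ L l n n<N → k L l (suc (suc n)) (s≤s (s≤s n<N))

-- The norm of x + y t + z t² for t³ = q.
cubes : Series → Series → Series → Series
cubes x y z = x * (x * x) + q^ 1 * (y * (y * y)) + q^ 1 * (q^ 1 * (z * (z * z))) - κ 3ℚ * (q^ 1 * (x * (y * z)))

-- the norm of the extension ℚ((q)) ⊇ ℚ((q³)), with q³ renamed to q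
norm : Series → Series
norm f = cubes (comp₀ f) (comp₁ f) (comp₂ f)

cubes-cong : ∀ {x x′ y y′ z z′} → x ≈ x′ → y ≈ y′ → z ≈ z′ → cubes x y z ≈ cubes x′ y′ z′
cubes-cong p r s = +-cong (+-cong (+-cong (*-cong p (*-cong p p)) (*-cong ≈-refl (*-cong r (*-cong r r)))) (*-cong ≈-refl (*-cong ≈-refl (*-cong s (*-cong s s))))) (-‿cong (*-cong ≈-refl (*-cong ≈-refl (*-cong p (*-cong r s)))))

norm-cong : ∀ {f g} → f ≈ g → norm f ≈ norm g
norm-cong p = cubes-cong (comp₀-cong p) (comp₁-cong p) (comp₂-cong p)

norm-⟶ : ∀ {s F} → s ⟶ F → (λ n → norm (s n)) ⟶ norm F
norm-⟶ {s} {F} h = ⟶-⊕ (⟶-⊕ (⟶-⊕ (cube x) (⟶-⊗ (⟶-const (q^ 1)) (cube y′))) (⟶-⊗ (⟶-const (q^ 1)) (⟶-⊗ (⟶-const (q^ 1)) (cube z))))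
  (neg (⟶-⊗ (⟶-const (κ 3ℚ)) (⟶-⊗ (⟶-const (q^ 1)) (⟶-⊗ x (⟶-⊗ y′ z)))))
  where
  x = comp₀-⟶ h
  y′ = comp₁-⟶ h
  z = comp₂-⟶ h
  cube : ∀ {t G} → t ⟶ G → (λ n → t n * (t n * t n)) ⟶ G * (G * G)
  cube p = ⟶-⊗ p (⟶-⊗ p p)
  neg : ∀ {t G} → t ⟶ G → (λ n → - t n) ⟶ - G
  neg {t} {G} p = ⟶-cong (λ n → solve 1 (λ x → :- con 1ℚ :* x := :- x) ≈-refl (t n)) (solve 1 (λ x → :- con 1ℚ :* x := :- x) ≈-refl G) (⟶-⊗ (⟶-const (- 1#)) p)

private
  sub : ∀ f g → f * (1# - g) ≈ f + - (g * f)
  sub = solve 2 (λ f g → f :* (con 1ℚ :- g) := f :+ :- (g :* f)) ≈-refl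

  minus₀ : ∀ {f g h} → comp₀ g ≈ h → comp₀ (f + - g) ≈ comp₀ f + - h
  minus₀ p = ≈-trans (comp₀-+ _ _) (+-cong ≈-refl (≈-trans (comp₀-neg _) (-‿cong p)))
  minus₁ : ∀ {f g h} → comp₁ g ≈ h → comp₁ (f + - g) ≈ comp₁ f + - h
  minus₁ p = ≈-trans (comp₁-+ _ _) (+-cong ≈-refl (≈-trans (comp₁-neg _) (-‿cong p)))
  minus₂ : ∀ {f g h} → comp₂ g ≈ h → comp₂ (f + - g) ≈ comp₂ f + - h
  minus₂ p = ≈-trans (comp₂-+ _ _) (+-cong ≈-refl (≈-trans (comp₂-neg _) (-‿cong p)))

-- Multiplicativity of the norm is used only for factors 1 - t^i u with i = 0, 1, 2 and u a series
-- in q³, where it is a polynomial identity.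
norm-factor₀ : ∀ f u → norm (f * (1# - 𝐒 u)) ≈ norm f * ((1# - u) * ((1# - u) * (1# - u)))
norm-factor₀ f u = ≈-trans (norm-cong (sub f (𝐒 u))) (≈-trans (cubes-cong (minus₀ (comp₀-𝐒* u f)) (minus₁ (comp₁-𝐒* u f)) (minus₂ (comp₂-𝐒* u f)))
  (solve 5 (λ x y z q u → let X = x :+ :- (u :* x) ; Y = y :+ :- (u :* y) ; Z = z :+ :- (u :* z) in
      X :* (X :* X) :+ q :* (Y :* (Y :* Y)) :+ q :* (q :* (Z :* (Z :* Z))) :- con 3ℚ :* (q :* (X :* (Y :* Z)))
      := (x :* (x :* x) :+ q :* (y :* (y :* y)) :+ q :* (q :* (z :* (z :* z))) :- con 3ℚ :* (q :* (x :* (y :* z)))) :* ((con 1ℚ :- u) :* ((con 1ℚ :- u) :* (con 1ℚ :- u)))) ≈-refl (comp₀ f) (comp₁ f) (comp₂ f) (q^ 1) u))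

norm-factor₁ : ∀ f u → norm (f * (1# - q^ 1 * 𝐒 u)) ≈ norm f * (1# - q^ 1 * (u * (u * u)))
norm-factor₁ f u = ≈-trans (norm-cong (≈-trans (sub f _) (+-cong ≈-refl (-‿cong (*-assoc _ _ _))))) (≈-trans (cubes-cong
    (minus₀ (≈-trans (comp₀-q* _) (*-cong ≈-refl (comp₂-𝐒* u f)))) (minus₁ (≈-trans (comp₁-q* _) (comp₀-𝐒* u f))) (minus₂ (≈-trans (comp₂-q* _) (comp₁-𝐒* u f))))
  (solve 5 (λ x y z q u → let X = x :+ :- (q :* (u :* z)) ; Y = y :+ :- (u :* x) ; Z = z :+ :- (u :* y) in
      X :* (X :* X) :+ q :* (Y :* (Y :* Y)) :+ q :* (q :* (Z :* (Z :* Z))) :- con 3ℚ :* (q :* (X :* (Y :* Z)))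
      := (x :* (x :* x) :+ q :* (y :* (y :* y)) :+ q :* (q :* (z :* (z :* z))) :- con 3ℚ :* (q :* (x :* (y :* z)))) :* (con 1ℚ :- q :* (u :* (u :* u)))) ≈-refl (comp₀ f) (comp₁ f) (comp₂ f) (q^ 1) u))

norm-factor₂ : ∀ f u → norm (f * (1# - q^ 1 * (q^ 1 * 𝐒 u))) ≈ norm f * (1# - q^ 1 * (q^ 1 * (u * (u * u))))
norm-factor₂ f u = ≈-trans (norm-cong (≈-trans (sub f _) (+-cong ≈-refl (-‿cong (≈-trans (*-assoc _ _ _) (*-cong ≈-refl (*-assoc _ _ _))))))) (≈-trans (cubes-cong
    (minus₀ (≈-trans (comp₀-q* _) (*-cong ≈-refl (≈-trans (comp₂-q* _) (comp₁-𝐒* u f)))))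
    (minus₁ (≈-trans (comp₁-q* _) (≈-trans (comp₀-q* _) (*-cong ≈-refl (comp₂-𝐒* u f)))))
    (minus₂ (≈-trans (comp₂-q* _) (≈-trans (comp₁-q* _) (comp₀-𝐒* u f)))))
  (solve 5 (λ x y z q u → let X = x :+ :- (q :* (u :* y)) ; Y = y :+ :- (q :* (u :* z)) ; Z = z :+ :- (u :* x) in
      X :* (X :* X) :+ q :* (Y :* (Y :* Y)) :+ q :* (q :* (Z :* (Z :* Z))) :- con 3ℚ :* (q :* (X :* (Y :* Z)))
      := (x :* (x :* x) :+ q :* (y :* (y :* y)) :+ q :* (q :* (z :* (z :* z))) :- con 3ℚ :* (q :* (x :* (y :* z)))) :* (con 1ℚ :- q :* (q :* (u :* (u :* u))))) ≈-refl (comp₀ f) (comp₁ f) (comp₂ f) (q^ 1) u))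

∏-interleave : ∀ u {x y z : ℕ → Series} → (∀ n → x n ≈ u (thrice n)) → (∀ n → y n ≈ u (suc (thrice n))) → (∀ n → z n ≈ u (suc (suc (thrice n)))) →
  ∀ L → ∏ L (λ n → x n * y n * z n) ≈ ∏ (thrice L) u
∏-interleave u p r s zero = ≈-refl
∏-interleave u p r s (suc L) = ≈-trans (*-cong (∏-interleave u p r s L) (*-cong (*-cong (p L) (r L)) (s L))) (solve 4 (λ a x y z → a :* (x :* y :* z) := a :* x :* y :* z) ≈-refl _ _ _ _)

q^-cube : ∀ e → q^ e * (q^ e * q^ e) ≈ 𝐒 (q^ e)
q^-cube e = ≈-trans (*-cong ≈-refl (q^-+ e e)) (≈-trans (q^-+ e (e ℕ.+ e)) (≈-trans (q^-cong (sym (thrice-is e))) (≈-sym (𝐒-q^ e))))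

-- For a monomial u the cube of u is 𝐒 u. Hence the norm reproduces a factor whose exponent is prime
-- to 3, while 1 - q^(3k) becomes (1 - q^k)³. The factors 1 - q^(3k) stay in the product on the
-- right and are compensated by 𝐒 of the product of the 1 - q^k on the left, without any division.
module NormProduct (i j k : ℕ → ℕ) where
  h₁ h₂ h₀ : ℕ → Series
  h₁ m = 1# - q^ 1 * 𝐒 (q^ i m)
  h₂ m = 1# - q^ 1 * (q^ 1 * 𝐒 (q^ j m))
  h₀ m = 1# - 𝐒 (q^ k m)

  finite : ∀ f L → norm (f * ∏ L (λ m → h₁ m * h₂ m * h₀ m)) * 𝐒 (∏ L (λ m → 1# - q^ k m))
    ≈ norm f * (∏ L (λ m → h₁ m * h₂ m * h₀ m) * (∏ L (λ m → 1# - q^ k m) * (∏ L (λ m → 1# - q^ k m) * ∏ L (λ m → 1# - q^ k m))))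
  finite f zero = ≈-trans (*-cong (norm-cong (*-identityʳ f)) (𝐒-κ 1ℚ)) (solve 1 (λ n → n :* con 1ℚ := n :* (con 1ℚ :* (con 1ℚ :* (con 1ℚ :* con 1ℚ)))) ≈-refl (norm f))
  finite f (suc L) = begin
    norm (f * (Π * (h₁ L * h₂ L * h₀ L))) * 𝐒 (K * (1# - q^ k L))
      ≈⟨ *-cong (norm-cong (solve 5 (λ f p x y z → f :* (p :* (x :* y :* z)) := (((f :* p) :* x) :* y) :* z) ≈-refl f Π (h₁ L) (h₂ L) (h₀ L)))
           (≈-trans (𝐒-* _ _) (*-cong ≈-refl (≈-trans (𝐒-+ _ _) (+-cong (𝐒-κ 1ℚ) (𝐒-neg _))))) ⟩
    norm ((((f * Π) * h₁ L) * h₂ L) * h₀ L) * (𝐒 K * h₀ L)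
      ≈⟨ *-cong (≈-trans (norm-factor₀ _ _) (*-cong (≈-trans (norm-factor₂ _ _) (*-cong (≈-trans (norm-factor₁ _ _) (*-cong ≈-refl (+-cong ≈-refl (-‿cong (*-cong ≈-refl (q^-cube (i L))))))) (+-cong ≈-refl (-‿cong (*-cong ≈-refl (*-cong ≈-refl (q^-cube (j L)))))))) ≈-refl)) ≈-refl ⟩
    (((norm (f * Π) * h₁ L) * h₂ L) * (w * (w * w))) * (𝐒 K * h₀ L)
      ≈⟨ solve 6 (λ n x y t s z → (((n :* x) :* y) :* (t :* (t :* t))) :* (s :* z) := (n :* s) :* ((x :* y :* z) :* (t :* (t :* t)))) ≈-refl (norm (f * Π)) (h₁ L) (h₂ L) w (𝐒 K) (h₀ L) ⟩
    (norm (f * Π) * 𝐒 K) * ((h₁ L * h₂ L * h₀ L) * (w * (w * w))) ≈⟨ *-cong (finite f L) ≈-refl ⟩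
    (norm f * (Π * (K * (K * K)))) * ((h₁ L * h₂ L * h₀ L) * (w * (w * w)))
      ≈⟨ solve 5 (λ n p k h t → (n :* (p :* (k :* (k :* k)))) :* (h :* (t :* (t :* t))) := n :* ((p :* h) :* ((k :* t) :* ((k :* t) :* (k :* t))))) ≈-refl (norm f) Π K _ w ⟩
    _ ∎
    where
    open SR
    Π = ∏ L (λ m → h₁ m * h₂ m * h₀ m)
    K = ∏ L (λ m → 1# - q^ k m)
    w = 1# - q^ k L

  norm-product : ∀ f {F G} → (λ L → ∏ L (λ m → h₁ m * h₂ m * h₀ m)) ⟶ F → (λ L → ∏ L (λ m → 1# - q^ k m)) ⟶ G → norm (f * F) * 𝐒 G ≈ norm f * (F * (G * (G * G)))
  norm-product f p r = ⟶-unique (⟶-⊗ (norm-⟶ (⟶-⊗ (⟶-const f) p)) (𝐒-⟶ r))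
    (⟶-cong (λ L → ≈-sym (finite f L)) ≈-refl (⟶-⊗ (⟶-const (norm f)) (⟶-⊗ p (⟶-⊗ r (⟶-⊗ r r)))))

J₂ J₃ : Series
J₂ = 𝐃 J₁
J₃ = 𝐒 J₁

norm-J₁ : ∀ f → norm (f * J₁) * J₃ ≈ norm f * (J₁ * (J₁ * (J₁ * J₁)))
norm-J₁ f = norm-product f
  (⟶-cong (λ L → ≈-sym (∏-interleave (λ n → 1# - q^ suc n)
      (λ n → +-cong ≈-refl (-‿cong (≈-trans (*-cong ≈-refl (𝐒-q^ n)) (q^-+ 1 _))))
      (λ n → +-cong ≈-refl (-‿cong (≈-trans (*-cong ≈-refl (≈-trans (*-cong ≈-refl (𝐒-q^ n)) (q^-+ 1 _))) (q^-+ 1 _))))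
      (λ n → +-cong ≈-refl (-‿cong (𝐒-q^ (suc n)))) L)) ≈-refl (⟶-subseq thrice ≤-thrice J₁-⟶))
  J₁-⟶
  where open NormProduct (λ m → m) (λ m → m) suc

J₂-⟶ : (λ L → ∏ L (λ k → 1# - q^ (suc k ℕ.+ suc k))) ⟶ J₂
J₂-⟶ = ⟶-cong (λ L → ≈-trans (𝐃-∏ _ L) (∏-cong L λ k → 𝐃-1-q^ (suc k))) ≈-refl (𝐃-⟶ J₁-⟶)

norm-J₂ : ∀ f → norm (f * J₂) * 𝐒 J₂ ≈ norm f * (J₂ * (J₂ * (J₂ * J₂)))
norm-J₂ f = norm-product f
  -- Among even exponents 6n + 2 is the class 2 and 6n + 4 the class 1 modulo 3, so the first two
  -- factors change places.
  (⟶-cong (λ L → ≈-sym (≈-trans (∏-cong L λ n → *-cong (*-comm _ _) ≈-refl) (∏-interleave (λ n → 1# - q^ (suc n ℕ.+ suc n))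
      (λ n → +-cong ≈-refl (-‿cong (≈-trans (*-cong ≈-refl (≈-trans (*-cong ≈-refl (𝐒-q^ (n ℕ.+ n))) (q^-+ 1 _))) (≈-trans (q^-+ 1 _) (q^-cong (e₂ n))))))
      (λ n → +-cong ≈-refl (-‿cong (≈-trans (*-cong ≈-refl (𝐒-q^ (suc (n ℕ.+ n)))) (≈-trans (q^-+ 1 _) (q^-cong (e₁ n))))))
      (λ n → +-cong ≈-refl (-‿cong (≈-trans (𝐒-q^ (suc n ℕ.+ suc n)) (q^-cong (e₀ n))))) L))) ≈-refl (⟶-subseq thrice ≤-thrice J₂-⟶))
  J₂-⟶
  where
  open NormProduct (λ m → suc (m ℕ.+ m)) (λ m → m ℕ.+ m) (λ m → suc m ℕ.+ suc m)
  thrice-+ : ∀ m n → thrice (m ℕ.+ n) ≡ thrice m ℕ.+ thrice n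
  thrice-+ zero n = refl
  thrice-+ (suc m) n = cong (λ z → suc (suc (suc z))) (thrice-+ m n)
  e₂ : ∀ n → suc (suc (thrice (n ℕ.+ n))) ≡ suc (thrice n) ℕ.+ suc (thrice n)
  e₂ n = trans (cong (suc ∘ suc) (thrice-+ n n)) (cong suc (sym (ℕP.+-suc (thrice n) (thrice n))))
  e₁ : ∀ n → suc (thrice (suc (n ℕ.+ n))) ≡ suc (suc (thrice n)) ℕ.+ suc (suc (thrice n))
  e₁ n = trans (cong (λ z → 4 ℕ.+ z) (thrice-+ n n)) (ℕR.solve 1 (λ t → ℕR.con 4 ℕR.:+ (t ℕR.:+ t) ℕR.:= (ℕR.con 2 ℕR.:+ t) ℕR.:+ (ℕR.con 2 ℕR.:+ t)) refl (thrice n))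
  e₀ : ∀ n → thrice (suc n ℕ.+ suc n) ≡ suc (suc (suc (thrice n))) ℕ.+ suc (suc (suc (thrice n)))
  e₀ n = thrice-+ (suc n) (suc n)

J₁-unit : Unit J₁
J₁-unit = refl

J₂-unit : Unit J₂
J₂-unit = 𝐃-unit {J₁} J₁-unit

𝐒-unit : ∀ {f} → Unit f → Unit (𝐒 f)
𝐒-unit {f} p = trans (at-0 f) p
  where
  opaque
    unfolding 𝐒
    at-0 : ∀ f → 𝐒 f 0 ≡ f 0
    at-0 f = refl

φJ₂ : φ * J₂ ≈ J₁ * J₁
φJ₂ = begin
  φ * J₂ ≈⟨ *-cong ≈-refl (≈-sym J₁²P̄) ⟩
  φ * (J₁ * J₁ * P̄) ≈⟨ solve 3 (λ f j p → f :* (j :* j :* p) := (f :* p) :* (j :* j)) ≈-refl φ J₁ P̄ ⟩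
  (φ * P̄) * (J₁ * J₁) ≈⟨ *-cong φP̄ ≈-refl ⟩
  1# * (J₁ * J₁) ≈⟨ *-identityˡ _ ⟩
  J₁ * J₁ ∎
  where open SR

a𝐒J₂ : a * 𝐒 J₂ ≈ J₃ * J₃
a𝐒J₂ = ≈-trans (≈-sym (𝐒-* φ J₂)) (≈-trans (𝐒-cong φJ₂) (𝐒-* _ _))

-- With c̃₁ = J₁, this is φ J₂ = J₁² compared with c₁ J₁ = J₂ a.
ac̃₁ : a * c̃₁ ≈ φ * c₁
ac̃₁ = unit-cancel {c̃₁} c̃₁-unit (begin
  c̃₁ * (a * c̃₁) ≈⟨ solve 2 (λ c a → c :* (a :* c) := a :* (c :* c)) ≈-refl c̃₁ a ⟩
  a * (c̃₁ * c̃₁) ≈⟨ *-cong ≈-refl (≈-trans (*-cong pentagonal pentagonal) (≈-sym φJ₂)) ⟩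
  a * (φ * J₂) ≈⟨ solve 3 (λ a f j → a :* (f :* j) := f :* (j :* a)) ≈-refl a φ J₂ ⟩
  φ * (J₂ * a) ≈⟨ *-cong ≈-refl (≈-sym (≈-trans c₁c̃₁ (*-cong (𝐃-cong pentagonal) ≈-refl))) ⟩
  φ * (c₁ * c̃₁) ≈⟨ solve 3 (λ f c d → f :* (c :* d) := d :* (f :* c)) ≈-refl φ c₁ c̃₁ ⟩
  c̃₁ * (φ * c₁) ∎)
  where open SR

Δ : Series
Δ = a * (a * a) - κ 8ℚ * (q^ 1 * (b * (b * b)))

norm-φ : norm φ ≈ Δ
norm-φ = ≈-trans (cubes-cong p₀ p₁ p₂) (solve 3 (λ a b q → a :* (a :* a) :+ q :* ((:- (con 2ℚ :* b)) :* ((:- (con 2ℚ :* b)) :* (:- (con 2ℚ :* b)))) :+ q :* (q :* (con 0ℚ :* (con 0ℚ :* con 0ℚ))) :- con 3ℚ :* (q :* (a :* ((:- (con 2ℚ :* b)) :* con 0ℚ)))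
    := a :* (a :* a) :- con 8ℚ :* (q :* (b :* (b :* b)))) ≈-refl a b (q^ 1))
  where
  p₀ : comp₀ φ ≈ a
  p₀ = ≈-trans (comp₀-cong (≈-sym (*-identityʳ φ))) (≈-trans (φ*₀ 1#) (≈-trans (+-cong (*-cong ≈-refl (comp₀-κ 1ℚ)) (-‿cong (*-cong ≈-refl (*-cong ≈-refl (*-cong ≈-refl (comp₂-κ 1ℚ))))))
    (solve 3 (λ a b q → a :* con 1ℚ :- con 2ℚ :* (q :* (b :* con 0ℚ)) := a) ≈-refl a b (q^ 1))))
  p₁ : comp₁ φ ≈ - (κ 2ℚ * b)
  p₁ = ≈-trans (comp₁-cong (≈-sym (*-identityʳ φ))) (≈-trans (φ*₁ 1#) (≈-trans (+-cong (*-cong ≈-refl (comp₁-κ 1ℚ)) (-‿cong (*-cong ≈-refl (*-cong ≈-refl (comp₀-κ 1ℚ)))))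
    (solve 2 (λ a b → a :* con 0ℚ :- con 2ℚ :* (b :* con 1ℚ) := :- (con 2ℚ :* b)) ≈-refl a b)))
  p₂ : comp₂ φ ≈ 0#
  p₂ = ≈-trans (comp₂-cong (≈-sym (*-identityʳ φ))) (≈-trans (φ*₂ 1#) (≈-trans (+-cong (*-cong ≈-refl (comp₂-κ 1ℚ)) (-‿cong (*-cong ≈-refl (*-cong ≈-refl (comp₁-κ 1ℚ)))))
    (solve 2 (λ a b → a :* con 0ℚ :- con 2ℚ :* (b :* con 0ℚ) := con 0ℚ) ≈-refl a b)))

norm-J₁-val : norm J₁ * J₃ ≈ J₁ * (J₁ * (J₁ * J₁))
norm-J₁-val = ≈-trans (*-cong (norm-cong (≈-sym (*-identityˡ J₁))) ≈-refl) (≈-trans (norm-J₁ 1#) (≈-trans (*-cong (≈-trans (cubes-cong (comp₀-κ 1ℚ) (comp₁-κ 1ℚ) (comp₂-κ 1ℚ))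
  (solve 1 (λ q → con 1ℚ :* (con 1ℚ :* con 1ℚ) :+ q :* (con 0ℚ :* (con 0ℚ :* con 0ℚ)) :+ q :* (q :* (con 0ℚ :* (con 0ℚ :* con 0ℚ))) :- con 3ℚ :* (q :* (con 1ℚ :* (con 0ℚ :* con 0ℚ))) := con 1ℚ) ≈-refl (q^ 1))) ≈-refl) (*-identityˡ _)))

-- The norm of φ J₂ = J₁² evaluated on both sides: Δ J₂⁴ / J₂(q³) on the left and J₁⁸ / J₁(q³)² on
-- the right, where a = J₁(q³)² / J₂(q³).
Δa : Δ * a ≈ φ * (φ * (φ * φ))
Δa = unit-cancel {𝐒 J₂} (𝐒-unit {J₂} J₂-unit) (unit-cancel {J₂ * (J₂ * (J₂ * J₂))} u⁴ (begin
  J⁴ * (S * (Δ * a)) ≈⟨ solve 4 (λ j s d a → j :* (s :* (d :* a)) := (d :* j) :* (a :* s)) ≈-refl J⁴ S Δ a ⟩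
  (Δ * J⁴) * (a * S) ≈⟨ *-cong (≈-trans (*-cong (≈-sym norm-φ) ≈-refl) (≈-sym (norm-J₂ φ))) a𝐒J₂ ⟩
  (norm (φ * J₂) * S) * (J₃ * J₃) ≈⟨ solve 3 (λ n s c → (n :* s) :* (c :* c) := s :* ((n :* c) :* c)) ≈-refl (norm (φ * J₂)) S J₃ ⟩
  S * ((norm (φ * J₂) * J₃) * J₃) ≈⟨ *-cong ≈-refl (*-cong (≈-trans (*-cong (norm-cong φJ₂) ≈-refl) (norm-J₁ J₁)) ≈-refl) ⟩
  S * ((norm J₁ * (J₁ * (J₁ * (J₁ * J₁)))) * J₃) ≈⟨ solve 4 (λ s n j c → s :* ((n :* j) :* c) := s :* ((n :* c) :* j)) ≈-refl S (norm J₁) (J₁ * (J₁ * (J₁ * J₁))) J₃ ⟩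
  S * ((norm J₁ * J₃) * (J₁ * (J₁ * (J₁ * J₁)))) ≈⟨ *-cong ≈-refl (*-cong norm-J₁-val ≈-refl) ⟩
  S * ((J₁ * (J₁ * (J₁ * J₁))) * (J₁ * (J₁ * (J₁ * J₁)))) ≈⟨ solve 2 (λ s j → s :* ((j :* (j :* (j :* j))) :* (j :* (j :* (j :* j)))) := s :* ((j :* j) :* ((j :* j) :* ((j :* j) :* (j :* j))))) ≈-refl S J₁ ⟩
  S * ((J₁ * J₁) * ((J₁ * J₁) * ((J₁ * J₁) * (J₁ * J₁)))) ≈⟨ *-cong ≈-refl (*-cong h (*-cong h (*-cong h h))) ⟩
  S * ((φ * J₂) * ((φ * J₂) * ((φ * J₂) * (φ * J₂)))) ≈⟨ solve 3 (λ s f j → s :* ((f :* j) :* ((f :* j) :* ((f :* j) :* (f :* j)))) := (j :* (j :* (j :* j))) :* (s :* (f :* (f :* (f :* f))))) ≈-refl S φ J₂ ⟩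
  J⁴ * (S * (φ * (φ * (φ * φ)))) ∎))
  where
  open SR
  S = 𝐒 J₂
  J⁴ = J₂ * (J₂ * (J₂ * J₂))
  h = ≈-sym φJ₂
  u⁴ : Unit J⁴
  u⁴ = unit-* {J₂} {J₂ * (J₂ * J₂)} J₂-unit (unit-* {J₂} {J₂ * J₂} J₂-unit (unit-* {J₂} {J₂} J₂-unit J₂-unit))

-- Cramer's rule for the system `aP₀`, `aP₁`, `aP₂`; its determinant is Δ and the relevant cofactor
-- a².
ΔP₀ : Δ * P₀ ≈ a * a
ΔP₀ = begin
  Δ * P₀ ≈⟨ solve 4 (λ a b q p → (a :* (a :* a) :- con 8ℚ :* (q :* (b :* (b :* b)))) :* p := (a :* a) :* (a :* p) :- con 4ℚ :* ((q :* (b :* b)) :* (con 2ℚ :* (b :* p)))) ≈-refl a b (q^ 1) P₀ ⟩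
  (a * a) * (a * P₀) - κ 4ℚ * ((q^ 1 * (b * b)) * (κ 2ℚ * (b * P₀))) ≈⟨ +-cong (*-cong ≈-refl aP₀) (-‿cong (*-cong ≈-refl (*-cong ≈-refl (≈-sym aP₁)))) ⟩
  (a * a) * (1# + κ 2ℚ * (q^ 1 * (b * P₂))) - κ 4ℚ * ((q^ 1 * (b * b)) * (a * P₁))
    ≈⟨ solve 5 (λ a b q p r → (a :* a) :* (con 1ℚ :+ con 2ℚ :* (q :* (b :* p))) :- con 4ℚ :* ((q :* (b :* b)) :* (a :* r)) := a :* a :+ con 2ℚ :* ((q :* (a :* b)) :* (a :* p :- con 2ℚ :* (b :* r)))) ≈-refl a b (q^ 1) P₂ P₁ ⟩
  a * a + κ 2ℚ * ((q^ 1 * (a * b)) * (a * P₂ - κ 2ℚ * (b * P₁))) ≈⟨ ≈-trans (+-cong ≈-refl (≈-trans (*-cong ≈-refl (≈-trans (*-cong ≈-refl (zero-diff aP₂)) (zeroʳ _))) (zeroʳ _))) (+-identityʳ _) ⟩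
  a * a ∎
  where open SR

P₀φ⁴ : P₀ * (φ * (φ * (φ * φ))) ≈ a * (a * a)
P₀φ⁴ = ≈-trans (*-cong ≈-refl (≈-sym Δa)) (≈-trans (solve 3 (λ p d a → p :* (d :* a) := a :* (d :* p)) ≈-refl P₀ Δ a) (*-cong ≈-refl ΔP₀))

theta-quotient : ∀ {R} → c₁ * R ≈ P₀ * (c̃₁ * (φ * φ)) → φ * R ≈ a * a
theta-quotient {R} h = unit-cancel {c₁} c₁-unit (unit-cancel {a} a-unit (begin
  a * (c₁ * (φ * R)) ≈⟨ solve 4 (λ a c f r → a :* (c :* (f :* r)) := (a :* f) :* (c :* r)) ≈-refl a c₁ φ R ⟩
  (a * φ) * (c₁ * R) ≈⟨ *-cong ≈-refl h ⟩
  (a * φ) * (P₀ * (c̃₁ * (φ * φ))) ≈⟨ solve 4 (λ a f p c → (a :* f) :* (p :* (c :* (f :* f))) := (a :* c) :* (p :* (f :* (f :* f)))) ≈-refl a φ P₀ c̃₁ ⟩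
  (a * c̃₁) * (P₀ * (φ * (φ * φ))) ≈⟨ *-cong ac̃₁ ≈-refl ⟩
  (φ * c₁) * (P₀ * (φ * (φ * φ))) ≈⟨ solve 3 (λ f c p → (f :* c) :* (p :* (f :* (f :* f))) := c :* (p :* (f :* (f :* (f :* f))))) ≈-refl φ c₁ P₀ ⟩
  c₁ * (P₀ * (φ * (φ * (φ * φ)))) ≈⟨ *-cong ≈-refl P₀φ⁴ ⟩
  c₁ * (a * (a * a)) ≈⟨ solve 2 (λ c a → c :* (a :* (a :* a)) := a :* (c :* (a :* a))) ≈-refl c₁ a ⟩
  a * (c₁ * (a * a)) ∎))
  where open SR

φR₃ : φ * comp₀ (rank-sum cos₃) ≈ a * a
φR₃ = theta-quotient (≈-trans R₃-val (*-cong ≈-refl 𝒫₊-val))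

φR₆ : φ * comp₀ (rank-sum cos₆) ≈ a * a
φR₆ = theta-quotient (≈-trans R₆-val (*-cong ≈-refl (*-cong ≈-refl η≈φφ)))

-- Quotients

recip-inverse : ∀ c → c ≢ 0ℚ → c ℚ.* recip c ≡ 1ℚ
recip-inverse c c≢0 with c ℚP.≟ 0ℚ
... | yes p = contradiction p c≢0
... | no ¬p = ℚP.*-inverseʳ c {{ℚ.≢-nonZero ¬p}}

downFrom : Series → ℕ → List ℚ
downFrom g zero = g 0 ∷ []
downFrom g (suc n) = g (suc n) ∷ downFrom g n

convolution : ∀ f g n → sumℚ (zipWith ℚ._*_ (applyUpTo f (suc n)) (downFrom g n)) ≡ (f * g) n
convolution f g zero = trans (ℚP.+-identityʳ _) (sym (*-at-0 f g))
convolution f g (suc n) = trans (cong (f 0 ℚ.* g (suc n) ℚ.+_) (convolution (shift f) g n)) (sym (*-at-suc f g n))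

invAux-suc : ∀ f n → let x = ℚ.- (recip (f 0) ℚ.* sumℚ (zipWith ℚ._*_ (applyUpTo (λ i → f (suc i)) (suc n)) (proj₂ (invAux f n)))) in
  invAux f (suc n) ≡ (x , x ∷ proj₂ (invAux f n))
invAux-suc f n with invAux f n
... | (_ , bs) = refl

invAux-list : ∀ f n → proj₂ (invAux f n) ≡ downFrom (inv f) n
invAux-list f zero = refl
invAux-list f (suc n) = trans (cong proj₂ (invAux-suc f n)) (cong₂ _∷_ (sym (cong proj₁ (invAux-suc f n))) (invAux-list f n))

-- The list kept by `invAux` holds the earlier coefficients in reverse order, so its zip with the
-- shifted series is the convolution that the next coefficient has to cancel.
*-inv : ∀ f → f 0 ≢ 0ℚ → f * inv f ≈ 1#
*-inv f f₀≢0 = ≈-trans (mk go) one-is-1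
  where
  go : ∀ n → (f * inv f) n ≡ one n
  go zero = trans (*-at-0 f (inv f)) (recip-inverse (f 0) f₀≢0)
  go (suc n) = trans (*-at-suc f (inv f) n) (trans (cong (ℚ._+ S) (cong (f 0 ℚ.*_) (trans (cong proj₁ (invAux-suc f n)) (cong (λ z → ℚ.- (recip (f 0) ℚ.* z)) (trans (cong (λ l → sumℚ (zipWith ℚ._*_ (applyUpTo (λ i → f (suc i)) (suc n)) l)) (invAux-list f n)) (convolution (shift f) (inv f) n))))))
    (trans (ℚR.solve 3 (λ c r s → c ℚR.:* (ℚR.:- (r ℚR.:* s)) ℚR.:+ s ℚR.:= s ℚR.:* (ℚR.con 1ℚ ℚR.:- c ℚR.:* r)) refl (f 0) (recip (f 0)) S)
      (trans (cong (λ z → S ℚ.* (1ℚ ℚ.- z)) (recip-inverse (f 0) f₀≢0)) (ℚP.*-zeroʳ S))))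
    where S = (shift f * inv f) n

⊘-≈ : ∀ {f g h} → g 0 ≢ 0ℚ → g * h ≈ f → f ⊘ g ≈ h
⊘-≈ {f} {g} {h} g₀≢0 p = begin
  f ⊘ g ≈⟨ ⊗-is-* f (inv g) ⟩
  f * inv g ≈⟨ *-cong (≈-sym p) ≈-refl ⟩
  g * h * inv g ≈⟨ solve 3 (λ g h i → g :* h :* i := (g :* i) :* h) ≈-refl g h (inv g) ⟩
  (g * inv g) * h ≈⟨ *-cong (*-inv g g₀≢0) ≈-refl ⟩
  1# * h ≈⟨ *-identityˡ h ⟩
  h ∎
  where open SR

^^-is-^ : ∀ f n → f ^^ n ≈ f ^ n
^^-is-^ f zero = one-is-1
^^-is-^ f (suc n) = ≈-trans (⊗-is-* f _) (*-cong ≈-refl (^^-is-^ f n))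

⊗-≈ : ∀ {f f′ g g′} → f ≈ f′ → g ≈ g′ → f ⊗ g ≈ f′ * g′
⊗-≈ {f} {f′} {g} p r = ≈-trans (⊗-is-* f g) (*-cong p r)

^^-≈ : ∀ {f f′} n → f ≈ f′ → f ^^ n ≈ f′ ^ n
^^-≈ {f} n p = ≈-trans (^^-is-^ f n) (^-cong p (refl {x = n}))

-- The factors of (q;q) sorted by the greatest common divisor of the exponent with 6. All products
-- of the theorem are monomials in these four.
xₚ yₚ cₚ dₚ : Series
xₚ = P 1 6 * P 5 6
yₚ = P 2 6 * P 4 6
cₚ = P 3 6
dₚ = P 6 6

J₂-split : P 2 2 ≈ yₚ * dₚ
J₂-split = P-split₃ 1 1

J₁-split : J₁ ≈ xₚ * cₚ * (yₚ * dₚ)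
J₁-split = ≈-trans (P-split₂ 0 0) (*-cong (≈-trans (P-split₃ 0 1) (solve 3 (λ x c y → x :* c :* y := x :* y :* c) ≈-refl (P 1 6) cₚ (P 5 6))) J₂-split)

a-product : a ≈ cₚ * cₚ * dₚ
a-product = unit-cancel {dₚ} refl (begin
  dₚ * a ≈⟨ *-comm _ _ ⟩
  a * dₚ ≈⟨ *-cong ≈-refl (≈-sym (≈-trans (𝐒-cong (𝐃P 0 0)) (𝐒P 1 1))) ⟩
  a * 𝐒 J₂ ≈⟨ a𝐒J₂ ⟩
  J₃ * J₃ ≈⟨ *-cong J₃-split J₃-split ⟩
  (cₚ * dₚ) * (cₚ * dₚ) ≈⟨ solve 2 (λ c d → (c :* d) :* (c :* d) := d :* (c :* c :* d)) ≈-refl cₚ dₚ ⟩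
  dₚ * (cₚ * cₚ * dₚ) ∎)
  where
  open SR
  J₃-split : J₃ ≈ cₚ * dₚ
  J₃-split = ≈-trans (𝐒P 0 0) (P-split₂ 2 2)

1≢0 : ∀ {x} → x ≡ 1ℚ → x ≢ 0ℚ
1≢0 refl ()

unit-letters : Unit xₚ × Unit yₚ × Unit cₚ × Unit dₚ
unit-letters = unit-* {P 1 6} {P 5 6} refl refl , unit-* {P 2 6} {P 4 6} refl refl , refl , refl

φ-product : φ ≈ xₚ * xₚ * yₚ * (cₚ * cₚ * dₚ)
φ-product = unit-cancel {yₚ * dₚ} (unit-* {yₚ} {dₚ} (proj₁ (proj₂ unit-letters)) refl) (begin
  (yₚ * dₚ) * φ ≈⟨ *-comm _ _ ⟩
  φ * (yₚ * dₚ) ≈⟨ *-cong ≈-refl (≈-sym (≈-trans (𝐃P 0 0) J₂-split)) ⟩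
  φ * J₂ ≈⟨ φJ₂ ⟩
  J₁ * J₁ ≈⟨ *-cong J₁-split J₁-split ⟩
  (xₚ * cₚ * (yₚ * dₚ)) * (xₚ * cₚ * (yₚ * dₚ)) ≈⟨ solve 4 (λ x y c d → (x :* c :* (y :* d)) :* (x :* c :* (y :* d)) := (y :* d) :* (x :* x :* y :* (c :* c :* d))) ≈-refl xₚ yₚ cₚ dₚ ⟩
  (yₚ * dₚ) * (xₚ * xₚ * yₚ * (cₚ * cₚ * dₚ)) ∎)
  where open SR

J₁₆ : J[ 1 , 6 ] ≈ xₚ * dₚ
J₁₆ = ⊗-≈ (⊗-is-* _ _) ≈-refl

J₃₆ : J[ 3 , 6 ] ≈ cₚ * cₚ * dₚ
J₃₆ = ⊗-≈ (⊗-is-* _ _) ≈-refl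

unit-^ : ∀ {f} n → Unit f → Unit (f ^ n)
unit-^ zero p = 1-at-0
unit-^ {f} (suc n) p = unit-* {f} {f ^ n} p (unit-^ n p)

A-value : A ≈ P₀
A-value = ⊘-≈ (λ ()) (≈-trans (*-cong (⊗-≈ (⊗-≈ (^^-≈ 8 J₁₆) (^^-≈ 4 J₂-split)) J₃₆) ≈-refl) (≈-trans
  (solve 5 (λ x y c d p → ((x :* d) :^ 8 :* (y :* d) :^ 4 :* (c :* c :* d)) :* p := d :^ 12 :* (p :* (x :^ 8 :* y :^ 4 :* (c :* c :* d)))) ≈-refl xₚ yₚ cₚ dₚ P₀)
  (≈-trans (*-cong ≈-refl core) (≈-trans (*-identityʳ _) (≈-sym (^^-is-^ dₚ 12))))))
  where
  core : P₀ * (xₚ ^ 8 * yₚ ^ 4 * (cₚ * cₚ * dₚ)) ≈ 1#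
  -- The added factor is a³, the right side of `P₀φ⁴`.
  core = unit-cancel {cₚ ^ 6 * dₚ ^ 3} (unit-* {cₚ ^ 6} {dₚ ^ 3} (unit-^ {cₚ} 6 refl) (unit-^ {dₚ} 3 refl)) (≈-trans
    (solve 5 (λ x y c d p → (c :^ 6 :* d :^ 3) :* (p :* (x :^ 8 :* y :^ 4 :* (c :* c :* d))) := let f = x :* x :* y :* (c :* c :* d) in p :* (f :* (f :* (f :* f)))) ≈-refl xₚ yₚ cₚ dₚ P₀)
    (≈-trans (*-cong ≈-refl (*-cong f (*-cong f (*-cong f f)))) (≈-trans P₀φ⁴ (≈-trans (*-cong a-product (*-cong a-product a-product))
      (solve 2 (λ c d → (c :* c :* d) :* ((c :* c :* d) :* (c :* c :* d)) := (c :^ 6 :* d :^ 3) :* con 1ℚ) ≈-refl cₚ dₚ)))))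
    where f = ≈-sym φ-product

B-value : ∀ {R} → φ * R ≈ a * a → B ≈ R
B-value {R} h = ⊘-≈ (λ ()) (≈-trans (*-cong (⊗-≈ (^^-≈ 2 J₁₆) J₂-split) ≈-refl) (≈-trans
  (solve 4 (λ x y d r → ((x :* d) :^ 2 :* (y :* d)) :* r := d :^ 3 :* (x :* x :* y :* r)) ≈-refl xₚ yₚ dₚ R)
  (≈-trans (*-cong ≈-refl core) (≈-sym (⊗-≈ (^^-is-^ dₚ 3) J₃₆)))))
  where
  core : xₚ * xₚ * yₚ * R ≈ cₚ * cₚ * dₚ
  core = unit-cancel {cₚ * cₚ * dₚ} (unit-* {cₚ * cₚ} {dₚ} (unit-* {cₚ} {cₚ} refl refl) refl) (≈-trans
    (solve 4 (λ x y e r → e :* (x :* x :* y :* r) := (x :* x :* y :* e) :* r) ≈-refl xₚ yₚ (cₚ * cₚ * dₚ) R)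
    (≈-trans (*-cong (≈-sym φ-product) ≈-refl) (≈-trans h (*-cong a-product a-product))))

C-value : C ≈ φ * (φ * a)
C-value = ⊘-≈ (λ ()) (≈-trans (*-cong (^^-is-^ dₚ 6) (*-cong φ-product (*-cong φ-product a-product))) (≈-trans
  (solve 4 (λ x y c d → let f = x :* x :* y :* (c :* c :* d) in d :^ 6 :* (f :* (f :* (c :* c :* d))) := (x :* d) :^ 4 :* (y :* d) :^ 2 :* (c :* c :* d) :^ 3) ≈-refl xₚ yₚ cₚ dₚ)
  (≈-sym (⊗-≈ (⊗-≈ (^^-≈ 4 J₁₆) (^^-≈ 2 J₂-split)) (^^-≈ 3 J₃₆)))))

-- The bilateral sum

-- Σ_{j ≥ 0} (-1)^j (j + 1) q^{(n+1)j}, the expansion of (1 + q^{n+1})^{-2}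
geo : ℕ → Series
dec-geo : ∀ n → Dec (λ j → (σℕ j * ιℕ (suc j)) * q^ (suc n ℕ.* j))
dec-geo n = dec-ord λ j → ord-⊗ʳ (σℕ j * ιℕ (suc j)) (ord-≤ (ℕP.m≤m+n j (n ℕ.* j)) (q^-ord _))
geo n = ∑ (λ j → (σℕ j * ιℕ (suc j)) * q^ (suc n ℕ.* j)) (dec-geo n)

geo-val : ∀ n → (1# + q^ suc n) * ((1# + q^ suc n) * geo n) ≈ 1#
geo-val n = begin
  (1# + Q) * ((1# + Q) * geo n) ≈⟨ *-cong ≈-refl (diff-zero (≈-trans (solve 3 (λ Q g s → (con 1ℚ :+ Q) :* g :- (con 1ℚ :- Q :* s) := g :- (con 1ℚ :+ :- Q :* g :+ :- Q :* s)) ≈-refl Q (geo n) s) (zero-diff geo-rec))) ⟩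
  (1# + Q) * (1# - Q * s) ≈⟨ *-cong ≈-refl (≈-trans (solve 2 (λ Q s → con 1ℚ :- Q :* s := con 1ℚ :+ :- Q :* s) ≈-refl Q s) (≈-sym s-rec)) ⟩
  (1# + Q) * s ≈⟨ solve 2 (λ Q s → (con 1ℚ :+ Q) :* s := s :+ Q :* s) ≈-refl Q s ⟩
  s + Q * s ≈⟨ +-cong s-rec ≈-refl ⟩
  (1# + (- Q) * s) + Q * s ≈⟨ solve 2 (λ Q s → (con 1ℚ :+ :- Q :* s) :+ Q :* s := con 1ℚ) ≈-refl Q s ⟩
  1# ∎
  where
  open SR
  Q = q^ suc n
  ds : Dec (λ j → σℕ j * q^ (suc n ℕ.* j))
  ds = dec-ord λ j → ord-⊗ʳ (σℕ j) (ord-≤ (ℕP.m≤m+n j (n ℕ.* j)) (q^-ord _))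
  s = ∑ (λ j → σℕ j * q^ (suc n ℕ.* j)) ds
  next : ∀ j → q^ (suc n ℕ.* suc j) ≈ Q * q^ (suc n ℕ.* j)
  next j = ≈-sym (q^*q^ (sym (ℕP.*-suc (suc n) j)))
  init : q^ (suc n ℕ.* 0) ≈ 1#
  init = ≈-trans (q^-cong (ℕP.*-zeroʳ n)) q^-0
  ds′ : Dec (λ j → - Q * (σℕ j * q^ (suc n ℕ.* j)))
  ds′ = dec-⊗ʳ (λ _ → - Q) ds
  dg′ : Dec (λ j → - Q * ((σℕ j * ιℕ (suc j)) * q^ (suc n ℕ.* j)))
  dg′ = dec-⊗ʳ (λ _ → - Q) (dec-geo n)
  s-rec : s ≈ 1# + (- Q) * s
  s-rec = ≈-trans (∑-suc ds (dec-suc ds)) (+-cong (≈-trans (*-identityˡ _) init) (≈-trans (∑-cong _ ds′ λ j → ≈-trans (*-cong ≈-refl (next j)) (solve 3 (λ s Q x → :- s :* (Q :* x) := :- Q :* (s :* x)) ≈-refl (σℕ j) Q _)) (∑-⊗ _ _ ds)))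
  geo-rec : geo n ≈ 1# + - Q * geo n + - Q * s
  geo-rec = ≈-trans (∑-suc (dec-geo n) (dec-suc (dec-geo n))) (≈-trans (+-cong (≈-trans (*-cong ≈-refl init) (solve 0 (con 1ℚ :* (con 0ℚ :+ con 1ℚ) :* con 1ℚ := con 1ℚ) ≈-refl))
    (≈-trans (∑-cong _ (dec-⊕ dg′ ds′) λ j → ≈-trans (*-cong ≈-refl (next j)) (solve 4 (λ s i Q x → (:- s :* (i :+ con 1ℚ)) :* (Q :* x) := :- Q :* ((s :* i) :* x) :+ :- Q :* (s :* x)) ≈-refl (σℕ j) (ιℕ (suc j)) Q _))
      (≈-trans (∑-⊕ _ dg′ ds′) (+-cong (∑-⊗ _ _ (dec-geo n)) (∑-⊗ _ _ ds))))) (≈-sym (+-assoc _ _ _)))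

lambert : ℕ → Series
lambert n = (σℕ (suc n) * q^ (sq (+ suc n) ℕ.+ suc n)) * geo n

lambert-ord : ∀ n → Ord (suc n) (lambert n)
lambert-ord n = ord-⊗ˡ (geo n) (ord-⊗ʳ (σℕ (suc n)) (ord-≤ (ℕP.m≤n+m (suc n) (sq (+ suc n))) (q^-ord _)))

dec-suc-ord : ∀ {u} → (∀ n → Ord (suc n) (u n)) → Dec u
dec-suc-ord h = dec-ord λ n → ord-≤ (ℕP.n≤1+n n) (h n)

dec-wθ : Dec (λ j → (σℕ (suc j) * ιℕ (suc j)) * θ (suc j))
dec-wθ = dec-⊗ʳ (λ j → σℕ (suc j) * ιℕ (suc j)) (dec-ord λ j → ∑-ord _ j λ n → ord-⊗ʳ (σℕ n) (ord-≤ (ℕP.≤-trans (ℕP.≤-trans (ℕP.n≤1+n j) (ℕP.m≤m+n (suc j) (n ℕ.* suc j))) (ℕP.m≤n+m _ (sq (+ suc n)))) (q^-ord _)))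

-- rows: θ weighted by (-1)^j j; columns: a double geometric series
wθ-lambert : ∑ (λ j → (σℕ (suc j) * ιℕ (suc j)) * θ (suc j)) dec-wθ ≈ ∑ lambert (dec-suc-ord lambert-ord)
wθ-lambert = ≈-trans (∑-cong _ (rows D²) (λ j → ≈-sym (∑-⊗ _ _ (dec-θ (suc j))))) (≈-trans (∑-swap D² (transpose D²)) (∑-cong _ _ col))
  where
  G′ : ℕ → ℕ → Series
  G′ j n = (σℕ (suc j) * ιℕ (suc j)) * θ-term (suc j) n
  big : ∀ j n → j ℕ.⊔ n ≤ sq (+ suc n) ℕ.+ suc n ℕ.* suc j
  big j n = ℕP.⊔-lub (ℕP.≤-trans (ℕP.≤-trans (ℕP.n≤1+n j) (ℕP.m≤m+n (suc j) (n ℕ.* suc j))) (ℕP.m≤n+m _ (sq (+ suc n))))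
    (ℕP.≤-trans (ℕP.≤-trans (ℕP.m≤m+n n (T n)) (ℕP.m≤m+n (T (suc n)) _)) (ℕP.m≤m+n _ _))
  D² : Dec² G′
  D² N = N , λ { j n (inj₁ l) → ord-⊗ʳ _ (ord-⊗ʳ (σℕ n) (ord-≤ (ℕP.≤-trans l (ℕP.≤-trans (ℕP.m≤m⊔n j n) (big j n))) (q^-ord _)))
               ; j n (inj₂ l) → ord-⊗ʳ _ (ord-⊗ʳ (σℕ n) (ord-≤ (ℕP.≤-trans l (ℕP.≤-trans (ℕP.m≤n⊔m j n) (big j n))) (q^-ord _))) }
  col : ∀ n → ∑ (λ j → G′ j n) (row (transpose D²) n) ≈ lambert n
  col n = ≈-trans (∑-cong _ (dec-⊗ʳ (λ _ → σℕ (suc n) * q^ (sq (+ suc n) ℕ.+ suc n)) (dec-geo n)) (λ j → ≈-trans (*-cong ≈-refl (*-cong ≈-refl (≈-sym (q^*q^ (expo j)))))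
      (solve 5 (λ s i t x y → (:- s :* i) :* (t :* (x :* y)) := (:- t :* x) :* ((s :* i) :* y)) ≈-refl (σℕ j) (ιℕ (suc j)) (σℕ n) (q^ (sq (+ suc n) ℕ.+ suc n)) (q^ (suc n ℕ.* j))))) (∑-⊗ _ _ (dec-geo n))
    where
    expo : ∀ j → sq (+ suc n) ℕ.+ suc n ℕ.+ suc n ℕ.* j ≡ sq (+ suc n) ℕ.+ suc n ℕ.* suc j
    expo j = trans (ℕP.+-assoc (sq (+ suc n)) (suc n) _) (cong (sq (+ suc n) ℕ.+_) (sym (ℕP.*-suc (suc n) j)))

Λ : Series
Λ = ∑ lambert (dec-suc-ord lambert-ord)

-- By `v-θ` the factor P̄ comes out. The weights 4 (-1)^d d remain against partial theta series,
-- whose double sum is the Lambert series Λ.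
rank-sum-cos₂ : rank-sum cos₂ ≈ P̄ * (1# + κ 8ℚ * Λ)
rank-sum-cos₂ = ≈-trans (+-cong ≈-refl (*-cong ≈-refl (≈-trans (∑-cong _ (dec-⊗ʳ (λ _ → P̄ * κ 4ℚ) dec-wθ) (λ d → ≈-trans (*-cong (cf₂ (suc d)) (v-θ (suc d)))
    (solve 3 (λ w p t → (con 4ℚ :* w) :* (p :* t) := (p :* con 4ℚ) :* (w :* t)) ≈-refl _ P̄ (θ (suc d))))) (≈-trans (∑-⊗ _ _ dec-wθ) (*-cong ≈-refl wθ-lambert)))))
  (solve 2 (λ p l → con 1ℚ :* p :+ con 2ℚ :* ((p :* con 4ℚ) :* l) := p :* (con 1ℚ :+ con 8ℚ :* l)) ≈-refl P̄ Λ)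

a𝐒R₂ : a * 𝐒 (rank-sum cos₂) ≈ 1# + κ 8ℚ * 𝐒 Λ
a𝐒R₂ = ≈-trans (*-cong ≈-refl (≈-trans (𝐒-cong rank-sum-cos₂) (≈-trans (𝐒-* _ _) (*-cong ≈-refl (≈-trans (𝐒-+ _ _) (+-cong (𝐒-κ 1ℚ) (≈-trans (𝐒-* _ _) (*-cong (𝐒-κ 8ℚ) ≈-refl))))))))
  (≈-trans (≈-sym (*-assoc _ _ _)) (≈-trans (*-cong a𝐒P̄ ≈-refl) (*-identityˡ _)))

private
  κsgn : ∀ k → κ (sgn k) ≈ σℕ k
  κsgn zero = ≈-refl
  κsgn (suc zero) = κ-neg 1ℚ
  κsgn (suc (suc k)) = ≈-trans (κsgn k) (solve 1 (λ s → s := :- (:- s)) ≈-refl (σℕ k))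

  denominator : ∀ n {d} → d ≈ 1# + q^ (3 ℕ.* suc n) → d ^^ 2 ≈ 𝐒 (1# + q^ suc n) * 𝐒 (1# + q^ suc n)
  denominator n p = ≈-trans (⊗-≈ p (≈-trans (⊗-≈ p one-is-1) (*-identityʳ _))) (*-cong e e)
    where e = ≈-sym (≈-trans (𝐒-+ _ _) (+-cong (𝐒-κ 1ℚ) (≈-trans (𝐒-q^ (suc n)) (q^-cong (trans (thrice-is (suc n)) (ℕR.solve 1 (λ n → n ℕR.:+ (n ℕR.:+ n) ℕR.:= ℕR.con 3 ℕR.:* n) refl (suc n)))))))

  numerator : ∀ n e → e ≡ 3 ℕ.* suc n ℕ.* suc n ℕ.+ 3 ℕ.* suc n → q^ e ≈ 𝐒 (q^ (sq (+ suc n) ℕ.+ suc n))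
  numerator n e p = ≈-sym (≈-trans (𝐒-q^ _) (q^-cong (trans (thrice-is _) (trans (cong (λ z → (z ℕ.+ suc n) ℕ.+ ((z ℕ.+ suc n) ℕ.+ (z ℕ.+ suc n))) (ℤP.+-injective (trans (sq-is (+ suc n)) (sym (ℤP.pos-* (suc n) (suc n))))))
    (trans (ℕR.solve 1 (λ n → let z = n ℕR.:* n in (z ℕR.:+ n) ℕR.:+ ((z ℕR.:+ n) ℕR.:+ (z ℕR.:+ n)) ℕR.:= ℕR.con 3 ℕR.:* n ℕR.:* n ℕR.:+ ℕR.con 3 ℕR.:* n) refl (suc n)) (sym p))))))

  𝐒geo : ∀ n → 𝐒 (1# + q^ suc n) * 𝐒 (1# + q^ suc n) * 𝐒 (geo n) ≈ 1#
  𝐒geo n = ≈-trans (*-assoc _ _ _) (≈-trans (*-cong ≈-refl (≈-sym (𝐒-* _ _))) (≈-trans (≈-sym (𝐒-* _ _)) (≈-trans (𝐒-cong (geo-val n)) (𝐒-κ 1ℚ))))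

  summand : ∀ n {f d} → d 0 ≡ 1ℚ → f ≈ q^ (3 ℕ.* suc n ℕ.* suc n ℕ.+ 3 ℕ.* suc n) → d ≈ 𝐒 (1# + q^ suc n) * 𝐒 (1# + q^ suc n) → sgn (suc n) · (f ⊘ d) ≈ 𝐒 (lambert n)
  summand n {f} {d} u p r = ≈-trans (·-is-κ* _ _) (≈-trans (*-cong (κsgn (suc n)) (⊘-≈ {f} {d} {𝐒 (q^ (sq (+ suc n) ℕ.+ suc n)) * 𝐒 (geo n)} (1≢0 u)
      (≈-trans (*-cong r ≈-refl) (≈-trans (solve 3 (λ d x g → d :* (x :* g) := x :* (d :* g)) ≈-refl _ _ (𝐒 (geo n))) (≈-trans (*-cong ≈-refl (𝐒geo n)) (≈-trans (*-identityʳ _) (≈-trans (≈-sym (numerator n _ refl)) (≈-sym p))))))))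
    (≈-sym (≈-trans (𝐒-* _ _) (≈-trans (*-cong (≈-trans (𝐒-* _ _) (*-cong (𝐒-σ (+ suc n)) ≈-refl)) ≈-refl) (*-assoc _ _ _)))))

-- The central denominator is (1 + 1)², hence the constant ¼.
term-zero : term (+ 0) ≈ κ ¼
term-zero = ≈-trans (·-is-κ* _ _) (≈-trans (*-identityˡ _) (⊘-≈ (λ ()) (≈-trans (*-cong (≈-trans (⊗-≈ e (≈-trans (⊗-≈ e one-is-1) (*-identityʳ _))) ≈-refl) ≈-refl)
  (≈-trans (solve 0 (con 2ℚ :* con 2ℚ :* con ¼ := con 1ℚ) ≈-refl) (≈-trans (≈-sym q^-0) (≈-sym (mono-is-q^ 0)))))))
  where
  e : one ⊕ mono 0 ≈ κ 2ℚ
  e = ≈-trans (⊕-is-+ _ _) (≈-trans (+-cong one-is-1 (≈-trans (mono-is-q^ 0) q^-0)) (solve 0 (con 1ℚ :+ con 1ℚ := con 2ℚ) ≈-refl))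

term-pos : ∀ k → term (+ suc k) ≈ 𝐒 (lambert k)
term-pos k = summand k refl (mono-is-q^ _) (denominator k (≈-trans (⊕-is-+ _ _) (+-cong one-is-1 (mono-is-q^ _))))

term-neg : ∀ k → term -[1+ k ] ≈ 𝐒 (lambert k)
term-neg k = summand k {mono (3 ℕ.* m ℕ.* m ∸ 3 ℕ.* m) ⊗ mono (6 ℕ.* m)} {(mono (3 ℕ.* m) ⊕ one) ^^ 2} refl (≈-trans (⊗-≈ (mono-is-q^ (3 ℕ.* m ℕ.* m ∸ 3 ℕ.* m)) (mono-is-q^ (6 ℕ.* m))) (q^*q^ expo)) (denominator k (≈-trans (⊕-is-+ _ _) (≈-trans (+-cong (mono-is-q^ _) one-is-1) (+-comm _ _))))
  where
  m = suc k
  expo : 3 ℕ.* m ℕ.* m ∸ 3 ℕ.* m ℕ.+ 6 ℕ.* m ≡ 3 ℕ.* m ℕ.* m ℕ.+ 3 ℕ.* m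
  expo = trans (cong (3 ℕ.* m ℕ.* m ∸ 3 ℕ.* m ℕ.+_) (ℕR.solve 1 (λ m → ℕR.con 6 ℕR.:* m ℕR.:= ℕR.con 3 ℕR.:* m ℕR.:+ ℕR.con 3 ℕR.:* m) refl m))
    (trans (sym (ℕP.+-assoc _ (3 ℕ.* m) (3 ℕ.* m))) (cong (ℕ._+ 3 ℕ.* m) (ℕP.m∸n+n≡m (ℕP.m≤m*n (3 ℕ.* m) m))))

psum-at : ∀ u L n → psum L u n ≡ ∑< L (λ k → u k n)
psum-at u zero n = 0-at n
psum-at u (suc L) n = trans (at (psum-suc u L) n) (trans (+-at _ _ n) (cong (u 0 n ℚ.+_) (psum-at (λ k → u (suc k)) L n)))

bilateral-value : bilateral ≈ κ ¼ + κ 2ℚ * 𝐒 Λ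
-- Both halves reduce to N terms of the same series. Its k-th term has order k + 1, so N terms
-- determine the N-th coefficient.
bilateral-value = mk λ N → trans (cong₂ ℚ._+_
    (trans (sum-map-upTo (λ k → term (+ k) N) (suc N)) (cong₂ ℚ._+_ (at term-zero N) (trans (∑<-cong N (λ k → at (term-pos k) N)) (S-at N))))
    (trans (sum-map-upTo (λ k → term -[1+ k ] N) N) (trans (∑<-cong N (λ k → at (term-neg k) N)) (S-at N))))
  (trans (ℚR.solve 2 (λ c s → c ℚR.:+ s ℚR.:+ s ℚR.:= c ℚR.:+ ℚR.con 2ℚ ℚR.:* s) refl (κ ¼ N) (𝐒 Λ N)) (sym (trans (+-at _ _ N) (cong (κ ¼ N ℚ.+_) (κ-at 2ℚ (𝐒 Λ) N)))))
  where
  𝐒l : ℕ → Series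
  𝐒l n = 𝐒 (lambert n)
  u-ord : ∀ n → Ord (suc n) (𝐒l n)
  u-ord n = 𝐒-ord (lambert-ord n)
  S-at : ∀ N → ∑< N (λ k → 𝐒l k N) ≡ 𝐒 Λ N
  S-at N = trans (sym (psum-at 𝐒l N N)) (trans (trans (sym (ℚP.+-identityʳ _)) (trans (cong (psum N 𝐒l N ℚ.+_) (sym (u-ord N N ℕP.≤-refl))) (sym (+-at (psum N 𝐒l) (𝐒l N) N))))
    (trans (sym (∑-approx 𝐒l (dec-suc-ord u-ord) (suc N) (suc N) ℕP.≤-refl N ℕP.≤-refl)) (sym (at (𝐒-∑ _ (dec-suc-ord u-ord)) N))))

D-value : D ≈ κ ¼ * 𝐒 (rank-sum cos₂)
D-value = ⊘-≈ (λ ()) (begin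
  J[ 3 , 6 ] * (κ ¼ * R) ≈⟨ *-cong (≈-trans J₃₆ (≈-sym a-product)) ≈-refl ⟩
  a * (κ ¼ * R) ≈⟨ solve 2 (λ a r → a :* (con ¼ :* r) := con ¼ :* (a :* r)) ≈-refl a R ⟩
  κ ¼ * (a * R) ≈⟨ *-cong ≈-refl a𝐒R₂ ⟩
  κ ¼ * (1# + κ 8ℚ * 𝐒 Λ) ≈⟨ solve 1 (λ l → con ¼ :* (con 1ℚ :+ con 8ℚ :* l) := con ¼ :+ con 2ℚ :* l) ≈-refl (𝐒 Λ) ⟩
  κ ¼ + κ 2ℚ * 𝐒 Λ ≈⟨ ≈-sym bilateral-value ⟩
  bilateral ∎)
  where
  open SR
  R = 𝐒 (rank-sum cos₂)

-- Residues of the rank modulo six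

suc-/1 : ∀ n → + suc n ℚ./ 1 ≡ 1ℚ ℚ.+ (+ n ℚ./ 1)
suc-/1 n = ℚP.toℚᵘ-injective (ℚᵘP.≃-trans (ℚP.toℚᵘ-fromℚᵘ (mkℚᵘ (+ suc n) 0)) (ℚᵘP.≃-sym (ℚᵘP.≃-trans (ℚP.toℚᵘ-homo-+ 1ℚ (+ n ℚ./ 1))
  (ℚᵘP.≃-trans (ℚᵘP.+-congʳ (ℚ.toℚᵘ 1ℚ) (ℚP.toℚᵘ-fromℚᵘ (mkℚᵘ (+ n) 0))) (*≡* (cong (λ z → (+ 1 ℤ.+ z) ℤ.* + 1) (ℤP.*-identityʳ (+ n))))))))

indicator : ℕ → ℤ → ℚ
indicator s z = if does ((z %ℕ 6) ℕ.≟ (s ℕ.% 6)) then 1ℚ else 0ℚ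

count : ∀ s L → + length (filter (λ π → (rank π %ℕ 6) ℕ.≟ (s ℕ.% 6)) L) ℚ./ 1 ≡ weigh (λ π → indicator s (rank π)) L
count s [] = refl
count s (π ∷ L) with does ((rank π %ℕ 6) ℕ.≟ (s ℕ.% 6))
... | true = trans (suc-/1 (length (filter (λ π → (rank π %ℕ 6) ℕ.≟ (s ℕ.% 6)) L))) (cong (1ℚ ℚ.+_) (count s L))
... | false = trans (count s L) (sym (ℚP.+-identityˡ _))

rbar-rank-sum : ∀ s → rbar s 0 ≈ comp₀ (rank-sum (even-part (indicator s)))
rbar-rank-sum s = ≈-trans (mk λ n → trans (count s (overpartitions (3 ℕ.* n ℕ.+ 0))) (trans (cong (Rank.total (indicator s)) (trans (ℕR.solve 1 (λ n → ℕR.con 3 ℕR.:* n ℕR.:+ ℕR.con 0 ℕR.:= n ℕR.:+ (n ℕR.:+ n)) refl n) (sym (thrice-is n)))) (sym (comp₀-at (Rank.total (indicator s)) n))))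
  (comp₀-cong (total-rank-sum (indicator s)))

cf-+ : ∀ f g m → cf (λ m → f m ℚ.+ g m) m ≡ cf f m ℚ.+ cf g m
cf-+ f g zero = refl
cf-+ f g (suc m) = trans (cong (λ z → (2ℚ ℚ.* (f (suc m) ℚ.+ g (suc m)) ℚ.- 2ℚ ℚ.* (f m ℚ.+ g m)) ℚ.- z) (cf-+ f g m))
  (ℚR.solve 6 (λ a b c d x y → (ℚR.con 2ℚ ℚR.:* (a ℚR.:+ b) ℚR.:- ℚR.con 2ℚ ℚR.:* (c ℚR.:+ d)) ℚR.:- (x ℚR.:+ y) ℚR.:= ((ℚR.con 2ℚ ℚR.:* a ℚR.:- ℚR.con 2ℚ ℚR.:* c) ℚR.:- x) ℚR.:+ ((ℚR.con 2ℚ ℚR.:* b ℚR.:- ℚR.con 2ℚ ℚR.:* d) ℚR.:- y)) refl (f (suc m)) (g (suc m)) (f m) (g m) (cf f m) (cf g m))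

cf-* : ∀ c f m → cf (λ m → c ℚ.* f m) m ≡ c ℚ.* cf f m
cf-* c f zero = sym (ℚP.*-zeroʳ c)
cf-* c f (suc m) = trans (cong (λ z → (2ℚ ℚ.* (c ℚ.* f (suc m)) ℚ.- 2ℚ ℚ.* (c ℚ.* f m)) ℚ.- z) (cf-* c f m))
  (ℚR.solve 4 (λ c a b x → (ℚR.con 2ℚ ℚR.:* (c ℚR.:* a) ℚR.:- ℚR.con 2ℚ ℚR.:* (c ℚR.:* b)) ℚR.:- c ℚR.:* x ℚR.:= c ℚR.:* ((ℚR.con 2ℚ ℚR.:* a ℚR.:- ℚR.con 2ℚ ℚR.:* b) ℚR.:- x)) refl c (f (suc m)) (f m) (cf f m))

cf-const : ∀ c m → cf (λ _ → c) m ≡ 0ℚ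
cf-const c zero = refl
cf-const c (suc m) = trans (cong (λ z → (2ℚ ℚ.* c ℚ.- 2ℚ ℚ.* c) ℚ.- z) (cf-const c m)) (ℚR.solve 1 (λ c → (ℚR.con 2ℚ ℚR.:* c ℚR.:- ℚR.con 2ℚ ℚR.:* c) ℚR.:- ℚR.con 0ℚ ℚR.:= ℚR.con 0ℚ) refl c)

cf-cong : ∀ {f g} → (∀ m → f m ≡ g m) → ∀ m → cf f m ≡ cf g m
cf-cong h zero = refl
cf-cong h (suc m) = cong₂ ℚ._-_ (cong₂ (λ a b → 2ℚ ℚ.* a ℚ.- 2ℚ ℚ.* b) (h (suc m)) (h m)) (cf-cong h m)

rank-sum-cong : ∀ {f g} → (∀ m → f m ≡ g m) → rank-sum f ≈ rank-sum g
rank-sum-cong h = +-cong (*-cong (≡⇒≈ (cong κ (h 0))) ≈-refl) (*-cong ≈-refl (∑-cong _ _ λ d → *-cong (≡⇒≈ (cong κ (cf-cong h (suc d)))) ≈-refl))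

rank-sum-+ : ∀ f g → rank-sum (λ m → f m ℚ.+ g m) ≈ rank-sum f + rank-sum g
rank-sum-+ f g = ≈-trans (+-cong (*-cong (κ-+ _ _) ≈-refl) (*-cong ≈-refl (≈-trans (∑-cong _ (dec-⊕ (dec-κv f) (dec-κv g)) λ d →
    ≈-trans (*-cong (≈-trans (≡⇒≈ (cong κ (cf-+ f g (suc d)))) (κ-+ _ _)) ≈-refl) (distribʳ _ _ _)) (∑-⊕ _ _ _))))
  (solve 5 (λ a b p x y → (a :+ b) :* p :+ con 2ℚ :* (x :+ y) := (a :* p :+ con 2ℚ :* x) :+ (b :* p :+ con 2ℚ :* y)) ≈-refl (κ (f 0)) (κ (g 0)) P̄ _ _)

rank-sum-* : ∀ c f → rank-sum (λ m → c ℚ.* f m) ≈ κ c * rank-sum f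
rank-sum-* c f = ≈-trans (+-cong (*-cong (κ-* _ _) ≈-refl) (*-cong ≈-refl (≈-trans (∑-cong _ (dec-⊗ʳ (λ _ → κ c) (dec-κv f)) λ d →
    ≈-trans (*-cong (≈-trans (≡⇒≈ (cong κ (cf-* c f (suc d)))) (κ-* _ _)) ≈-refl) (*-assoc _ _ _)) (∑-⊗ _ _ _))))
  (solve 4 (λ c a p x → (c :* a) :* p :+ con 2ℚ :* (c :* x) := c :* (a :* p :+ con 2ℚ :* x)) ≈-refl (κ c) (κ (f 0)) P̄ _)

rank-sum-const : ∀ c → rank-sum (λ _ → c) ≈ κ c * P̄
rank-sum-const c = ≈-trans (+-cong ≈-refl (≈-trans (*-cong ≈-refl (∑-0 _ λ d → ≈-trans (*-cong (≡⇒≈ (cong κ (cf-const c (suc d)))) ≈-refl) (zeroˡ _))) (zeroʳ _))) (+-identityʳ _)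

-- The general even function on the integers modulo 6, in rational form: one coefficient for each
-- pair of conjugate sixth roots of unity.
cosines : (α β γ δ : ℚ) → ℕ → ℚ
cosines α β γ δ m = α ℚ.+ β ℚ.* cos₂ m ℚ.+ γ ℚ.* cos₃ m ℚ.+ δ ℚ.* cos₆ m

cosines-period : ∀ α β γ δ m → cosines α β γ δ (6 ℕ.+ m) ≡ cosines α β γ δ m
cosines-period α β γ δ m = cong₂ (λ x y → α ℚ.+ β ℚ.* x ℚ.+ γ ℚ.* cos₃ m ℚ.+ δ ℚ.* y)
  (trans (neg² _) (trans (neg² _) (neg² (cos₂ m)))) (neg² (cos₆ m))
  where
  neg² : ∀ x → ℚ.- (ℚ.- x) ≡ x
  neg² = ℚR.solve 1 (λ x → ℚR.:- (ℚR.:- x) ℚR.:= x) refl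

-- The value at -1 is 12 D - 2 C, because D is a quarter of the rank sum at q³, which enters three
-- times. The values at ω and -ω both equal B.
component : (α β γ δ : ℚ) (A B C D : Series) → Series
component α β γ δ A B C D = κ α * A + κ β * (κ (+ 12 ℚ./ 1) * D - κ 2ℚ * C) + κ γ * B + κ δ * B

component-cong : ∀ α β γ δ {R R₂ R₃ R₆ S c A B C D} → A ≈ R → R₂ ≈ κ 3ℚ * S - κ 2ℚ * c → B ≈ R₃ → B ≈ R₆ → C ≈ c → D ≈ κ ¼ * S →
  κ α * R + κ β * R₂ + κ γ * R₃ + κ δ * R₆ ≈ component α β γ δ A B C D
component-cong α β γ δ {S = S} p p₂ p₃ p₆ pC pD = +-cong (+-cong (+-cong (*-cong ≈-refl (≈-sym p)) (*-cong ≈-refl (≈-trans p₂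
  (+-cong (≈-sym (≈-trans (*-cong ≈-refl pD) (solve 1 (λ r → con (+ 12 ℚ./ 1) :* (con ¼ :* r) := con 3ℚ :* r) ≈-refl S))) (-‿cong (*-cong ≈-refl (≈-sym pC))))))) (*-cong ≈-refl (≈-sym p₃))) (*-cong ≈-refl (≈-sym p₆))

module _ (s : ℕ) (α β γ δ : ℚ) where
  private
    Agrees : ℕ → Set
    Agrees m = even-part (indicator s) m ≡ cosines α β γ δ m

  fourier : All Agrees (upTo 7) → ∀ m → Agrees m
  fourier (p₀ ∷ p₁ ∷ p₂ ∷ p₃ ∷ p₄ ∷ p₅ ∷ p₆ ∷ []) = go
    where
    go : ∀ m → Agrees m
    go 0 = p₀
    go 1 = p₁
    go 2 = p₂
    go 3 = p₃
    go 4 = p₄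
    go 5 = p₅
    go 6 = p₆
    -- The residue of -(m + 7) reduces to that of -(m + 1) by computation. Starting at 6 would
    -- compare with - m, which is not in constructor form; hence seven initial cases rather than
    -- six.
    go (suc (suc (suc (suc (suc (suc (suc m))))))) = trans (go (suc m)) (sym (cosines-period α β γ δ (suc m)))

  rank-sum-cosines : rank-sum (cosines α β γ δ) ≈ κ α * P̄ + κ β * rank-sum cos₂ + κ γ * rank-sum cos₃ + κ δ * rank-sum cos₆
  rank-sum-cosines = ≈-trans (rank-sum-+ (λ m → α ℚ.+ β ℚ.* cos₂ m ℚ.+ γ ℚ.* cos₃ m) (λ m → δ ℚ.* cos₆ m)) (+-cong (≈-trans (rank-sum-+ (λ m → α ℚ.+ β ℚ.* cos₂ m) (λ m → γ ℚ.* cos₃ m)) (+-cong (≈-trans (rank-sum-+ (λ _ → α) (λ m → β ℚ.* cos₂ m)) (+-cong (rank-sum-const α) (rank-sum-* β cos₂))) (rank-sum-* γ cos₃))) (rank-sum-* δ cos₆))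

  comp₀-combination : ∀ f g h e → comp₀ (κ α * f + κ β * g + κ γ * h + κ δ * e) ≈ κ α * comp₀ f + κ β * comp₀ g + κ γ * comp₀ h + κ δ * comp₀ e
  comp₀-combination f g h e = ≈-trans (comp₀-+ _ _) (+-cong (≈-trans (comp₀-+ _ _) (+-cong (≈-trans (comp₀-+ _ _) (+-cong (comp₀-κ* α f) (comp₀-κ* β g))) (comp₀-κ* γ h))) (comp₀-κ* δ e))

  rbar-value : (∀ m → Agrees m) → rbar s 0 ≈ component α β γ δ A B C D
  rbar-value h = ≈-trans (rbar-rank-sum s) (≈-trans (comp₀-cong (≈-trans (rank-sum-cong h) rank-sum-cosines))
    (≈-trans (comp₀-combination P̄ (rank-sum cos₂) (rank-sum cos₃) (rank-sum cos₆))
      (component-cong α β γ δ A-value R₂-val (B-value φR₃) (B-value φR₆) C-value D-value)))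

private
  ⅙ ⅓ ⅔ : ℚ
  ⅙ = + 1 / 6
  ⅓ = + 1 / 3
  ⅔ = + 2 / 3

  plus : ∀ f {f′} g {g′} → f ≈ f′ → g ≈ g′ → f ⊕ g ≈ f′ + g′
  plus f g p r = ≈-trans (⊕-is-+ f g) (+-cong p r)
  minus : ∀ f {f′} g {g′} → f ≈ f′ → g ≈ g′ → f ⊖ g ≈ f′ - g′
  minus f g p r = ≈-trans (⊖-is-− f g) (+-cong p (-‿cong r))

  component₀ : ∀ A B C D → component ⅙ ⅙ ⅓ ⅓ A B C D ≈ ⅙ · A ⊕ ⅔ · B ⊖ ⅓ · C ⊕ 2ℚ · D
  component₀ A B C D = ≈-trans (solve 4 (λ A B C D → con ⅙ :* A :+ con ⅙ :* (con (+ 12 / 1) :* D :- con 2ℚ :* C) :+ con ⅓ :* B :+ con ⅓ :* B := con ⅙ :* A :+ con ⅔ :* B :- con ⅓ :* C :+ con 2ℚ :* D) ≈-refl A B C D)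
    (≈-sym (plus (⅙ · A ⊕ ⅔ · B ⊖ ⅓ · C) (2ℚ · D) (minus (⅙ · A ⊕ ⅔ · B) (⅓ · C) (plus (⅙ · A) (⅔ · B) (·-is-κ* ⅙ A) (·-is-κ* ⅔ B)) (·-is-κ* ⅓ C)) (·-is-κ* 2ℚ D)))

  -- For odd residues the coefficients at ω and -ω are opposite, which is why B is absent from these
  -- two formulas.
  component₁₃ : ∀ γ δ → γ ℚ.+ δ ≡ 0ℚ → ∀ A B C D → component ⅙ (ℚ.- ⅙) γ δ A B C D ≈ ⅙ · A ⊕ ⅓ · C ⊖ 2ℚ · D
  component₁₃ γ δ γ+δ≡0 A B C D = ≈-trans (solve 6 (λ A B C D c d → con ⅙ :* A :+ con (ℚ.- ⅙) :* (con (+ 12 / 1) :* D :- con 2ℚ :* C) :+ c :* B :+ d :* B := (con ⅙ :* A :+ con ⅓ :* C :- con 2ℚ :* D) :+ (c :+ d) :* B) ≈-refl A B C D (κ γ) (κ δ))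
    (≈-trans (≈-trans (+-cong ≈-refl (≈-trans (*-cong (≈-trans (≈-sym (κ-+ γ δ)) (≡⇒≈ (cong κ γ+δ≡0))) ≈-refl) (zeroˡ B))) (+-identityʳ _))
    (≈-sym (minus (⅙ · A ⊕ ⅓ · C) (2ℚ · D) (plus (⅙ · A) (⅓ · C) (·-is-κ* ⅙ A) (·-is-κ* ⅓ C)) (·-is-κ* 2ℚ D))))

  component₂ : ∀ A B C D → component ⅙ ⅙ (ℚ.- ⅙) (ℚ.- ⅙) A B C D ≈ ⅙ · A ⊖ ⅓ · B ⊖ ⅓ · C ⊕ 2ℚ · D
  component₂ A B C D = ≈-trans (solve 4 (λ A B C D → con ⅙ :* A :+ con ⅙ :* (con (+ 12 / 1) :* D :- con 2ℚ :* C) :+ con (ℚ.- ⅙) :* B :+ con (ℚ.- ⅙) :* B := con ⅙ :* A :- con ⅓ :* B :- con ⅓ :* C :+ con 2ℚ :* D) ≈-refl A B C D)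
    (≈-sym (plus (⅙ · A ⊖ ⅓ · B ⊖ ⅓ · C) (2ℚ · D) (minus (⅙ · A ⊖ ⅓ · B) (⅓ · C) (minus (⅙ · A) (⅓ · B) (·-is-κ* ⅙ A) (·-is-κ* ⅓ B)) (·-is-κ* ⅓ C)) (·-is-κ* 2ℚ D)))

theorem5p7 :
      (rbar 0 0 ≋ (+ 1 / 6) · A ⊕ (+ 2 / 3) · B ⊖ (+ 1 / 3) · C ⊕ (+ 2 / 1) · D)
    × (rbar 1 0 ≋ (+ 1 / 6) · A ⊕ (+ 1 / 3) · C ⊖ (+ 2 / 1) · D)
    × (rbar 2 0 ≋ (+ 1 / 6) · A ⊖ (+ 1 / 3) · B ⊖ (+ 1 / 3) · C ⊕ (+ 2 / 1) · D)
    × (rbar 3 0 ≋ (+ 1 / 6) · A ⊕ (+ 1 / 3) · C ⊖ (+ 2 / 1) · D)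
-- The constants are the Fourier coefficients of the residue s: 1/6 at 1, (-1)^s/6 at -1,
-- cos(2πs/3)/3 at ω and cos(πs/3)/3 at -ω, each conjugate pair counted together.
theorem5p7 =
    at (≈-trans (rbar-value 0 ⅙ ⅙ ⅓ ⅓ (fourier 0 ⅙ ⅙ ⅓ ⅓ (refl ∷ refl ∷ refl ∷ refl ∷ refl ∷ refl ∷ refl ∷ []))) (component₀ A B C D))
  , at (≈-trans (rbar-value 1 ⅙ (ℚ.- ⅙) (ℚ.- ⅙) ⅙ (fourier 1 ⅙ (ℚ.- ⅙) (ℚ.- ⅙) ⅙ (refl ∷ refl ∷ refl ∷ refl ∷ refl ∷ refl ∷ refl ∷ []))) (component₁₃ (ℚ.- ⅙) ⅙ refl A B C D))
  , at (≈-trans (rbar-value 2 ⅙ ⅙ (ℚ.- ⅙) (ℚ.- ⅙) (fourier 2 ⅙ ⅙ (ℚ.- ⅙) (ℚ.- ⅙) (refl ∷ refl ∷ refl ∷ refl ∷ refl ∷ refl ∷ refl ∷ []))) (component₂ A B C D))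
  , at (≈-trans (rbar-value 3 ⅙ (ℚ.- ⅙) ⅓ (ℚ.- ⅓) (fourier 3 ⅙ (ℚ.- ⅙) ⅓ (ℚ.- ⅓) (refl ∷ refl ∷ refl ∷ refl ∷ refl ∷ refl ∷ refl ∷ []))) (component₁₃ ⅓ (ℚ.- ⅓) refl A B C D))
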